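{- Let $p>3$ be a prime and $t\in\mathbb{F}_p^\times$ with $t\neq 1$. Let $f_t(y)=27y^3-27y^2+\frac4t$ and $g_t(y)=27y^3-27y^2+\frac{4}{1-t}$ be polynomials over $\mathbb{F}_p$. If $f_t(y)\equiv 0\pmod p$ has $r_1$ incongruent solutions and $g_t(y)\equiv0\pmod p$ has $r_2$ incongruent solutions modulo $p$, then $$ {_2G_2}(p,t)={_2G_2}(p,1-t)+{_2\widetilde{G}_2}(p,1-t)+(r_1-r_2)+(1-r_2)\varphi(3(1-t)).$$
   Context: $\varphi$ is the quadratic character of $\mathbb{F}_p$. $\omega$ denotes the Teichmüller character of $\mathbb{F}_p$ (values in $\mathbb{Z}_p$, $\omega(a)\equiv a\pmod p$, $\omega(0)=0$), $\overline{\omega}$ its inverse; $\Gamma_p$ is Morita's $p$-adic gamma function; $\lfloor x\rfloor$ is the floor and $\langle x\rangle=x-\lfloor x\rfloor$. McCarthy's function: for $t\in\mathbb{F}_p$, $m\ge 1$, $a_k,b_k\in\mathbb{Q}\cap\mathbb{Z}_p$, $$ {_m\mathbb{G}_m}\left[\begin{array}{ccc} a_1,&\ldots,&a_m\\ b_1,&\ldots,&b_m\end{array}\Big| t\right]_p:=\frac{ -1}{p-1}\sum_{j=0}^{p-2}(-1)^{jm}\,\overline{\omega}^j(t)\prod_{k=1}^m(-p)^{ -\lfloor\langle a_k\rangle-\frac{j}{p-1}\rfloor-\lfloor\langle -b_k\rangle+\frac{j}{p-1}\rfloor}\frac{\Gamma_p(\langle a_k-\frac{j}{p-1}\rangle)}{\Gamma_p(\langle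 a_k\rangle)}\frac{\Gamma_p(\langle -b_k+\frac{j}{p-1}\rangle)}{\Gamma_p(\langle -b_k\rangle)}.$$ ${_2G_2}(p,t)$ denotes this function with $m=2$, upper parameters $\frac13,\frac23$, lower parameters $0,\frac12$; ${_2\widetilde{G}_2}(p,t)$ denotes it with $m=2$, upper parameters $\frac16,\frac56$, lower parameters $0,\frac12$. -}

module Defs where

open import Data.Bool using (Bool; true; false; if_then_else_)
open import Data.Nat as ℕ using (ℕ; zero; suc; _≡ᵇ_)
import Data.Nat.DivMod as ℕD
open import Data.Integer as ℤ using (ℤ; +_; -[1+_]; _+_; _*_; _-_; -_; _^_; 0ℤ; 1ℤ)
open import Data.Integer.DivMod using (_%ℕ_)
open import Data.Rational as ℚ using (ℚ; ↥_; ↧ₙ_; floor)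
open import Data.List using (List; []; _∷_; length; filterᵇ; upTo; map; foldr)
open import Data.Bool.ListAction using (any)
open import Data.Vec as Vec using (Vec; []; _∷_)

sumℤ : List ℤ → ℤ
sumℤ = foldr _+_ 0ℤ

-- Small arithmetic helpers (all modular quantities are integer
-- representatives; congruences are stated with divisibility).

modN : ℤ → ℕ → ℕ
modN a zero    = 0
modN a (suc n) = a %ℕ suc n

divᵇ : ℕ → ℕ → Bool
divᵇ zero    n = n ≡ᵇ 0
divᵇ (suc q) n = ℕD._%_ n (suc q) ≡ᵇ 0

divNat : ℤ → ℕ → ℚ
divNat a zero    = ℚ.0ℚ
divNat a (suc d) = a ℚ./ suc d

frac : ℚ → ℚ
frac x = x ℚ.- (floor x ℚ./ 1)

-- inverse of a p-adic unit u modulo p^k (Euler: u^(p^k (p-1)) ≡ 1 mod p^k)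
invZ : ℕ → ℕ → ℤ → ℤ
invZ p k u = u ^ ((p ℕ.^ k) ℕ.* (p ℕ.∸ 1) ℕ.∸ 1)

prodUnits : ℕ → ℕ → ℤ
prodUnits p zero    = 1ℤ
prodUnits p (suc n) =
  prodUnits p n * (if (n ≡ᵇ 0) then 1ℤ else (if divᵇ p n then 1ℤ else + n))

gammaNat : ℕ → ℕ → ℤ
gammaNat p n = ((- 1ℤ) ^ n) * prodUnits p n

-- a non-negative integer n with n ≡ x (mod p^k), for x ∈ ℚ ∩ ℤ_p
ratRep : ℕ → ℕ → ℚ → ℕ
ratRep p k x = modN ((↥ x) * invZ p k (+ (↧ₙ x))) (p ℕ.^ k)

-- Γ_p(x) mod p^k  (Γ_p is 1-Lipschitz, so Γ_p(x) ≡ Γ_p(n) mod p^k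
-- whenever n ≡ x mod p^k)
gammaP : ℕ → ℕ → ℚ → ℤ
gammaP p k x = gammaNat p (ratRep p k x)

-- Teichmüller character modulo p^k: ω(t) ≡ t^(p^k) (mod p^(k+1)).

teich : ℕ → ℕ → ℤ → ℤ
teich p k t = t ^ (p ℕ.^ k)

teichBarPow : ℕ → ℕ → ℤ → ℕ → ℤ
teichBarPow p k t j = invZ p k (teich p k t) ^ j

-- McCarthy's function, scaled by p^m, modulo p^k.
--
-- For each k the factor (-p)^e with e = -⌊⟨a⟩-j/(p-1)⌋ - ⌊⟨-b⟩+j/(p-1)⌋
-- satisfies e ≥ -1, so p·(-p)^e = -(-p)^(e+1) is a p-adic integer.
-- (The branch e + 1 < 0 never occurs; its value is irrelevant.)

pTimesNegPPow : ℕ → ℤ → ℤ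
pTimesNegPPow p e with e + 1ℤ
... | + n      = - ((- (+ p)) ^ n)
... | -[1+ n ] = 0ℤ

factor : ℕ → ℕ → ℕ → ℚ → ℚ → ℤ
factor p k j a b =
  let jq = divNat (+ j) (p ℕ.∸ 1)
      fa = frac a
      fb = frac (ℚ.- b)
      e  = (- floor (fa ℚ.- jq)) - floor (fb ℚ.+ jq)
  in pTimesNegPPow p e
     * gammaP p k (frac (a ℚ.- jq)) * invZ p k (gammaP p k fa)
     * gammaP p k (frac ((ℚ.- b) ℚ.+ jq)) * invZ p k (gammaP p k fb)

prodFactors : ∀ {m} → ℕ → ℕ → ℕ → Vec ℚ m → Vec ℚ m → ℤ
prodFactors p k j []       []       = 1ℤ
prodFactors p k j (a ∷ as) (b ∷ bs) = factor p k j a b * prodFactors p k j as bs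

scaledG : (m : ℕ) → Vec ℚ m → Vec ℚ m → (p k : ℕ) → ℤ → ℤ
scaledG m as bs p k t =
  - (invZ p k (+ (p ℕ.∸ 1))
     * sumℤ (map (λ j → ((- 1ℤ) ^ (j ℕ.* m)) * teichBarPow p k t j * prodFactors p k j as bs)
                (upTo (p ℕ.∸ 1))))

scaled2G2 : (p k : ℕ) → ℤ → ℤ
scaled2G2 = scaledG 2 (divNat (+ 1) 3 ∷ divNat (+ 2) 3 ∷ []) (ℚ.0ℚ ∷ divNat (+ 1) 2 ∷ [])

scaled2G2t : (p k : ℕ) → ℤ → ℤ
scaled2G2t = scaledG 2 (divNat (+ 1) 6 ∷ divNat (+ 5) 6 ∷ []) (ℚ.0ℚ ∷ divNat (+ 1) 2 ∷ [])

-- inverse in 𝔽_p (Fermat): x⁻¹ = x^(p-2)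
invFp : ℕ → ℤ → ℤ
invFp p x = x ^ (p ℕ.∸ 2)

qchar : ℕ → ℤ → ℤ
qchar p a =
  if modN a p ≡ᵇ 0 then 0ℤ
  else (if any (λ x → modN (+ x * + x - a) p ≡ᵇ 0) (upTo p) then 1ℤ else - 1ℤ)

cubic : ℕ → ℤ → ℤ → ℤ
cubic p s y = + 27 * y ^ 3 - + 27 * y ^ 2 + + 4 * invFp p s

numRoots : ℕ → ℤ → ℕ
numRoots p s = length (filterᵇ (λ y → modN (cubic p s (+ y)) p ≡ᵇ 0) (upTo p))

{-# OPTIONS --safe #-}
-- Both functions reduce to point counts: p² ₂G₂(s) = p² (r(s) - 1) and p² ₂G̃₂(s) = p² φ(3s) (r(s) - 1), where r(s) is the
-- number of roots of the cubic attached to s; the theorem is a linear combination of these.  By the multiplication formula of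
-- Γ_p for m = 2, 3 and the reflection formula, the j-th summand of ₂G₂ is Γ_p(⟨-3j/q⟩) Γ_p(⟨2j/q⟩) Γ_p(j/q) up to a
-- power of -p and the value of a character, q = p - 1, which by Gross and Koblitz is the Jacobi sum Σ ω̄(x²y)^j over 1 + x + y = 0.
-- Summing over j counts the points with x²y prescribed, that is, the roots of the cubic.  Shifting j by q/2 turns the summands
-- of the second function into those of the first.
--
-- The Gross–Koblitz formula is proved with rational numbers only.  Let c_n be the coefficients of exp(y + y^p/p).  With π^q = -p
-- the Gauss sum of ω^(-a) is q π^a Σ_m (-p)^m c_(a+qm).  Contiguity (G-step) evaluates the sum as (-p)^k k! / (a+pk)! for any k
-- close to -a/q, which is a value of Γ_p.  Convergence rests on finite differences of k ↦ (-p)^k k! / (pk)!.  Products of Gauss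
-- sums are handled through the trace of ℚ(π) over ℚ, which only sees the coefficients of exponents divisible by q.
module Submission where

open import Data.Nat using (ℕ; suc; _<_)
open import Data.Nat.Primality using (Prime)

-- All statements are congruences modulo p^k, so nothing is completed: p-adic integers are
-- represented by rationals with denominator prime to p, and every infinite series is cut off with
-- an explicit error. A margin makes this possible. Under y = πz the series exp (y + y^p/p) becomes
-- Dwork's exp (π (z - z^p)), but its coefficients have growing denominators. They are bounded by
-- p^(n/p + n/p²), while π^n contributes p^(n/(p-1)); since (p-1)(p+1) = p² - 1 < p², every p - 1
-- exponents gain 1/p². The bound comes from 1/Γ_p(pk), whose differences in k are highly divisible
-- by p, thanks to Wilson's theorem.
--
-- No p-th root of unity appears. From π^p = -pπ alone the trace of exp (a y + b y^p/p) at π is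
-- unchanged when pα is added to both a and b, which is what the periodicity of an additive
-- character amounts to.
--
-- The parameters 1/3, 2/3, 1/2, 1/6, 5/6 and j/(p-1) have the common denominator 6(p-1), so floors
-- and fractional parts become divisions with remainder by that number.

module Base where

  open import Data.Nat as ℕ using (ℕ; zero; suc; z≤n; s≤s)
  import Data.Nat.Properties as ℕP
  open import Data.Integer as ℤ using (ℤ)
  import Data.Integer.Properties as ℤP
  open import Data.Rational using (ℚ; mkℚ; 0ℚ; 1ℚ; _+_; _*_; _-_; -_; ↥_; ↧ₙ_; toℚᵘ)
  import Data.Rational as ℚ
  open import Data.Rational.Properties using (toℚᵘ-injective; toℚᵘ-fromℚᵘ; toℚᵘ-homo-+; toℚᵘ-homo-*; +-identityˡ; +-identityʳ; *-identityˡ; *-identityʳ; *-zeroˡ; *-zeroʳ; *-comm; +-assoc; *-assoc; *-distribˡ-+; *-distribʳ-+; +-inverseʳ)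
  open import Data.Rational.Solver using (module +-*-Solver)
  import Data.Rational.Unnormalised as ℚᵘ
  import Data.Rational.Unnormalised.Properties as ℚᵘP
  open import Relation.Binary.PropositionalEquality
  open import Function using (_∘_)

  open +-*-Solver

  -- Integers inside the rationals

  abstract
    -- Opaque, so that large integers are handled by the ring laws and never by normalising a
    -- fraction; `ι-def` reopens it at the few places where a literal fraction occurs.
    ι : ℤ → ℚ
    ι z = z ℚ./ 1

    toℚᵘ-ι : ∀ z → toℚᵘ (ι z) ℚᵘ.≃ ℚᵘ.mkℚᵘ z 0
    toℚᵘ-ι z = toℚᵘ-fromℚᵘ (ℚᵘ.mkℚᵘ z 0)

    ι-+ : ∀ a b → ι (a ℤ.+ b) ≡ ι a + ι b
    ι-+ a b = toℚᵘ-injective (ℚᵘP.≃-trans (toℚᵘ-ι (a ℤ.+ b)) (ℚᵘP.≃-sym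
      (ℚᵘP.≃-trans (toℚᵘ-homo-+ (ι a) (ι b)) (ℚᵘP.≃-trans (ℚᵘP.+-cong (toℚᵘ-ι a) (toℚᵘ-ι b))
        (ℚᵘ.*≡* (cong (ℤ._* ℤ.+ 1) (cong₂ ℤ._+_ (ℤP.*-identityʳ a) (ℤP.*-identityʳ b))))))))

    ι-* : ∀ a b → ι (a ℤ.* b) ≡ ι a * ι b
    ι-* a b = toℚᵘ-injective (ℚᵘP.≃-trans (toℚᵘ-ι (a ℤ.* b)) (ℚᵘP.≃-sym
      (ℚᵘP.≃-trans (toℚᵘ-homo-* (ι a) (ι b)) (ℚᵘP.≃-trans (ℚᵘP.*-cong (toℚᵘ-ι a) (toℚᵘ-ι b))
        (ℚᵘ.*≡* refl)))))

    ι-inj : ∀ {a b} → ι a ≡ ι b → a ≡ b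
    ι-inj {a} {b} e with ℚᵘP.≃-trans (ℚᵘP.≃-sym (toℚᵘ-ι a)) (ℚᵘP.≃-trans (ℚᵘP.≃-reflexive (cong toℚᵘ e)) (toℚᵘ-ι b))
    ... | ℚᵘ.*≡* h = trans (sym (ℤP.*-identityʳ a)) (trans h (ℤP.*-identityʳ b))

    ι-def : ∀ z → ι z ≡ z ℚ./ 1
    ι-def z = refl

  # : ℕ → ℚ
  # n = ι (ℤ.+ n)

  abstract
    #0 : # 0 ≡ 0ℚ
    #0 = refl

    #1 : # 1 ≡ 1ℚ
    #1 = refl

    /-* : ∀ z d → (z ℚ./ suc d) * # (suc d) ≡ ι z
    /-* z d = toℚᵘ-injective (ℚᵘP.≃-trans (toℚᵘ-homo-* (z ℚ./ suc d) (# (suc d)))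
      (ℚᵘP.≃-trans (ℚᵘP.*-cong (toℚᵘ-fromℚᵘ (ℚᵘ.mkℚᵘ z d)) (toℚᵘ-ι (ℤ.+ suc d)))
      (ℚᵘP.≃-trans (ℚᵘ.*≡* (trans (ℤP.*-identityʳ _) (cong (λ k → z ℤ.* ℤ.+ suc k) (sym (ℕP.*-identityʳ d))))) (ℚᵘP.≃-sym (toℚᵘ-ι z)))))

    ↥↧ : ∀ x → x * # (↧ₙ x) ≡ ι (↥ x)
    ↥↧ x@(mkℚ n d c) = toℚᵘ-injective (ℚᵘP.≃-trans (toℚᵘ-homo-* x (# (suc d)))
      (ℚᵘP.≃-trans (ℚᵘP.*-cong (ℚᵘP.≃-refl {ℚᵘ.mkℚᵘ n d}) (toℚᵘ-ι (ℤ.+ suc d)))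
      (ℚᵘP.≃-trans (ℚᵘ.*≡* (trans (ℤP.*-identityʳ _) (cong (λ k → n ℤ.* ℤ.+ suc k) (sym (ℕP.*-identityʳ d))))) (ℚᵘP.≃-sym (toℚᵘ-ι n)))))

    -- iv 0 is a junk value
    iv : ℕ → ℚ
    iv zero    = 0ℚ
    iv (suc n) = ℤ.+ 1 ℚ./ suc n

    iv-inv : ∀ n → iv (suc n) * # (suc n) ≡ 1ℚ
    iv-inv n = /-* (ℤ.+ 1) n

  ι-neg : ∀ a → ι (ℤ.- a) ≡ - ι a
  ι-neg a = begin
    ι (ℤ.- a)                  ≡⟨ solve 2 (λ x y → x := (x :+ y) :- y) refl (ι (ℤ.- a)) (ι a) ⟩
    (ι (ℤ.- a) + ι a) - ι a    ≡⟨ cong (_- ι a) (trans (sym (ι-+ (ℤ.- a) a)) (trans (cong ι (ℤP.+-inverseˡ a)) #0)) ⟩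
    0ℚ - ι a                   ≡⟨ +-identityˡ (- ι a) ⟩
    - ι a                      ∎
    where open ≡-Reasoning

  ι-- : ∀ a b → ι (a ℤ.- b) ≡ ι a - ι b
  ι-- a b = trans (ι-+ a (ℤ.- b)) (cong (λ z → ι a + z) (ι-neg b))

  #-+ : ∀ m n → # (m ℕ.+ n) ≡ # m + # n
  #-+ m n = ι-+ (ℤ.+ m) (ℤ.+ n)

  #-* : ∀ m n → # (m ℕ.* n) ≡ # m * # n
  #-* m n = trans (cong ι (ℤP.pos-* m n)) (ι-* (ℤ.+ m) (ℤ.+ n))

  #-suc : ∀ n → # (suc n) ≡ 1ℚ + # n
  #-suc n = trans (#-+ 1 n) (cong (_+ # n) #1)

  #-cancel : ∀ n {x y} → # (suc n) * x ≡ # (suc n) * y → x ≡ y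
  #-cancel n {x} {y} e = trans (sym (h x)) (trans (cong (iv (suc n) *_) e) (h y))
    where
    h : ∀ z → iv (suc n) * (# (suc n) * z) ≡ z
    h z = trans (sym (*-assoc (iv (suc n)) (# (suc n)) z)) (trans (cong (_* z) (iv-inv n)) (*-identityˡ z))

  -- Powers and finite sums

  infixr 8 _^_
  _^_ : ℚ → ℕ → ℚ
  x ^ zero  = 1ℚ
  x ^ suc n = x * x ^ n

  ^-+ : ∀ x m n → x ^ (m ℕ.+ n) ≡ x ^ m * x ^ n
  ^-+ x zero    n = sym (*-identityˡ _)
  ^-+ x (suc m) n = trans (cong (x *_) (^-+ x m n)) (sym (*-assoc x (x ^ m) (x ^ n)))

  1^ : ∀ n → 1ℚ ^ n ≡ 1ℚ
  1^ zero    = refl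
  1^ (suc n) = trans (*-identityˡ _) (1^ n)

  0^ : ∀ n → 0ℚ ^ suc n ≡ 0ℚ
  0^ n = *-zeroˡ (0ℚ ^ n)

  *-^ : ∀ x y n → (x * y) ^ n ≡ x ^ n * y ^ n
  *-^ x y zero    = refl
  *-^ x y (suc n) = trans (cong (x * y *_) (*-^ x y n))
    (solve 4 (λ x y a b → x :* y :* (a :* b) := x :* a :* (y :* b)) refl x y (x ^ n) (y ^ n))

  ^-* : ∀ x m n → x ^ (m ℕ.* n) ≡ (x ^ m) ^ n
  ^-* x zero    n = sym (1^ n)
  ^-* x (suc m) n = trans (^-+ x n (m ℕ.* n)) (trans (cong (x ^ n *_) (^-* x m n)) (sym (*-^ x (x ^ m) n)))

  ι-^ : ∀ z n → ι (z ℤ.^ n) ≡ ι z ^ n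
  ι-^ z zero    = #1
  ι-^ z (suc n) = trans (ι-* z (z ℤ.^ n)) (cong (ι z *_) (ι-^ z n))

  #-^ : ∀ m n → # (m ℕ.^ n) ≡ # m ^ n
  #-^ m zero    = #1
  #-^ m (suc n) = trans (#-* m (m ℕ.^ n)) (cong (# m *_) (#-^ m n))

  ∑ : ℕ → (ℕ → ℚ) → ℚ
  ∑ zero    f = 0ℚ
  ∑ (suc n) f = f 0 + ∑ n (f ∘ suc)

  ∑-cong : ∀ n {f g : ℕ → ℚ} → (∀ i → i ℕ.< n → f i ≡ g i) → ∑ n f ≡ ∑ n g
  ∑-cong zero    h = refl
  ∑-cong (suc n) h = cong₂ _+_ (h 0 (s≤s z≤n)) (∑-cong n (λ i l → h (suc i) (s≤s l)))

  ∑-ext : ∀ n {f g : ℕ → ℚ} → (∀ i → f i ≡ g i) → ∑ n f ≡ ∑ n g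
  ∑-ext n h = ∑-cong n (λ i _ → h i)

  ∑-zero : ∀ n {f : ℕ → ℚ} → (∀ i → i ℕ.< n → f i ≡ 0ℚ) → ∑ n f ≡ 0ℚ
  ∑-zero zero    h = refl
  ∑-zero (suc n) h = trans (cong₂ _+_ (h 0 (s≤s z≤n)) (∑-zero n (λ i l → h (suc i) (s≤s l)))) (+-identityˡ 0ℚ)

  ∑-+ : ∀ n (f g : ℕ → ℚ) → ∑ n (λ i → f i + g i) ≡ ∑ n f + ∑ n g
  ∑-+ zero    f g = refl
  ∑-+ (suc n) f g = trans (cong (f 0 + g 0 +_) (∑-+ n (f ∘ suc) (g ∘ suc)))
    (solve 4 (λ a b c d → a :+ b :+ (c :+ d) := a :+ c :+ (b :+ d)) refl (f 0) (g 0) (∑ n (f ∘ suc)) (∑ n (g ∘ suc)))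

  ∑-*ˡ : ∀ n c (f : ℕ → ℚ) → ∑ n (λ i → c * f i) ≡ c * ∑ n f
  ∑-*ˡ zero    c f = sym (*-zeroʳ c)
  ∑-*ˡ (suc n) c f = trans (cong (c * f 0 +_) (∑-*ˡ n c (f ∘ suc))) (sym (*-distribˡ-+ c (f 0) _))

  ∑-*ʳ : ∀ n (f : ℕ → ℚ) c → ∑ n (λ i → f i * c) ≡ ∑ n f * c
  ∑-*ʳ n f c = trans (∑-ext n (λ i → *-comm (f i) c)) (trans (∑-*ˡ n c f) (*-comm c _))

  ∑-- : ∀ n (f g : ℕ → ℚ) → ∑ n (λ i → f i - g i) ≡ ∑ n f - ∑ n g
  ∑-- zero    f g = refl
  ∑-- (suc n) f g = trans (cong (f 0 - g 0 +_) (∑-- n (f ∘ suc) (g ∘ suc)))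
    (solve 4 (λ a b c d → a :- b :+ (c :- d) := a :+ c :- (b :+ d)) refl (f 0) (g 0) (∑ n (f ∘ suc)) (∑ n (g ∘ suc)))

  ∑-split : ∀ m n (f : ℕ → ℚ) → ∑ (m ℕ.+ n) f ≡ ∑ m f + ∑ n (λ i → f (m ℕ.+ i))
  ∑-split zero    n f = sym (+-identityˡ _)
  ∑-split (suc m) n f = trans (cong (f 0 +_) (∑-split m n (f ∘ suc))) (sym (+-assoc (f 0) _ _))

  ∑-swap : ∀ m n (f : ℕ → ℕ → ℚ) → ∑ m (λ i → ∑ n (f i)) ≡ ∑ n (λ j → ∑ m (λ i → f i j))
  ∑-swap zero    n f = sym (∑-zero n (λ _ _ → refl))
  ∑-swap (suc m) n f = trans (cong (∑ n (f 0) +_) (∑-swap m n (f ∘ suc))) (sym (∑-+ n (f 0) (λ j → ∑ m (λ i → f (suc i) j))))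

  ∑-* : ∀ m n (f g : ℕ → ℚ) → ∑ m f * ∑ n g ≡ ∑ m (λ i → ∑ n (λ j → f i * g j))
  ∑-* m n f g = trans (sym (∑-*ʳ m f (∑ n g))) (∑-ext m (λ i → sym (∑-*ˡ n (f i) g)))

  ∑-telescope : ∀ n (f : ℕ → ℚ) → ∑ n (λ i → f (suc i) - f i) ≡ f n - f 0
  ∑-telescope zero    f = sym (+-inverseʳ (f 0))
  ∑-telescope (suc n) f = trans (cong (f 1 - f 0 +_) (∑-telescope n (f ∘ suc)))
    (solve 3 (λ a b c → a :- b :+ (c :- a) := c :- b) refl (f 1) (f 0) (f (suc n)))

  ∑-single : ∀ n (f : ℕ → ℚ) k → k ℕ.< n → (∀ i → i ℕ.< n → i ≢ k → f i ≡ 0ℚ) → ∑ n f ≡ f k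
  ∑-single (suc n) f zero    _       h = trans (cong (f 0 +_) (∑-zero n (λ i l → h (suc i) (s≤s l) (λ ())))) (+-identityʳ (f 0))
  ∑-single (suc n) f (suc k) (s≤s l) h = trans
    (cong₂ _+_ (h 0 (s≤s z≤n) (λ ())) (∑-single n (f ∘ suc) k l (λ i l′ ne → h (suc i) (s≤s l′) (ne ∘ ℕP.suc-injective))))
    (+-identityˡ _)

  ∑-const : ∀ n c → ∑ n (λ _ → c) ≡ # n * c
  ∑-const zero    c = trans (sym (*-zeroˡ c)) (cong (_* c) (sym #0))
  ∑-const (suc n) c = trans (cong (c +_) (∑-const n c))
    (trans (solve 2 (λ c m → c :+ m :* c := (con 1ℚ :+ m) :* c) refl c (# n)) (cong (_* c) (sym (#-suc n))))

  -- Formal power series are sequences of coefficients, S is multiplication by the variable y, D is y d/dy.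
  Seq : Set
  Seq = ℕ → ℚ

  tl : Seq → Seq
  tl f n = f (suc n)

  S : Seq → Seq
  S f zero    = 0ℚ
  S f (suc n) = f n

  S^ : ℕ → Seq → Seq
  S^ zero    f = f
  S^ (suc k) f = S (S^ k f)

  D : Seq → Seq
  D f n = # n * f n

  infixl 7 _⋆_
  _⋆_ : Seq → Seq → Seq
  (f ⋆ g) zero    = f 0 * g 0
  (f ⋆ g) (suc n) = f 0 * g (suc n) + (tl f ⋆ g) n

  ⋆-cong : ∀ {f f′ g g′ : Seq} n → (∀ i → i ℕ.≤ n → f i ≡ f′ i) → (∀ i → i ℕ.≤ n → g i ≡ g′ i) → (f ⋆ g) n ≡ (f′ ⋆ g′) n
  ⋆-cong zero    hf hg = cong₂ _*_ (hf 0 z≤n) (hg 0 z≤n)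
  ⋆-cong (suc n) hf hg = cong₂ _+_ (cong₂ _*_ (hf 0 z≤n) (hg (suc n) ℕP.≤-refl))
    (⋆-cong n (λ i l → hf (suc i) (s≤s l)) (λ i l → hg i (ℕP.m≤n⇒m≤1+n l)))

  ⋆-ext : ∀ {f f′ g g′ : Seq} → (∀ i → f i ≡ f′ i) → (∀ i → g i ≡ g′ i) → ∀ n → (f ⋆ g) n ≡ (f′ ⋆ g′) n
  ⋆-ext hf hg n = ⋆-cong n (λ i _ → hf i) (λ i _ → hg i)

  ⋆-+ˡ : ∀ f f′ g n → ((λ i → f i + f′ i) ⋆ g) n ≡ (f ⋆ g) n + (f′ ⋆ g) n
  ⋆-+ˡ f f′ g zero    = *-distribʳ-+ (g 0) (f 0) (f′ 0)
  ⋆-+ˡ f f′ g (suc n) = trans (cong ((f 0 + f′ 0) * g (suc n) +_) (⋆-+ˡ (tl f) (tl f′) g n))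
    (solve 5 (λ a b c d e → (a :+ b) :* c :+ (d :+ e) := (a :* c :+ d) :+ (b :* c :+ e)) refl (f 0) (f′ 0) (g (suc n)) _ _)

  ⋆-+ʳ : ∀ f g g′ n → (f ⋆ (λ i → g i + g′ i)) n ≡ (f ⋆ g) n + (f ⋆ g′) n
  ⋆-+ʳ f g g′ zero    = *-distribˡ-+ (f 0) (g 0) (g′ 0)
  ⋆-+ʳ f g g′ (suc n) = trans (cong (f 0 * (g (suc n) + g′ (suc n)) +_) (⋆-+ʳ (tl f) g g′ n))
    (solve 5 (λ a b c d e → a :* (b :+ c) :+ (d :+ e) := (a :* b :+ d) :+ (a :* c :+ e)) refl (f 0) (g (suc n)) (g′ (suc n)) _ _)

  ⋆-*ˡ : ∀ c f g n → ((λ i → c * f i) ⋆ g) n ≡ c * (f ⋆ g) n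
  ⋆-*ˡ c f g zero    = *-assoc c (f 0) (g 0)
  ⋆-*ˡ c f g (suc n) = trans (cong (c * f 0 * g (suc n) +_) (⋆-*ˡ c (tl f) g n))
    (solve 4 (λ c a b d → c :* a :* b :+ c :* d := c :* (a :* b :+ d)) refl c (f 0) (g (suc n)) _)

  ⋆-*ʳ : ∀ c f g n → (f ⋆ (λ i → c * g i)) n ≡ c * (f ⋆ g) n
  ⋆-*ʳ c f g zero    = solve 3 (λ c a b → a :* (c :* b) := c :* (a :* b)) refl c (f 0) (g 0)
  ⋆-*ʳ c f g (suc n) = trans (cong (f 0 * (c * g (suc n)) +_) (⋆-*ʳ c (tl f) g n))
    (solve 4 (λ c a b d → a :* (c :* b) :+ c :* d := c :* (a :* b :+ d)) refl c (f 0) (g (suc n)) _)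

  ⋆-zeroˡ : ∀ g n → ((λ _ → 0ℚ) ⋆ g) n ≡ 0ℚ
  ⋆-zeroˡ g zero    = *-zeroˡ (g 0)
  ⋆-zeroˡ g (suc n) = trans (cong₂ _+_ (*-zeroˡ (g (suc n))) (⋆-zeroˡ g n)) refl

  ⋆-zeroʳ : ∀ f n → (f ⋆ (λ _ → 0ℚ)) n ≡ 0ℚ
  ⋆-zeroʳ f zero    = *-zeroʳ (f 0)
  ⋆-zeroʳ f (suc n) = trans (cong₂ _+_ (*-zeroʳ (f 0)) (⋆-zeroʳ (tl f) n)) refl

  ⋆-∑ˡ : ∀ m (F : ℕ → Seq) g n → ((λ i → ∑ m (λ x → F x i)) ⋆ g) n ≡ ∑ m (λ x → (F x ⋆ g) n)
  ⋆-∑ˡ zero    F g n = ⋆-zeroˡ g n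
  ⋆-∑ˡ (suc m) F g n = trans (⋆-+ˡ (F 0) _ g n) (cong ((F 0 ⋆ g) n +_) (⋆-∑ˡ m (F ∘ suc) g n))

  ⋆-∑ʳ : ∀ m f (G : ℕ → Seq) n → (f ⋆ (λ i → ∑ m (λ x → G x i))) n ≡ ∑ m (λ x → (f ⋆ G x) n)
  ⋆-∑ʳ zero    f G n = ⋆-zeroʳ f n
  ⋆-∑ʳ (suc m) f G n = trans (⋆-+ʳ f (G 0) _ n) (cong ((f ⋆ G 0) n +_) (⋆-∑ʳ m f (G ∘ suc) n))

  ⋆-Sˡ : ∀ f g n → (S f ⋆ g) n ≡ S (f ⋆ g) n
  ⋆-Sˡ f g zero    = *-zeroˡ (g 0)
  ⋆-Sˡ f g (suc n) = trans (cong (_+ (f ⋆ g) n) (*-zeroˡ (g (suc n)))) (+-identityˡ _)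

  ⋆-Sʳ : ∀ f g n → (f ⋆ S g) n ≡ S (f ⋆ g) n
  ⋆-Sʳ f g zero          = *-zeroʳ (f 0)
  ⋆-Sʳ f g (suc zero)    = trans (cong (f 0 * g 0 +_) (*-zeroʳ (f 1))) (+-identityʳ _)
  ⋆-Sʳ f g (suc (suc n)) = cong (f 0 * g (suc n) +_) (⋆-Sʳ (tl f) g (suc n))

  S-cong : ∀ {f g : Seq} → (∀ i → f i ≡ g i) → ∀ n → S f n ≡ S g n
  S-cong h zero    = refl
  S-cong h (suc n) = h n

  ⋆-S^ˡ : ∀ k f g n → (S^ k f ⋆ g) n ≡ S^ k (f ⋆ g) n
  ⋆-S^ˡ zero    f g n = refl
  ⋆-S^ˡ (suc k) f g n = trans (⋆-Sˡ (S^ k f) g n) (S-cong (⋆-S^ˡ k f g) n)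

  ⋆-S^ʳ : ∀ k f g n → (f ⋆ S^ k g) n ≡ S^ k (f ⋆ g) n
  ⋆-S^ʳ zero    f g n = refl
  ⋆-S^ʳ (suc k) f g n = trans (⋆-Sʳ f (S^ k g) n) (S-cong (⋆-S^ʳ k f g) n)

  S^-+ : ∀ k f n → S^ k f (k ℕ.+ n) ≡ f n
  S^-+ zero    f n = refl
  S^-+ (suc k) f n = S^-+ k f n

  S^-< : ∀ k f n → n ℕ.< k → S^ k f n ≡ 0ℚ
  S^-< (suc k) f zero    l       = refl
  S^-< (suc k) f (suc n) (s≤s l) = S^-< k f n l

  D-⋆ : ∀ f g n → D (f ⋆ g) n ≡ (D f ⋆ g) n + (f ⋆ D g) n
  D-⋆ f g zero    = trans (cong (_* (f 0 * g 0)) #0) (trans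
    (solve 2 (λ a b → con 0ℚ :* (a :* b) := con 0ℚ :* a :* b :+ a :* (con 0ℚ :* b)) refl (f 0) (g 0))
    (cong₂ (λ x y → x * f 0 * g 0 + f 0 * (y * g 0)) (sym #0) (sym #0)))
  D-⋆ f g (suc n) = begin
    # (suc n) * (f 0 * g (suc n) + (tl f ⋆ g) n)
      ≡⟨ cong (λ a → a * (f 0 * g (suc n) + (tl f ⋆ g) n)) (#-suc n) ⟩
    (1ℚ + # n) * (f 0 * g (suc n) + (tl f ⋆ g) n)
      ≡⟨ solve 4 (λ m a b x → (con 1ℚ :+ m) :* (a :* b :+ x) := (con 1ℚ :+ m) :* (a :* b) :+ (x :+ m :* x)) refl (# n) (f 0) (g (suc n)) ((tl f ⋆ g) n) ⟩
    (1ℚ + # n) * (f 0 * g (suc n)) + ((tl f ⋆ g) n + D (tl f ⋆ g) n)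
      ≡⟨ cong (λ x → (1ℚ + # n) * (f 0 * g (suc n)) + ((tl f ⋆ g) n + x)) (D-⋆ (tl f) g n) ⟩
    (1ℚ + # n) * (f 0 * g (suc n)) + ((tl f ⋆ g) n + ((D (tl f) ⋆ g) n + (tl f ⋆ D g) n))
      ≡⟨ solve 6 (λ m a b x y z → (con 1ℚ :+ m) :* (a :* b) :+ (x :+ (y :+ z)) := (con 0ℚ :* a :* b :+ (x :+ y)) :+ (a :* ((con 1ℚ :+ m) :* b) :+ z)) refl
           (# n) (f 0) (g (suc n)) ((tl f ⋆ g) n) ((D (tl f) ⋆ g) n) ((tl f ⋆ D g) n) ⟩
    (0ℚ * f 0 * g (suc n) + ((tl f ⋆ g) n + (D (tl f) ⋆ g) n)) + (f 0 * ((1ℚ + # n) * g (suc n)) + (tl f ⋆ D g) n)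
      ≡⟨ cong (λ z → (z * f 0 * g (suc n) + ((tl f ⋆ g) n + (D (tl f) ⋆ g) n)) + (f 0 * ((1ℚ + # n) * g (suc n)) + (tl f ⋆ D g) n)) (sym #0) ⟩
    (# 0 * f 0 * g (suc n) + ((tl f ⋆ g) n + (D (tl f) ⋆ g) n)) + (f 0 * ((1ℚ + # n) * g (suc n)) + (tl f ⋆ D g) n)
      ≡⟨ cong₂ (λ a b → (# 0 * f 0 * g (suc n) + a) + (f 0 * (b * g (suc n)) + (tl f ⋆ D g) n)) (trans (sym (⋆-+ˡ (tl f) (D (tl f)) g n)) (⋆-ext e (λ _ → refl) n)) (sym (#-suc n)) ⟩
    (D f ⋆ g) (suc n) + (f ⋆ D g) (suc n) ∎
    where
    open ≡-Reasoning
    e : ∀ i → tl f i + D (tl f) i ≡ tl (D f) i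
    e i = trans (solve 2 (λ x m → x :+ m :* x := (con 1ℚ :+ m) :* x) refl (f (suc i)) (# i)) (cong (_* f (suc i)) (sym (#-suc i)))

  -- A weight on the index n can be shared out between the two factors, pair by pair. This serves
  -- geometric weights, where it is a change of variable, and trace weights, which are
  -- multiplicative only on residue classes of the index.
  ⋆-weighted : ∀ (f g f′ g′ : Seq) (w : ℕ → ℚ) n → (∀ i j → i ℕ.+ j ≡ n → w n * (f i * g j) ≡ f′ i * g′ j) → w n * (f ⋆ g) n ≡ (f′ ⋆ g′) n
  ⋆-weighted f g f′ g′ w zero    h = h 0 0 refl
  ⋆-weighted f g f′ g′ w (suc n) h = trans (*-distribˡ-+ (w (suc n)) _ _) (cong₂ _+_ (h 0 (suc n) refl)
    (⋆-weighted (tl f) g (tl f′) g′ (λ m → w (suc m)) n (λ i j e → h (suc i) j (cong suc e))))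

  -- A truncated Cauchy product is a sum over a triangle. The missing part of the square, the pairs
  -- with i + j ≥ N, is estimated in `∑-⋆-≈`.
  ∑-⋆ : ∀ (f g : Seq) N → ∑ N (f ⋆ g) ≡ ∑ N (λ i → f i * ∑ (N ℕ.∸ i) g)
  ∑-⋆ f g zero          = refl
  ∑-⋆ f g (suc N)       = begin
    f 0 * g 0 + ∑ N (λ n → f 0 * g (suc n) + (tl f ⋆ g) n)
      ≡⟨ cong (f 0 * g 0 +_) (∑-+ N (λ n → f 0 * g (suc n)) (tl f ⋆ g)) ⟩
    f 0 * g 0 + (∑ N (λ n → f 0 * g (suc n)) + ∑ N (tl f ⋆ g))
      ≡⟨ cong₂ (λ a b → f 0 * g 0 + (a + b)) (∑-*ˡ N (f 0) (g ∘ suc)) (∑-⋆ (tl f) g N) ⟩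
    f 0 * g 0 + (f 0 * ∑ N (g ∘ suc) + ∑ N (λ i → f (suc i) * ∑ (N ℕ.∸ i) g))
      ≡⟨ solve 4 (λ a b c d → a :* b :+ (a :* c :+ d) := a :* (b :+ c) :+ d) refl (f 0) (g 0) _ _ ⟩
    f 0 * (g 0 + ∑ N (g ∘ suc)) + ∑ N (λ i → f (suc i) * ∑ (N ℕ.∸ i) g) ∎
    where open ≡-Reasoning

module Proof (q : ℕ) (pp : Prime (suc q)) (q>2 : 2 < q) where

  open import Data.Nat as ℕ using (ℕ; zero; suc; z≤n; s≤s)
  import Data.Nat.Properties as ℕP
  open import Data.Integer as ℤ using (ℤ; -[1+_])
  import Data.Integer.Properties as ℤP
  open import Data.Rational using (ℚ; mkℚ; 0ℚ; 1ℚ; _+_; _*_; _-_; -_; ↥_; ↧ₙ_)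
  import Data.Rational as ℚ
  open import Data.Rational.Properties using (+-identityˡ; +-identityʳ; *-identityˡ; *-identityʳ; *-zeroˡ; *-zeroʳ; +-comm; *-comm; +-assoc; *-assoc; *-distribˡ-+; *-distribʳ-+; +-inverseʳ)
  open import Data.Rational.Solver using (module +-*-Solver)
  open import Data.Product using (Σ; _×_; _,_; proj₁; proj₂)
  open import Data.Sum using (_⊎_; inj₁; inj₂; [_,_]′)
  open import Data.Empty using (⊥; ⊥-elim)
  open import Relation.Nullary using (¬_; Dec; yes; no)
  open import Relation.Binary.PropositionalEquality
  open import Function using (_∘_)
  open import Data.Nat.Primality using (Prime; euclidsLemma; composite)
  open import Data.Nat.Divisibility using (_∣_; divides; _∣0; _∣?_; 1∣_; ∣-trans; m∣m*n; n∣m*n; *-monoʳ-∣; *-cancelˡ-∣; ∣m+n∣m⇒∣n; ∣m∣n⇒∣m+n; ∣⇒≤; ∣-refl)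
  open import Data.Nat using (NonZero; >-nonZero)
  open import Relation.Binary.Definitions using (Tri; tri<; tri≈; tri>)
  import Data.Nat.DivMod as ℕD
  open import Data.Integer.DivMod using (_%ℕ_; _/ℕ_; n%ℕd<d; a≡a%ℕn+[a/ℕn]*n; n%d<d; a≡a%n+[a/n]*n)
  import Data.Nat.Solver
  import Defs as F
  open import Data.Vec using (Vec) renaming (_∷_ to _∷ᵛ_; [] to []ᵛ)
  open import Data.Bool.ListAction using (any)
  open import Data.Bool using (Bool; true; false; if_then_else_)
  open import Data.List using (map; upTo; applyUpTo; length; filterᵇ)
  open import Data.Nat.Divisibility using (m%n≡0⇒n∣m; n∣m⇒m%n≡0)
  open import Data.Nat.GCD using (gcd-greatest)
  open import Data.Nat.Coprimality as Coprimality using (coprime⇒gcd≡1)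
  module NS = Data.Nat.Solver.+-*-Solver

  open Base
  open +-*-Solver

  -- Rationals integral at p

  p : ℕ
  p = suc q

  P : ℚ
  P = # p

  0<q : 0 ℕ.< q
  0<q = ℕP.≤-trans (s≤s z≤n) q>2

  p∤1 : ¬ (p ∣ 1)
  p∤1 h = ℕP.<-irrefl refl (ℕP.≤-trans (s≤s 0<q) (∣⇒≤ h))

  p∤* : ∀ {m n} → ¬ (p ∣ m) → ¬ (p ∣ n) → ¬ (p ∣ m ℕ.* n)
  p∤* {m} {n} hm hn h with euclidsLemma m n pp h
  ... | inj₁ x = hm x
  ... | inj₂ y = hn y

  p∤<p : ∀ i → i ℕ.< q → ¬ (p ∣ suc i)
  p∤<p i l h = ℕP.<-irrefl refl (ℕP.≤-trans (s≤s l) (∣⇒≤ h))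

  -- The localisation of ℤ at p, witnessed by a denominator that need not be reduced, so that sums
  -- and products are integral without any gcd.
  record Int (x : ℚ) : Set where
    constructor int
    field
      den   : ℕ
      unit  : ¬ (p ∣ den)
      num   : ℤ
      den-* : # den * x ≡ ι num

  Int-ι : ∀ z → Int (ι z)
  Int-ι z = int 1 p∤1 z (trans (cong (_* ι z) #1) (*-identityˡ (ι z)))

  Int-# : ∀ n → Int (# n)
  Int-# n = Int-ι (ℤ.+ n)

  Int-0 : Int 0ℚ
  Int-0 = subst Int #0 (Int-# 0)

  Int-1 : Int 1ℚ
  Int-1 = subst Int #1 (Int-# 1)

  Int-≡ : ∀ {x y} → x ≡ y → Int x → Int y
  Int-≡ refl h = h

  Int-+ : ∀ {x y} → Int x → Int y → Int (x + y)
  Int-+ {x} {y} (int d pd z e) (int d′ pd′ z′ e′) = int (d ℕ.* d′) (p∤* pd pd′) ((ℤ.+ d′) ℤ.* z ℤ.+ (ℤ.+ d) ℤ.* z′) (begin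
    # (d ℕ.* d′) * (x + y)               ≡⟨ cong (_* (x + y)) (#-* d d′) ⟩
    # d * # d′ * (x + y)                 ≡⟨ solve 4 (λ a b x y → a :* b :* (x :+ y) := b :* (a :* x) :+ a :* (b :* y)) refl (# d) (# d′) x y ⟩
    # d′ * (# d * x) + # d * (# d′ * y)  ≡⟨ cong₂ (λ a b → # d′ * a + # d * b) e e′ ⟩
    # d′ * ι z + # d * ι z′              ≡⟨ sym (trans (ι-+ ((ℤ.+ d′) ℤ.* z) ((ℤ.+ d) ℤ.* z′)) (cong₂ _+_ (ι-* (ℤ.+ d′) z) (ι-* (ℤ.+ d) z′))) ⟩
    ι ((ℤ.+ d′) ℤ.* z ℤ.+ (ℤ.+ d) ℤ.* z′) ∎)
    where open ≡-Reasoning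

  Int-* : ∀ {x y} → Int x → Int y → Int (x * y)
  Int-* {x} {y} (int d pd z e) (int d′ pd′ z′ e′) = int (d ℕ.* d′) (p∤* pd pd′) (z ℤ.* z′) (begin
    # (d ℕ.* d′) * (x * y)   ≡⟨ cong (_* (x * y)) (#-* d d′) ⟩
    # d * # d′ * (x * y)     ≡⟨ solve 4 (λ a b x y → a :* b :* (x :* y) := (a :* x) :* (b :* y)) refl (# d) (# d′) x y ⟩
    (# d * x) * (# d′ * y)   ≡⟨ cong₂ _*_ e e′ ⟩
    ι z * ι z′               ≡⟨ sym (ι-* z z′) ⟩
    ι (z ℤ.* z′)             ∎)
    where open ≡-Reasoning

  Int-neg : ∀ {x} → Int x → Int (- x)
  Int-neg {x} (int d pd z e) = int d pd (ℤ.- z) (trans (solve 2 (λ d x → d :* (:- x) := :- (d :* x)) refl (# d) x) (trans (cong -_ e) (sym (ι-neg z))))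

  Int-- : ∀ {x y} → Int x → Int y → Int (x - y)
  Int-- hx hy = Int-+ hx (Int-neg hy)

  Int-^ : ∀ {x} n → Int x → Int (x ^ n)
  Int-^ zero    h = Int-1
  Int-^ (suc n) h = Int-* h (Int-^ n h)

  Int-∑ : ∀ n {f : ℕ → ℚ} → (∀ i → Int (f i)) → Int (∑ n f)
  Int-∑ zero    h = Int-0
  Int-∑ (suc n) h = Int-+ (h 0) (Int-∑ n (λ i → h (suc i)))

  Int-iv : ∀ n → ¬ (p ∣ n) → Int (iv n)
  Int-iv zero    h = ⊥-elim (h (p ∣0))
  Int-iv (suc n) h = int (suc n) h ℤ.1ℤ (trans (*-comm (# (suc n)) (iv (suc n))) (trans (iv-inv n) (sym #1)))

  record Unit (u : ℚ) : Set where
    constructor unit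
    field
      int-u   : Int u
      inv     : ℚ
      int-inv : Int inv
      u-inv   : u * inv ≡ 1ℚ

  Unit-1 : Unit 1ℚ
  Unit-1 = unit Int-1 1ℚ Int-1 refl

  Unit-* : ∀ {u v} → Unit u → Unit v → Unit (u * v)
  Unit-* {u} {v} (unit iu u′ iu′ eu) (unit iv v′ iv′ gauss) = unit (Int-* iu iv) (u′ * v′) (Int-* iu′ iv′)
    (trans (solve 4 (λ a b c d → a :* b :* (c :* d) := (a :* c) :* (b :* d)) refl u v u′ v′) (cong₂ _*_ eu gauss))

  Unit-^ : ∀ {u} n → Unit u → Unit (u ^ n)
  Unit-^ zero    h = Unit-1
  Unit-^ (suc n) h = Unit-* h (Unit-^ n h)

  Unit-neg : ∀ {u} → Unit u → Unit (- u)
  Unit-neg {u} (unit iu v iv e) = unit (Int-neg iu) (- v) (Int-neg iv) (trans (solve 2 (λ u v → (:- u) :* (:- v) := u :* v) refl u v) e)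

  Unit-# : ∀ n → ¬ (p ∣ n) → Unit (# n)
  Unit-# zero    h = ⊥-elim (h (p ∣0))
  Unit-# (suc n) h = unit (Int-# (suc n)) (iv (suc n)) (Int-iv (suc n) h) (trans (*-comm (# (suc n)) (iv (suc n))) (iv-inv n))

  Unit-ι : ∀ z → ¬ (p ∣ ℤ.∣ z ∣) → Unit (ι z)
  Unit-ι (ℤ.+ n)  h = Unit-# n h
  Unit-ι -[1+ n ] h = subst Unit (sym (ι-neg (ℤ.+ suc n))) (Unit-neg (Unit-# (suc n) h))

  Unit-q : Unit (# q)
  Unit-q = go q refl
    where
    go : ∀ m → m ≡ q → Unit (# m)
    go zero    e = ⊥-elim (ℕP.<-irrefl refl (ℕP.≤-trans (subst (2 ℕ.<_) (sym e) q>2) z≤n))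
    go (suc r) e = Unit-# (suc r) (p∤<p r (subst (r ℕ.<_) e ℕP.≤-refl))

  P^-cancel : ∀ a {x y} → P ^ a * x ≡ P ^ a * y → x ≡ y
  P^-cancel zero    {x} {y} e = trans (sym (*-identityˡ x)) (trans e (*-identityˡ y))
  P^-cancel (suc a) {x} {y} e = P^-cancel a (#-cancel q (trans (sym (*-assoc P (P ^ a) x)) (trans e (*-assoc P (P ^ a) y))))

  record Div (e : ℕ) (x : ℚ) : Set where
    constructor div
    field
      quo   : ℚ
      int-q : Int quo
      eq-q  : x ≡ P ^ e * quo

  Div-≡ : ∀ {e x y} → x ≡ y → Div e x → Div e y
  Div-≡ refl h = h

  Int→Div : ∀ {x} → Int x → Div 0 x
  Int→Div {x} h = div x h (sym (*-identityˡ x))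

  Div→Int : ∀ {e x} → Div e x → Int x
  Div→Int {e} (div y h eq) = Int-≡ (sym eq) (Int-* (Int-^ e (Int-# p)) h)

  Div-P^ : ∀ e {x} → Int x → Div e (P ^ e * x)
  Div-P^ e {x} h = div x h refl

  Div-0 : ∀ e → Div e 0ℚ
  Div-0 e = div 0ℚ Int-0 (sym (*-zeroʳ (P ^ e)))

  Div-+ : ∀ {e x y} → Div e x → Div e y → Div e (x + y)
  Div-+ {e} (div a ha refl) (div b hb refl) = div (a + b) (Int-+ ha hb) (sym (*-distribˡ-+ (P ^ e) a b))

  Div-*ʳ : ∀ {e x y} → Div e x → Int y → Div e (x * y)
  Div-*ʳ {e} {y = y} (div a ha refl) hy = div (a * y) (Int-* ha hy) (*-assoc (P ^ e) a y)

  Div-*ˡ : ∀ {e x y} → Int x → Div e y → Div e (x * y)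
  Div-*ˡ {e} {x} {y} hx hy = Div-≡ (*-comm y x) (Div-*ʳ hy hx)

  Div-* : ∀ {a b x y} → Div a x → Div b y → Div (a ℕ.+ b) (x * y)
  Div-* {a} {b} (div x hx refl) (div y hy refl) = div (x * y) (Int-* hx hy)
    (trans (solve 4 (λ a b x y → a :* x :* (b :* y) := a :* b :* (x :* y)) refl (P ^ a) (P ^ b) x y) (cong (_* (x * y)) (sym (^-+ P a b))))

  Div-neg : ∀ {e x} → Div e x → Div e (- x)
  Div-neg {e} (div a ha refl) = div (- a) (Int-neg ha) (solve 2 (λ p a → :- (p :* a) := p :* (:- a)) refl (P ^ e) a)

  Div-- : ∀ {e x y} → Div e x → Div e y → Div e (x - y)
  Div-- hx hy = Div-+ hx (Div-neg hy)

  Div-∑ : ∀ {e} n {f : ℕ → ℚ} → (∀ i → i ℕ.< n → Div e (f i)) → Div e (∑ n f)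
  Div-∑ {e} zero    h = Div-0 e
  Div-∑ (suc n) h = Div-+ (h 0 (s≤s z≤n)) (Div-∑ n (λ i l → h (suc i) (s≤s l)))

  Div-weaken : ∀ {e e′ x} → e ℕ.≤ e′ → Div e′ x → Div e x
  Div-weaken {e} {e′} l (div y h refl) = div (P ^ (e′ ℕ.∸ e) * y) (Int-* (Int-^ (e′ ℕ.∸ e) (Int-# p)) h)
    (trans (cong (λ k → P ^ k * y) (sym (ℕP.m+[n∸m]≡n l))) (trans (cong (_* y) (^-+ P e (e′ ℕ.∸ e))) (*-assoc (P ^ e) (P ^ (e′ ℕ.∸ e)) y)))

  Div-cancelP : ∀ a {e x} → Div (a ℕ.+ e) (P ^ a * x) → Div e x
  Div-cancelP a {e} {x} (div y h eq) = div y h (P^-cancel a (trans eq (trans (cong (_* y) (^-+ P a e)) (*-assoc (P ^ a) (P ^ e) y))))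

  Div-cancelUnit : ∀ {e u x} → Unit u → Div e (u * x) → Div e x
  Div-cancelUnit {e} {u} {x} (unit _ v iv eq) h = Div-≡
    (trans (solve 3 (λ u v x → v :* (u :* x) := (u :* v) :* x) refl u v x) (trans (cong (_* x) eq) (*-identityˡ x))) (Div-*ˡ iv h)

  -- Congruences modulo powers of p

  infix 4 _≈[_]_
  record _≈[_]_ (x : ℚ) (e : ℕ) (y : ℚ) : Set where
    constructor mk
    field
      diff : Div e (x - y)

  ≈-reflexive : ∀ {e x y} → x ≡ y → x ≈[ e ] y
  ≈-reflexive {e} {x} refl = mk (Div-≡ (sym (+-inverseʳ x)) (Div-0 e))

  ≈-refl : ∀ {e x} → x ≈[ e ] x
  ≈-refl = ≈-reflexive refl

  ≈-sym : ∀ {e x y} → x ≈[ e ] y → y ≈[ e ] x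
  ≈-sym {e} {x} {y} (mk h) = mk (Div-≡ (solve 2 (λ x y → :- (x :- y) := y :- x) refl x y) (Div-neg h))

  ≈-trans : ∀ {e x y z} → x ≈[ e ] y → y ≈[ e ] z → x ≈[ e ] z
  ≈-trans {e} {x} {y} {z} (mk h) (mk k) = mk (Div-≡ (solve 3 (λ x y z → (x :- y) :+ (y :- z) := x :- z) refl x y z) (Div-+ h k))

  ≈-+ : ∀ {e x y z w} → x ≈[ e ] y → z ≈[ e ] w → x + z ≈[ e ] y + w
  ≈-+ {e} {x} {y} {z} {w} (mk h) (mk k) = mk (Div-≡ (solve 4 (λ x y z w → (x :- y) :+ (z :- w) := (x :+ z) :- (y :+ w)) refl x y z w) (Div-+ h k))

  ≈-neg : ∀ {e x y} → x ≈[ e ] y → - x ≈[ e ] - y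
  ≈-neg {e} {x} {y} (mk h) = mk (Div-≡ (solve 2 (λ x y → :- (x :- y) := :- x :- :- y) refl x y) (Div-neg h))

  ≈-- : ∀ {e x y z w} → x ≈[ e ] y → z ≈[ e ] w → x - z ≈[ e ] y - w
  ≈-- h k = ≈-+ h (≈-neg k)

  ≈-*ˡ : ∀ {e x y z} → Int z → x ≈[ e ] y → z * x ≈[ e ] z * y
  ≈-*ˡ {e} {x} {y} {z} iz (mk h) = mk (Div-≡ (solve 3 (λ x y z → z :* (x :- y) := z :* x :- z :* y) refl x y z) (Div-*ˡ iz h))

  ≈-*ʳ : ∀ {e x y z} → Int z → x ≈[ e ] y → x * z ≈[ e ] y * z
  ≈-*ʳ {e} {x} {y} {z} iz (mk h) = mk (Div-≡ (solve 3 (λ x y z → (x :- y) :* z := x :* z :- y :* z) refl x y z) (Div-*ʳ h iz))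

  ≈-Int : ∀ {e x y} → x ≈[ e ] y → Int y → Int x
  ≈-Int {e} {x} {y} (mk h) iy = Int-≡ (solve 2 (λ x y → (x :- y) :+ y := x) refl x y) (Int-+ (Div→Int h) iy)

  ≈-* : ∀ {e x y z w} → x ≈[ e ] y → z ≈[ e ] w → Int y → Int z → x * z ≈[ e ] y * w
  ≈-* h k iy iz = ≈-trans (≈-*ʳ iz h) (≈-*ˡ iy k)

  ≈-^ : ∀ {e x y} n → Int x → Int y → x ≈[ e ] y → x ^ n ≈[ e ] y ^ n
  ≈-^ zero    ix iy h = ≈-refl
  ≈-^ (suc n) ix iy h = ≈-* h (≈-^ n ix iy h) iy (Int-^ n ix)

  ≈-∑ : ∀ {e} n {f g : ℕ → ℚ} → (∀ i → i ℕ.< n → f i ≈[ e ] g i) → ∑ n f ≈[ e ] ∑ n g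
  ≈-∑ zero    h = ≈-refl
  ≈-∑ (suc n) h = ≈-+ (h 0 (s≤s z≤n)) (≈-∑ n (λ i l → h (suc i) (s≤s l)))

  ≈-weaken : ∀ {e e′ x y} → e ℕ.≤ e′ → x ≈[ e′ ] y → x ≈[ e ] y
  ≈-weaken l (mk h) = mk (Div-weaken l h)

  ≈-≡ : ∀ {e x y x′ y′} → x ≡ x′ → y ≡ y′ → x ≈[ e ] y → x′ ≈[ e ] y′
  ≈-≡ refl refl h = h

  ≈-cancelUnit : ∀ {e u x y} → Unit u → u * x ≈[ e ] u * y → x ≈[ e ] y
  ≈-cancelUnit {e} {u} {x} {y} hu (mk h) = mk (Div-cancelUnit hu (Div-≡ (solve 3 (λ u x y → u :* x :- u :* y := u :* (x :- y)) refl u x y) h))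

  Div→≈0 : ∀ {e x} → Div e x → x ≈[ e ] 0ℚ
  Div→≈0 {e} {x} h = mk (Div-≡ (solve 1 (λ x → x := x :- con 0ℚ) refl x) h)

  ≈0→Div : ∀ {e x} → x ≈[ e ] 0ℚ → Div e x
  ≈0→Div {e} {x} (mk h) = Div-≡ (solve 1 (λ x → x :- con 0ℚ := x) refl x) h

  p^∣-cancel : ∀ k d n → ¬ (p ∣ d) → p ℕ.^ k ∣ d ℕ.* n → p ℕ.^ k ∣ n
  p^∣-cancel zero    d n pd h = 1∣ n
  p^∣-cancel (suc k) d n pd h with euclidsLemma d n pp (∣-trans (m∣m*n (p ℕ.^ k)) h)
  ... | inj₁ x = ⊥-elim (pd x)
  ... | inj₂ (divides m refl) = subst (p ℕ.* p ℕ.^ k ∣_) (ℕP.*-comm p m) (*-monoʳ-∣ p (p^∣-cancel k d m pd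
    (*-cancelˡ-∣ p (subst (p ℕ.* p ℕ.^ k ∣_) (trans (sym (ℕP.*-assoc d m p)) (ℕP.*-comm (d ℕ.* m) p)) h))))

  -- The way back to ℤ: the denominator of the quotient is prime to p and can be cancelled from the
  -- divisibility.
  Div→∣ : ∀ k z → Div k (ι z) → p ℕ.^ k ∣ ℤ.∣ z ∣
  Div→∣ k z (div y (int d pd n e) eq) = p^∣-cancel k d ℤ.∣ z ∣ pd (divides ℤ.∣ n ∣
    (trans (sym (ℤP.abs-* (ℤ.+ d) z)) (trans (cong ℤ.∣_∣ h) (trans (ℤP.abs-* (ℤ.+ (p ℕ.^ k)) n) (ℕP.*-comm (p ℕ.^ k) ℤ.∣ n ∣)))))
    where
    open ≡-Reasoning
    h : (ℤ.+ d) ℤ.* z ≡ (ℤ.+ (p ℕ.^ k)) ℤ.* n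
    h = ι-inj (begin
      ι ((ℤ.+ d) ℤ.* z)            ≡⟨ ι-* (ℤ.+ d) z ⟩
      # d * ι z                    ≡⟨ cong (# d *_) eq ⟩
      # d * (P ^ k * y)            ≡⟨ solve 3 (λ a b c → a :* (b :* c) := b :* (a :* c)) refl (# d) (P ^ k) y ⟩
      P ^ k * (# d * y)            ≡⟨ cong₂ _*_ (sym (#-^ p k)) e ⟩
      # (p ℕ.^ k) * ι n            ≡⟨ sym (ι-* (ℤ.+ (p ℕ.^ k)) n) ⟩
      ι ((ℤ.+ (p ℕ.^ k)) ℤ.* n)    ∎)

  ∣→Div : ∀ k n → p ℕ.^ k ∣ n → Div k (# n)
  ∣→Div k n (divides m refl) = div (# m) (Int-# m) (trans (#-* m (p ℕ.^ k)) (trans (*-comm (# m) (# (p ℕ.^ k))) (cong (_* # m) (#-^ p k))))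

  ∣→Div-ι : ∀ k z → p ℕ.^ k ∣ ℤ.∣ z ∣ → Div k (ι z)
  ∣→Div-ι k (ℤ.+ n)  h = ∣→Div k n h
  ∣→Div-ι k -[1+ n ] h = Div-≡ (sym (ι-neg (ℤ.+ suc n))) (Div-neg (∣→Div k (suc n) h))

  Div1→∣ : ∀ n → Div 1 (# n) → p ∣ n
  Div1→∣ n h = subst (_∣ n) (ℕP.*-identityʳ p) (Div→∣ 1 (ℤ.+ n) h)

  ∣→Div1 : ∀ n → p ∣ n → Div 1 (# n)
  ∣→Div1 n h = ∣→Div 1 n (subst (_∣ n) (sym (ℕP.*-identityʳ p)) h)

  -- Factorials and their p-adic size

  fac : ℕ → ℚ
  fac zero    = 1ℚ
  fac (suc n) = # (suc n) * fac n

  Int-fac : ∀ n → Int (fac n)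
  Int-fac zero    = Int-1
  Int-fac (suc n) = Int-* (Int-# (suc n)) (Int-fac n)

  ifac : ℕ → ℚ
  ifac zero    = 1ℚ
  ifac (suc n) = iv (suc n) * ifac n

  fac-ifac : ∀ n → fac n * ifac n ≡ 1ℚ
  fac-ifac zero    = refl
  fac-ifac (suc n) = trans (solve 4 (λ a b c d → a :* b :* (c :* d) := (c :* a) :* (b :* d)) refl (# (suc n)) (fac n) (iv (suc n)) (ifac n))
    (trans (cong₂ _*_ (iv-inv n) (fac-ifac n)) refl)

  -- the part of n! prime to p is a product of these
  un : ℕ → ℚ
  un n with p ∣? n
  ... | yes _ = 1ℚ
  ... | no  _ = # n

  un-yes : ∀ n → p ∣ n → un n ≡ 1ℚ
  un-yes n h with p ∣? n
  ... | yes _ = refl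
  ... | no  k = ⊥-elim (k h)

  un-no : ∀ n → ¬ (p ∣ n) → un n ≡ # n
  un-no n h with p ∣? n
  ... | yes k = ⊥-elim (h k)
  ... | no  _ = refl

  Unit-un : ∀ n → Unit (un n)
  Unit-un n with p ∣? n
  ... | yes _ = Unit-1
  ... | no  h = Unit-# n h

  Πu : ℕ → ℚ
  Πu zero    = 1ℚ
  Πu (suc n) = Πu n * un n

  Unit-Πu : ∀ n → Unit (Πu n)
  Unit-Πu zero    = Unit-1
  Unit-Πu (suc n) = Unit-* (Unit-Πu n) (Unit-un n)

  p∤+ : ∀ a n → suc a ℕ.< p → ¬ (p ∣ suc a ℕ.+ p ℕ.* n)
  p∤+ a n (s≤s l) h = p∤<p a l (∣m+n∣m⇒∣n (subst (p ∣_) (ℕP.+-comm (suc a) (p ℕ.* n)) h) (m∣m*n n))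

  -- The factors of (a + pn)! divisible by p are p, 2p, ..., np. They contribute p^n n!, and `Πu`
  -- collects the remaining ones.
  fac-split : ∀ n a → a ℕ.< p → fac (a ℕ.+ p ℕ.* n) ≡ P ^ n * fac n * Πu (suc (a ℕ.+ p ℕ.* n))
  fac-split zero zero l = trans (cong fac (ℕP.*-zeroʳ p)) (trans (sym (cong (λ x → 1ℚ * 1ℚ * (1ℚ * x)) (un-yes 0 (p ∣0))))
    (cong (λ k → 1ℚ * 1ℚ * Πu (suc k)) (sym (ℕP.*-zeroʳ p))))
  fac-split (suc n) zero l = begin
    fac (p ℕ.* suc n)
      ≡⟨ cong fac (ℕP.*-suc p n) ⟩
    # (p ℕ.+ p ℕ.* n) * fac (q ℕ.+ p ℕ.* n)
      ≡⟨ cong₂ _*_ (trans (cong # (sym (ℕP.*-suc p n))) (#-* p (suc n))) (fac-split n q ℕP.≤-refl) ⟩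
    P * # (suc n) * (P ^ n * fac n * Πu (p ℕ.+ p ℕ.* n))
      ≡⟨ solve 5 (λ a b c d e → a :* b :* (c :* d :* e) := a :* c :* (b :* d) :* (e :* con 1ℚ)) refl P (# (suc n)) (P ^ n) (fac n) _ ⟩
    P * P ^ n * (# (suc n) * fac n) * (Πu (p ℕ.+ p ℕ.* n) * 1ℚ)
      ≡⟨ cong (P * P ^ n * (# (suc n) * fac n) *_) (trans (cong (λ k → Πu k * 1ℚ) (sym (ℕP.*-suc p n))) (cong (Πu (p ℕ.* suc n) *_) (sym (un-yes (p ℕ.* suc n) (m∣m*n (suc n)))))) ⟩
    P ^ suc n * fac (suc n) * Πu (suc (p ℕ.* suc n)) ∎
    where open ≡-Reasoning
  fac-split n (suc a) l = begin
    # (suc a ℕ.+ p ℕ.* n) * fac (a ℕ.+ p ℕ.* n)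
      ≡⟨ cong₂ _*_ (sym (un-no _ (p∤+ a n l))) (fac-split n a (ℕP.≤-trans (ℕP.n≤1+n (suc a)) l)) ⟩
    un (suc a ℕ.+ p ℕ.* n) * (P ^ n * fac n * Πu (suc a ℕ.+ p ℕ.* n))
      ≡⟨ solve 4 (λ a b c d → a :* (b :* c :* d) := b :* c :* (d :* a)) refl (un (suc a ℕ.+ p ℕ.* n)) (P ^ n) (fac n) _ ⟩
    P ^ n * fac n * Πu (suc (suc a ℕ.+ p ℕ.* n)) ∎
    where open ≡-Reasoning

  ifac-split : ∀ n a → a ℕ.< p → P ^ n * ifac (a ℕ.+ p ℕ.* n) * Πu (suc (a ℕ.+ p ℕ.* n)) ≡ ifac n
  ifac-split n a l = begin
    P ^ n * ifac m * Πu (suc m)                          ≡⟨ solve 3 (λ a b c → a :* b :* c := con 1ℚ :* (a :* b :* c)) refl (P ^ n) (ifac m) (Πu (suc m)) ⟩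
    1ℚ * (P ^ n * ifac m * Πu (suc m))                   ≡⟨ cong (_* (P ^ n * ifac m * Πu (suc m))) (sym (fac-ifac n)) ⟩
    fac n * ifac n * (P ^ n * ifac m * Πu (suc m))       ≡⟨ solve 5 (λ a b c d e → a :* b :* (c :* d :* e) := b :* (c :* a :* e :* d)) refl (fac n) (ifac n) (P ^ n) (ifac m) (Πu (suc m)) ⟩
    ifac n * (P ^ n * fac n * Πu (suc m) * ifac m)       ≡⟨ cong (λ x → ifac n * (x * ifac m)) (sym (fac-split n a l)) ⟩
    ifac n * (fac m * ifac m)                            ≡⟨ cong (ifac n *_) (fac-ifac m) ⟩
    ifac n * 1ℚ                                          ≡⟨ *-identityʳ (ifac n) ⟩
    ifac n                                               ∎
    where
    open ≡-Reasoning
    m = a ℕ.+ p ℕ.* n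

  divMod-p : ∀ m → Σ ℕ λ a → Σ ℕ λ n → a ℕ.< p × m ≡ a ℕ.+ p ℕ.* n
  divMod-p m = m ℕD.% p , m ℕD./ p , ℕD.m%n<n m p , trans (ℕD.m≡m%n+[m/n]*n m p) (cong (m ℕD.% p ℕ.+_) (ℕP.*-comm (m ℕD./ p) p))

  n+n≤ : ∀ a n → n ℕ.+ n ℕ.≤ a ℕ.+ p ℕ.* n
  n+n≤ a n = ℕP.≤-trans (ℕP.≤-trans (ℕP.+-monoʳ-≤ n (ℕP.≤-trans (ℕP.≤-reflexive (sym (ℕP.*-identityˡ n))) (ℕP.*-monoˡ-≤ n 0<q)))
    (ℕP.≤-refl {n ℕ.+ q ℕ.* n})) (ℕP.m≤n+m (p ℕ.* n) a)

  -- If p^n clears the denominator of 1/n!, then by `ifac-split` p^(2n) clears that of 1/(a + pn)!.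
  -- Since 2n ≤ a + pn, this closes the strong induction in `P^ifac`.
  ifac-lat : ∀ n a → a ℕ.< p → Int (P ^ n * ifac n) → Int (P ^ (n ℕ.+ n) * ifac (a ℕ.+ p ℕ.* n))
  ifac-lat n a l h = go (a ℕ.+ p ℕ.* n) (ifac-split n a l) (Unit-Πu (suc (a ℕ.+ p ℕ.* n)))
    where
    open ≡-Reasoning
    go : ∀ m → P ^ n * ifac m * Πu (suc m) ≡ ifac n → Unit (Πu (suc m)) → Int (P ^ (n ℕ.+ n) * ifac m)
    go m e (unit iu v iv eq) = Int-≡ (begin
      P ^ n * ifac n * v                               ≡⟨ cong (λ x → P ^ n * x * v) (sym e) ⟩
      P ^ n * (P ^ n * ifac m * Πu (suc m)) * v        ≡⟨ solve 4 (λ a b c d → a :* (a :* b :* c) :* d := a :* a :* b :* (c :* d)) refl (P ^ n) (ifac m) (Πu (suc m)) v ⟩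
      P ^ n * P ^ n * ifac m * (Πu (suc m) * v)        ≡⟨ cong₂ (λ x y → x * ifac m * y) (sym (^-+ P n n)) eq ⟩
      P ^ (n ℕ.+ n) * ifac m * 1ℚ                      ≡⟨ *-identityʳ (P ^ (n ℕ.+ n) * ifac m) ⟩
      P ^ (n ℕ.+ n) * ifac m                           ∎) (Int-* h iv)

  Int-P^≤ : ∀ {a b x} → a ℕ.≤ b → Int (P ^ a * x) → Int (P ^ b * x)
  Int-P^≤ {a} {b} {x} l h = Int-≡ (trans (sym (*-assoc (P ^ (b ℕ.∸ a)) (P ^ a) x)) (cong (_* x) (trans (sym (^-+ P (b ℕ.∸ a) a)) (cong (P ^_) (ℕP.m∸n+n≡m l)))))
    (Int-* (Int-^ (b ℕ.∸ a) (Int-# p)) h)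

  P^ifac : ∀ b m → m ℕ.≤ b → Int (P ^ m * ifac m)
  P^ifac zero    zero    l = Int-1
  P^ifac (suc b) m l = go m (divMod-p m) l
    where
    go : ∀ m → Σ ℕ (λ a → Σ ℕ λ n → a ℕ.< p × m ≡ a ℕ.+ p ℕ.* n) → m ℕ.≤ suc b → Int (P ^ m * ifac m)
    go _ (a , zero  , la , refl) l = Int-P^≤ {0} {a ℕ.+ p ℕ.* 0} z≤n (ifac-lat 0 a la Int-1)
    go _ (a , suc n , la , refl) l = Int-P^≤ (n+n≤ a (suc n)) (ifac-lat (suc n) a la (P^ifac b (suc n) (ℕP.≤-pred
      (ℕP.≤-trans (ℕP.+-mono-≤ (s≤s (z≤n {n})) (ℕP.≤-refl {suc n})) (ℕP.≤-trans (n+n≤ a (suc n)) l)))))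

  Int-P^ifac : ∀ m → Int (P ^ m * ifac m)
  Int-P^ifac m = P^ifac m m ℕP.≤-refl

  Int-ifac : ∀ n a → a ℕ.< p → Int (P ^ (n ℕ.+ n) * ifac (a ℕ.+ p ℕ.* n))
  Int-ifac n a l = ifac-lat n a l (Int-P^ifac n)

  -- The series exp (a y + b y^p / p)

  ⋆-last : ∀ f g n → (f ⋆ g) (suc n) ≡ (f ⋆ tl g) n + f (suc n) * g 0
  ⋆-last f g zero    = refl
  ⋆-last f g (suc n) = trans (cong (f 0 * g (suc (suc n)) +_) (⋆-last (tl f) g n)) (sym (+-assoc (f 0 * g (suc (suc n))) _ _))

  -- The row n of H lists the coefficients n, n-1, … of exp (λ y + μ y^p / p).
  H : ℚ → ℚ → ℕ → ℕ → ℚ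
  H λ′ μ zero    zero    = 1ℚ
  H λ′ μ zero    (suc i) = 0ℚ
  H λ′ μ (suc n) zero    = iv (suc n) * (λ′ * H λ′ μ n 0 + μ * H λ′ μ n q)
  H λ′ μ (suc n) (suc i) = H λ′ μ n i

  X : ℚ → ℚ → Seq
  X λ′ μ n = H λ′ μ n 0

  H-S^ : ∀ a b n i → H a b n i ≡ S^ i (X a b) n
  H-S^ a b zero    zero    = refl
  H-S^ a b zero    (suc i) = refl
  H-S^ a b (suc n) zero    = refl
  H-S^ a b (suc n) (suc i) = H-S^ a b n i

  -- ODE a b f expresses y f' = (a y + b y^p) f.
  record ODE (a b : ℚ) (f : Seq) : Set where
    constructor ode
    field
      coeff : ∀ n → D f n ≡ a * S f n + b * S^ p f n

  open ODE

  X-D : ∀ a b n → D (X a b) n ≡ a * S (X a b) n + b * S^ p (X a b) n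
  X-D a b zero    = trans (cong (_* 1ℚ) #0) (solve 2 (λ a b → con 0ℚ :* con 1ℚ := a :* con 0ℚ :+ b :* con 0ℚ) refl a b)
  X-D a b (suc n) = begin
    # (suc n) * (iv (suc n) * (a * X a b n + b * H a b n q))   ≡⟨ solve 3 (λ x y z → x :* (y :* z) := y :* x :* z) refl (# (suc n)) (iv (suc n)) _ ⟩
    iv (suc n) * # (suc n) * (a * X a b n + b * H a b n q)     ≡⟨ cong₂ (λ u v → u * (a * X a b n + b * v)) (iv-inv n) (H-S^ a b n q) ⟩
    1ℚ * (a * X a b n + b * S^ q (X a b) n)                    ≡⟨ *-identityˡ (a * X a b n + b * S^ q (X a b) n) ⟩
    a * X a b n + b * S^ q (X a b) n                           ∎
    where open ≡-Reasoning

  X-ODE : ∀ a b → ODE a b (X a b)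
  X-ODE a b = ode (X-D a b)

  S^-cong≤ : ∀ k {f g : Seq} n → (∀ i → i ℕ.≤ n → f i ≡ g i) → S^ k f n ≡ S^ k g n
  S^-cong≤ zero    n       h = h n ℕP.≤-refl
  S^-cong≤ (suc k) zero    h = refl
  S^-cong≤ (suc k) (suc n) h = S^-cong≤ k n (λ i l → h i (ℕP.m≤n⇒m≤1+n l))

  -- The equation gives n f(n) in terms of earlier coefficients. Exponentials are handled through it
  -- throughout: a product or a substitution is recognised by the equation it satisfies and by its
  -- constant term.
  ODE-unique : ∀ {a b f g} → ODE a b f → ODE a b g → f 0 ≡ g 0 → ∀ n → f n ≡ g n
  ODE-unique {a} {b} {f} {g} (ode hf) (ode hg) e n = go n n ℕP.≤-refl
    where
    go : ∀ N n → n ℕ.≤ N → f n ≡ g n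
    go N       zero    l       = e
    go (suc N) (suc n) (s≤s l) = #-cancel n (trans (hf (suc n)) (trans
      (cong₂ (λ u v → a * u + b * v) (go N n l) (S^-cong≤ q n (λ i l′ → go N i (ℕP.≤-trans l′ l)))) (sym (hg (suc n)))))

  ⋆-ODE : ∀ {a b a′ b′ f g} → ODE a b f → ODE a′ b′ g → ODE (a + a′) (b + b′) (f ⋆ g)
  ⋆-ODE {a} {b} {a′} {b′} {f} {g} (ode hf) (ode hg) = ode λ n → begin
    D (f ⋆ g) n
      ≡⟨ D-⋆ f g n ⟩
    (D f ⋆ g) n + (f ⋆ D g) n
      ≡⟨ cong₂ _+_ (⋆-ext hf (λ _ → refl) n) (⋆-ext (λ _ → refl) hg n) ⟩
    ((λ i → a * S f i + b * S^ p f i) ⋆ g) n + (f ⋆ (λ i → a′ * S g i + b′ * S^ p g i)) n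
      ≡⟨ cong₂ _+_
           (trans (⋆-+ˡ (λ i → a * S f i) (λ i → b * S^ p f i) g n) (cong₂ _+_ (⋆-*ˡ a (S f) g n) (⋆-*ˡ b (S^ p f) g n)))
           (trans (⋆-+ʳ f (λ i → a′ * S g i) (λ i → b′ * S^ p g i) n) (cong₂ _+_ (⋆-*ʳ a′ f (S g) n) (⋆-*ʳ b′ f (S^ p g) n))) ⟩
    (a * (S f ⋆ g) n + b * (S^ p f ⋆ g) n) + (a′ * (f ⋆ S g) n + b′ * (f ⋆ S^ p g) n)
      ≡⟨ cong₂ _+_ (cong₂ (λ u v → a * u + b * v) (⋆-Sˡ f g n) (⋆-S^ˡ p f g n)) (cong₂ (λ u v → a′ * u + b′ * v) (⋆-Sʳ f g n) (⋆-S^ʳ p f g n)) ⟩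
    (a * S (f ⋆ g) n + b * S^ p (f ⋆ g) n) + (a′ * S (f ⋆ g) n + b′ * S^ p (f ⋆ g) n)
      ≡⟨ solve 6 (λ a b c d x y → (a :* x :+ b :* y) :+ (c :* x :+ d :* y) := (a :+ c) :* x :+ (b :+ d) :* y) refl a b a′ b′ (S (f ⋆ g) n) (S^ p (f ⋆ g) n) ⟩
    (a + a′) * S (f ⋆ g) n + (b + b′) * S^ p (f ⋆ g) n ∎
    where open ≡-Reasoning

  X-⋆ : ∀ a b a′ b′ n → (X a b ⋆ X a′ b′) n ≡ X (a + a′) (b + b′) n
  X-⋆ a b a′ b′ = ODE-unique (⋆-ODE (X-ODE a b) (X-ODE a′ b′)) (X-ODE (a + a′) (b + b′)) refl

  X-⋆′ : ∀ {a b} a₁ b₁ a₂ b₂ → a ≡ a₁ + a₂ → b ≡ b₁ + b₂ → ∀ n → X a b n ≡ (X a₁ b₁ ⋆ X a₂ b₂) n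
  X-⋆′ a₁ b₁ a₂ b₂ refl refl n = sym (X-⋆ a₁ b₁ a₂ b₂ n)

  S^-twist : ∀ k s (f : Seq) n → s ^ k * S^ k (λ i → s ^ i * f i) n ≡ s ^ n * S^ k f n
  S^-twist zero    s f n       = *-identityˡ (s ^ n * f n)
  S^-twist (suc k) s f zero    = trans (*-zeroʳ (s * s ^ k)) (sym (*-zeroʳ 1ℚ))
  S^-twist (suc k) s f (suc n) = trans (*-assoc s (s ^ k) _) (trans (cong (s *_) (S^-twist k s f n)) (sym (*-assoc s (s ^ n) _)))

  -- This is the substitution y ↦ s y. With s a Teichmüller representative it moves Dwork's series
  -- to the point s.
  X-twist : ∀ s a b n → X (s * a) (s ^ p * b) n ≡ s ^ n * X a b n
  X-twist s a b = ODE-unique (X-ODE (s * a) (s ^ p * b)) (ode eqn) (sym (*-identityˡ 1ℚ))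
    where
    f : Seq
    f n = s ^ n * X a b n
    open ≡-Reasoning
    eqn : ∀ n → D f n ≡ s * a * S f n + s ^ p * b * S^ p f n
    eqn n = begin
      # n * (s ^ n * X a b n)                                   ≡⟨ solve 3 (λ x y z → x :* (y :* z) := y :* (x :* z)) refl (# n) (s ^ n) (X a b n) ⟩
      s ^ n * D (X a b) n                                       ≡⟨ cong (s ^ n *_) (X-D a b n) ⟩
      s ^ n * (a * S (X a b) n + b * S^ p (X a b) n)            ≡⟨ solve 5 (λ s a b x y → s :* (a :* x :+ b :* y) := a :* (s :* x) :+ b :* (s :* y)) refl (s ^ n) a b (S (X a b) n) (S^ p (X a b) n) ⟩
      a * (s ^ n * S (X a b) n) + b * (s ^ n * S^ p (X a b) n)  ≡⟨ cong₂ (λ u v → a * u + b * v) (sym (S^-twist 1 s (X a b) n)) (sym (S^-twist p s (X a b) n)) ⟩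
      a * (s ^ 1 * S f n) + b * (s ^ p * S^ p f n)              ≡⟨ solve 6 (λ a b s t x y → a :* (s :* con 1ℚ :* x) :+ b :* (t :* y) := s :* a :* x :+ t :* b :* y) refl a b s (s ^ p) (S f n) (S^ p f n) ⟩
      s * a * S f n + s ^ p * b * S^ p f n                      ∎

  X-a0 : ∀ a n → X a 0ℚ n ≡ a ^ n * ifac n
  X-a0 a zero    = refl
  X-a0 a (suc n) = trans (cong (λ z → iv (suc n) * (a * z + 0ℚ * H a 0ℚ n q)) (X-a0 a n))
    (solve 5 (λ i a x y h → i :* (a :* (x :* y) :+ con 0ℚ :* h) := a :* x :* (i :* y)) refl (iv (suc n)) a (a ^ n) (ifac n) (H a 0ℚ n q))

  X-0b-none : ∀ b i → i ℕ.< q → ∀ n → X 0ℚ b (suc i ℕ.+ p ℕ.* n) ≡ 0ℚ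
  X-0b-none b i l n = go n i l
    where
    e : ∀ N → # (suc N) * X 0ℚ b (suc N) ≡ b * S^ p (X 0ℚ b) (suc N)
    e N = trans (X-D 0ℚ b (suc N)) (trans (cong (_+ b * S^ p (X 0ℚ b) (suc N)) (*-zeroˡ (X 0ℚ b N))) (+-identityˡ _))
    z : ∀ N → S^ p (X 0ℚ b) (suc N) ≡ 0ℚ → X 0ℚ b (suc N) ≡ 0ℚ
    z N h = #-cancel N (trans (e N) (trans (cong (b *_) h) (trans (*-zeroʳ b) (sym (*-zeroʳ (# (suc N)))))))
    go : ∀ n i → i ℕ.< q → X 0ℚ b (suc i ℕ.+ p ℕ.* n) ≡ 0ℚ
    go zero    i l = z (i ℕ.+ p ℕ.* 0) (S^-< p (X 0ℚ b) _ (subst (ℕ._< p) (sym (trans (cong (suc i ℕ.+_) (ℕP.*-zeroʳ p)) (ℕP.+-identityʳ (suc i)))) (s≤s l)))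
    go (suc n) i l = z (i ℕ.+ p ℕ.* suc n) (trans (cong (S^ p (X 0ℚ b)) eq) (trans (S^-+ p (X 0ℚ b) _) (go n i l)))
      where
      eq : suc i ℕ.+ p ℕ.* suc n ≡ p ℕ.+ (suc i ℕ.+ p ℕ.* n)
      eq = trans (cong (suc i ℕ.+_) (ℕP.*-suc p n)) (trans (sym (ℕP.+-assoc (suc i) p (p ℕ.* n))) (trans (cong (ℕ._+ p ℕ.* n) (ℕP.+-comm (suc i) p)) (ℕP.+-assoc p (suc i) (p ℕ.* n))))

  X-0b : ∀ b n → X 0ℚ b (p ℕ.* n) ≡ (b * iv p) ^ n * ifac n
  X-0b b zero    = trans (cong (X 0ℚ b) (ℕP.*-zeroʳ p)) refl
  X-0b b (suc n) = #-cancel q (#-cancel n (begin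
    # (suc n) * (P * X 0ℚ b (p ℕ.* suc n))           ≡⟨ solve 3 (λ a b c → a :* (b :* c) := b :* a :* c) refl (# (suc n)) P (X 0ℚ b (p ℕ.* suc n)) ⟩
    P * # (suc n) * X 0ℚ b (p ℕ.* suc n)             ≡⟨ cong (_* X 0ℚ b (p ℕ.* suc n)) (sym (#-* p (suc n))) ⟩
    D (X 0ℚ b) (p ℕ.* suc n)                         ≡⟨ X-D 0ℚ b (p ℕ.* suc n) ⟩
    0ℚ * S (X 0ℚ b) (p ℕ.* suc n) + b * S^ p (X 0ℚ b) (p ℕ.* suc n)
      ≡⟨ cong₂ _+_ (*-zeroˡ (S (X 0ℚ b) (p ℕ.* suc n))) (cong (b *_) (trans (cong (S^ p (X 0ℚ b)) (ℕP.*-suc p n)) (trans (S^-+ p (X 0ℚ b) (p ℕ.* n)) (X-0b b n)))) ⟩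
    0ℚ + b * ((b * iv p) ^ n * ifac n)               ≡⟨ solve 3 (λ a b c → con 0ℚ :+ a :* (b :* c) := con 1ℚ :* con 1ℚ :* (a :* (b :* c))) refl b ((b * iv p) ^ n) (ifac n) ⟩
    1ℚ * 1ℚ * (b * ((b * iv p) ^ n * ifac n))        ≡⟨ cong₂ (λ u v → u * v * (b * ((b * iv p) ^ n * ifac n))) (sym (iv-inv q)) (sym (iv-inv n)) ⟩
    iv p * P * (iv (suc n) * # (suc n)) * (b * ((b * iv p) ^ n * ifac n))
      ≡⟨ solve 7 (λ i p j n b x f → i :* p :* (j :* n) :* (b :* (x :* f)) := n :* (p :* (b :* i :* x :* (j :* f)))) refl (iv p) P (iv (suc n)) (# (suc n)) b ((b * iv p) ^ n) (ifac n) ⟩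
    # (suc n) * (P * ((b * iv p) ^ suc n * ifac (suc n))) ∎))
    where open ≡-Reasoning

  ⋆-skip : ∀ k (h f : Seq) N → (∀ i → i ℕ.< k → h i ≡ 0ℚ) → (h ⋆ f) (k ℕ.+ N) ≡ ((λ i → h (k ℕ.+ i)) ⋆ f) N
  ⋆-skip zero    h f N z = refl
  ⋆-skip (suc k) h f N z = trans (cong (λ u → u * f (suc k ℕ.+ N) + (tl h ⋆ f) (k ℕ.+ N)) (z 0 (s≤s z≤n)))
    (trans (cong (_+ (tl h ⋆ f) (k ℕ.+ N)) (*-zeroˡ (f (suc k ℕ.+ N)))) (trans (+-identityˡ _) (⋆-skip k (tl h) f N (λ i l → z (suc i) (s≤s l)))))

  -- A factor supported on multiples of p preserves the residue of the index modulo p, so on each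
  -- residue class the product is a product of series in y^p.
  ⋆-sparse : ∀ (g f : Seq) → (∀ i → i ℕ.< q → ∀ n → g (suc i ℕ.+ p ℕ.* n) ≡ 0ℚ) → ∀ a → a ℕ.< p → ∀ n →
    (g ⋆ f) (a ℕ.+ p ℕ.* n) ≡ ((λ m → g (p ℕ.* m)) ⋆ (λ m → f (a ℕ.+ p ℕ.* m))) n
  ⋆-sparse g f z zero    l zero = trans (cong (g ⋆ f) (ℕP.*-zeroʳ p)) (cong₂ (λ u v → g u * f v) (sym (ℕP.*-zeroʳ p)) (sym (ℕP.*-zeroʳ p)))
  ⋆-sparse g f z (suc a) l zero = trans (cong (g ⋆ f) e) (trans (cong (g 0 * f (suc a) +_) (trans (⋆-cong a h (λ _ _ → refl)) (⋆-zeroˡ f a)))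
    (trans (+-identityʳ _) (cong₂ (λ u v → g u * f v) (sym (ℕP.*-zeroʳ p)) (sym e))))
    where
    e : suc a ℕ.+ p ℕ.* 0 ≡ suc a
    e = trans (cong (suc a ℕ.+_) (ℕP.*-zeroʳ p)) (ℕP.+-identityʳ (suc a))
    h : ∀ i → i ℕ.≤ a → tl g i ≡ 0ℚ
    h i le = trans (cong g (sym (trans (cong (suc i ℕ.+_) (ℕP.*-zeroʳ p)) (ℕP.+-identityʳ (suc i))))) (z i (ℕP.≤-trans (s≤s le) (ℕP.≤-pred l)) 0)
  ⋆-sparse g f z a l (suc n) = begin
    (g ⋆ f) (a ℕ.+ p ℕ.* suc n)
      ≡⟨ cong (g ⋆ f) e ⟩
    g 0 * f (suc (q ℕ.+ N)) + (tl g ⋆ f) (q ℕ.+ N)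
      ≡⟨ cong₂ (λ u v → g u * f v + (tl g ⋆ f) (q ℕ.+ N)) (sym (ℕP.*-zeroʳ p)) (sym e) ⟩
    g (p ℕ.* 0) * f (a ℕ.+ p ℕ.* suc n) + (tl g ⋆ f) (q ℕ.+ N)
      ≡⟨ cong (g (p ℕ.* 0) * f (a ℕ.+ p ℕ.* suc n) +_) (trans (⋆-skip q (tl g) f N h) (trans (⋆-sparse (λ i → g (p ℕ.+ i)) f z′ a l n)
           (⋆-ext (λ m → cong g (sym (ℕP.*-suc p m))) (λ _ → refl) n))) ⟩
    g (p ℕ.* 0) * f (a ℕ.+ p ℕ.* suc n) + ((λ m → g (p ℕ.* suc m)) ⋆ (λ m → f (a ℕ.+ p ℕ.* m))) n ∎
    where
    open ≡-Reasoning
    N = a ℕ.+ p ℕ.* n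
    e′ : ∀ a n → a ℕ.+ p ℕ.* suc n ≡ p ℕ.+ (a ℕ.+ p ℕ.* n)
    e′ a n = trans (cong (a ℕ.+_) (ℕP.*-suc p n)) (trans (sym (ℕP.+-assoc a p (p ℕ.* n))) (trans (cong (ℕ._+ p ℕ.* n) (ℕP.+-comm a p)) (ℕP.+-assoc p a (p ℕ.* n))))
    e = e′ a n
    h : ∀ i → i ℕ.< q → tl g i ≡ 0ℚ
    h i le = trans (cong g (sym (trans (cong (suc i ℕ.+_) (ℕP.*-zeroʳ p)) (ℕP.+-identityʳ (suc i))))) (z i le 0)
    z′ : ∀ i → i ℕ.< q → ∀ n → g (p ℕ.+ (suc i ℕ.+ p ℕ.* n)) ≡ 0ℚ
    z′ i l n = trans (cong g (sym (e′ (suc i) n))) (z i l (suc n))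

  Int-ifac-< : ∀ n → n ℕ.< p → Int (ifac n)
  Int-ifac-< zero    l       = Int-1
  Int-ifac-< (suc n) (s≤s l) = Int-* (Int-iv (suc n) (p∤<p n l)) (Int-ifac-< n (ℕP.m≤n⇒m≤1+n l))

  Int-⋆ : ∀ (f g : Seq) n → (∀ i → i ℕ.≤ n → Int (f i)) → (∀ i → i ℕ.≤ n → Int (g i)) → Int ((f ⋆ g) n)
  Int-⋆ f g zero    hf hg = Int-* (hf 0 z≤n) (hg 0 z≤n)
  Int-⋆ f g (suc n) hf hg = Int-+ (Int-* (hf 0 z≤n) (hg (suc n) ℕP.≤-refl)) (Int-⋆ (tl f) g n (λ i l → hf (suc i) (s≤s l)) (λ i l → hg i (ℕP.m≤n⇒m≤1+n l)))

  -- Comparing coefficients of y^p in e^{xy} e^y = e^{(x+1)y}.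
  frobenius : ∀ x → Int x → (x + 1ℚ) ^ p ≈[ 1 ] x ^ p + 1ℚ
  frobenius x ix = mk (Div-≡ eq (Div-* {1} {0} (Div-P^ 1 Int-1) (Int→Div (Int-* {fac q} (Int-fac q) mid))))
    where
    f : Seq
    f = X x 0ℚ
    g : Seq
    g = X 1ℚ 0ℚ
    M : ℚ
    M = (tl f ⋆ tl g) (q ℕ.∸ 1)
    q≡ : q ≡ suc (q ℕ.∸ 1)
    q≡ = sym (ℕP.m+[n∸m]≡n {1} {q} 0<q)
    lt : ∀ i → i ℕ.≤ q ℕ.∸ 1 → suc i ℕ.< p
    lt i l = s≤s (subst (suc i ℕ.≤_) (sym q≡) (s≤s l))
    -- Only indices from 1 to p - 1 enter on both sides, where 1/i! is integral; multiplying by p! =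
    -- p (p-1)! leaves a multiple of p.
    mid : Int M
    mid = Int-⋆ (tl f) (tl g) (q ℕ.∸ 1)
      (λ i l → Int-≡ (sym (X-a0 x (suc i))) (Int-* (Int-^ (suc i) ix) (Int-ifac-< (suc i) (lt i l))))
      (λ i l → Int-≡ (sym (X-a0 1ℚ (suc i))) (Int-* (Int-^ (suc i) Int-1) (Int-ifac-< (suc i) (lt i l))))
    open ≡-Reasoning
    split : X (x + 1ℚ) 0ℚ p ≡ f 0 * g p + (M + f p * g 0)
    split = begin
      X (x + 1ℚ) 0ℚ p                  ≡⟨ X-⋆′ x 0ℚ 1ℚ 0ℚ refl refl p ⟩
      f 0 * g p + (tl f ⋆ g) q         ≡⟨ cong (λ k → f 0 * g p + (tl f ⋆ g) k) q≡ ⟩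
      f 0 * g p + (tl f ⋆ g) (suc (q ℕ.∸ 1))
        ≡⟨ cong (f 0 * g p +_) (⋆-last (tl f) g (q ℕ.∸ 1)) ⟩
      f 0 * g p + (M + tl f (suc (q ℕ.∸ 1)) * g 0)
        ≡⟨ cong (λ k → f 0 * g p + (M + tl f k * g 0)) (sym q≡) ⟩
      f 0 * g p + (M + f p * g 0)      ∎
    F : ℚ
    F = fac p
    I : ℚ
    I = ifac p
    eq : P ^ 1 * 1ℚ * (fac q * M) ≡ (x + 1ℚ) ^ p - (x ^ p + 1ℚ)
    eq = begin
      P ^ 1 * 1ℚ * (fac q * M)
        ≡⟨ solve 5 (λ P F M x t → P :* con 1ℚ :* con 1ℚ :* (F :* M) := P :* F :* (con 1ℚ :* t :+ (M :+ x :* con 1ℚ)) :- (P :* F :* x :+ P :* F :* t)) refl P (fac q) M (f p) (g p) ⟩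
      F * (f 0 * g p + (M + f p * g 0)) - (F * f p + F * g p)
        ≡⟨ cong (λ z → F * z - (F * f p + F * g p)) (sym split) ⟩
      F * X (x + 1ℚ) 0ℚ p - (F * f p + F * g p)
        ≡⟨ cong₂ (λ u v → F * u - v) (X-a0 (x + 1ℚ) p) (cong₂ (λ u v → F * u + F * v) (X-a0 x p) (trans (X-a0 1ℚ p) (cong (_* I) (1^ p)))) ⟩
      F * ((x + 1ℚ) ^ p * I) - (F * (x ^ p * I) + F * (1ℚ * I))
        ≡⟨ solve 4 (λ F I a b → F :* (a :* I) :- (F :* (b :* I) :+ F :* (con 1ℚ :* I)) := F :* I :* (a :- (b :+ con 1ℚ))) refl F I ((x + 1ℚ) ^ p) (x ^ p) ⟩
      F * I * ((x + 1ℚ) ^ p - (x ^ p + 1ℚ))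
        ≡⟨ cong (_* ((x + 1ℚ) ^ p - (x ^ p + 1ℚ))) (fac-ifac p) ⟩
      1ℚ * ((x + 1ℚ) ^ p - (x ^ p + 1ℚ))
        ≡⟨ *-identityˡ _ ⟩
      (x + 1ℚ) ^ p - (x ^ p + 1ℚ) ∎

  fermat : ∀ n → # n ^ p ≈[ 1 ] # n
  fermat zero    = ≈-reflexive (trans (cong (_^ p) #0) (trans (0^ q) (sym #0)))
  fermat (suc n) = ≈-trans (≈-reflexive (cong (_^ p) e)) (≈-trans (frobenius (# n) (Int-# n)) (≈-trans (≈-+ (fermat n) ≈-refl) (≈-reflexive (sym e))))
    where
    e : # (suc n) ≡ # n + 1ℚ
    e = trans (#-suc n) (+-comm 1ℚ (# n))

  fermat-unit : ∀ n → ¬ (p ∣ n) → # n ^ q ≈[ 1 ] 1ℚ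
  fermat-unit n h = ≈-cancelUnit (Unit-# n h) (≈-trans (fermat n) (≈-reflexive (sym (*-identityʳ (# n)))))

  -- Finite differences and the coefficients of exp (y + y^p / p)

  Δ : Seq → Seq
  Δ f k = f (suc k) - f k

  Δ^ : ℕ → Seq → Seq
  Δ^ zero    f = f
  Δ^ (suc n) f = Δ (Δ^ n f)

  Δ^-ext : ∀ n {f g : Seq} → (∀ k → f k ≡ g k) → ∀ k → Δ^ n f k ≡ Δ^ n g k
  Δ^-ext zero    h k = h k
  Δ^-ext (suc n) h k = cong₂ _-_ (Δ^-ext n h (suc k)) (Δ^-ext n h k)

  Δ^-Δ : ∀ n f k → Δ^ n (Δ f) k ≡ Δ^ (suc n) f k
  Δ^-Δ zero    f k = refl
  Δ^-Δ (suc n) f k = cong₂ _-_ (Δ^-Δ n f (suc k)) (Δ^-Δ n f k)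

  Δ^-shift : ∀ n f k → Δ^ n (tl f) k ≡ Δ^ n f (suc k)
  Δ^-shift zero    f k = refl
  Δ^-shift (suc n) f k = cong₂ _-_ (Δ^-shift n f (suc k)) (Δ^-shift n f k)

  Δ^-+ : ∀ n f g k → Δ^ n (λ i → f i + g i) k ≡ Δ^ n f k + Δ^ n g k
  Δ^-+ zero    f g k = refl
  Δ^-+ (suc n) f g k = trans (cong₂ _-_ (Δ^-+ n f g (suc k)) (Δ^-+ n f g k))
    (solve 4 (λ a b c d → (a :+ b) :- (c :+ d) := (a :- c) :+ (b :- d)) refl (Δ^ n f (suc k)) (Δ^ n g (suc k)) (Δ^ n f k) (Δ^ n g k))

  Δ^-zero : ∀ n k → Δ^ n (λ _ → 0ℚ) k ≡ 0ℚ
  Δ^-zero zero    k = refl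
  Δ^-zero (suc n) k = cong₂ _-_ (Δ^-zero n (suc k)) (Δ^-zero n k)

  Δ^-const : ∀ n c k → Δ^ (suc n) (λ _ → c) k ≡ 0ℚ
  Δ^-const n c k = trans (sym (Δ^-Δ n (λ _ → c) k)) (trans (Δ^-ext n (λ _ → +-inverseʳ c) k) (Δ^-zero n k))

  Δ^-≈ : ∀ {e} n {f g : Seq} k → (∀ i → i ℕ.≤ n → f (i ℕ.+ k) ≈[ e ] g (i ℕ.+ k)) → Δ^ n f k ≈[ e ] Δ^ n g k
  Δ^-≈ zero    k h = h 0 z≤n
  Δ^-≈ {e} (suc n) {f} {g} k h = ≈-- (Δ^-≈ n (suc k) (λ i l → subst (λ j → f j ≈[ e ] g j) (sym (ℕP.+-suc i k)) (h (suc i) (s≤s l))))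
                                 (Δ^-≈ n k (λ i l → h i (ℕP.m≤n⇒m≤1+n l)))

  -- Leibniz' rule for iterated differences stops after two terms because the first difference of L
  -- is constant.
  Δ^-linear : ∀ d (L f : Seq) → (∀ k → L (suc k) ≡ L k + d) → ∀ n k →
    Δ^ (suc n) (λ i → L i * f i) k ≡ L k * Δ^ (suc n) f k + # (suc n) * d * Δ^ n f (suc k)
  Δ^-linear d L f hL zero k = trans (cong (λ z → z * f (suc k) - L k * f k) (hL k))
    (trans (solve 4 (λ l d x y → (l :+ d) :* x :- l :* y := l :* (x :- y) :+ con 1ℚ :* d :* x) refl (L k) d (f (suc k)) (f k))
      (cong (λ z → L k * Δ^ 1 f k + z * d * f (suc k)) (sym #1)))
  Δ^-linear d L f hL (suc n) k = begin
    Δ^ (suc n) (λ i → L i * f i) (suc k) - Δ^ (suc n) (λ i → L i * f i) k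
      ≡⟨ cong₂ _-_ (Δ^-linear d L f hL n (suc k)) (Δ^-linear d L f hL n k) ⟩
    (L (suc k) * Δ^ (suc n) f (suc k) + m * d * Δ^ n f (suc (suc k))) - (L k * Δ^ (suc n) f k + m * d * Δ^ n f (suc k))
      ≡⟨ cong (λ z → (z * Δ^ (suc n) f (suc k) + m * d * Δ^ n f (suc (suc k))) - (L k * Δ^ (suc n) f k + m * d * Δ^ n f (suc k))) (hL k) ⟩
    ((L k + d) * (a - b) + m * d * a) - (L k * c + m * d * b)
      ≡⟨ solve 6 (λ l d m a b c → ((l :+ d) :* (a :- b) :+ m :* d :* a) :- (l :* c :+ m :* d :* b) := l :* ((a :- b) :- c) :+ (con 1ℚ :+ m) :* d :* (a :- b)) refl (L k) d m a b c ⟩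
    L k * ((a - b) - c) + (1ℚ + m) * d * (a - b)
      ≡⟨ cong (λ z → L k * ((a - b) - c) + z * d * (a - b)) (sym (#-suc (suc n))) ⟩
    L k * Δ^ (suc (suc n)) f k + # (suc (suc n)) * d * Δ^ (suc n) f (suc k) ∎
    where
    open ≡-Reasoning
    m = # (suc n)
    a = Δ^ n f (suc (suc k))
    b = Δ^ n f (suc k)
    c = Δ^ (suc n) f k

  Δ^-linear-0 : ∀ d (L f : Seq) → (∀ k → L (suc k) ≡ L k + d) → ∀ n → (∀ k → Δ^ n f k ≡ 0ℚ) → ∀ k → Δ^ (suc n) (λ i → L i * f i) k ≡ 0ℚ
  Δ^-linear-0 d L f hL n h k = trans (Δ^-linear d L f hL n k) (trans
    (cong₂ (λ u v → L k * u + # (suc n) * d * v) (cong₂ _-_ (h (suc k)) (h k)) (h (suc k)))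
    (solve 2 (λ l m → l :* (con 0ℚ :- con 0ℚ) :+ m :* con 0ℚ := con 0ℚ) refl (L k) (# (suc n) * d)))

  Δ^-pow : ∀ n k → Δ^ n (λ i → # i ^ n) k ≡ fac n
  Δ^-pow zero    k = refl
  Δ^-pow (suc n) k = trans (Δ^-linear 1ℚ # (λ i → # i ^ n) (λ k → trans (#-suc k) (+-comm 1ℚ (# k))) n k) (trans
    (cong₂ (λ u v → # k * u + # (suc n) * 1ℚ * v) (cong₂ _-_ (Δ^-pow n (suc k)) (Δ^-pow n k)) (Δ^-pow n (suc k)))
    (solve 3 (λ k m f → k :* (f :- f) :+ m :* con 1ℚ :* f := m :* f) refl (# k) (# (suc n)) (fac n)))

  δ₀ : Seq
  δ₀ zero    = 1ℚ
  δ₀ (suc _) = 0ℚ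

  Int-δ₀ : ∀ n → Int (δ₀ n)
  Int-δ₀ zero    = Int-1
  Int-δ₀ (suc _) = Int-0

  Δ^-δ₀-suc : ∀ n k → Δ^ n δ₀ (suc k) ≡ 0ℚ
  Δ^-δ₀-suc zero    k = refl
  Δ^-δ₀-suc (suc n) k = cong₂ _-_ (Δ^-δ₀-suc n (suc k)) (Δ^-δ₀-suc n k)

  Δ^-δ₀ : ∀ n → Δ^ n δ₀ 0 ≡ (- 1ℚ) ^ n
  Δ^-δ₀ zero    = refl
  Δ^-δ₀ (suc n) = trans (cong₂ _-_ (Δ^-δ₀-suc n 0) (Δ^-δ₀ n)) (solve 1 (λ x → con 0ℚ :- x := con (- 1ℚ) :* x) refl ((- 1ℚ) ^ n))

  Even : ℕ → Set
  Even n = Σ ℕ λ m → n ≡ m ℕ.+ m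

  even⊎odd : ∀ n → Even n ⊎ Σ ℕ λ m → n ≡ suc (m ℕ.+ m)
  even⊎odd zero = inj₁ (0 , refl)
  even⊎odd (suc n) with even⊎odd n
  ... | inj₁ (m , e) = inj₂ (m , cong suc e)
  ... | inj₂ (m , e) = inj₁ (suc m , cong suc (trans e (sym (ℕP.+-suc m m))))

  -1^even : ∀ m → (- 1ℚ) ^ (m ℕ.+ m) ≡ 1ℚ
  -1^even m = trans (^-+ (- 1ℚ) m m) (trans (sym (*-^ (- 1ℚ) (- 1ℚ) m)) (1^ m))

  q-even : Even q
  q-even with even⊎odd q
  ... | inj₁ h = h
  ... | inj₂ (zero , e)  = ⊥-elim (ℕP.<-irrefl refl (ℕP.≤-trans (subst (2 ℕ.<_) e q>2) (s≤s z≤n)))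
  ... | inj₂ (suc m , e) = ⊥-elim (Prime.notComposite pp (composite {2} (s≤s (ℕP.≤-trans (s≤s (s≤s z≤n)) q>2))
      (divides (suc (suc m)) (trans (cong suc e) (trans (cong (λ z → suc (suc (suc z))) (ℕP.+-suc m m))
        (cong (λ z → suc (suc (suc (suc z)))) (trans (cong (m ℕ.+_) (sym (ℕP.+-identityʳ m))) (ℕP.*-comm 2 m))))))))

  -1^q : (- 1ℚ) ^ q ≡ 1ℚ
  -1^q = trans (cong ((- 1ℚ) ^_) (proj₂ q-even)) (-1^even (proj₁ q-even))

  -- (p-1)! is the (p-1)-st difference at 0 of x^(p-1), which agrees with 1 - δ₀ modulo p.
  wilson : fac q ≈[ 1 ] - 1ℚ
  wilson = ≈-trans (≈-reflexive (sym (Δ^-pow q 0))) (≈-trans (Δ^-≈ q 0 h) (≈-reflexive e))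
    where
    q-pos : Σ ℕ λ r → q ≡ suc r
    q-pos = q ℕ.∸ 1 , sym (ℕP.m+[n∸m]≡n {1} {q} 0<q)
    f : Seq
    f i = 1ℚ + (- 1ℚ) * δ₀ i
    h : ∀ i → i ℕ.≤ q → # (i ℕ.+ 0) ^ q ≈[ 1 ] f (i ℕ.+ 0)
    h zero    l = ≈-reflexive (trans (cong₂ _^_ #0 (proj₂ q-pos)) (0^ (proj₁ q-pos)))
    h (suc i) l = subst (λ j → # j ^ q ≈[ 1 ] f j) (sym (ℕP.+-identityʳ (suc i))) (fermat-unit (suc i) (p∤<p i l))
    neg : ∀ n k → Δ^ n (λ i → (- 1ℚ) * δ₀ i) k ≡ (- 1ℚ) * Δ^ n δ₀ k
    neg zero    k = refl
    neg (suc n) k = trans (cong₂ _-_ (neg n (suc k)) (neg n k)) (solve 3 (λ c a b → c :* a :- c :* b := c :* (a :- b)) refl (- 1ℚ) (Δ^ n δ₀ (suc k)) (Δ^ n δ₀ k))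
    e : Δ^ q f 0 ≡ - 1ℚ
    e = trans (Δ^-+ q (λ _ → 1ℚ) (λ i → (- 1ℚ) * δ₀ i) 0) (cong₂ _+_
          (trans (cong (λ n → Δ^ n (λ _ → 1ℚ) 0) (proj₂ q-pos)) (Δ^-const (proj₁ q-pos) 1ℚ 0))
          (trans (neg q 0) (cong ((- 1ℚ) *_) (trans (Δ^-δ₀ q) -1^q))))

  -- By Δ(QF) = ΔQ · F(k+1) + Q · ΔF each difference falls either on Q or on F. As Q behaves like a
  -- polynomial of degree below d, at most d - 1 of the m differences can fall on Q in a nonzero
  -- term, so at least m + 1 - d fall on F, while Q and its differences keep their factor p^e.
  Δ^-product : ∀ d m (Q F : Seq) e (v : ℕ → ℕ) → (∀ {i j} → i ℕ.≤ j → v i ℕ.≤ v j) → (∀ k → Div e (Q k)) → (∀ k → Δ^ d Q k ≡ 0ℚ) →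
    (∀ n k → n ℕ.≤ m → Div (v n) (Δ^ n F k)) → ∀ k → Div (e ℕ.+ v (suc m ℕ.∸ d)) (Δ^ m (λ i → Q i * F i) k)
  Δ^-product zero m Q F e v mono hQ hd hF k = Div-≡ (sym (trans (Δ^-ext m (λ i → trans (cong (_* F i) (hd i)) (*-zeroˡ (F i))) k) (Δ^-zero m k))) (Div-0 _)
  Δ^-product (suc d) zero Q F e v mono hQ hd hF k = Div-weaken (ℕP.+-monoʳ-≤ e (mono (ℕP.m∸n≤m 0 d))) (Div-* (hQ k) (hF 0 k z≤n))
  Δ^-product (suc d) (suc m) Q F e v mono hQ hd hF k = Div-≡ eq (Div-+ one two)
    where
    one : Div (e ℕ.+ v (suc m ℕ.∸ d)) (Δ^ m (λ i → Δ Q i * tl F i) k)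
    one = Δ^-product d m (Δ Q) (tl F) e v mono (λ k → Div-- (hQ (suc k)) (hQ k)) (λ k → trans (Δ^-Δ d Q k) (hd k))
      (λ n k l → Div-≡ (sym (Δ^-shift n F k)) (hF n (suc k) (ℕP.m≤n⇒m≤1+n l))) k
    two : Div (e ℕ.+ v (suc m ℕ.∸ d)) (Δ^ m (λ i → Q i * Δ F i) k)
    two = Div-weaken (ℕP.+-monoʳ-≤ e (mono le))
      (Δ^-product (suc d) m Q (Δ F) e (λ n → v (suc n)) (λ l → mono (s≤s l)) hQ hd (λ n k l → Div-≡ (sym (Δ^-Δ n F k)) (hF (suc n) k (s≤s l))) k)
      where
      le : suc m ℕ.∸ d ℕ.≤ suc (m ℕ.∸ d)
      le = h m d
        where
        h : ∀ m d → suc m ℕ.∸ d ℕ.≤ suc (m ℕ.∸ d)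
        h m       zero    = ℕP.≤-refl
        h zero    (suc d) = ℕP.≤-trans (ℕP.≤-reflexive (ℕP.0∸n≡0 d)) z≤n
        h (suc m) (suc d) = h m d
    eq : Δ^ m (λ i → Δ Q i * tl F i) k + Δ^ m (λ i → Q i * Δ F i) k ≡ Δ^ (suc m) (λ i → Q i * F i) k
    eq = trans (sym (Δ^-+ m (λ i → Δ Q i * tl F i) (λ i → Q i * Δ F i) k)) (trans
      (Δ^-ext m (λ i → solve 4 (λ a b c d → (a :- b) :* c :+ b :* (c :- d) := a :* c :- b :* d) refl (Q (suc i)) (Q i) (F (suc i)) (F i)) k)
      (Δ^-Δ m (λ i → Q i * F i) k))

  rise : ℕ → ℕ → ℚ
  rise zero    N = 1ℚ
  rise (suc m) N = # (suc m ℕ.+ N) * rise m N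

  fac-rise : ∀ m N → fac (m ℕ.+ N) ≡ rise m N * fac N
  fac-rise zero    N = sym (*-identityˡ (fac N))
  fac-rise (suc m) N = trans (cong (# (suc m ℕ.+ N) *_) (fac-rise m N)) (sym (*-assoc (# (suc m ℕ.+ N)) (rise m N) (fac N)))

  ifac-rise : ∀ m N → ifac N ≡ rise m N * ifac (m ℕ.+ N)
  ifac-rise m N = begin
    ifac N                                             ≡⟨ sym (*-identityʳ (ifac N)) ⟩
    ifac N * 1ℚ                                        ≡⟨ cong (ifac N *_) (sym (fac-ifac (m ℕ.+ N))) ⟩
    ifac N * (fac (m ℕ.+ N) * ifac (m ℕ.+ N))          ≡⟨ cong (λ z → ifac N * (z * ifac (m ℕ.+ N))) (fac-rise m N) ⟩
    ifac N * (rise m N * fac N * ifac (m ℕ.+ N))       ≡⟨ solve 4 (λ i r f j → i :* (r :* f :* j) := f :* i :* (r :* j)) refl (ifac N) (rise m N) (fac N) (ifac (m ℕ.+ N)) ⟩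
    fac N * ifac N * (rise m N * ifac (m ℕ.+ N))       ≡⟨ cong (_* (rise m N * ifac (m ℕ.+ N))) (fac-ifac N) ⟩
    1ℚ * (rise m N * ifac (m ℕ.+ N))                   ≡⟨ *-identityˡ _ ⟩
    rise m N * ifac (m ℕ.+ N)                          ∎
    where open ≡-Reasoning

  -- A polynomial in k of degree m, with unit values as long as m < p. For m = p - 1 it is, up to
  -- sign, the ratio of consecutive values of `ρ`.
  Q₁ : ℕ → Seq
  Q₁ m k = rise m (p ℕ.* k)

  Δ^-rise : ∀ m k → Δ^ (suc m) (Q₁ m) k ≡ 0ℚ
  Δ^-rise zero    k = Δ^-const 0 1ℚ k
  Δ^-rise (suc m) k = Δ^-linear-0 P (λ k → # (suc m ℕ.+ p ℕ.* k)) (Q₁ m) hL (suc m) (Δ^-rise m) k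
    where
    hL : ∀ k → # (suc m ℕ.+ p ℕ.* suc k) ≡ # (suc m ℕ.+ p ℕ.* k) + P
    hL k = trans (cong # (trans (cong (suc m ℕ.+_) (trans (ℕP.*-suc p k) (ℕP.+-comm p (p ℕ.* k)))) (sym (ℕP.+-assoc (suc m) (p ℕ.* k) p)))) (#-+ (suc m ℕ.+ p ℕ.* k) p)

  Unit-rise : ∀ m k → m ℕ.≤ q → Unit (Q₁ m k)
  Unit-rise zero    k l = Unit-1
  Unit-rise (suc m) k l = Unit-* (Unit-# (suc m ℕ.+ p ℕ.* k) (p∤+ m k (s≤s l))) (Unit-rise m k (ℕP.≤-trans (ℕP.n≤1+n m) l))

  rise≈fac : ∀ m k → m ℕ.≤ q → Q₁ m k ≈[ 1 ] fac m
  rise≈fac zero    k l = ≈-refl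
  rise≈fac (suc m) k l = ≈-* h (rise≈fac m k (ℕP.≤-trans (ℕP.n≤1+n m) l)) (Int-# (suc m)) (Unit.int-u (Unit-rise m k (ℕP.≤-trans (ℕP.n≤1+n m) l)))
    where
    h : # (suc m ℕ.+ p ℕ.* k) ≈[ 1 ] # (suc m)
    h = mk (Div-≡ (trans (solve 2 (λ a b → b := (a :+ b) :- a) refl (# (suc m)) (# (p ℕ.* k))) (cong (_- # (suc m)) (sym (#-+ (suc m) (p ℕ.* k))))) (∣→Div1 (p ℕ.* k) (m∣m*n k)))

  -- By `fac-split` this is 1/Γ_p(pk). Its differences at 0 are the Mahler coefficients of that
  -- function, up to the choice of normalisation by n!.
  ρ : Seq
  ρ k = (- P) ^ k * fac k * ifac (p ℕ.* k)

  ρ-step : ∀ k → ρ k ≡ - (Q₁ q k) * ρ (suc k)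
  ρ-step k = begin
    (- P) ^ k * fac k * ifac (p ℕ.* k)
      ≡⟨ cong ((- P) ^ k * fac k *_) (ifac-rise p (p ℕ.* k)) ⟩
    (- P) ^ k * fac k * (# (p ℕ.+ p ℕ.* k) * Q₁ q k * ifac (p ℕ.+ p ℕ.* k))
      ≡⟨ cong₂ (λ u v → (- P) ^ k * fac k * (u * Q₁ q k * v)) (trans (cong # (sym (ℕP.*-suc p k))) (#-* p (suc k))) (cong ifac (sym (ℕP.*-suc p k))) ⟩
    (- P) ^ k * fac k * (P * # (suc k) * Q₁ q k * ifac (p ℕ.* suc k))
      ≡⟨ solve 6 (λ x f P k r i → x :* f :* (P :* k :* r :* i) := (:- r) :* ((:- P) :* x :* (k :* f) :* i)) refl ((- P) ^ k) (fac k) P (# (suc k)) (Q₁ q k) (ifac (p ℕ.* suc k)) ⟩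
    - (Q₁ q k) * ρ (suc k) ∎
    where open ≡-Reasoning

  Int-ρ : ∀ k → Int (ρ k)
  Int-ρ zero    = Int-≡ (sym (cong (λ n → 1ℚ * 1ℚ * ifac n) (ℕP.*-zeroʳ p))) Int-1
  Int-ρ (suc k) = Div→Int {0} (Div-cancelUnit (Unit-neg (Unit-rise q k ℕP.≤-refl)) (Div-≡ (ρ-step k) (Int→Div (Int-ρ k))))

  v/p : ℕ → ℕ
  v/p n = n ℕD./ p

  v/p-mono : ∀ {i j} → i ℕ.≤ j → v/p i ℕ.≤ v/p j
  v/p-mono l = ℕD./-monoˡ-≤ p l

  v/p-step : ∀ m → v/p (suc m) ℕ.≤ 1 ℕ.+ v/p (suc m ℕ.∸ p)
  v/p-step m with p ℕ.≤? suc m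
  ... | yes l = ℕP.≤-reflexive (ℕD.m/n≡1+[m∸n]/n l)
  ... | no ¬l = ℕP.≤-trans (ℕP.≤-reflexive (ℕD.m<n⇒m/n≡0 (ℕP.≰⇒> ¬l))) z≤n

  -- By `ρ-step` the first difference is (1 + Q₁ q k) ρ(k+1). Wilson's theorem makes the first
  -- factor divisible by p, and it is a polynomial of degree p - 1. So `Δ^-product` gains one factor
  -- p while using up at most p differences.
  Δ^ρ : ∀ N n → n ℕ.≤ N → ∀ k → Div (v/p n) (Δ^ n ρ k)
  Δ^ρ N       zero    l k = Div-weaken (ℕP.≤-reflexive (ℕD.0/n≡0 p)) (Int→Div (Int-ρ k))
  Δ^ρ (suc N) (suc m) (s≤s l) k = Div-≡ (trans (sym (Δ^-ext m e k)) (Δ^-Δ m ρ k)) (Div-weaken (v/p-step m)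
    (Δ^-product p m (λ k → 1ℚ + Q₁ q k) (tl ρ) 1 v/p v/p-mono hQ hd (λ n k l′ → Div-≡ (sym (Δ^-shift n ρ k)) (Δ^ρ N n (ℕP.≤-trans l′ l) (suc k))) k))
    where
    e : ∀ k → Δ ρ k ≡ (1ℚ + Q₁ q k) * ρ (suc k)
    e k = trans (cong (λ z → ρ (suc k) - z) (ρ-step k)) (solve 2 (λ r x → x :- (:- r) :* x := (con 1ℚ :+ r) :* x) refl (Q₁ q k) (ρ (suc k)))
    hQ : ∀ k → Div 1 (1ℚ + Q₁ q k)
    hQ k = Div-≡ (solve 1 (λ r → r :- (:- con 1ℚ) := con 1ℚ :+ r) refl (Q₁ q k)) (_≈[_]_.diff (≈-trans (rise≈fac q k ℕP.≤-refl) wilson))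
    hd : ∀ k → Δ^ p (λ k → 1ℚ + Q₁ q k) k ≡ 0ℚ
    hd k = trans (Δ^-+ p (λ _ → 1ℚ) (Q₁ q) k) (trans (cong₂ _+_ (Δ^-const q 1ℚ k) (Δ^-rise q k)) refl)

  -- Newton's formula Δ^n r(0) = Σ (-1)^(n-i) (n choose i) r(i), as a product of exponential generating functions
  newton : ∀ n (r : Seq) → fac n * ((λ i → (- 1ℚ) ^ i * ifac i) ⋆ (λ i → r i * ifac i)) n ≡ Δ^ n r 0
  newton zero    r = solve 1 (λ x → con 1ℚ :* (con 1ℚ :* con 1ℚ :* (x :* con 1ℚ)) := x) refl (r 0)
  newton (suc n) r = begin
    # (suc n) * fac n * (ε ⋆ g r) (suc n)         ≡⟨ solve 3 (λ a b c → a :* b :* c := b :* (a :* c)) refl (# (suc n)) (fac n) ((ε ⋆ g r) (suc n)) ⟩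
    fac n * D (ε ⋆ g r) (suc n)                   ≡⟨ cong (fac n *_) (D-⋆ ε (g r) (suc n)) ⟩
    fac n * ((D ε ⋆ g r) (suc n) + (ε ⋆ D (g r)) (suc n))
      ≡⟨ cong₂ (λ u v → fac n * (u + v)) (trans (⋆-ext Dε (λ _ → refl) (suc n)) (trans (⋆-*ˡ (- 1ℚ) (S ε) (g r) (suc n)) (cong ((- 1ℚ) *_) (⋆-Sˡ ε (g r) (suc n)))))
           (trans (⋆-ext {ε} {ε} (λ _ → refl) Dg (suc n)) (⋆-Sʳ ε (g (tl r)) (suc n))) ⟩
    fac n * ((- 1ℚ) * (ε ⋆ g r) n + (ε ⋆ g (tl r)) n)
      ≡⟨ cong (fac n *_) (trans (cong (_+ (ε ⋆ g (tl r)) n) (sym (⋆-*ʳ (- 1ℚ) ε (g r) n))) (trans (sym (⋆-+ʳ ε (λ i → (- 1ℚ) * g r i) (g (tl r)) n)) (⋆-ext (λ _ → refl) eq n))) ⟩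
    fac n * (ε ⋆ g (Δ r)) n                       ≡⟨ newton n (Δ r) ⟩
    Δ^ n (Δ r) 0                                  ≡⟨ Δ^-Δ n r 0 ⟩
    Δ^ (suc n) r 0 ∎
    where
    open ≡-Reasoning
    ε : Seq
    ε i = (- 1ℚ) ^ i * ifac i
    g : Seq → Seq
    g r i = r i * ifac i
    eq : ∀ i → (- 1ℚ) * g r i + g (tl r) i ≡ g (Δ r) i
    eq i = solve 3 (λ a b c → (con (- 1ℚ)) :* (a :* c) :+ b :* c := (b :- a) :* c) refl (r i) (r (suc i)) (ifac i)
    Dε : ∀ i → D ε i ≡ (- 1ℚ) * S ε i
    Dε zero    = trans (cong (_* (1ℚ * 1ℚ)) #0) refl
    Dε (suc i) = trans (solve 5 (λ a m x i f → a :* (m :* x :* (i :* f)) := i :* a :* (m :* (x :* f))) refl (# (suc i)) (- 1ℚ) ((- 1ℚ) ^ i) (iv (suc i)) (ifac i))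
      (trans (cong (_* ((- 1ℚ) * ε i)) (iv-inv i)) (*-identityˡ ((- 1ℚ) * ε i)))
    Dg : ∀ i → D (g r) i ≡ S (g (tl r)) i
    Dg zero    = trans (cong (_* g r 0) #0) (*-zeroˡ (g r 0))
    Dg (suc i) = trans (solve 4 (λ a x i f → a :* (x :* (i :* f)) := i :* a :* (x :* f)) refl (# (suc i)) (r (suc i)) (iv (suc i)) (ifac i))
      (trans (cong (_* (r (suc i) * ifac i)) (iv-inv i)) (*-identityˡ (r (suc i) * ifac i)))

  -- With π^(p-1) = -p, the numbers c_n π^n are the coefficients of Dwork's exp (π (z - z^p)).
  -- Separating π^n keeps the coefficients rational.
  c : Seq
  c = X 1ℚ 1ℚ

  -- The coefficient of y^(pn) in exp (y^p/p) · exp y involves only multiples of p. The weight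
  -- (-p)^n turns the first factor into (-1)^i/i! and the second into ρ(j)/j!, which is the shape of
  -- Newton's formula.
  c-Δ : ∀ n → fac n * ((- P) ^ n * c (p ℕ.* n)) ≡ Δ^ n ρ 0
  c-Δ n = trans (cong (fac n *_) (trans (cong ((- P) ^ n *_) e₁)
    (⋆-weighted ξ g (λ i → (- 1ℚ) ^ i * ifac i) (λ i → ρ i * ifac i) (λ n → (- P) ^ n) n w))) (newton n ρ)
    where
    ξ g : Seq
    ξ m = X 0ℚ 1ℚ (p ℕ.* m)
    g m = X 1ℚ 0ℚ (p ℕ.* m)
    e₁ : c (p ℕ.* n) ≡ (ξ ⋆ g) n
    e₁ = trans (X-⋆′ 0ℚ 1ℚ 1ℚ 0ℚ refl refl (p ℕ.* n)) (⋆-sparse (X 0ℚ 1ℚ) (X 1ℚ 0ℚ) (X-0b-none 1ℚ) 0 (s≤s z≤n) n)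
    PP : ∀ i → (- P) ^ i * (1ℚ * iv p) ^ i ≡ (- 1ℚ) ^ i
    PP i = trans (sym (*-^ (- P) (1ℚ * iv p) i)) (cong (_^ i) (trans (solve 2 (λ P v → (:- P) :* (con 1ℚ :* v) := :- (v :* P)) refl P (iv p)) (cong -_ (iv-inv q))))
    open ≡-Reasoning
    w : ∀ i j → i ℕ.+ j ≡ n → (- P) ^ n * (ξ i * g j) ≡ (- 1ℚ) ^ i * ifac i * (ρ j * ifac j)
    w i j refl = begin
      (- P) ^ (i ℕ.+ j) * (ξ i * g j)
        ≡⟨ cong₂ _*_ (^-+ (- P) i j) (cong₂ _*_ (X-0b 1ℚ i) (trans (X-a0 1ℚ (p ℕ.* j)) (trans (cong (_* ifac (p ℕ.* j)) (1^ (p ℕ.* j))) (*-identityˡ _)))) ⟩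
      (- P) ^ i * (- P) ^ j * ((1ℚ * iv p) ^ i * ifac i * ifac (p ℕ.* j))
        ≡⟨ solve 5 (λ a b c d e → a :* b :* (c :* d :* e) := a :* c :* d :* (b :* con 1ℚ :* e)) refl ((- P) ^ i) ((- P) ^ j) ((1ℚ * iv p) ^ i) (ifac i) (ifac (p ℕ.* j)) ⟩
      (- P) ^ i * (1ℚ * iv p) ^ i * ifac i * ((- P) ^ j * 1ℚ * ifac (p ℕ.* j))
        ≡⟨ cong₂ (λ u v → u * ifac i * ((- P) ^ j * v * ifac (p ℕ.* j))) (PP i) (sym (fac-ifac j)) ⟩
      (- 1ℚ) ^ i * ifac i * ((- P) ^ j * (fac j * ifac j) * ifac (p ℕ.* j))
        ≡⟨ cong ((- 1ℚ) ^ i * ifac i *_) (solve 4 (λ a b c d → a :* (b :* c) :* d := a :* b :* d :* c) refl ((- P) ^ j) (fac j) (ifac j) (ifac (p ℕ.* j))) ⟩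
      (- 1ℚ) ^ i * ifac i * (ρ j * ifac j) ∎

  -- Bounds the order of p in the denominator of c_n. The rate 1/p + 1/p² lies below 1/(p-1), the
  -- order of π, and convergence needs no more than this.
  slope : ℕ → ℕ
  slope n = n ℕD./ p ℕ.+ n ℕD./ p ℕD./ p

  slope-mono : ∀ {i j} → i ℕ.≤ j → slope i ℕ.≤ slope j
  slope-mono l = ℕP.+-mono-≤ (v/p-mono l) (v/p-mono (v/p-mono l))

  /p-eq : ∀ a n → a ℕ.< p → (a ℕ.+ p ℕ.* n) ℕD./ p ≡ n
  /p-eq a n l = trans (cong (ℕD._/ p) (cong (a ℕ.+_) (ℕP.*-comm p n))) (trans (ℕD.+-distrib-/ a (n ℕ.* p) (subst (ℕ._< p) (sym (trans (cong₂ ℕ._+_ (ℕD.m<n⇒m%n≡m l) (ℕD.m*n%n≡0 n p)) (ℕP.+-identityʳ a))) l))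
    (cong₂ ℕ._+_ (ℕD.m<n⇒m/n≡0 l) (ℕD.m*n/n≡m n p)))

  P^-neg : ∀ n → (- P) ^ n ≡ (- 1ℚ) ^ n * P ^ n
  P^-neg n = trans (cong (_^ n) (solve 1 (λ p → :- p := con (- 1ℚ) :* p) refl P)) (*-^ (- 1ℚ) P n)

  -1^-sq : ∀ n → (- 1ℚ) ^ n * (- 1ℚ) ^ n ≡ 1ℚ
  -1^-sq n = trans (sym (^-+ (- 1ℚ) n n)) (-1^even n)

  -- In `c-Δ` the power of p costs m and the factorial m! costs at most 2⌊m/p⌋, while `Δ^ρ` gives
  -- back ⌊m/p⌋. The balance m + ⌊m/p⌋ is the slope at pm.
  c-lat-p : ∀ m → Int (P ^ slope (p ℕ.* m) * c (p ℕ.* m))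
  c-lat-p m = subst (λ s → Int (P ^ s * c (p ℕ.* m))) (sym (cong (λ z → z ℕ.+ v/p z) (/p-eq 0 m (s≤s z≤n)))) (go (Δ^ρ m m ℕP.≤-refl 0) (divMod-p m))
    where
    open ≡-Reasoning
    go : Div (v/p m) (Δ^ m ρ 0) → Σ ℕ (λ a → Σ ℕ λ n → a ℕ.< p × m ≡ a ℕ.+ p ℕ.* n) → Int (P ^ (m ℕ.+ v/p m) * c (p ℕ.* m))
    go (div y iy e) (a , l , al , refl) = Int-≡ eq (Int-* (Int-* (Int-^ m (Int-neg Int-1)) (Int-ifac l a al)) iy)
      where
      m′ = a ℕ.+ p ℕ.* l
      vl : v/p m′ ≡ l
      vl = /p-eq a l al
      C = c (p ℕ.* m′)
      e′ : fac m′ * ((- 1ℚ) ^ m′ * P ^ m′ * C) ≡ P ^ l * y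
      e′ = trans (cong (λ z → fac m′ * (z * C)) (sym (P^-neg m′))) (trans (c-Δ m′) (trans e (cong (λ k → P ^ k * y) vl)))
      eq : (- 1ℚ) ^ m′ * (P ^ (l ℕ.+ l) * ifac m′) * y ≡ P ^ (m′ ℕ.+ v/p m′) * C
      eq = begin
        (- 1ℚ) ^ m′ * (P ^ (l ℕ.+ l) * ifac m′) * y
          ≡⟨ cong (λ z → (- 1ℚ) ^ m′ * (z * ifac m′) * y) (^-+ P l l) ⟩
        (- 1ℚ) ^ m′ * (P ^ l * P ^ l * ifac m′) * y
          ≡⟨ solve 4 (λ s p i y → s :* (p :* p :* i) :* y := s :* p :* i :* (p :* y)) refl ((- 1ℚ) ^ m′) (P ^ l) (ifac m′) y ⟩
        (- 1ℚ) ^ m′ * P ^ l * ifac m′ * (P ^ l * y)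
          ≡⟨ cong ((- 1ℚ) ^ m′ * P ^ l * ifac m′ *_) (sym e′) ⟩
        (- 1ℚ) ^ m′ * P ^ l * ifac m′ * (fac m′ * ((- 1ℚ) ^ m′ * P ^ m′ * C))
          ≡⟨ solve 6 (λ s p i f q c → s :* p :* i :* (f :* (s :* q :* c)) := (s :* s) :* (f :* i) :* (q :* p :* c)) refl ((- 1ℚ) ^ m′) (P ^ l) (ifac m′) (fac m′) (P ^ m′) C ⟩
        ((- 1ℚ) ^ m′ * (- 1ℚ) ^ m′) * (fac m′ * ifac m′) * (P ^ m′ * P ^ l * C)
          ≡⟨ cong₂ (λ u v → u * v * (P ^ m′ * P ^ l * C)) (-1^-sq m′) (fac-ifac m′) ⟩
        1ℚ * 1ℚ * (P ^ m′ * P ^ l * C)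
          ≡⟨ *-identityˡ _ ⟩
        P ^ m′ * P ^ l * C
          ≡⟨ cong (_* C) (trans (sym (^-+ P m′ l)) (cong (λ k → P ^ (m′ ℕ.+ k)) (sym vl))) ⟩
        P ^ (m′ ℕ.+ v/p m′) * C ∎

  -- Away from the multiples of p the recursion n c_n = c_(n-1) + c_(n-p) divides by a unit and
  -- creates no denominator; the multiples of p are `c-lat-p`.
  c-lat : ∀ N n → n ℕ.≤ N → Int (P ^ slope n * c n)
  c-lat N zero l = subst (λ n → Int (P ^ slope n * c n)) (ℕP.*-zeroʳ p) (c-lat-p 0)
  c-lat (suc N) (suc n) (s≤s l) = go (p ∣? suc n)
    where
    shifted : ∀ k m → m ℕ.≤ N → m ℕ.≤ suc n → Int (P ^ slope (suc n) * S^ k c m)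
    shifted zero    m       h k = Int-P^≤ (slope-mono k) (c-lat N m h)
    shifted (suc i) zero    h k = Int-≡ (sym (*-zeroʳ (P ^ slope (suc n)))) Int-0
    shifted (suc i) (suc m) h k = shifted i m (ℕP.≤-trans (ℕP.n≤1+n m) h) (ℕP.≤-trans (ℕP.n≤1+n m) k)
    go : Dec (p ∣ suc n) → Int (P ^ slope (suc n) * c (suc n))
    go (yes (divides m e)) = subst (λ n → Int (P ^ slope n * c n)) (trans (ℕP.*-comm p m) (sym e)) (c-lat-p m)
    go (no ∤n) = Int-≡ (trans (solve 4 (λ i s a b → i :* (s :* a :+ s :* b) := s :* (i :* (con 1ℚ :* a :+ con 1ℚ :* b))) refl (iv (suc n)) (P ^ slope (suc n)) (c n) (S^ q c n))
        (cong (λ z → P ^ slope (suc n) * (iv (suc n) * (1ℚ * c n + 1ℚ * z))) (sym (H-S^ 1ℚ 1ℚ n q))))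
      (Int-* (Int-iv (suc n) ∤n) (Int-+ (Int-P^≤ (slope-mono (ℕP.n≤1+n n)) (c-lat N n l)) (shifted q n l (ℕP.n≤1+n n))))

  Int-c : ∀ n → Int (P ^ slope n * c n)
  Int-c n = c-lat n n ℕP.≤-refl

  -- The Gross–Koblitz formula

  ⋆-comm : ∀ f g n → (f ⋆ g) n ≡ (g ⋆ f) n
  ⋆-comm f g zero    = *-comm (f 0) (g 0)
  ⋆-comm f g (suc n) = trans (cong₂ _+_ (*-comm (f 0) (g (suc n))) (⋆-comm (tl f) g n))
    (trans (+-comm (g (suc n) * f 0) ((g ⋆ tl f) n)) (sym (⋆-last g f n)))

  fall : ℕ → ℕ → ℚ
  fall k       zero    = 1ℚ
  fall zero    (suc d) = 0ℚ
  fall (suc k) (suc d) = # (suc k) * fall k d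

  fall-last : ∀ k d → fall k (suc d) ≡ fall k d * (# k - # d)
  fall-last zero    zero    = trans (solve 1 (λ x → con 0ℚ := con 1ℚ :* (x :- x)) refl (# 0)) refl
  fall-last zero    (suc d) = sym (*-zeroˡ (# 0 - # (suc d)))
  fall-last (suc k) zero    = trans (solve 1 (λ x → x :* con 1ℚ := con 1ℚ :* (x :- con 0ℚ)) refl (# (suc k))) (cong (λ z → 1ℚ * (# (suc k) - z)) (sym #0))
  fall-last (suc k) (suc d) = trans (cong (# (suc k) *_) (fall-last k d)) (trans
    (solve 4 (λ s f k d → s :* (f :* (k :- d)) := s :* f :* ((con 1ℚ :+ k) :- (con 1ℚ :+ d))) refl (# (suc k)) (fall k d) (# k) (# d))
    (cong₂ (λ u v → # (suc k) * fall k d * (u - v)) (sym (#-suc k)) (sym (#-suc d))))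

  fall-> : ∀ k d → k ℕ.< d → fall k d ≡ 0ℚ
  fall-> zero    (suc d) l       = refl
  fall-> (suc k) (suc d) (s≤s l) = trans (cong (# (suc k) *_) (fall-> k d l)) (*-zeroʳ (# (suc k)))

  fall-pascal : ∀ k d → fall (suc k) (suc d) ≡ fall k (suc d) + # (suc d) * fall k d
  fall-pascal k d = trans (trans (cong (_* fall k d) (#-suc k)) (solve 3 (λ k d f → (con 1ℚ :+ k) :* f := f :* (k :- d) :+ (con 1ℚ :+ d) :* f) refl (# k) (# d) (fall k d)))
    (cong₂ (λ u v → u + v * fall k d) (sym (fall-last k d)) (sym (#-suc d)))

  fall-fac : ∀ k d → Σ ℚ λ b → Int b × fall k d ≡ fac d * b
  fall-fac k       zero    = 1ℚ , Int-1 , refl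
  fall-fac zero    (suc d) = 0ℚ , Int-0 , sym (*-zeroʳ (fac (suc d)))
  fall-fac (suc k) (suc d) = go (fall-fac k (suc d)) (fall-fac k d)
    where
    go : (Σ ℚ λ b → Int b × fall k (suc d) ≡ fac (suc d) * b) → (Σ ℚ λ b → Int b × fall k d ≡ fac d * b) → Σ ℚ λ b → Int b × fall (suc k) (suc d) ≡ fac (suc d) * b
    go (b , ib , e) (b′ , ib′ , e′) = b + b′ , Int-+ ib ib′ , trans (fall-pascal k d) (trans (cong₂ (λ u v → u + # (suc d) * v) e e′)
      (solve 4 (λ s f a b → s :* f :* a :+ s :* (f :* b) := s :* f :* (a :+ b)) refl (# (suc d)) (fac d) b b′))

  Div-fac : ∀ n → Div (v/p n) (fac n)
  Div-fac n = go n (divMod-p n)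
    where
    go : ∀ n → Σ ℕ (λ a → Σ ℕ λ m → a ℕ.< p × n ≡ a ℕ.+ p ℕ.* m) → Div (v/p n) (fac n)
    go _ (a , m , l , refl) = Div-≡ (trans (sym (*-assoc (P ^ m) (fac m) _)) (sym (fac-split m a l)))
      (subst (λ e → Div e (P ^ m * (fac m * Πu (suc (a ℕ.+ p ℕ.* m))))) (sym (/p-eq a m l)) (Div-P^ m (Int-* (Int-fac m) (Unit.int-u (Unit-Πu (suc (a ℕ.+ p ℕ.* m)))))))

  Div-fall : ∀ k d → Div (v/p d) (fall k d)
  Div-fall k d = go (fall-fac k d)
    where
    go : (Σ ℚ λ b → Int b × fall k d ≡ fac d * b) → Div (v/p d) (fall k d)
    go (b , ib , e) = Div-≡ (sym e) (Div-*ʳ (Div-fac d) ib)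

  fac-⋆ifac : ∀ k (g : Seq) → fac k * (g ⋆ ifac) k ≡ ∑ (suc k) (λ d → fall k d * g d)
  fac-⋆ifac zero    g = solve 1 (λ g → con 1ℚ :* (g :* con 1ℚ) := con 1ℚ :* g :+ con 0ℚ) refl (g 0)
  fac-⋆ifac (suc k) g = begin
    fac (suc k) * (g 0 * ifac (suc k) + (tl g ⋆ ifac) k)
      ≡⟨ solve 5 (λ s f g i x → s :* f :* (g :* i :+ x) := s :* f :* i :* g :+ s :* (f :* x)) refl (# (suc k)) (fac k) (g 0) (ifac (suc k)) ((tl g ⋆ ifac) k) ⟩
    fac (suc k) * ifac (suc k) * g 0 + # (suc k) * (fac k * (tl g ⋆ ifac) k)
      ≡⟨ cong₂ (λ u v → u * g 0 + # (suc k) * v) (fac-ifac (suc k)) (fac-⋆ifac k (tl g)) ⟩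
    1ℚ * g 0 + # (suc k) * ∑ (suc k) (λ d → fall k d * g (suc d))
      ≡⟨ cong (1ℚ * g 0 +_) (trans (sym (∑-*ˡ (suc k) (# (suc k)) (λ d → fall k d * g (suc d)))) (∑-ext (suc k) (λ d → sym (*-assoc (# (suc k)) (fall k d) (g (suc d)))))) ⟩
    ∑ (suc (suc k)) (λ d → fall (suc k) d * g d) ∎
    where open ≡-Reasoning

  G : ℕ → ℕ → ℚ
  G b k = ∑ (suc k) (λ d → fall k d * ((- P) ^ d * c (b ℕ.+ p ℕ.* d)))

  -- Multiplying exp (y + y^p/p) by exp (-y^p/p) leaves exp y. The sum is (-p)^k k! times the
  -- coefficient of y^(a+pk) in this product, since k!/(k-d)! is `fall k d`.
  G-ρ : ∀ a → a ℕ.< p → ∀ k → G a k ≡ (- P) ^ k * fac k * ifac (a ℕ.+ p ℕ.* k)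
  G-ρ a l k = begin
    G a k                                            ≡⟨ sym (fac-⋆ifac k (λ d → (- P) ^ d * h d)) ⟩
    fac k * ((λ d → (- P) ^ d * h d) ⋆ ifac) k       ≡⟨ cong (fac k *_) (sym (⋆-weighted h ξ (λ d → (- P) ^ d * h d) ifac (λ n → (- P) ^ n) k w)) ⟩
    fac k * ((- P) ^ k * (h ⋆ ξ) k)                  ≡⟨ solve 3 (λ a b c → a :* (b :* c) := b :* a :* c) refl (fac k) ((- P) ^ k) ((h ⋆ ξ) k) ⟩
    (- P) ^ k * fac k * (h ⋆ ξ) k                    ≡⟨ cong ((- P) ^ k * fac k *_) (trans (⋆-comm h ξ k) (trans (sym (⋆-sparse (X 0ℚ (- 1ℚ)) c (X-0b-none (- 1ℚ)) a l k)) (trans (X-⋆ 0ℚ (- 1ℚ) 1ℚ 1ℚ (a ℕ.+ p ℕ.* k))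
                                                         (trans (X-a0 1ℚ (a ℕ.+ p ℕ.* k)) (trans (cong (_* ifac (a ℕ.+ p ℕ.* k)) (1^ (a ℕ.+ p ℕ.* k))) (*-identityˡ (ifac (a ℕ.+ p ℕ.* k)))))))) ⟩
    (- P) ^ k * fac k * ifac (a ℕ.+ p ℕ.* k)         ∎
    where
    open ≡-Reasoning
    h ξ : Seq
    h d = c (a ℕ.+ p ℕ.* d)
    ξ d = X 0ℚ (- 1ℚ) (p ℕ.* d)
    pv : - P * (- 1ℚ * iv p) ≡ 1ℚ
    pv = trans (solve 2 (λ P v → (:- P) :* ((:- con 1ℚ) :* v) := v :* P) refl P (iv p)) (iv-inv q)
    w : ∀ i j → i ℕ.+ j ≡ k → (- P) ^ k * (h i * ξ j) ≡ (- P) ^ i * h i * ifac j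
    w i j refl = begin
      (- P) ^ (i ℕ.+ j) * (h i * ξ j)                                ≡⟨ cong₂ (λ u v → u * (h i * v)) (^-+ (- P) i j) (X-0b (- 1ℚ) j) ⟩
      (- P) ^ i * (- P) ^ j * (h i * ((- 1ℚ * iv p) ^ j * ifac j))   ≡⟨ solve 5 (λ a b h x i → a :* b :* (h :* (x :* i)) := a :* h :* (b :* x :* i)) refl ((- P) ^ i) ((- P) ^ j) (h i) ((- 1ℚ * iv p) ^ j) (ifac j) ⟩
      (- P) ^ i * h i * ((- P) ^ j * (- 1ℚ * iv p) ^ j * ifac j)     ≡⟨ cong (λ z → (- P) ^ i * h i * (z * ifac j)) (trans (sym (*-^ (- P) (- 1ℚ * iv p) j)) (trans (cong (_^ j) pv) (1^ j))) ⟩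
      (- P) ^ i * h i * (1ℚ * ifac j)                                ≡⟨ cong ((- P) ^ i * h i *_) (*-identityˡ (ifac j)) ⟩
      (- P) ^ i * h i * ifac j ∎

  R : ℕ → ℕ → ℚ
  R b k = ∑ (suc k) (λ d → fall k d * ((- P) ^ suc d * c (b ℕ.+ p ℕ.* suc d)))

  shift-index : ∀ b d → b ℕ.+ p ℕ.* suc d ≡ suc ((b ℕ.+ q) ℕ.+ p ℕ.* d)
  shift-index b d = trans (cong (b ℕ.+_) (ℕP.*-suc p d)) (trans (sym (ℕP.+-assoc b p (p ℕ.* d))) (cong (ℕ._+ p ℕ.* d) (ℕP.+-suc b q)))

  shift-index′ : ∀ b d → b ℕ.+ p ℕ.* suc d ≡ p ℕ.+ (b ℕ.+ p ℕ.* d)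
  shift-index′ b d = trans (cong (b ℕ.+_) (ℕP.*-suc p d)) (trans (sym (ℕP.+-assoc b p (p ℕ.* d))) (trans (cong (ℕ._+ p ℕ.* d) (ℕP.+-comm b p)) (ℕP.+-assoc p b (p ℕ.* d))))

  c-rec : ∀ b d → # (b ℕ.+ p ℕ.* suc d) * c (b ℕ.+ p ℕ.* suc d) ≡ c ((b ℕ.+ q) ℕ.+ p ℕ.* d) + c (b ℕ.+ p ℕ.* d)
  c-rec b d = trans (X-D 1ℚ 1ℚ (b ℕ.+ p ℕ.* suc d)) (cong₂ _+_
    (trans (*-identityˡ (S c (b ℕ.+ p ℕ.* suc d))) (cong (S c) (shift-index b d)))
    (trans (*-identityˡ (S^ p c (b ℕ.+ p ℕ.* suc d))) (trans (cong (S^ p c) (shift-index′ b d)) (S^-+ p c (b ℕ.+ p ℕ.* d)))))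

  -- Contiguity: y^b exp(…) and y^(b+q) exp(…) are proportional modulo exact forms and multiples of b + q (k+1).
  G-step : ∀ b k → G b (suc k) + P * G (b ℕ.+ q) k ≡ (1ℚ - P) * c b - # (b ℕ.+ q ℕ.* suc k) * R b k
  G-step b k = begin
    G b (suc k) + P * G (b ℕ.+ q) k
      ≡⟨ cong₂ _+_ (cong (_+ ∑ (suc k) T₁) (trans (*-identityˡ (1ℚ * c (b ℕ.+ p ℕ.* 0))) (trans (*-identityˡ (c (b ℕ.+ p ℕ.* 0))) (cong c (trans (cong (b ℕ.+_) (ℕP.*-zeroʳ p)) (ℕP.+-identityʳ b))))))
           (sym (∑-*ˡ (suc k) P (λ d → fall k d * ((- P) ^ d * E d)))) ⟩
    (c b + ∑ (suc k) (λ d → # (suc k) * fall k d * ((- P) ^ suc d * C (suc d)))) + ∑ (suc k) (λ d → P * (fall k d * ((- P) ^ d * E d)))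
      ≡⟨ trans (+-assoc (c b) (∑ (suc k) T₁) (∑ (suc k) T₂)) (cong (c b +_) (sym (∑-+ (suc k) T₁ T₂))) ⟩
    c b + ∑ (suc k) (λ d → # (suc k) * fall k d * ((- P) ^ suc d * C (suc d)) + P * (fall k d * ((- P) ^ d * E d)))
      ≡⟨ cong (c b +_) (∑-ext (suc k) term) ⟩
    c b + ∑ (suc k) (λ d → (- n) * (fall k d * ((- P) ^ suc d * C (suc d))) + (- 1ℚ) * (φ (suc d) - φ d))
      ≡⟨ cong (c b +_) (trans (∑-+ (suc k) (λ d → (- n) * T₃ d) (λ d → (- 1ℚ) * (φ (suc d) - φ d))) (cong₂ _+_ (∑-*ˡ (suc k) (- n) T₃) (trans (∑-*ˡ (suc k) (- 1ℚ) (λ d → φ (suc d) - φ d)) (cong ((- 1ℚ) *_) (∑-telescope (suc k) φ))))) ⟩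
    c b + ((- n) * R b k + (- 1ℚ) * (φ (suc k) - φ 0))
      ≡⟨ cong₂ (λ u v → c b + ((- n) * R b k + (- 1ℚ) * (u - v))) φ-last φ-0 ⟩
    c b + ((- n) * R b k + (- 1ℚ) * (0ℚ - (- P) * c b))
      ≡⟨ solve 4 (λ c n r p → c :+ ((:- n) :* r :+ (:- con 1ℚ) :* (con 0ℚ :- (:- p) :* c)) := (con 1ℚ :- p) :* c :- n :* r) refl (c b) n (R b k) P ⟩
    (1ℚ - P) * c b - n * R b k ∎
    where
    open ≡-Reasoning
    n : ℚ
    n = # (b ℕ.+ q ℕ.* suc k)
    C E φ : Seq
    C d = c (b ℕ.+ p ℕ.* d)
    E d = c ((b ℕ.+ q) ℕ.+ p ℕ.* d)
    -- The primitive of the exact form. It vanishes at d = k + 1 because the falling factorial does,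
    -- and its value at d = 0 turns c b into (1 - p) c b.
    φ d = fall k d * ((- P) ^ suc d * C d)
    T₁ T₂ T₃ : Seq
    T₁ d = # (suc k) * fall k d * ((- P) ^ suc d * C (suc d))
    T₂ d = P * (fall k d * ((- P) ^ d * E d))
    T₃ d = fall k d * ((- P) ^ suc d * C (suc d))
    φ-last : φ (suc k) ≡ 0ℚ
    φ-last = trans (cong (_* ((- P) ^ suc (suc k) * C (suc k))) (fall-> k (suc k) ℕP.≤-refl)) (*-zeroˡ ((- P) ^ suc (suc k) * C (suc k)))
    φ-0 : φ 0 ≡ (- P) * c b
    φ-0 = trans (solve 2 (λ p c → con 1ℚ :* (p :* con 1ℚ :* c) := p :* c) refl (- P) (C 0)) (cong (λ z → (- P) * c z) (trans (cong (b ℕ.+_) (ℕP.*-zeroʳ p)) (ℕP.+-identityʳ b)))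
    n≡ : n ≡ # b + (P - 1ℚ) * # (suc k)
    n≡ = trans (#-+ b (q ℕ.* suc k)) (cong (# b +_) (trans (#-* q (suc k)) (cong (_* # (suc k)) (trans (solve 1 (λ x → x := (con 1ℚ :+ x) :- con 1ℚ) refl (# q)) (cong (_- 1ℚ) (sym (#-suc q)))))))
    N≡ : ∀ d → # (b ℕ.+ p ℕ.* suc d) ≡ # b + P * (1ℚ + # d)
    N≡ d = trans (#-+ b (p ℕ.* suc d)) (cong (# b +_) (trans (#-* p (suc d)) (cong (P *_) (#-suc d))))
    E≡ : ∀ d → E d ≡ (# b + P * (1ℚ + # d)) * C (suc d) - C d
    E≡ d = trans (solve 2 (λ e c → e := (e :+ c) :- c) refl (E d) (C d)) (cong (_- C d) (trans (sym (c-rec b d)) (cong (_* C (suc d)) (N≡ d))))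
    term : ∀ d → # (suc k) * fall k d * ((- P) ^ suc d * C (suc d)) + P * (fall k d * ((- P) ^ d * E d))
      ≡ (- n) * (fall k d * ((- P) ^ suc d * C (suc d))) + (- 1ℚ) * (φ (suc d) - φ d)
    term d = begin
      # (suc k) * F * ((- P) * x * c₁) + P * (F * (x * E d))
        ≡⟨ cong₂ (λ u v → u * F * ((- P) * x * c₁) + P * (F * (x * v))) (#-suc k) (E≡ d) ⟩
      (1ℚ + # k) * F * ((- P) * x * c₁) + P * (F * (x * ((# b + P * (1ℚ + # d)) * c₁ - c₀)))
        ≡⟨ solve 8 (λ k f p x c₁ c₀ b d →
             (con 1ℚ :+ k) :* f :* ((:- p) :* x :* c₁) :+ p :* (f :* (x :* ((b :+ p :* (con 1ℚ :+ d)) :* c₁ :- c₀)))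
             := (:- (b :+ (p :- con 1ℚ) :* (con 1ℚ :+ k))) :* (f :* ((:- p) :* x :* c₁)) :+ (:- con 1ℚ) :* (f :* (k :- d) :* ((:- p) :* ((:- p) :* x) :* c₁) :- f :* ((:- p) :* x :* c₀)))
             refl (# k) F P x c₁ c₀ (# b) (# d) ⟩
      (- (# b + (P - 1ℚ) * (1ℚ + # k))) * (F * ((- P) * x * c₁)) + (- 1ℚ) * (F * (# k - # d) * ((- P) * ((- P) * x) * c₁) - φ d)
        ≡⟨ cong₂ (λ u v → (- u) * (F * ((- P) * x * c₁)) + (- 1ℚ) * (v * ((- P) * ((- P) * x) * c₁) - φ d)) (trans (cong (λ z → # b + (P - 1ℚ) * z) (sym (#-suc k))) (sym n≡)) (sym (fall-last k d)) ⟩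
      (- n) * (F * ((- P) * x * c₁)) + (- 1ℚ) * (φ (suc d) - φ d) ∎
      where
      F = fall k d
      x = (- P) ^ d
      c₁ = C (suc d)
      c₀ = C d

  slope-bound : ∀ N → slope N ℕ.* (p ℕ.* p) ℕ.≤ N ℕ.* suc p
  slope-bound N = begin
    slope N ℕ.* (p ℕ.* p)                         ≡⟨ ℕP.*-distribʳ-+ (p ℕ.* p) (v/p N) (v/p (v/p N)) ⟩
    v/p N ℕ.* (p ℕ.* p) ℕ.+ v/p (v/p N) ℕ.* (p ℕ.* p)
      ≡⟨ cong₂ ℕ._+_ (sym (ℕP.*-assoc (v/p N) p p)) (sym (ℕP.*-assoc (v/p (v/p N)) p p)) ⟩
    v/p N ℕ.* p ℕ.* p ℕ.+ v/p (v/p N) ℕ.* p ℕ.* p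
      ≤⟨ ℕP.+-mono-≤ (ℕP.*-monoˡ-≤ p (ℕD.m/n*n≤m N p)) (ℕP.≤-trans (ℕP.*-monoˡ-≤ p (ℕD.m/n*n≤m (v/p N) p)) (ℕD.m/n*n≤m N p)) ⟩
    N ℕ.* p ℕ.+ N                                 ≡⟨ trans (ℕP.+-comm (N ℕ.* p) N) (sym (ℕP.*-suc N p)) ⟩
    N ℕ.* suc p                                   ∎
    where open ℕP.≤-Reasoning

  lam : ℕ → ℕ
  lam m = m ℕD./ (p ℕ.* p)

  aq : ∀ a m → a ℕ.< q → suc a ℕ.+ q ℕ.* m ℕ.≤ q ℕ.* suc m
  aq a m l = ℕP.≤-trans (ℕP.+-monoˡ-≤ (q ℕ.* m) l) (ℕP.≤-reflexive (sym (ℕP.*-suc q m)))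

  -- Along the progression a + qm the slope grows like m (p-1)(p+1)/p² = m (1 - 1/p²), so of the
  -- factor (-p)^m a surplus of ⌊m/p²⌋ survives.
  slope-lam : ∀ a m → a ℕ.< q → slope (a ℕ.+ q ℕ.* m) ℕ.+ lam m ℕ.≤ m
  slope-lam a m l = ℕP.≤-pred (ℕP.*-cancelʳ-< (p ℕ.* p) (slope N ℕ.+ lam m) (suc m) (begin-strict
    (slope N ℕ.+ lam m) ℕ.* (p ℕ.* p)                 ≡⟨ ℕP.*-distribʳ-+ (p ℕ.* p) (slope N) (lam m) ⟩
    slope N ℕ.* (p ℕ.* p) ℕ.+ lam m ℕ.* (p ℕ.* p)     ≤⟨ ℕP.+-mono-≤ (slope-bound N) (ℕD.m/n*n≤m m (p ℕ.* p)) ⟩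
    N ℕ.* suc p ℕ.+ m                                 <⟨ ℕP.+-monoʳ-< (N ℕ.* suc p) (ℕP.n<1+n m) ⟩
    N ℕ.* suc p ℕ.+ suc m                             ≤⟨ ℕP.+-monoˡ-≤ (suc m) (ℕP.*-monoˡ-≤ (suc p) (ℕP.≤-trans (ℕP.n≤1+n N) (aq a m l))) ⟩
    q ℕ.* suc m ℕ.* suc p ℕ.+ suc m                   ≡⟨ NS.solve 2 (λ q m → q NS.:* m NS.:* (NS.con 2 NS.:+ q) NS.:+ m NS.:= m NS.:* ((NS.con 1 NS.:+ q) NS.:* (NS.con 1 NS.:+ q))) refl q (suc m) ⟩
    suc m ℕ.* (p ℕ.* p)                               ∎))
    where
    open ℕP.≤-Reasoning
    N = a ℕ.+ q ℕ.* m

  slope-R : ∀ a j d → a ℕ.< q → slope ((a ℕ.+ q ℕ.* j) ℕ.+ p ℕ.* suc d) ℕ.≤ 2 ℕ.+ j ℕ.+ v/p d ℕ.+ suc d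
  slope-R a j d l = ℕP.*-cancelʳ-≤ (slope N) (2 ℕ.+ j ℕ.+ v/p d ℕ.+ suc d) (p ℕ.* p) (begin
    slope N ℕ.* (p ℕ.* p)                             ≤⟨ slope-bound N ⟩
    N ℕ.* suc p                                       ≤⟨ ℕP.*-monoˡ-≤ (suc p) (ℕP.+-monoˡ-≤ (p ℕ.* suc d) (ℕP.≤-trans (ℕP.n≤1+n (a ℕ.+ q ℕ.* j)) (aq a j l))) ⟩
    (q ℕ.* suc j ℕ.+ p ℕ.* suc d) ℕ.* suc p           ≤⟨ ℕP.m≤m+n _ (suc j) ⟩
    (q ℕ.* suc j ℕ.+ p ℕ.* suc d) ℕ.* suc p ℕ.+ suc j
      ≡⟨ NS.solve 3 (λ q j d → (q NS.:* j NS.:+ (NS.con 1 NS.:+ q) NS.:* d) NS.:* (NS.con 2 NS.:+ q) NS.:+ j NS.:= (j NS.:+ d) NS.:* ((NS.con 1 NS.:+ q) NS.:* (NS.con 1 NS.:+ q)) NS.:+ d NS.:* (NS.con 1 NS.:+ q)) refl q (suc j) (suc d) ⟩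
    (suc j ℕ.+ suc d) ℕ.* (p ℕ.* p) ℕ.+ suc d ℕ.* p   ≤⟨ ℕP.+-monoʳ-≤ ((suc j ℕ.+ suc d) ℕ.* (p ℕ.* p)) (ℕP.*-monoˡ-≤ p d<) ⟩
    (suc j ℕ.+ suc d) ℕ.* (p ℕ.* p) ℕ.+ suc (v/p d) ℕ.* p ℕ.* p
      ≡⟨ NS.solve 4 (λ j d v p → (j NS.:+ d) NS.:* (p NS.:* p) NS.:+ (NS.con 1 NS.:+ v) NS.:* p NS.:* p NS.:= (NS.con 1 NS.:+ j NS.:+ v NS.:+ d) NS.:* (p NS.:* p)) refl (suc j) (suc d) (v/p d) p ⟩
    (2 ℕ.+ j ℕ.+ v/p d ℕ.+ suc d) ℕ.* (p ℕ.* p) ∎)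
    where
    open ℕP.≤-Reasoning
    N = (a ℕ.+ q ℕ.* j) ℕ.+ p ℕ.* suc d
    d< : suc d ℕ.≤ suc (v/p d) ℕ.* p
    d< = ℕP.≤-trans (ℕP.≤-reflexive (cong suc (ℕD.m≡m%n+[m/n]*n d p))) (ℕP.+-monoˡ-≤ (v/p d ℕ.* p) (ℕD.m%n<n d p))

  term : ℕ → ℕ → ℚ
  term a m = (- P) ^ m * c (a ℕ.+ q ℕ.* m)

  gauss : ℕ → ℕ → ℚ
  gauss a M = ∑ M (term a)

  Int-±1^ : ∀ n → Int ((- 1ℚ) ^ n)
  Int-±1^ n = Int-^ n (Int-neg Int-1)

  Div-term : ∀ a m → a ℕ.< q → Div (lam m) (term a m)
  Div-term a m l = Div-≡ eq (Div-P^ (lam m) (Int-* (Int-±1^ m) (Int-P^≤ (ℕP.m+n≤o⇒m≤o∸n (slope N) (slope-lam a m l)) (Int-c N))))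
    where
    open ≡-Reasoning
    N = a ℕ.+ q ℕ.* m
    eq : P ^ lam m * ((- 1ℚ) ^ m * (P ^ (m ℕ.∸ lam m) * c N)) ≡ (- P) ^ m * c N
    eq = begin
      P ^ lam m * ((- 1ℚ) ^ m * (P ^ (m ℕ.∸ lam m) * c N))  ≡⟨ solve 4 (λ a b d e → a :* (b :* (d :* e)) := b :* (a :* d) :* e) refl (P ^ lam m) ((- 1ℚ) ^ m) (P ^ (m ℕ.∸ lam m)) (c N) ⟩
      (- 1ℚ) ^ m * (P ^ lam m * P ^ (m ℕ.∸ lam m)) * c N    ≡⟨ cong (λ z → (- 1ℚ) ^ m * z * c N) (trans (sym (^-+ P (lam m) (m ℕ.∸ lam m))) (cong (P ^_) (ℕP.m+[n∸m]≡n (ℕP.≤-trans (ℕP.m≤n+m (lam m) (slope N)) (slope-lam a m l))))) ⟩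
      (- 1ℚ) ^ m * P ^ m * c N                              ≡⟨ cong (_* c N) (sym (P^-neg m)) ⟩
      (- P) ^ m * c N ∎

  -- The explicit powers of p and the divisibility of `fall k d` by p^⌊d/p⌋ cover the denominators
  -- of c up to p², uniformly in j and k. Hence the 2 in the hypothesis of `G-gauss`.
  Int-R : ∀ a j k → a ℕ.< q → Int (P ^ 2 * ((- P) ^ j * R (a ℕ.+ q ℕ.* j) k))
  Int-R a j k l = Int-≡ (trans (∑-*ˡ (suc k) (P ^ 2 * (- P) ^ j) (λ d → fall k d * ((- P) ^ suc d * c ((a ℕ.+ q ℕ.* j) ℕ.+ p ℕ.* suc d)))) (*-assoc (P ^ 2) ((- P) ^ j) (R (a ℕ.+ q ℕ.* j) k))) (Int-∑ (suc k) (λ d → go d (Div-fall k d)))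
    where
    open ≡-Reasoning
    go : ∀ d → Div (v/p d) (fall k d) → Int (P ^ 2 * (- P) ^ j * (fall k d * ((- P) ^ suc d * c ((a ℕ.+ q ℕ.* j) ℕ.+ p ℕ.* suc d))))
    go d (div y iy e) = Int-≡ (begin
      y * ((- 1ℚ) ^ j * (- 1ℚ) ^ suc d * (P ^ (2 ℕ.+ j ℕ.+ v/p d ℕ.+ suc d) * C))
        ≡⟨ cong (λ z → y * ((- 1ℚ) ^ j * (- 1ℚ) ^ suc d * (z * C))) (trans (^-+ P (2 ℕ.+ j ℕ.+ v/p d) (suc d)) (cong (_* P ^ suc d) (trans (^-+ P (2 ℕ.+ j) (v/p d)) (cong (_* P ^ v/p d) (^-+ P 2 j))))) ⟩
      y * ((- 1ℚ) ^ j * (- 1ℚ) ^ suc d * (P ^ 2 * P ^ j * P ^ v/p d * P ^ suc d * C))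
        ≡⟨ solve 8 (λ y s t two pj pv pd c → y :* (s :* t :* (two :* pj :* pv :* pd :* c)) := two :* (s :* pj) :* (pv :* y :* (t :* pd :* c))) refl
             y ((- 1ℚ) ^ j) ((- 1ℚ) ^ suc d) (P ^ 2) (P ^ j) (P ^ v/p d) (P ^ suc d) C ⟩
      P ^ 2 * ((- 1ℚ) ^ j * P ^ j) * (P ^ v/p d * y * ((- 1ℚ) ^ suc d * P ^ suc d * C))
        ≡⟨ cong₂ (λ u v → P ^ 2 * u * (v * ((- 1ℚ) ^ suc d * P ^ suc d * C))) (sym (P^-neg j)) (sym e) ⟩
      P ^ 2 * (- P) ^ j * (fall k d * ((- 1ℚ) ^ suc d * P ^ suc d * C))
        ≡⟨ cong (λ z → P ^ 2 * (- P) ^ j * (fall k d * (z * C))) (sym (P^-neg (suc d))) ⟩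
      P ^ 2 * (- P) ^ j * (fall k d * ((- P) ^ suc d * C)) ∎)
      (Int-* iy (Int-* (Int-* (Int-±1^ j) (Int-±1^ (suc d))) (Int-P^≤ (slope-R a j d l) (Int-c N))))
      where
      N = (a ℕ.+ q ℕ.* j) ℕ.+ p ℕ.* suc d
      C = c N

  -- The number a + q (j + k) does not change when `G-step` lowers k and raises j, so one
  -- divisibility kills the remainder at every step. Each step splits off (1 - p) times a term of
  -- the Gauss sum; the term left at the end is small for large k.
  G-gauss : ∀ e a → a ℕ.< q → ∀ k j → Div (2 ℕ.+ e) (# (a ℕ.+ q ℕ.* (j ℕ.+ k))) →
    (- P) ^ j * G (a ℕ.+ q ℕ.* j) k ≈[ e ] (1ℚ - P) * ∑ k (λ i → term a (j ℕ.+ i)) + term a (j ℕ.+ k)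
  G-gauss e a l zero j h = ≈-reflexive (trans (solve 2 (λ x y → x :* (con 1ℚ :* (con 1ℚ :* y) :+ con 0ℚ) := x :* y) refl ((- P) ^ j) (c (a ℕ.+ q ℕ.* j ℕ.+ p ℕ.* 0)))
    (trans (cong (λ n → (- P) ^ j * c n) (trans (cong (a ℕ.+ q ℕ.* j ℕ.+_) (ℕP.*-zeroʳ p)) (ℕP.+-identityʳ _)))
    (trans (cong (term a) (sym (ℕP.+-identityʳ j))) (solve 2 (λ p t → t := (con 1ℚ :- p) :* con 0ℚ :+ t) refl P (term a (j ℕ.+ 0))))))
  G-gauss e a l (suc k) j h = ≈-trans (mk (Div-≡ eq err)) (≈-trans (≈-+ (≈-refl {x = (1ℚ - P) * term a j}) IH) (≈-reflexive eq₂))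
    where
    open ≡-Reasoning
    b = a ℕ.+ q ℕ.* j
    b+q : b ℕ.+ q ≡ a ℕ.+ q ℕ.* suc j
    b+q = trans (ℕP.+-assoc a (q ℕ.* j) q) (cong (a ℕ.+_) (trans (ℕP.+-comm (q ℕ.* j) q) (sym (ℕP.*-suc q j))))
    n≡ : a ℕ.+ q ℕ.* (j ℕ.+ suc k) ≡ b ℕ.+ q ℕ.* suc k
    n≡ = trans (cong (a ℕ.+_) (ℕP.*-distribˡ-+ q j (suc k))) (sym (ℕP.+-assoc a (q ℕ.* j) (q ℕ.* suc k)))
    N = # (b ℕ.+ q ℕ.* suc k)
    IH : (- P) ^ suc j * G (a ℕ.+ q ℕ.* suc j) k ≈[ e ] (1ℚ - P) * ∑ k (λ i → term a (suc j ℕ.+ i)) + term a (suc j ℕ.+ k)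
    IH = G-gauss e a l k (suc j) (subst (λ i → Div (2 ℕ.+ e) (# (a ℕ.+ q ℕ.* i))) (ℕP.+-suc j k) h)
    err : Div e (- ((- P) ^ j * (N * R b k)))
    err = Div-neg (Div-cancelP 2 (Div-≡ (solve 4 (λ n t x r → n :* (t :* (x :* r)) := t :* (x :* (n :* r))) refl N (P ^ 2) ((- P) ^ j) (R b k))
      (Div-*ʳ (Div-≡ (cong # n≡) h) (Int-R a j k l))))
    eq : - ((- P) ^ j * (N * R b k)) ≡ (- P) ^ j * G b (suc k) - ((1ℚ - P) * term a j + (- P) ^ suc j * G (a ℕ.+ q ℕ.* suc j) k)
    eq = begin
      - (x * (N * R b k))
        ≡⟨ solve 5 (λ x n r pp c → :- (x :* (n :* r)) := x :* ((con 1ℚ :- pp) :* c :- n :* r) :- (con 1ℚ :- pp) :* (x :* c)) refl x N (R b k) P (c b) ⟩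
      x * ((1ℚ - P) * c b - N * R b k) - (1ℚ - P) * (x * c b)
        ≡⟨ cong (λ z → x * z - (1ℚ - P) * (x * c b)) (sym (G-step b k)) ⟩
      x * (G b (suc k) + P * G (b ℕ.+ q) k) - (1ℚ - P) * (x * c b)
        ≡⟨ solve 5 (λ x g p h t → x :* (g :+ p :* h) :- t := x :* g :- (t :+ (:- p) :* x :* h)) refl x (G b (suc k)) P (G (b ℕ.+ q) k) ((1ℚ - P) * (x * c b)) ⟩
      x * G b (suc k) - ((1ℚ - P) * (x * c b) + (- P) * x * G (b ℕ.+ q) k)
        ≡⟨ cong (λ n → x * G b (suc k) - ((1ℚ - P) * (x * c b) + (- P) * x * G n k)) b+q ⟩
      x * G b (suc k) - ((1ℚ - P) * term a j + (- P) ^ suc j * G (a ℕ.+ q ℕ.* suc j) k) ∎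
      where x = (- P) ^ j
    eq₂ : (1ℚ - P) * term a j + ((1ℚ - P) * ∑ k (λ i → term a (suc j ℕ.+ i)) + term a (suc j ℕ.+ k)) ≡ (1ℚ - P) * ∑ (suc k) (λ i → term a (j ℕ.+ i)) + term a (j ℕ.+ suc k)
    eq₂ = trans (cong₂ (λ u v → (1ℚ - P) * term a j + ((1ℚ - P) * u + v)) (∑-ext k (λ i → cong (term a) (sym (ℕP.+-suc j i)))) (cong (term a) (sym (ℕP.+-suc j k))))
      (trans (solve 4 (λ p t s l → p :* t :+ (p :* s :+ l) := p :* (t :+ s) :+ l) refl (1ℚ - P) (term a j) (∑ k (λ i → term a (j ℕ.+ suc i))) (term a (j ℕ.+ suc k)))
        (cong (λ z → (1ℚ - P) * (term a z + ∑ k (λ i → term a (j ℕ.+ suc i))) + term a (j ℕ.+ suc k)) (sym (ℕP.+-identityʳ j))))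

  lam-≥ : ∀ E m → E ℕ.* (p ℕ.* p) ℕ.≤ m → E ℕ.≤ lam m
  lam-≥ E m l = ℕP.≤-trans (ℕP.≤-reflexive (sym (ℕD.m*n/n≡m E (p ℕ.* p)))) (ℕD./-monoˡ-≤ (p ℕ.* p) l)

  ∑-tail : ∀ E (f : Seq) M₀ → (∀ m → M₀ ℕ.≤ m → Div E (f m)) → ∀ M → M₀ ℕ.≤ M → ∑ M f ≈[ E ] ∑ M₀ f
  ∑-tail E f M₀ h M l = subst (λ M → ∑ M f ≈[ E ] ∑ M₀ f) (ℕP.m+[n∸m]≡n l)
    (mk (Div-≡ (trans (solve 2 (λ a b → b := (a :+ b) :- a) refl (∑ M₀ f) (∑ (M ℕ.∸ M₀) (λ i → f (M₀ ℕ.+ i)))) (cong (_- ∑ M₀ f) (sym (∑-split M₀ (M ℕ.∸ M₀) f))))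
      (Div-∑ (M ℕ.∸ M₀) (λ i _ → h (M₀ ℕ.+ i) (ℕP.m≤m+n M₀ i)))))

  gauss-stable : ∀ E a → a ℕ.< q → ∀ M M′ → E ℕ.* (p ℕ.* p) ℕ.≤ M → E ℕ.* (p ℕ.* p) ℕ.≤ M′ → gauss a M ≈[ E ] gauss a M′
  gauss-stable E a l M M′ h h′ = ≈-trans (∑-tail E (term a) _ t M h) (≈-sym (∑-tail E (term a) _ t M′ h′))
    where
    t : ∀ m → E ℕ.* (p ℕ.* p) ℕ.≤ m → Div E (term a m)
    t m l′ = Div-weaken (lam-≥ E m l′) (Div-term a m l)

  -- For k near -a/q the contiguity relations identify (1 - p) times the Gauss sum with `G a k`. In
  -- the closed form of the latter p^k k! cancels against the same factor of (a + pk)!, leaving only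
  -- the product of units and a sign.
  gross-koblitz : ∀ E a → a ℕ.< q → ∀ k → Div (2 ℕ.+ E) (# (a ℕ.+ q ℕ.* k)) → E ℕ.* (p ℕ.* p) ℕ.≤ k → ∀ M → E ℕ.* (p ℕ.* p) ℕ.≤ M →
    (1ℚ - P) * gauss a M * Πu (suc (a ℕ.+ p ℕ.* k)) ≈[ E ] (- 1ℚ) ^ k
  gross-koblitz E a l k h hk M hM = ≈-trans (≈-*ʳ (Unit.int-u (Unit-Πu (suc (a ℕ.+ p ℕ.* k)))) step) (≈-reflexive eq)
    where
    open ≡-Reasoning
    l′ : a ℕ.< p
    l′ = ℕP.m≤n⇒m≤1+n l
    step : (1ℚ - P) * gauss a M ≈[ E ] G a k
    step = ≈-trans (≈-*ˡ (Int-- Int-1 (Int-# p)) (gauss-stable E a l M k hM hk)) (≈-sym (≈-trans (≈-reflexive e₀)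
      (≈-trans (G-gauss E a l k 0 h) (≈-trans (≈-+ (≈-refl {x = (1ℚ - P) * gauss a k}) (Div→≈0 (Div-weaken (lam-≥ E k hk) (Div-term a k l)))) (≈-reflexive (+-identityʳ ((1ℚ - P) * gauss a k)))))))
      where
      e₀ : G a k ≡ (- P) ^ 0 * G (a ℕ.+ q ℕ.* 0) k
      e₀ = trans (cong (λ n → G n k) (trans (sym (ℕP.+-identityʳ a)) (cong (a ℕ.+_) (sym (ℕP.*-zeroʳ q))))) (sym (*-identityˡ (G (a ℕ.+ q ℕ.* 0) k)))
    eq : G a k * Πu (suc (a ℕ.+ p ℕ.* k)) ≡ (- 1ℚ) ^ k
    eq = begin
      G a k * Π                                          ≡⟨ cong (_* Π) (trans (G-ρ a l′ k) (cong (λ z → z * fac k * i) (P^-neg k))) ⟩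
      (- 1ℚ) ^ k * P ^ k * fac k * i * Π                 ≡⟨ solve 5 (λ s x f i u → s :* x :* f :* i :* u := s :* (f :* (x :* i :* u))) refl ((- 1ℚ) ^ k) (P ^ k) (fac k) i Π ⟩
      (- 1ℚ) ^ k * (fac k * (P ^ k * i * Π))             ≡⟨ cong (λ z → (- 1ℚ) ^ k * (fac k * z)) (ifac-split k a l′) ⟩
      (- 1ℚ) ^ k * (fac k * ifac k)                      ≡⟨ cong ((- 1ℚ) ^ k *_) (fac-ifac k) ⟩
      (- 1ℚ) ^ k * 1ℚ                                    ≡⟨ *-identityʳ ((- 1ℚ) ^ k) ⟩
      (- 1ℚ) ^ k                                         ∎
      where
      Π = Πu (suc (a ℕ.+ p ℕ.* k))
      i = ifac (a ℕ.+ p ℕ.* k)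

  -- Traces from ℚ(π), π^(p-1) = -p

  convolution : (ℕ → ℕ → ℚ) → Seq
  convolution K zero    = K 0 0
  convolution K (suc n) = K 0 (suc n) + convolution (λ i j → K (suc i) j) n

  ∑-convolution : ∀ (K : ℕ → ℕ → ℚ) N → ∑ N (convolution K) ≡ ∑ N (λ i → ∑ (N ℕ.∸ i) (K i))
  ∑-convolution K zero    = refl
  ∑-convolution K (suc N) = trans (cong (K 0 0 +_) (trans (∑-+ N (λ n → K 0 (suc n)) (convolution (λ i j → K (suc i) j))) (cong (∑ N (λ n → K 0 (suc n)) +_) (∑-convolution (λ i j → K (suc i) j) N))))
    (sym (+-assoc (K 0 0) (∑ N (λ n → K 0 (suc n))) (∑ N (λ i → ∑ (N ℕ.∸ i) (K (suc i))))))

  ⋆-convolution : ∀ (f g : Seq) (w : ℕ → ℚ) n → w n * (f ⋆ g) n ≡ convolution (λ i j → w (i ℕ.+ j) * (f i * g j)) n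
  ⋆-convolution f g w zero    = refl
  ⋆-convolution f g w (suc n) = trans (*-distribˡ-+ (w (suc n)) (f 0 * g (suc n)) ((tl f ⋆ g) n)) (cong (w (suc n) * (f 0 * g (suc n)) +_) (⋆-convolution (tl f) g (λ m → w (suc m)) n))

  instance
    q-nonZero : NonZero q
    q-nonZero = >-nonZero 0<q

  ∑-block : ∀ d M (g : Seq) → ∑ (M ℕ.* d) g ≡ ∑ M (λ m → ∑ d (λ r → g (r ℕ.+ d ℕ.* m)))
  ∑-block d zero    g = refl
  ∑-block d (suc M) g = trans (∑-split d (M ℕ.* d) g) (cong₂ _+_
    (∑-ext d (λ r → cong g (sym (trans (cong (r ℕ.+_) (ℕP.*-zeroʳ d)) (ℕP.+-identityʳ r)))))
    (trans (∑-block d M (λ i → g (d ℕ.+ i))) (∑-ext M (λ m → ∑-ext d (λ r → cong g (trans (sym (ℕP.+-assoc d r (d ℕ.* m)))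
      (trans (cong (ℕ._+ d ℕ.* m) (ℕP.+-comm d r)) (trans (ℕP.+-assoc r d (d ℕ.* m)) (cong (r ℕ.+_) (sym (ℕP.*-suc d m)))))))))))

  ∑-class : ∀ d M (g : Seq) b → b ℕ.< d → (∀ r → r ℕ.< d → r ≢ b → ∀ m → g (r ℕ.+ d ℕ.* m) ≡ 0ℚ) → ∑ (M ℕ.* d) g ≡ ∑ M (λ m → g (b ℕ.+ d ℕ.* m))
  ∑-class d M g b l h = trans (∑-block d M g) (∑-ext M (λ m → ∑-single d (λ r → g (r ℕ.+ d ℕ.* m)) b l (λ r l′ ne → h r l′ ne m)))

  divMod-q : ∀ m → Σ ℕ λ a → Σ ℕ λ n → a ℕ.< q × m ≡ a ℕ.+ q ℕ.* n
  divMod-q m = m ℕD.% q , m ℕD./ q , ℕD.m%n<n m q , trans (ℕD.m≡m%n+[m/n]*n m q) (cong (m ℕD.% q ℕ.+_) (ℕP.*-comm (m ℕD./ q) q))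

  %q-eq : ∀ a n → a ℕ.< q → (a ℕ.+ q ℕ.* n) ℕD.% q ≡ a
  %q-eq a n l = trans (cong (λ z → (a ℕ.+ z) ℕD.% q) (ℕP.*-comm q n)) (trans (ℕD.[m+kn]%n≡m%n a n q) (ℕD.m<n⇒m%n≡m l))

  /q-eq : ∀ a n → a ℕ.< q → (a ℕ.+ q ℕ.* n) ℕD./ q ≡ n
  /q-eq a n l = ℕP.*-cancelʳ-≡ ((a ℕ.+ q ℕ.* n) ℕD./ q) n q (ℕP.+-cancelˡ-≡ a _ _ (trans
    (trans (cong (ℕ._+ (a ℕ.+ q ℕ.* n) ℕD./ q ℕ.* q) (sym (%q-eq a n l))) (sym (ℕD.m≡m%n+[m/n]*n (a ℕ.+ q ℕ.* n) q))) (cong (a ℕ.+_) (ℕP.*-comm q n))))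

  -- w n is the trace of π^n from ℚ(π) to ℚ divided by q, where π^q = -p.
  w : Seq
  w n = δ₀ (n ℕD.% q) * (- P) ^ (n ℕD./ q)

  w-eq : ∀ r m → r ℕ.< q → w (r ℕ.+ q ℕ.* m) ≡ δ₀ r * (- P) ^ m
  w-eq r m l = cong₂ (λ a b → δ₀ a * (- P) ^ b) (%q-eq r m l) (/q-eq r m l)

  w-shift : ∀ n m → w (n ℕ.+ q ℕ.* m) ≡ w n * (- P) ^ m
  w-shift n m = go n (divMod-q n)
    where
    go : ∀ n → Σ ℕ (λ a → Σ ℕ λ n′ → a ℕ.< q × n ≡ a ℕ.+ q ℕ.* n′) → w (n ℕ.+ q ℕ.* m) ≡ w n * (- P) ^ m
    go _ (r , k , l , refl) = trans (cong w (trans (ℕP.+-assoc r (q ℕ.* k) (q ℕ.* m)) (cong (r ℕ.+_) (sym (ℕP.*-distribˡ-+ q k m)))))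
      (trans (w-eq r (k ℕ.+ m) l) (trans (cong (δ₀ r *_) (^-+ (- P) k m)) (trans (sym (*-assoc (δ₀ r) ((- P) ^ k) ((- P) ^ m))) (cong (_* (- P) ^ m) (sym (w-eq r k l))))))

  χ : ℕ → ℕ → ℚ
  χ a n with n ℕD.% q ℕ.≟ a
  ... | yes _ = 1ℚ
  ... | no  _ = 0ℚ

  χ-yes : ∀ a n → n ℕD.% q ≡ a → χ a n ≡ 1ℚ
  χ-yes a n e with n ℕD.% q ℕ.≟ a
  ... | yes _ = refl
  ... | no ne = ⊥-elim (ne e)

  χ-no : ∀ a n → n ℕD.% q ≢ a → χ a n ≡ 0ℚ
  χ-no a n e with n ℕD.% q ℕ.≟ a
  ... | yes y = ⊥-elim (e y)
  ... | no _  = refl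

  S^w-eq : ∀ a r m → a ℕ.< q → r ℕ.< q → r ≢ a → S^ a w (r ℕ.+ q ℕ.* m) ≡ 0ℚ
  S^w-eq a r m la lr ne = go (ℕP.<-cmp (r ℕ.+ q ℕ.* m) a)
    where
    go : Tri ((r ℕ.+ q ℕ.* m) ℕ.< a) ((r ℕ.+ q ℕ.* m) ≡ a) (a ℕ.< (r ℕ.+ q ℕ.* m)) → S^ a w (r ℕ.+ q ℕ.* m) ≡ 0ℚ
    go (tri< l _ _) = S^-< a w _ l
    go (tri≈ _ e _) = ⊥-elim (ne (trans (sym (%q-eq r m lr)) (trans (cong (ℕD._% q) e) (ℕD.m<n⇒m%n≡m la))))
    go (tri> _ _ g) = h (divMod-q d)
      where
      d = (r ℕ.+ q ℕ.* m) ℕ.∸ a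
      a+d : a ℕ.+ d ≡ r ℕ.+ q ℕ.* m
      a+d = ℕP.m+[n∸m]≡n (ℕP.<⇒≤ g)
      h : Σ ℕ (λ s → Σ ℕ λ k → s ℕ.< q × d ≡ s ℕ.+ q ℕ.* k) → S^ a w (r ℕ.+ q ℕ.* m) ≡ 0ℚ
      h (zero  , k , l , e) = ⊥-elim (ne (trans (sym (%q-eq r m lr)) (trans (cong (ℕD._% q) (trans (sym a+d) (cong (a ℕ.+_) e))) (%q-eq a k la))))
      h (suc s , k , l , e) = trans (cong (S^ a w) (sym a+d)) (trans (S^-+ a w d) (trans (cong w e) (trans (w-eq (suc s) k l) (*-zeroˡ ((- P) ^ k)))))

  S^w-val : ∀ a m → S^ a w (a ℕ.+ q ℕ.* m) ≡ (- P) ^ m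
  S^w-val a m = trans (S^-+ a w (q ℕ.* m)) (trans (w-eq 0 m 0<q) (*-identityˡ ((- P) ^ m)))

  -- π^(n+j) = π^(n+a) π^(j-a), and the second factor is rational once j ≡ a modulo p - 1. A series
  -- restricted to one residue class can therefore be pulled out of the trace.
  w-χ : ∀ a n j → a ℕ.< q → w (n ℕ.+ j) * χ a j ≡ w (n ℕ.+ a) * S^ a w j
  w-χ a n j la = go j (divMod-q j)
    where
    go : ∀ j → Σ ℕ (λ s → Σ ℕ λ k → s ℕ.< q × j ≡ s ℕ.+ q ℕ.* k) → w (n ℕ.+ j) * χ a j ≡ w (n ℕ.+ a) * S^ a w j
    go _ (r , m , l , refl) with r ℕ.≟ a
    ... | yes refl = trans (cong₂ _*_ (trans (cong w (sym (ℕP.+-assoc n r (q ℕ.* m)))) (w-shift (n ℕ.+ r) m)) (χ-yes r (r ℕ.+ q ℕ.* m) (%q-eq r m l)))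
                       (trans (*-identityʳ (w (n ℕ.+ r) * (- P) ^ m)) (cong (w (n ℕ.+ r) *_) (sym (S^w-val r m))))
    ... | no ne = trans (cong (w (n ℕ.+ (r ℕ.+ q ℕ.* m)) *_) (χ-no a (r ℕ.+ q ℕ.* m) (λ e → ne (trans (sym (%q-eq r m l)) e))))
                       (trans (*-zeroʳ (w (n ℕ.+ (r ℕ.+ q ℕ.* m)))) (sym (trans (cong (w (n ℕ.+ a) *_) (S^w-eq a r m la l ne)) (*-zeroʳ (w (n ℕ.+ a))))))

  -- When the restricted factors have been pulled out, the trace itself selects the class of the
  -- remaining one, the class that makes the total exponent divisible by p - 1.
  w-last : ∀ c₀ s e → c₀ ℕ.< q → c₀ ℕ.+ s ≡ q ℕ.* e → ∀ i → w (i ℕ.+ s) ≡ (- P) ^ e * S^ c₀ w i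
  w-last c₀ s e lc h i = go i (divMod-q i)
    where
    go : ∀ i → Σ ℕ (λ r → Σ ℕ λ k → r ℕ.< q × i ≡ r ℕ.+ q ℕ.* k) → w (i ℕ.+ s) ≡ (- P) ^ e * S^ c₀ w i
    go _ (r , m , l , refl) with r ℕ.≟ c₀
    ... | yes refl = trans (cong w (trans (ℕP.+-assoc r (q ℕ.* m) s) (trans (cong (r ℕ.+_) (ℕP.+-comm (q ℕ.* m) s)) (trans (sym (ℕP.+-assoc r s (q ℕ.* m))) (cong (ℕ._+ q ℕ.* m) h)))))
                       (trans (w-shift (q ℕ.* e) m) (cong₂ _*_ (trans (w-eq 0 e 0<q) (*-identityˡ ((- P) ^ e))) (sym (S^w-val r m))))
    ... | no ne = trans zero-w (sym (trans (cong ((- P) ^ e *_) (S^w-eq c₀ r m lc l ne)) (*-zeroʳ ((- P) ^ e))))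
      where
      zero-w : w ((r ℕ.+ q ℕ.* m) ℕ.+ s) ≡ 0ℚ
      zero-w = g (divMod-q ((r ℕ.+ q ℕ.* m) ℕ.+ s))
        where
        g : Σ ℕ (λ u → Σ ℕ λ k → u ℕ.< q × (r ℕ.+ q ℕ.* m) ℕ.+ s ≡ u ℕ.+ q ℕ.* k) → w ((r ℕ.+ q ℕ.* m) ℕ.+ s) ≡ 0ℚ
        g (suc u , k , lu , eu) = trans (cong w eu) (trans (w-eq (suc u) k lu) (*-zeroˡ ((- P) ^ k)))
        g (zero  , k , lu , eu) = ⊥-elim (ne (trans (sym (%q-eq r (m ℕ.+ e) l)) (trans (cong (ℕD._% q) eq) (%q-eq c₀ k lc))))
          where
          eq : r ℕ.+ q ℕ.* (m ℕ.+ e) ≡ c₀ ℕ.+ q ℕ.* k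
          eq = begin
            r ℕ.+ q ℕ.* (m ℕ.+ e)                 ≡⟨ cong (r ℕ.+_) (ℕP.*-distribˡ-+ q m e) ⟩
            r ℕ.+ (q ℕ.* m ℕ.+ q ℕ.* e)           ≡⟨ cong (λ z → r ℕ.+ (q ℕ.* m ℕ.+ z)) (sym h) ⟩
            r ℕ.+ (q ℕ.* m ℕ.+ (c₀ ℕ.+ s))        ≡⟨ NS.solve 4 (λ r x c s → r NS.:+ (x NS.:+ (c NS.:+ s)) NS.:= c NS.:+ ((r NS.:+ x) NS.:+ s)) refl r (q ℕ.* m) c₀ s ⟩
            c₀ ℕ.+ ((r ℕ.+ q ℕ.* m) ℕ.+ s)        ≡⟨ cong (c₀ ℕ.+_) eu ⟩
            c₀ ℕ.+ q ℕ.* k                        ∎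
            where open ≡-Reasoning

  -- Keeps the exponents n ≡ b and weights them by π^(n-b); summed for `c` this is the Gauss sum
  -- without its factor q π^b (`∑-hat`).
  hat : ℕ → Seq → Seq
  hat b f n = S^ b w n * f n

  -- The factor (-p)^e is π^(c₀+a+b), which is Stickelberger's power of p in a product of three
  -- Gauss sums.
  w-triple : ∀ a b c₀ e → a ℕ.< q → b ℕ.< q → c₀ ℕ.< q → c₀ ℕ.+ (a ℕ.+ b) ≡ q ℕ.* e → ∀ (f g h : Seq) n →
    w n * (f ⋆ ((λ j → χ a j * g j) ⋆ (λ l → χ b l * h l))) n ≡ (- P) ^ e * (hat c₀ f ⋆ (hat a g ⋆ hat b h)) n
  w-triple a b c₀ e la lb lc hs f g h n = trans (⋆-weighted f GH (λ i → (- P) ^ e * hat c₀ f i) (hat a g ⋆ hat b h) w n outer) (⋆-*ˡ ((- P) ^ e) (hat c₀ f) (hat a g ⋆ hat b h) n)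
    where
    open ≡-Reasoning
    Gχ Hχ GH : Seq
    Gχ j = χ a j * g j
    Hχ l = χ b l * h l
    GH = Gχ ⋆ Hχ
    inner : ∀ i m → w (i ℕ.+ m) * GH m ≡ w (i ℕ.+ (a ℕ.+ b)) * (hat a g ⋆ hat b h) m
    inner i m = trans (⋆-weighted Gχ Hχ (λ j → w (i ℕ.+ (a ℕ.+ b)) * hat a g j) (hat b h) (λ m → w (i ℕ.+ m)) m k) (⋆-*ˡ (w (i ℕ.+ (a ℕ.+ b))) (hat a g) (hat b h) m)
      where
      k : ∀ j l → j ℕ.+ l ≡ m → w (i ℕ.+ m) * (χ a j * g j * (χ b l * h l)) ≡ w (i ℕ.+ (a ℕ.+ b)) * hat a g j * hat b h l
      k j l refl = begin
        w (i ℕ.+ (j ℕ.+ l)) * (χ a j * g j * (χ b l * h l))   ≡⟨ solve 5 (λ w x g y h → w :* (x :* g :* (y :* h)) := w :* y :* x :* g :* h) refl (w (i ℕ.+ (j ℕ.+ l))) (χ a j) (g j) (χ b l) (h l) ⟩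
        w (i ℕ.+ (j ℕ.+ l)) * χ b l * χ a j * g j * h l       ≡⟨ cong (λ z → z * χ a j * g j * h l) (trans (cong (λ z → w z * χ b l) (sym (ℕP.+-assoc i j l))) (w-χ b (i ℕ.+ j) l lb)) ⟩
        w (i ℕ.+ j ℕ.+ b) * S^ b w l * χ a j * g j * h l      ≡⟨ cong (λ z → w z * S^ b w l * χ a j * g j * h l) (trans (ℕP.+-assoc i j b) (trans (cong (i ℕ.+_) (ℕP.+-comm j b)) (sym (ℕP.+-assoc i b j)))) ⟩
        w (i ℕ.+ b ℕ.+ j) * S^ b w l * χ a j * g j * h l      ≡⟨ solve 5 (λ w s x g h → w :* s :* x :* g :* h := w :* x :* g :* (s :* h)) refl (w (i ℕ.+ b ℕ.+ j)) (S^ b w l) (χ a j) (g j) (h l) ⟩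
        w (i ℕ.+ b ℕ.+ j) * χ a j * g j * hat b h l           ≡⟨ cong (λ z → z * g j * hat b h l) (w-χ a (i ℕ.+ b) j la) ⟩
        w (i ℕ.+ b ℕ.+ a) * S^ a w j * g j * hat b h l        ≡⟨ cong (λ z → w z * S^ a w j * g j * hat b h l) (trans (ℕP.+-assoc i b a) (cong (i ℕ.+_) (ℕP.+-comm b a))) ⟩
        w (i ℕ.+ (a ℕ.+ b)) * S^ a w j * g j * hat b h l      ≡⟨ cong (_* hat b h l) (*-assoc (w (i ℕ.+ (a ℕ.+ b))) (S^ a w j) (g j)) ⟩
        w (i ℕ.+ (a ℕ.+ b)) * hat a g j * hat b h l           ∎
    outer : ∀ i m → i ℕ.+ m ≡ n → w n * (f i * GH m) ≡ (- P) ^ e * hat c₀ f i * (hat a g ⋆ hat b h) m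
    outer i m refl = begin
      w (i ℕ.+ m) * (f i * GH m)                                      ≡⟨ solve 3 (λ w f g → w :* (f :* g) := f :* (w :* g)) refl (w (i ℕ.+ m)) (f i) (GH m) ⟩
      f i * (w (i ℕ.+ m) * GH m)                                      ≡⟨ cong (f i *_) (inner i m) ⟩
      f i * (w (i ℕ.+ (a ℕ.+ b)) * (hat a g ⋆ hat b h) m)             ≡⟨ cong (λ z → f i * (z * (hat a g ⋆ hat b h) m)) (w-last c₀ (a ℕ.+ b) e lc hs i) ⟩
      f i * ((- P) ^ e * S^ c₀ w i * (hat a g ⋆ hat b h) m)           ≡⟨ solve 4 (λ f p s g → f :* (p :* s :* g) := p :* (s :* f) :* g) refl (f i) ((- P) ^ e) (S^ c₀ w i) ((hat a g ⋆ hat b h) m) ⟩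
      (- P) ^ e * hat c₀ f i * (hat a g ⋆ hat b h) m                  ∎

  lamq : ℕ → ℕ
  lamq n = lam (n ℕD./ q)

  Div-hat : ∀ b → b ℕ.< q → ∀ n → Div (lamq n) (hat b c n)
  Div-hat b lb n = go n (divMod-q n)
    where
    go : ∀ n → Σ ℕ (λ r → Σ ℕ λ k → r ℕ.< q × n ≡ r ℕ.+ q ℕ.* k) → Div (lamq n) (hat b c n)
    go _ (r , m , l , refl) with r ℕ.≟ b
    ... | yes refl = subst (λ e → Div (lam e) (hat r c (r ℕ.+ q ℕ.* m))) (sym (/q-eq r m l)) (Div-≡ (cong (_* c (r ℕ.+ q ℕ.* m)) (sym (S^w-val r m))) (Div-term r m lb))
    ... | no ne = Div-≡ (sym (trans (cong (_* c (r ℕ.+ q ℕ.* m)) (S^w-eq b r m lb l ne)) (*-zeroˡ (c (r ℕ.+ q ℕ.* m))))) (Div-0 _)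

  ∑-hat : ∀ b → b ℕ.< q → ∀ M → ∑ (M ℕ.* q) (hat b c) ≡ gauss b M
  ∑-hat b lb M = trans (∑-class q M (hat b c) b lb (λ r l ne m → trans (cong (_* c (r ℕ.+ q ℕ.* m)) (S^w-eq b r m lb l ne)) (*-zeroˡ (c (r ℕ.+ q ℕ.* m)))))
    (∑-ext M (λ m → cong (_* c (b ℕ.+ q ℕ.* m)) (S^w-val b m)))

  quot-+ : ∀ i j d .{{_ : NonZero d}} → (i ℕ.+ j) ℕD./ d ℕ.≤ suc (i ℕD./ d ℕ.+ j ℕD./ d)
  quot-+ i j d = ℕP.≤-pred (ℕD.m<n*o⇒m/o<n (begin-strict
    i ℕ.+ j                                        ≡⟨ cong₂ ℕ._+_ (ℕD.m≡m%n+[m/n]*n i d) (ℕD.m≡m%n+[m/n]*n j d) ⟩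
    (i ℕD.% d ℕ.+ i ℕD./ d ℕ.* d) ℕ.+ (j ℕD.% d ℕ.+ j ℕD./ d ℕ.* d)
      <⟨ ℕP.+-mono-< (ℕP.+-monoˡ-< (i ℕD./ d ℕ.* d) (ℕD.m%n<n i d)) (ℕP.+-monoˡ-< (j ℕD./ d ℕ.* d) (ℕD.m%n<n j d)) ⟩
    (d ℕ.+ i ℕD./ d ℕ.* d) ℕ.+ (d ℕ.+ j ℕD./ d ℕ.* d)
      ≡⟨ NS.solve 3 (λ d x y → (d NS.:+ x NS.:* d) NS.:+ (d NS.:+ y NS.:* d) NS.:= (NS.con 2 NS.:+ (x NS.:+ y)) NS.:* d) refl d (i ℕD./ d) (j ℕD./ d) ⟩
    suc (suc (i ℕD./ d ℕ.+ j ℕD./ d)) ℕ.* d        ∎))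
    where open ℕP.≤-Reasoning

  lamq-+ : ∀ i j → lamq (i ℕ.+ j) ℕ.≤ 2 ℕ.+ (lamq i ℕ.+ lamq j)
  lamq-+ i j = ℕP.≤-trans (ℕD./-monoˡ-≤ (p ℕ.* p) (quot-+ i j q)) (ℕP.≤-trans (quot-+ 1 (i ℕD./ q ℕ.+ j ℕD./ q) (p ℕ.* p))
    (s≤s (ℕP.≤-trans (ℕP.≤-reflexive (cong (ℕ._+ lam (i ℕD./ q ℕ.+ j ℕD./ q)) z)) (quot-+ (i ℕD./ q) (j ℕD./ q) (p ℕ.* p)))))
    where
    z : 1 ℕD./ (p ℕ.* p) ≡ 0
    z = ℕD.m<n⇒m/n≡0 (ℕP.≤-trans (ℕP.≤-trans (s≤s (s≤s z≤n)) (s≤s q>2)) (ℕP.m≤m*n p p))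

  -- Null sequences with the rate of the Gauss sums, up to a loss k. A Cauchy product loses two
  -- more, one for each of the two nested floors in `lamq`, which are additive only up to one.
  Cls : ℕ → Seq → Set
  Cls k f = ∀ n → Div (lamq n ℕ.∸ k) (f n)

  Div-⋆ : ∀ e (f g : Seq) n → (∀ i j → i ℕ.+ j ≡ n → Div e (f i * g j)) → Div e ((f ⋆ g) n)
  Div-⋆ e f g zero    h = h 0 0 refl
  Div-⋆ e f g (suc n) h = Div-+ (h 0 (suc n) refl) (Div-⋆ e (tl f) g n (λ i j eq → h (suc i) j (cong suc eq)))

  Cls-term : ∀ k l f g → Cls k f → Cls l g → ∀ i j → Div (lamq (i ℕ.+ j) ℕ.∸ (2 ℕ.+ k ℕ.+ l)) (f i * g j)
  Cls-term k l f g hf hg i j = Div-weaken le (Div-* (hf i) (hg j))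
    where
    le : lamq (i ℕ.+ j) ℕ.∸ (2 ℕ.+ k ℕ.+ l) ℕ.≤ (lamq i ℕ.∸ k) ℕ.+ (lamq j ℕ.∸ l)
    le = ℕP.m≤n+o⇒m∸n≤o _ (2 ℕ.+ k ℕ.+ l) (ℕP.≤-trans (lamq-+ i j) (ℕP.≤-trans (s≤s (s≤s (ℕP.+-mono-≤ (ℕP.m≤n+m∸n (lamq i) k) (ℕP.m≤n+m∸n (lamq j) l))))
      (ℕP.≤-reflexive (NS.solve 4 (λ k l x y → NS.con 2 NS.:+ ((k NS.:+ x) NS.:+ (l NS.:+ y)) NS.:= (NS.con 2 NS.:+ k NS.:+ l) NS.:+ (x NS.:+ y)) refl k l (lamq i ℕ.∸ k) (lamq j ℕ.∸ l)))))

  Cls-⋆ : ∀ k l f g → Cls k f → Cls l g → Cls (2 ℕ.+ k ℕ.+ l) (f ⋆ g)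
  Cls-⋆ k l f g hf hg n = Div-⋆ _ f g n (λ { i j refl → Cls-term k l f g hf hg i j })

  -- The pairs i, j below N with i + j ≥ N, by which square and triangle differ, all contribute
  -- multiples of p^E.
  ∑-⋆-≈ : ∀ E k l f g N → Cls k f → Cls l g → (∀ n → N ℕ.≤ n → E ℕ.≤ lamq n ℕ.∸ (2 ℕ.+ k ℕ.+ l)) → ∑ N (f ⋆ g) ≈[ E ] ∑ N f * ∑ N g
  ∑-⋆-≈ E k l f g N hf hg hN = ≈-trans (≈-reflexive (∑-⋆ f g N)) (≈-trans (≈-∑ N t) (≈-reflexive (∑-*ʳ N f (∑ N g))))
    where
    t : ∀ i → i ℕ.< N → f i * ∑ (N ℕ.∸ i) g ≈[ E ] f i * ∑ N g
    t i il = ≈-sym (≈-trans (≈-reflexive (sym (∑-*ˡ N (f i) g))) (≈-trans (∑-tail E (λ j → f i * g j) (N ℕ.∸ i) (λ j lj → Div-weaken (hN (i ℕ.+ j) (ℕP.≤-trans (ℕP.m≤n+m∸n N i) (ℕP.+-monoʳ-≤ i lj))) (Cls-term k l f g hf hg i j)) N (ℕP.m∸n≤m N i))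
      (≈-reflexive (∑-*ˡ (N ℕ.∸ i) (f i) g))))

  lamq-≥ : ∀ k E M → (k ℕ.+ E) ℕ.* (p ℕ.* p) ℕ.≤ M → ∀ n → M ℕ.* q ℕ.≤ n → E ℕ.≤ lamq n ℕ.∸ k
  lamq-≥ k E M hM n l = ℕP.m+n≤o⇒m≤o∸n E (subst (ℕ._≤ lamq n) (ℕP.+-comm k E) (lam-≥ (k ℕ.+ E) (n ℕD./ q) (ℕP.≤-trans hM (ℕP.≤-trans (ℕP.≤-reflexive (sym (ℕD.m*n/n≡m M q))) (ℕD./-monoˡ-≤ q l)))))

  gauss-Int : ∀ a → a ℕ.< q → ∀ M → Int (gauss a M)
  gauss-Int a l M = Int-∑ M (λ m → Div→Int (Div-term a m l))

  trace : ℕ → Seq → ℚ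
  trace M f = ∑ (M ℕ.* q) (λ n → w n * f n)

  trace-triple : ∀ E M a b c₀ e → a ℕ.< q → b ℕ.< q → c₀ ℕ.< q → c₀ ℕ.+ (a ℕ.+ b) ≡ q ℕ.* e → (4 ℕ.+ E) ℕ.* (p ℕ.* p) ℕ.≤ M →
    trace M (c ⋆ ((λ j → χ a j * c j) ⋆ (λ l → χ b l * c l))) ≈[ E ] (- P) ^ e * (gauss c₀ M * (gauss a M * gauss b M))
  trace-triple E M a b c₀ e la lb lc hs hM = ≈-trans (≈-reflexive (trans (∑-ext (M ℕ.* q) (w-triple a b c₀ e la lb lc hs c c c)) (∑-*ˡ (M ℕ.* q) ((- P) ^ e) (hat c₀ c ⋆ (hat a c ⋆ hat b c)))))
    (≈-*ˡ (Int-^ e (Int-neg (Int-# p))) (≈-trans (∑-⋆-≈ E 0 2 (hat c₀ c) (hat a c ⋆ hat b c) (M ℕ.* q) (Div-hat c₀ lc) (Cls-⋆ 0 0 (hat a c) (hat b c) (Div-hat a la) (Div-hat b lb)) (lamq-≥ 4 E M hM))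
      (≈-trans (≈-*ˡ (Int-≡ (sym (∑-hat c₀ lc M)) (gauss-Int c₀ lc M)) (∑-⋆-≈ E 0 0 (hat a c) (hat b c) (M ℕ.* q) (Div-hat a la) (Div-hat b lb) (lamq-≥ 2 E M (ℕP.≤-trans (ℕP.*-monoˡ-≤ (p ℕ.* p) (s≤s (s≤s (ℕP.m≤n+m E 2)))) hM))))
        (≈-reflexive (cong₂ _*_ (∑-hat c₀ lc M) (cong₂ _*_ (∑-hat a la M) (∑-hat b lb M)))))))

  -- Invariance of the trace

  Lat : Seq → Set
  Lat f = ∀ n → Int (P ^ slope n * f n)

  Int-w : ∀ n → Int (w n)
  Int-w n = Int-* (Int-δ₀ (n ℕD.% q)) (Int-^ (n ℕD./ q) (Int-neg (Int-# p)))

  Int-⋆′ : ∀ t (f g : Seq) n → (∀ i j → i ℕ.+ j ≡ n → Int (t * (f i * g j))) → Int (t * (f ⋆ g) n)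
  Int-⋆′ t f g zero    h = h 0 0 refl
  Int-⋆′ t f g (suc n) h = Int-≡ (sym (*-distribˡ-+ t (f 0 * g (suc n)) ((tl f ⋆ g) n))) (Int-+ (h 0 (suc n) refl) (Int-⋆′ t (tl f) g n (λ i j e → h (suc i) j (cong suc e))))

  Lat-⋆ : ∀ f g → Lat f → (∀ n → Int (g n)) → Lat (f ⋆ g)
  Lat-⋆ f g hf hg n = Int-⋆′ (P ^ slope n) f g n (λ { i j refl → Int-≡ (*-assoc (P ^ slope (i ℕ.+ j)) (f i) (g j)) (Int-* (Int-P^≤ (slope-mono (ℕP.m≤m+n i j)) (hf i)) (hg j)) })

  ⋆-one : ∀ f n → (f ⋆ δ₀) n ≡ f n
  ⋆-one f n = trans (⋆-comm f δ₀ n) (h n)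
    where
    h : ∀ n → (δ₀ ⋆ f) n ≡ f n
    h zero    = *-identityˡ (f 0)
    h (suc n) = trans (cong (1ℚ * f (suc n) +_) (⋆-zeroˡ f n)) (trans (+-identityʳ (1ℚ * f (suc n))) (*-identityˡ (f (suc n))))

  X-small : ∀ L δ → Div (suc L) δ → ∀ i → Div L (X δ 0ℚ (suc i))
  X-small L δ (div d id e) i = Div-≡ (begin
    P ^ L * (d * (P ^ L * d) ^ i) * (P ^ suc i * ifac (suc i))   ≡⟨ solve 5 (λ a b c d e → a :* (b :* c) :* (d :* e) := d :* (a :* b :* c) :* e) refl (P ^ L) d ((P ^ L * d) ^ i) (P ^ suc i) (ifac (suc i)) ⟩
    P ^ suc i * (P ^ L * d) ^ suc i * ifac (suc i)               ≡⟨ cong (_* ifac (suc i)) (sym (*-^ P (P ^ L * d) (suc i))) ⟩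
    (P * (P ^ L * d)) ^ suc i * ifac (suc i)                     ≡⟨ cong (λ z → z ^ suc i * ifac (suc i)) (trans (sym (*-assoc P (P ^ L) d)) (sym e)) ⟩
    δ ^ suc i * ifac (suc i)                                     ≡⟨ sym (X-a0 δ (suc i)) ⟩
    X δ 0ℚ (suc i)                                               ∎)
    (Div-*ʳ (Div-P^ L (Int-* id (Int-^ i (Int-* (Int-^ L (Int-# p)) id)))) (Int-P^ifac (suc i)))
    where open ≡-Reasoning

  -- Multiplication by exp (δ y) changes nothing modulo p^E when δ outweighs p^s, the largest
  -- denominator that f has up to the index n. The extra factor p in δ pays for the factorials.
  ⋆-small : ∀ E s f δ → Lat f → Div (suc (s ℕ.+ E)) δ → ∀ n → slope n ℕ.≤ s → (f ⋆ X δ 0ℚ) n ≈[ E ] f n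
  ⋆-small E s f δ hf hδ n hn = mk (Div-≡ eq (Div-cancelP s {E} (Div-≡ (⋆-*ˡ (P ^ s) f g n) (Div-⋆ (s ℕ.+ E) (λ i → P ^ s * f i) g n t))))
    where
    g : Seq
    g zero    = 0ℚ
    g (suc i) = X δ 0ℚ (suc i)
    gD : ∀ j → Div (s ℕ.+ E) (g j)
    gD zero    = Div-0 (s ℕ.+ E)
    gD (suc i) = X-small (s ℕ.+ E) δ hδ i
    t : ∀ i j → i ℕ.+ j ≡ n → Div (s ℕ.+ E) (P ^ s * f i * g j)
    t i j refl = Div-*ˡ (Int-P^≤ (ℕP.≤-trans (slope-mono (ℕP.m≤m+n i j)) hn) (hf i)) (gD j)
    split : ∀ i → X δ 0ℚ i ≡ δ₀ i + g i
    split zero    = refl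
    split (suc i) = sym (+-identityˡ (X δ 0ℚ (suc i)))
    eq : (f ⋆ g) n ≡ (f ⋆ X δ 0ℚ) n - f n
    eq = sym (trans (cong (_- f n) (trans (⋆-ext {f} {f} (λ _ → refl) split n) (trans (⋆-+ʳ f δ₀ g n) (cong (_+ (f ⋆ g) n) (⋆-one f n)))))
      (solve 2 (λ a b → (a :+ b) :- a := b) refl (f n) ((f ⋆ g) n)))

  -- Again p² - 1 < p²: the power of p supplied by the trace weight at n = i + pm exceeds the
  -- denominators of f(i) and of 1/m! together, with E to spare.
  weight-bound : ∀ E n i m → n ≡ i ℕ.+ p ℕ.* m → suc E ℕ.* (p ℕ.* p) ℕ.≤ n ℕD./ q → (slope i ℕ.+ m) ℕ.+ E ℕ.≤ n ℕD./ q
  weight-bound E n i m e hu = ℕP.*-cancelʳ-≤ ((slope i ℕ.+ m) ℕ.+ E) u (p ℕ.* p) (ℕP.+-cancelʳ-≤ (p ℕ.* p) _ _ (begin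
    ((slope i ℕ.+ m) ℕ.+ E) ℕ.* (p ℕ.* p) ℕ.+ p ℕ.* p
      ≡⟨ NS.solve 4 (λ s m e x → ((s NS.:+ m) NS.:+ e) NS.:* x NS.:+ x NS.:= (s NS.:* x NS.:+ m NS.:* x) NS.:+ (NS.con 1 NS.:+ e) NS.:* x) refl (slope i) m E (p ℕ.* p) ⟩
    (slope i ℕ.* (p ℕ.* p) ℕ.+ m ℕ.* (p ℕ.* p)) ℕ.+ suc E ℕ.* (p ℕ.* p)
      ≤⟨ ℕP.+-mono-≤ (ℕP.+-mono-≤ (slope-bound i) mb) hu ⟩
    (i ℕ.* suc p ℕ.+ (p ℕ.* m) ℕ.* suc p) ℕ.+ u        ≡⟨ cong (ℕ._+ u) (trans (sym (ℕP.*-distribʳ-+ (suc p) i (p ℕ.* m))) (cong (ℕ._* suc p) (sym e))) ⟩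
    n ℕ.* suc p ℕ.+ u                                  ≤⟨ ℕP.+-mono-≤ (ℕP.*-monoˡ-≤ (suc p) (ℕP.<⇒≤ n<)) (ℕP.n≤1+n u) ⟩
    suc u ℕ.* q ℕ.* suc p ℕ.+ suc u                    ≡⟨ NS.solve 2 (λ u q → (NS.con 1 NS.:+ u) NS.:* q NS.:* (NS.con 2 NS.:+ q) NS.:+ (NS.con 1 NS.:+ u) NS.:= u NS.:* ((NS.con 1 NS.:+ q) NS.:* (NS.con 1 NS.:+ q)) NS.:+ (NS.con 1 NS.:+ q) NS.:* (NS.con 1 NS.:+ q)) refl u q ⟩
    u ℕ.* (p ℕ.* p) ℕ.+ p ℕ.* p                        ∎))
    where
    open ℕP.≤-Reasoning
    u = n ℕD./ q
    n< : n ℕ.< suc u ℕ.* q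
    n< = subst (ℕ._< suc u ℕ.* q) (sym (ℕD.m≡m%n+[m/n]*n n q)) (ℕP.+-monoˡ-< (u ℕ.* q) (ℕD.m%n<n n q))
    mb : m ℕ.* (p ℕ.* p) ℕ.≤ (p ℕ.* m) ℕ.* suc p
    mb = ℕP.≤-trans (ℕP.≤-reflexive (trans (sym (ℕP.*-assoc m p p)) (cong (ℕ._* p) (ℕP.*-comm m p)))) (ℕP.*-monoʳ-≤ (p ℕ.* m) (ℕP.n≤1+n p))

  -- π^p = -p π, so y^p and -p y have the same trace against anything.
  trace-swap : ∀ E M f β′ → Lat f → Int β′ → suc E ℕ.* (p ℕ.* p) ℕ.≤ M → trace M (f ⋆ X 0ℚ (P * β′)) ≈[ E ] trace M (f ⋆ X (- (P * β′)) 0ℚ)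
  trace-swap E M f β′ hf iβ hM = ≈-trans (≈-reflexive (expand g)) (≈-trans (≈-∑ N row) (≈-reflexive (sym (expand g′))))
    where
    open ≡-Reasoning
    N = M ℕ.* q
    β = P * β′
    g g′ : Seq
    g  = X 0ℚ β
    g′ = X (- β) 0ℚ
    K : Seq → ℕ → ℕ → ℚ
    K h i j = w (i ℕ.+ j) * (f i * h j)
    expand : ∀ h → trace M (f ⋆ h) ≡ ∑ N (λ i → ∑ (N ℕ.∸ i) (K h i))
    expand h = trans (∑-ext N (⋆-convolution f h w)) (∑-convolution (K h) N)
    βv : β * iv p ≡ β′
    βv = trans (solve 3 (λ P b v → P :* b :* v := v :* P :* b) refl P β′ (iv p)) (trans (cong (_* β′) (iv-inv q)) (*-identityˡ β′))
    Kz : ∀ i r → r ℕ.< p → r ≢ 0 → ∀ m → K g i (r ℕ.+ p ℕ.* m) ≡ 0ℚ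
    Kz i zero    l ne m = ⊥-elim (ne refl)
    Kz i (suc r) (s≤s l) ne m = trans (cong (λ z → w (i ℕ.+ (suc r ℕ.+ p ℕ.* m)) * (f i * z)) (X-0b-none β r l m))
      (solve 2 (λ w f → w :* (f :* con 0ℚ) := con 0ℚ) refl (w (i ℕ.+ (suc r ℕ.+ p ℕ.* m))) (f i))
    same : ∀ i m → K g i (p ℕ.* m) ≡ K g′ i m
    same i m = begin
      w (i ℕ.+ p ℕ.* m) * (f i * g (p ℕ.* m))
        ≡⟨ cong₂ (λ u v → u * (f i * v)) (trans (cong w (sym (ℕP.+-assoc i m (q ℕ.* m)))) (w-shift (i ℕ.+ m) m)) (trans (X-0b β m) (cong (λ z → z ^ m * ifac m) βv)) ⟩
      w (i ℕ.+ m) * (- P) ^ m * (f i * (β′ ^ m * ifac m))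
        ≡⟨ solve 5 (λ w x f b i → w :* x :* (f :* (b :* i)) := w :* (f :* (x :* b :* i))) refl (w (i ℕ.+ m)) ((- P) ^ m) (f i) (β′ ^ m) (ifac m) ⟩
      w (i ℕ.+ m) * (f i * ((- P) ^ m * β′ ^ m * ifac m))
        ≡⟨ cong (λ z → w (i ℕ.+ m) * (f i * (z * ifac m))) (trans (sym (*-^ (- P) β′ m)) (cong (_^ m) (solve 2 (λ P b → (:- P) :* b := :- (P :* b)) refl P β′))) ⟩
      w (i ℕ.+ m) * (f i * ((- β) ^ m * ifac m))
        ≡⟨ cong (λ z → w (i ℕ.+ m) * (f i * z)) (sym (X-a0 (- β) m)) ⟩
      K g′ i m ∎
    far : ∀ i j → N ℕ.≤ i ℕ.+ j → Div E (K g i j)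
    far i j l = go j (divMod-p j) l
      where
      go : ∀ j → Σ ℕ (λ a → Σ ℕ λ n → a ℕ.< p × j ≡ a ℕ.+ p ℕ.* n) → N ℕ.≤ i ℕ.+ j → Div E (K g i j)
      go _ (suc a , m , la , refl) l = Div-≡ (sym (Kz i (suc a) la (λ ()) m)) (Div-0 E)
      go _ (zero  , m , la , refl) l = Div-≡ eq (Div-P^ E (Int-* (Int-* (Int-δ₀ (n ℕD.% q)) (Int-±1^ u)) (Int-* (Int-^ m iβ) (Int-P^≤ v≤ both))))
        where
        n = i ℕ.+ p ℕ.* m
        u = n ℕD./ q
        hu : suc E ℕ.* (p ℕ.* p) ℕ.≤ u
        hu = ℕP.≤-trans hM (ℕP.≤-trans (ℕP.≤-reflexive (sym (ℕD.m*n/n≡m M q))) (ℕD./-monoˡ-≤ q l))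
        wb : (slope i ℕ.+ m) ℕ.+ E ℕ.≤ u
        wb = weight-bound E n i m refl hu
        v≤ : slope i ℕ.+ m ℕ.≤ u ℕ.∸ E
        v≤ = ℕP.m+n≤o⇒m≤o∸n (slope i ℕ.+ m) wb
        both : Int (P ^ (slope i ℕ.+ m) * (f i * ifac m))
        both = Int-≡ (trans (solve 4 (λ a b c d → (a :* b) :* (c :* d) := (a :* c) :* (b :* d)) refl (P ^ slope i) (f i) (P ^ m) (ifac m)) (cong (_* (f i * ifac m)) (sym (^-+ P (slope i) m))))
          (Int-* (hf i) (Int-P^ifac m))
        eq : P ^ E * (δ₀ (n ℕD.% q) * (- 1ℚ) ^ u * (β′ ^ m * (P ^ (u ℕ.∸ E) * (f i * ifac m)))) ≡ K g i (p ℕ.* m)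
        eq = begin
          P ^ E * (δ₀ (n ℕD.% q) * (- 1ℚ) ^ u * (β′ ^ m * (P ^ (u ℕ.∸ E) * (f i * ifac m))))
            ≡⟨ solve 7 (λ e d s b v f i → e :* (d :* s :* (b :* (v :* (f :* i)))) := d :* (s :* (e :* v)) :* (f :* (b :* i))) refl (P ^ E) (δ₀ (n ℕD.% q)) ((- 1ℚ) ^ u) (β′ ^ m) (P ^ (u ℕ.∸ E)) (f i) (ifac m) ⟩
          δ₀ (n ℕD.% q) * ((- 1ℚ) ^ u * (P ^ E * P ^ (u ℕ.∸ E))) * (f i * (β′ ^ m * ifac m))
            ≡⟨ cong₂ (λ x y → δ₀ (n ℕD.% q) * x * (f i * y)) (trans (cong ((- 1ℚ) ^ u *_) (trans (sym (^-+ P E (u ℕ.∸ E))) (cong (P ^_) (ℕP.m+[n∸m]≡n (ℕP.≤-trans (ℕP.m≤n+m E (slope i ℕ.+ m)) wb))))) (sym (P^-neg u)))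
                 (sym (trans (X-0b β m) (cong (λ z → z ^ m * ifac m) βv))) ⟩
          K g i (p ℕ.* m) ∎
    -- Cutting off at N does not respect the exchange of index pm with index m. The sum over
    -- multiples of p is first prolonged to (N - i) p terms, at a cost bounded by `far`, and then
    -- matched term by term.
    row : ∀ i → i ℕ.< N → ∑ (N ℕ.∸ i) (K g i) ≈[ E ] ∑ (N ℕ.∸ i) (K g′ i)
    row i il = ≈-trans (≈-sym (∑-tail E (K g i) T (λ j lj → far i j (ℕP.≤-trans (ℕP.m≤n+m∸n N i) (ℕP.+-monoʳ-≤ i lj))) (T ℕ.* p) (ℕP.m≤m*n T p)))
      (≈-reflexive (trans (∑-class p T (K g i) 0 (s≤s z≤n) (Kz i)) (∑-ext T (same i))))
      where T = N ℕ.∸ i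

  trace-ext : ∀ M {f g : Seq} → (∀ n → f n ≡ g n) → trace M f ≡ trace M g
  trace-ext M h = ∑-ext (M ℕ.* q) (λ n → cong (w n *_) (h n))

  -- At y = π the additional exponent pα′ y + β′ y^p equals pπ (α′ - β′), because π^p = -pπ. It is
  -- negligible when α′ and β′ are close, so the trace sees a and b only modulo such changes.
  trace-inv : ∀ E M a b α′ β′ → Lat (X a b) → Int α′ → Int β′ → Div (suc (slope (M ℕ.* q) ℕ.+ E)) (P * α′ - P * β′) → suc E ℕ.* (p ℕ.* p) ℕ.≤ M →
    trace M (X (a + P * α′) (b + P * β′)) ≈[ E ] trace M (X a b)
  trace-inv E M a b α′ β′ hf iα iβ hδ hM = ≈-trans (≈-reflexive (trace-ext M (X-⋆′ (a + P * α′) b 0ℚ (P * β′) (sym (+-identityʳ (a + P * α′))) refl)))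
    (≈-trans (trace-swap E M (X (a + P * α′) b) β′ lat₁ iβ hM)
    (≈-trans (≈-reflexive (trace-ext M (λ n → trans (X-⋆ (a + P * α′) b (- (P * β′)) 0ℚ n) (X-⋆′ a b (P * α′ - P * β′) 0ℚ (+-assoc a (P * α′) (- (P * β′))) refl n))))
      (≈-∑ (M ℕ.* q) (λ n l → ≈-*ˡ (Int-w n) (⋆-small E (slope (M ℕ.* q)) (X a b) (P * α′ - P * β′) hf hδ n (slope-mono (ℕP.<⇒≤ l)))))))
    where
    lat₁ : Lat (X (a + P * α′) b)
    lat₁ n = Int-≡ (cong (P ^ slope n *_) (sym (X-⋆′ a b (P * α′) 0ℚ refl (sym (+-identityʳ b)) n))) (Lat-⋆ (X a b) (X (P * α′) 0ℚ) hf
      (λ i → Int-≡ (trans (trans (solve 3 (λ a p f → a :* (p :* f) := p :* a :* f) refl (α′ ^ i) (P ^ i) (ifac i)) (cong (_* ifac i) (sym (*-^ P α′ i)))) (sym (X-a0 (P * α′) i))) (Int-* (Int-^ i iα) (Int-P^ifac i))) n)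

  Lat-X00 : Lat (X 0ℚ 0ℚ)
  Lat-X00 zero    = Int-* (Int-^ (slope 0) (Int-# p)) Int-1
  Lat-X00 (suc n) = Int-≡ (sym (trans (cong (P ^ slope (suc n) *_) (trans (X-a0 0ℚ (suc n)) (trans (cong (_* ifac (suc n)) (0^ n)) (*-zeroˡ (ifac (suc n)))))) (*-zeroʳ (P ^ slope (suc n))))) Int-0

  trace-X00 : ∀ M → 0 ℕ.< M → trace M (X 0ℚ 0ℚ) ≡ 1ℚ
  trace-X00 M l = trans (∑-single (M ℕ.* q) (λ n → w n * X 0ℚ 0ℚ n) 0 (ℕP.*-mono-< l 0<q) h)
    (trans (*-identityʳ (w 0)) (trans (cong w (sym (ℕP.*-zeroʳ q))) (trans (w-eq 0 0 0<q) refl)))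
    where
    h : ∀ i → i ℕ.< M ℕ.* q → i ≢ 0 → w i * X 0ℚ 0ℚ i ≡ 0ℚ
    h zero    l ne = ⊥-elim (ne refl)
    h (suc i) l ne = trans (cong (w (suc i) *_) (trans (X-a0 0ℚ (suc i)) (trans (cong (_* ifac (suc i)) (0^ i)) (*-zeroˡ (ifac (suc i)))))) (*-zeroʳ (w (suc i)))

  X-τ : ∀ τ n → X τ (τ ^ p) n ≡ τ ^ n * c n
  X-τ τ n = trans (cong₂ (λ a b → X a b n) (sym (*-identityʳ τ)) (sym (*-identityʳ (τ ^ p)))) (X-twist τ 1ℚ 1ℚ n)

  Lat-τ : ∀ τ → Int τ → Lat (X τ (τ ^ p))
  Lat-τ τ iτ n = Int-≡ (trans (solve 3 (λ a b c → a :* (b :* c) := b :* (a :* c)) refl (τ ^ n) (P ^ slope n) (c n)) (cong (P ^ slope n *_) (sym (X-τ τ n)))) (Int-* (Int-^ n iτ) (Int-c n))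

  -- Only exponents divisible by p - 1 survive the trace, and there the powers of τ are 1: the Dwork
  -- series at all Teichmüller units have the same trace.
  trace-τ : ∀ E M τ → Int τ → τ ^ q ≈[ E ] 1ℚ → trace M (X τ (τ ^ p)) ≈[ E ] gauss 0 M
  trace-τ E M τ iτ h = ≈-trans (≈-reflexive (∑-class q M (λ n → w n * X τ (τ ^ p) n) 0 0<q z)) (≈-∑ M (λ m _ → t m))
    where
    z : ∀ r → r ℕ.< q → r ≢ 0 → ∀ m → w (r ℕ.+ q ℕ.* m) * X τ (τ ^ p) (r ℕ.+ q ℕ.* m) ≡ 0ℚ
    z zero    l ne m = ⊥-elim (ne refl)
    z (suc r) l ne m = trans (cong (_* X τ (τ ^ p) (suc r ℕ.+ q ℕ.* m)) (trans (w-eq (suc r) m l) (*-zeroˡ ((- P) ^ m)))) (*-zeroˡ (X τ (τ ^ p) (suc r ℕ.+ q ℕ.* m)))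
    t : ∀ m → w (q ℕ.* m) * X τ (τ ^ p) (q ℕ.* m) ≈[ E ] term 0 m
    t m = ≈-trans (≈-reflexive (trans (cong₂ _*_ (trans (w-eq 0 m 0<q) (*-identityˡ ((- P) ^ m))) (trans (X-τ τ (q ℕ.* m)) (cong (_* c (q ℕ.* m)) (^-* τ q m))))
      (solve 3 (λ a b c → a :* (b :* c) := (a :* c) :* b) refl ((- P) ^ m) ((τ ^ q) ^ m) (c (q ℕ.* m)))))
      (≈-trans (≈-*ˡ (Div→Int (Div-term 0 m 0<q)) (≈-trans (≈-^ m (Int-^ q iτ) Int-1 h) (≈-reflexive (1^ m)))) (≈-reflexive (*-identityʳ (term 0 m))))

  -- Wilson’s theorem and the p-adic gamma function

  -- x^p - y^p = (x - y) · `gs p`, and the second factor is congruent to p y^(p-1), hence to 0,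
  -- modulo p.
  ≈-lift : ∀ {K x y} → Int x → Int y → x ≈[ suc K ] y → x ^ p ≈[ suc (suc K) ] y ^ p
  ≈-lift {K} {x} {y} ix iy h = mk (Div-≡ (sym (diff p)) (subst (λ e → Div e ((x - y) * gs p)) (ℕP.+-comm (suc K) 1) (Div-* (_≈[_]_.diff h) small)))
    where
    gs : ℕ → ℚ
    gs zero    = 0ℚ
    gs (suc n) = x * gs n + y ^ n
    diff : ∀ n → x ^ n - y ^ n ≡ (x - y) * gs n
    diff zero    = sym (*-zeroʳ (x - y))
    diff (suc n) = trans (solve 4 (λ x y a b → x :* a :- y :* b := x :* (a :- b) :+ (x :- y) :* b) refl x y (x ^ n) (y ^ n))
      (trans (cong (λ z → x * z + (x - y) * y ^ n) (diff n)) (solve 4 (λ x y g b → x :* ((x :- y) :* g) :+ (x :- y) :* b := (x :- y) :* (x :* g :+ b)) refl x y (gs n) (y ^ n)))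
    Int-gs : ∀ n → Int (gs n)
    Int-gs zero    = Int-0
    Int-gs (suc n) = Int-+ (Int-* ix (Int-gs n)) (Int-^ n iy)
    g≈ : ∀ n → gs (suc n) ≈[ 1 ] # (suc n) * y ^ n
    g≈ zero    = ≈-reflexive (trans (solve 1 (λ x → x :* con 0ℚ :+ con 1ℚ := con 1ℚ :* con 1ℚ) refl x) (cong (_* 1ℚ) (sym #1)))
    g≈ (suc n) = ≈-trans (≈-+ (≈-* (≈-weaken (s≤s z≤n) h) (g≈ n) iy (Int-gs (suc n))) ≈-refl)
      (≈-reflexive (trans (solve 3 (λ y m a → y :* (m :* a) :+ y :* a := (con 1ℚ :+ m) :* (y :* a)) refl y (# (suc n)) (y ^ n)) (cong (_* (y * y ^ n)) (sym (#-suc (suc n))))))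
    small : Div 1 (gs p)
    small = ≈0→Div (≈-trans (g≈ q) (Div→≈0 (Div-*ʳ (∣→Div1 p ∣-refl) (Int-^ q iy))))

  ≈-lift^ : ∀ L {K x y} → Int x → Int y → x ≈[ suc K ] y → x ^ (p ℕ.^ L) ≈[ suc (L ℕ.+ K) ] y ^ (p ℕ.^ L)
  ≈-lift^ zero    {x = x} {y} ix iy h = ≈-≡ (sym (*-identityʳ x)) (sym (*-identityʳ y)) h
  ≈-lift^ (suc L) {K} {x} {y} ix iy h = ≈-≡ (e x) (e y) (≈-lift (Int-^ (p ℕ.^ L) ix) (Int-^ (p ℕ.^ L) iy) (≈-lift^ L ix iy h))
    where
    e : ∀ x → (x ^ (p ℕ.^ L)) ^ p ≡ x ^ (p ℕ.^ suc L)
    e x = trans (sym (^-* x (p ℕ.^ L) p)) (cong (x ^_) (ℕP.*-comm (p ℕ.^ L) p))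

  -- The p^L-th power of 1 + p ℤ_(p) is 1 + p^(L+1) ℤ_(p).
  euler : ∀ L m → ¬ (p ∣ m) → # m ^ (q ℕ.* p ℕ.^ L) ≈[ suc L ] 1ℚ
  euler L m h = ≈-≡ (sym (^-* (# m) q (p ℕ.^ L))) (1^ (p ℕ.^ L)) (≈-weaken (s≤s (ℕP.m≤m+n L 0)) (≈-lift^ L (Int-^ q (Int-# m)) Int-1 (fermat-unit m h)))

  ν : ℕ → ℕ
  ν n with p ∣? n
  ... | yes _ = 0
  ... | no  _ = 1

  ν-yes : ∀ n → p ∣ n → ν n ≡ 0
  ν-yes n h with p ∣? n
  ... | yes _ = refl
  ... | no  k = ⊥-elim (k h)

  ν-no : ∀ n → ¬ (p ∣ n) → ν n ≡ 1
  ν-no n h with p ∣? n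
  ... | yes k = ⊥-elim (h k)
  ... | no  _ = refl

  -- Counts the units below n. It is the exponent with which a constant enters when each of these
  -- units is multiplied by it: -1 in the reflection formula, m in the multiplication formula.
  U : ℕ → ℕ
  U zero    = 0
  U (suc n) = U n ℕ.+ ν n

  U-eq : ∀ n a → a ℕ.< p → U (suc (a ℕ.+ p ℕ.* n)) ≡ a ℕ.+ q ℕ.* n
  U-eq zero zero l = trans (cong (λ k → U k ℕ.+ ν k) (ℕP.*-zeroʳ p)) (trans (ν-yes 0 (p ∣0)) (sym (ℕP.*-zeroʳ q)))
  U-eq (suc n) zero l = trans (cong₂ ℕ._+_ (trans (cong U (ℕP.*-suc p n)) (U-eq n q ℕP.≤-refl)) (ν-yes (p ℕ.* suc n) (m∣m*n (suc n))))
    (trans (ℕP.+-identityʳ _) (sym (ℕP.*-suc q n)))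
  U-eq n (suc a) l = trans (cong₂ ℕ._+_ (U-eq n a (ℕP.≤-trans (ℕP.n≤1+n (suc a)) l)) (ν-no _ (p∤+ a n l))) (ℕP.+-comm (a ℕ.+ q ℕ.* n) 1)

  ∣-resp : ∀ {K x y} → # x ≈[ suc K ] # y → p ∣ y → p ∣ x
  ∣-resp {K} {x} {y} h d = Div1→∣ x (≈0→Div (≈-trans (≈-weaken (s≤s z≤n) h) (Div→≈0 (∣→Div1 y d))))

  -- Multiplying by m turns the units below x into units near y = m x.
  un-scale : ∀ {K} m x y → ¬ (p ∣ m) → # m * # x ≈[ suc K ] # y → un x * # m ^ ν y ≈[ suc K ] un y
  un-scale {K} m x y hm h = go (p ∣? y)
    where
    h′ : # (m ℕ.* x) ≈[ suc K ] # y
    h′ = ≈-≡ (sym (#-* m x)) refl h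
    go : Dec (p ∣ y) → un x * # m ^ ν y ≈[ suc K ] un y
    go (yes d) = ≈-reflexive (trans (cong₂ (λ a b → a * # m ^ b) (un-yes x x∣) (ν-yes y d)) (trans refl (sym (un-yes y d))))
      where
      x∣ : p ∣ x
      x∣ = [ (λ z → ⊥-elim (hm z)) , (λ z → z) ]′ (euclidsLemma m x pp (∣-resp h′ d))
    go (no nd) = ≈-≡ (sym (trans (cong₂ (λ a b → a * # m ^ b) (un-no x nx) (ν-no y nd)) (solve 2 (λ x m → x :* (m :* con 1ℚ) := m :* x) refl (# x) (# m)))) (sym (un-no y nd)) h
      where
      nx : ¬ (p ∣ x)
      nx z = nd (∣-resp (≈-sym h′) (∣-trans z (n∣m*n m)))

  un-cong : ∀ {K} x y → # x ≈[ suc K ] # y → un x ≈[ suc K ] un y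
  un-cong {K} x y h = go (p ∣? y)
    where
    go : Dec (p ∣ y) → un x ≈[ suc K ] un y
    go (yes d) = ≈-reflexive (trans (un-yes x (∣-resp h d)) (sym (un-yes y d)))
    go (no nd) = ≈-≡ (sym (un-no x (λ z → nd (∣-resp (≈-sym h) z)))) (sym (un-no y nd)) h

  Πr : ℕ → ℕ → ℚ
  Πr s zero    = 1ℚ
  Πr s (suc M) = Πr s M * un (s ℕ.+ M)

  Πu-+ : ∀ s M → Πu (s ℕ.+ M) ≡ Πu s * Πr s M
  Πu-+ s zero    = trans (cong Πu (ℕP.+-identityʳ s)) (sym (*-identityʳ (Πu s)))
  Πu-+ s (suc M) = trans (cong Πu (ℕP.+-suc s M)) (trans (cong (_* un (s ℕ.+ M)) (Πu-+ s M)) (*-assoc (Πu s) (Πr s M) (un (s ℕ.+ M))))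

  Int-un : ∀ n → Int (un n)
  Int-un n = Unit.int-u (Unit-un n)

  Int-Πu : ∀ n → Int (Πu n)
  Int-Πu n = Unit.int-u (Unit-Πu n)

  T : ℕ → ℕ
  T zero    = 0
  T (suc n) = T n ℕ.+ n

  2T : ∀ n → T n ℕ.+ T n ℕ.+ n ≡ n ℕ.* n
  2T zero    = refl
  2T (suc n) = trans (NS.solve 2 (λ t n → (t NS.:+ n) NS.:+ (t NS.:+ n) NS.:+ (NS.con 1 NS.:+ n) NS.:= NS.con 1 NS.:+ ((n NS.:+ n) NS.:+ (t NS.:+ t NS.:+ n))) refl (T n) n)
    (trans (cong (λ z → 1 ℕ.+ ((n ℕ.+ n) ℕ.+ z)) (2T n)) (NS.solve 1 (λ n → NS.con 1 NS.:+ ((n NS.:+ n) NS.:+ n NS.:* n) NS.:= (NS.con 1 NS.:+ n) NS.:* (NS.con 1 NS.:+ n)) refl n))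

  p∤2 : ¬ (p ∣ 2)
  p∤2 = p∤<p 1 (ℕP.≤-trans (s≤s (s≤s z≤n)) q>2)

  p∣T : p ∣ T p
  p∣T = [ (λ z → ⊥-elim (p∤2 z)) , (λ z → z) ]′ (euclidsLemma 2 (T p) pp (subst (p ∣_) (cong (T p ℕ.+_) (sym (ℕP.+-identityʳ (T p))))
      (∣m+n∣m⇒∣n (subst (p ∣_) (trans (sym (2T p)) (ℕP.+-comm (T p ℕ.+ T p) p)) (m∣m*n p)) ∣-refl)))

  module PrimePower (K : ℕ) where

    N : ℕ
    N = p ℕ.^ suc K

    N≡ : # N ≡ P ^ suc K
    N≡ = #-^ p (suc K)

    p∣N : p ∣ N
    p∣N = m∣m*n (p ℕ.^ K)

    ν′ : ℕ → ℚ
    ν′ u = # (ν u)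

    un-shift : ∀ u i → un (N ℕ.* i ℕ.+ u) ≡ un u + # i * # N * ν′ u
    un-shift u i = go (p ∣? u)
      where
      p∣Ni : p ∣ N ℕ.* i
      p∣Ni = ∣-trans p∣N (m∣m*n i)
      go : Dec (p ∣ u) → un (N ℕ.* i ℕ.+ u) ≡ un u + # i * # N * ν′ u
      go (yes d) = trans (un-yes (N ℕ.* i ℕ.+ u) (∣m∣n⇒∣m+n p∣Ni d)) (sym (trans (cong₂ (λ a b → a + # i * # N * b) (un-yes u d) (trans (cong # (ν-yes u d)) #0))
        (solve 1 (λ x → con 1ℚ :+ x :* con 0ℚ := con 1ℚ) refl (# i * # N))))
      go (no nd) = trans (un-no (N ℕ.* i ℕ.+ u) (λ z → nd (∣m+n∣m⇒∣n z p∣Ni))) (trans (trans (#-+ (N ℕ.* i) u) (cong (_+ # u) (#-* N i)))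
        (sym (trans (cong₂ (λ a b → a + # i * # N * b) (un-no u nd) (trans (cong # (ν-no u nd)) #1)) (solve 3 (λ u i n → u :+ i :* n :* con 1ℚ := n :* i :+ u) refl (# u) (# i) (# N)))))

    -- Modulo N² a product of translated units is affine in the translation Ni; V is the derivative
    -- of the product.
    Πr-linear : ∀ M → Σ ℚ λ V → Int V × (∀ i → Πr (N ℕ.* i) M ≈[ suc K ℕ.+ suc K ] Πu M + # i * # N * V)
    Πr-linear zero    = 0ℚ , Int-0 , λ i → ≈-reflexive (solve 1 (λ x → con 1ℚ := con 1ℚ :+ x :* con 0ℚ) refl (# i * # N))
    Πr-linear (suc M) = step (Πr-linear M)
      where
      step : (Σ ℚ λ V → Int V × (∀ i → Πr (N ℕ.* i) M ≈[ suc K ℕ.+ suc K ] Πu M + # i * # N * V)) → Σ ℚ λ V → Int V × (∀ i → Πr (N ℕ.* i) (suc M) ≈[ suc K ℕ.+ suc K ] Πu (suc M) + # i * # N * V)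
      step (V , iV , h) = V * un M + Πu M * ν′ M , Int-+ (Int-* iV (Int-un M)) (Int-* (Int-Πu M) (Int-# (ν M))) , λ i →
        ≈-trans (≈-*ʳ (Int-un (N ℕ.* i ℕ.+ M)) (h i)) (≈-trans (≈-reflexive (cong ((Πu M + # i * # N * V) *_) (un-shift M i)))
          (mk (Div-≡ (solve 6 (λ a i n v u e → (n :* n) :* (i :* v :* (i :* e)) := (a :+ i :* n :* v) :* (u :+ i :* n :* e) :- (a :* u :+ i :* n :* (v :* u :+ a :* e))) refl (Πu M) (# i) (# N) V (un M) (ν′ M))
            (Div-*ʳ (Div-* (Div-≡ (trans (*-identityʳ (P ^ suc K)) (sym N≡)) (Div-P^ (suc K) Int-1)) (Div-≡ (trans (*-identityʳ (P ^ suc K)) (sym N≡)) (Div-P^ (suc K) Int-1)))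
              (Int-* (Int-* (Int-# i) iV) (Int-* (Int-# i) (Int-# (ν M))))))))

    -- The p blocks of length N have products W (1 + iNV′) modulo N², for i = 0, ..., p - 1. Their
    -- first-order terms add up to `T p` · N V′, and T p = p(p-1)/2 is divisible by p, so only W^p
    -- remains.
    wilson-step : Πu (p ℕ.* N) ≈[ suc (suc K) ] Πu N ^ p
    wilson-step = ≈-trans (≈-reflexive (cong Πu (ℕP.*-comm p N))) (go (Πr-linear N) (Unit-Πu N))
      where
      go : (Σ ℚ λ V → Int V × (∀ i → Πr (N ℕ.* i) N ≈[ suc K ℕ.+ suc K ] Πu N + # i * # N * V)) → Unit (Πu N) → Πu (N ℕ.* p) ≈[ suc (suc K) ] Πu N ^ p
      go (V , iV , h) (unit iW W′ iW′ eW) = ≈-trans (claim p) (≈-trans (≈-*ˡ (Int-^ p iW) (≈-trans (≈-+ ≈-refl (Div→≈0 small)) (≈-reflexive (+-identityʳ 1ℚ)))) (≈-reflexive (*-identityʳ (W ^ p))))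
        where
        W = Πu N
        V′ = V * W′
        iV′ : Int V′
        iV′ = Int-* iV iW′
        small : Div (suc (suc K)) (# (T p) * # N * V′)
        small = Div-*ʳ (Div-* (∣→Div1 (T p) p∣T) (Div-≡ (trans (*-identityʳ (P ^ suc K)) (sym N≡)) (Div-P^ (suc K) Int-1))) iV′
        claim : ∀ I → Πu (N ℕ.* I) ≈[ suc (suc K) ] W ^ I * (1ℚ + # (T I) * # N * V′)
        claim zero    = ≈-reflexive (trans (cong Πu (ℕP.*-zeroʳ N)) (trans (solve 2 (λ n v → con 1ℚ := con 1ℚ :* (con 1ℚ :+ con 0ℚ :* n :* v)) refl (# N) V′) (cong (λ z → 1ℚ * (1ℚ + z * # N * V′)) (sym #0))))
        claim (suc I) = ≈-trans (≈-reflexive (trans (cong Πu (trans (ℕP.*-suc N I) (ℕP.+-comm N (N ℕ.* I)))) (Πu-+ (N ℕ.* I) N)))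
          (≈-trans (≈-* (claim I) (≈-weaken (ℕP.+-monoˡ-≤ (suc K) (s≤s z≤n)) (h I)) (Int-* (Int-^ I iW) (Int-+ Int-1 (Int-* (Int-* (Int-# (T I)) (Int-# N)) iV′))) iΠr)
          (mk (Div-≡ eq (Div-weaken (ℕP.+-monoˡ-≤ (suc K) (s≤s z≤n)) (Div-*ʳ (Div-* dN dN) (Int-* (Int-^ (suc I) iW) (Int-* (Int-* (Int-# (T I)) iV′) (Int-* (Int-# I) iV′))))))))
          where
          dN : Div (suc K) (# N)
          dN = Div-≡ (trans (*-identityʳ (P ^ suc K)) (sym N≡)) (Div-P^ (suc K) Int-1)
          iΠr : Int (Πr (N ℕ.* I) N)
          iΠr = ≈-Int (h I) (Int-+ iW (Int-* (Int-* (Int-# I) (Int-# N)) iV))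
          eq : (# N * # N) * (W ^ suc I * (# (T I) * V′ * (# I * V′))) ≡ W ^ I * (1ℚ + # (T I) * # N * V′) * (W + # I * # N * V) - W ^ suc I * (1ℚ + # (T (suc I)) * # N * V′)
          eq = sym (trans (cong₂ (λ a b → W ^ I * (1ℚ + # (T I) * # N * V′) * (W + # I * # N * a) - W ^ suc I * (1ℚ + b * # N * V′))
                  (trans (trans (sym (*-identityʳ V)) (cong (V *_) (sym eW))) (solve 3 (λ v w x → v :* (w :* x) := w :* (v :* x)) refl V W W′)) (#-+ (T I) I))
                (solve 6 (λ x w t n i v → x :* (con 1ℚ :+ t :* n :* v) :* (w :+ i :* n :* (w :* v)) :- w :* x :* (con 1ℚ :+ (t :+ i) :* n :* v) := (n :* n) :* (w :* x :* (t :* v :* (i :* v)))) refl (W ^ I) W (# (T I)) (# N) (# I) V′))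

  -1^p : (- 1ℚ) ^ p ≡ - 1ℚ
  -1^p = trans (cong ((- 1ℚ) *_) -1^q) refl

  wilsonᴷ : ∀ K → Πu (p ℕ.^ suc K) ≈[ suc K ] - 1ℚ
  wilsonᴷ zero    = ≈-trans (≈-reflexive (trans (cong Πu (ℕP.*-identityʳ p)) (sym (h q ℕP.≤-refl)))) wilson
    where
    h : ∀ a → a ℕ.≤ q → fac a ≡ Πu (suc a)
    h a l = trans (cong fac (sym e)) (trans (fac-split 0 a (s≤s l)) (trans (*-identityˡ (Πu (suc (a ℕ.+ p ℕ.* 0)))) (cong (λ k → Πu (suc k)) e)))
      where
      e : a ℕ.+ p ℕ.* 0 ≡ a
      e = trans (cong (a ℕ.+_) (ℕP.*-zeroʳ p)) (ℕP.+-identityʳ a)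
  wilsonᴷ (suc K) = ≈-trans (PrimePower.wilson-step K) (≈-trans (≈-lift (Int-Πu (p ℕ.^ suc K)) (Int-neg Int-1) (wilsonᴷ K)) (≈-reflexive -1^p))

  Γₚ : ℕ → ℚ
  Γₚ n = (- 1ℚ) ^ n * Πu n

  Int-Γₚ : ∀ n → Int (Γₚ n)
  Int-Γₚ n = Int-* (Int-±1^ n) (Int-Πu n)

  Unit-Γₚ : ∀ n → Unit (Γₚ n)
  Unit-Γₚ n = Unit-* (Unit-^ n (Unit-neg Unit-1)) (Unit-Πu n)

  Γₚ-suc : ∀ n → Γₚ (suc n) ≡ Γₚ n * (- un n)
  Γₚ-suc n = solve 3 (λ s a u → (:- con 1ℚ) :* s :* (a :* u) := s :* a :* (:- u)) refl ((- 1ℚ) ^ n) (Πu n) (un n)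

  Πu-Γₚ : ∀ n → Πu n ≡ (- 1ℚ) ^ n * Γₚ n
  Πu-Γₚ n = trans (sym (trans (cong (_* Πu n) (-1^-sq n)) (*-identityˡ (Πu n)))) (*-assoc ((- 1ℚ) ^ n) ((- 1ℚ) ^ n) (Πu n))

  -1^N : ∀ L → (- 1ℚ) ^ (p ℕ.^ L) ≡ - 1ℚ
  -1^N zero    = refl
  -1^N (suc L) = trans (^-* (- 1ℚ) p (p ℕ.^ L)) (trans (cong (_^ (p ℕ.^ L)) -1^p) (-1^N L))

  Div-N : ∀ L z → Div L (# (p ℕ.^ L ℕ.* z))
  Div-N L z = ∣→Div L (p ℕ.^ L ℕ.* z) (m∣m*n z)

  Γₚ-period1 : ∀ K n → Γₚ (p ℕ.^ suc K ℕ.+ n) ≈[ suc K ] Γₚ n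
  Γₚ-period1 K zero    = ≈-trans (≈-reflexive (trans (cong Γₚ (ℕP.+-identityʳ (p ℕ.^ suc K))) (cong (_* Πu (p ℕ.^ suc K)) (-1^N (suc K))))) (≈-*ˡ (Int-neg Int-1) (wilsonᴷ K))
  Γₚ-period1 K (suc n) = ≈-≡ (sym (trans (cong Γₚ (ℕP.+-suc (p ℕ.^ suc K) n)) (Γₚ-suc (p ℕ.^ suc K ℕ.+ n)))) (sym (Γₚ-suc n))
    (≈-* (Γₚ-period1 K n) (≈-neg (un-cong (p ℕ.^ suc K ℕ.+ n) n (mk (Div-≡ (trans (solve 2 (λ a b → a := (a :+ b) :- b) refl (# (p ℕ.^ suc K)) (# n)) (cong (_- # n) (sym (#-+ (p ℕ.^ suc K) n))))
      (subst (λ m → Div (suc K) (# m)) (ℕP.*-identityʳ (p ℕ.^ suc K)) (Div-N (suc K) 1)))))) (Int-Γₚ n) (Int-neg (Int-un (p ℕ.^ suc K ℕ.+ n))))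

  Γₚ-period : ∀ K n z → Γₚ (p ℕ.^ suc K ℕ.* z ℕ.+ n) ≈[ suc K ] Γₚ n
  Γₚ-period K n zero    = ≈-reflexive (cong (λ m → Γₚ (m ℕ.+ n)) (ℕP.*-zeroʳ (p ℕ.^ suc K)))
  Γₚ-period K n (suc z) = ≈-trans (≈-reflexive (cong Γₚ (trans (cong (ℕ._+ n) (ℕP.*-suc (p ℕ.^ suc K) z)) (ℕP.+-assoc (p ℕ.^ suc K) (p ℕ.^ suc K ℕ.* z) n)))) (≈-trans (Γₚ-period1 K _) (Γₚ-period K n z))

  Γₚ-cong≤ : ∀ K m n → m ℕ.≤ n → # m ≈[ suc K ] # n → Γₚ m ≈[ suc K ] Γₚ n
  Γₚ-cong≤ K m n l (mk h) = go (Div→∣ (suc K) (ℤ.+ (n ℕ.∸ m)) (Div-≡ e (Div-neg h)))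
    where
    e : - (# m - # n) ≡ # (n ℕ.∸ m)
    e = trans (cong (λ z → - (# m - z)) (trans (cong # (sym (ℕP.m+[n∸m]≡n l))) (#-+ m (n ℕ.∸ m)))) (solve 2 (λ a b → :- (a :- (a :+ b)) := b) refl (# m) (# (n ℕ.∸ m)))
    go : p ℕ.^ suc K ∣ n ℕ.∸ m → Γₚ m ≈[ suc K ] Γₚ n
    go (divides z e) = ≈-sym (≈-trans (≈-reflexive (cong Γₚ (trans (sym (ℕP.m∸n+n≡m l)) (cong (ℕ._+ m) (trans e (ℕP.*-comm z (p ℕ.^ suc K))))))) (Γₚ-period K m z))

  Γₚ-cong : ∀ K m n → # m ≈[ suc K ] # n → Γₚ m ≈[ suc K ] Γₚ n
  Γₚ-cong K m n h = [ (λ l → Γₚ-cong≤ K m n l h) , (λ l → ≈-sym (Γₚ-cong≤ K n m l (≈-sym h))) ]′ (ℕP.≤-total m n)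

  -- Raising j by one takes the unit part of N - j out of the second product and puts that of j into
  -- the first. They differ by a sign if p ∤ j and both are 1 otherwise, which is what `U` records.
  -- At j = 0 the claim is Wilson's theorem modulo p^(K+1).
  reflection : ∀ K j → j ℕ.≤ p ℕ.^ suc K → Πu j * Πu (suc (p ℕ.^ suc K ℕ.∸ j)) * (- 1ℚ) ^ U j ≈[ suc K ] - 1ℚ
  reflection K zero    l = ≈-trans (≈-reflexive (trans (solve 2 (λ a u → con 1ℚ :* (a :* u) :* con 1ℚ := a :* u) refl (Πu N) (un N)) (trans (cong (Πu N *_) (un-yes N (m∣m*n (p ℕ.^ K)))) (*-identityʳ (Πu N))))) (wilsonᴷ K)
    where N = p ℕ.^ suc K
  reflection K (suc j) l = ≈-trans (≈-reflexive e₁) (≈-trans (≈-*ˡ (Int-* (Int-* (Int-Πu j) (Int-Πu (N ℕ.∸ j))) (Int-±1^ (U j))) key) (≈-trans (≈-reflexive e₂) (reflection K j (ℕP.≤-trans (ℕP.n≤1+n j) l))))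
    where
    N = p ℕ.^ suc K
    sN : suc (N ℕ.∸ suc j) ≡ N ℕ.∸ j
    sN = sym (ℕP.+-∸-assoc 1 l)
    e₁ : Πu (suc j) * Πu (suc (N ℕ.∸ suc j)) * (- 1ℚ) ^ U (suc j) ≡ Πu j * Πu (N ℕ.∸ j) * (- 1ℚ) ^ U j * (un j * (- 1ℚ) ^ ν j)
    e₁ = trans (cong₂ (λ a b → Πu (suc j) * a * b) (cong Πu sN) (^-+ (- 1ℚ) (U j) (ν j)))
      (solve 5 (λ a u b s t → a :* u :* b :* (s :* t) := a :* b :* s :* (u :* t)) refl (Πu j) (un j) (Πu (N ℕ.∸ j)) ((- 1ℚ) ^ U j) ((- 1ℚ) ^ ν j))
    e₂ : Πu j * Πu (N ℕ.∸ j) * (- 1ℚ) ^ U j * un (N ℕ.∸ j) ≡ Πu j * Πu (suc (N ℕ.∸ j)) * (- 1ℚ) ^ U j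
    e₂ = solve 4 (λ a b s u → a :* b :* s :* u := a :* (b :* u) :* s) refl (Πu j) (Πu (N ℕ.∸ j)) ((- 1ℚ) ^ U j) (un (N ℕ.∸ j))
    j≈ : # (N ℕ.∸ j) ≈[ suc K ] - # j
    j≈ = mk (Div-≡ (trans (cong # (sym (ℕP.m∸n+n≡m (ℕP.≤-trans (ℕP.n≤1+n j) l)))) (trans (#-+ (N ℕ.∸ j) j) (solve 2 (λ a b → a :+ b := a :- (:- b)) refl (# (N ℕ.∸ j)) (# j))))
      (subst (λ m → Div (suc K) (# m)) (ℕP.*-identityʳ N) (Div-N (suc K) 1)))
    key : un j * (- 1ℚ) ^ ν j ≈[ suc K ] un (N ℕ.∸ j)
    key = go (p ∣? j)
      where
      p∣N : p ∣ N
      p∣N = m∣m*n (p ℕ.^ K)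
      eN : N ℕ.∸ j ℕ.+ j ≡ N
      eN = ℕP.m∸n+n≡m (ℕP.≤-trans (ℕP.n≤1+n j) l)
      go : Dec (p ∣ j) → un j * (- 1ℚ) ^ ν j ≈[ suc K ] un (N ℕ.∸ j)
      go (yes d) = ≈-reflexive (trans (cong₂ (λ a b → a * (- 1ℚ) ^ b) (un-yes j d) (ν-yes j d)) (trans refl (sym (un-yes (N ℕ.∸ j) (∣m+n∣m⇒∣n (subst (p ∣_) (trans (sym eN) (ℕP.+-comm (N ℕ.∸ j) j)) p∣N) d)))))
      go (no nd) = ≈-≡ (sym (trans (cong₂ (λ a b → a * (- 1ℚ) ^ b) (un-no j nd) (ν-no j nd)) (solve 1 (λ x → x :* con (- 1ℚ) := :- x) refl (# j))))
        (sym (un-no (N ℕ.∸ j) (λ z → nd (∣m+n∣m⇒∣n (subst (p ∣_) (sym eN) p∣N) z)))) (≈-sym j≈)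

  -- The multiplication formula

  ∏ : ℕ → (ℕ → ℚ) → ℚ
  ∏ zero    f = 1ℚ
  ∏ (suc n) f = ∏ n f * f n

  Int-∏ : ∀ n {f : ℕ → ℚ} → (∀ i → Int (f i)) → Int (∏ n f)
  Int-∏ zero    h = Int-1
  Int-∏ (suc n) h = Int-* (Int-∏ n h) (h n)

  -- This is (p^K - 1)/(p - 1), a natural number congruent to -1/(p-1) modulo p^K.
  repunit : ℕ → ℕ
  repunit zero    = 0
  repunit (suc K) = 1 ℕ.+ p ℕ.* repunit K

  repunit-eq : ∀ K → 1 ℕ.+ q ℕ.* repunit K ≡ p ℕ.^ K
  repunit-eq zero    = cong suc (ℕP.*-zeroʳ q)
  repunit-eq (suc K) = trans (NS.solve 2 (λ q r → NS.con 1 NS.:+ q NS.:* (NS.con 1 NS.:+ (NS.con 1 NS.:+ q) NS.:* r) NS.:= (NS.con 1 NS.:+ q) NS.:* (NS.con 1 NS.:+ q NS.:* r)) refl q (repunit K)) (cong (p ℕ.*_) (repunit-eq K))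

  -- a natural number congruent to a / (p-1) modulo p^K
  n₀ : ℕ → ℕ → ℕ
  n₀ K a = 1 ℕ.+ (q ℕ.∸ a) ℕ.* repunit K

  n₀-eq : ∀ K a → a ℕ.≤ q → q ℕ.* n₀ K a ≡ a ℕ.+ p ℕ.^ K ℕ.* (q ℕ.∸ a)
  n₀-eq K a l = begin
    q ℕ.* (1 ℕ.+ d ℕ.* r)             ≡⟨ NS.solve 3 (λ q d r → q NS.:* (NS.con 1 NS.:+ d NS.:* r) NS.:= q NS.:+ d NS.:* (q NS.:* r)) refl q d r ⟩
    q ℕ.+ d ℕ.* (q ℕ.* r)             ≡⟨ cong (ℕ._+ d ℕ.* (q ℕ.* r)) (sym (ℕP.m+[n∸m]≡n l)) ⟩
    (a ℕ.+ d) ℕ.+ d ℕ.* (q ℕ.* r)     ≡⟨ NS.solve 3 (λ a d x → (a NS.:+ d) NS.:+ d NS.:* x NS.:= a NS.:+ (NS.con 1 NS.:+ x) NS.:* d) refl a d (q ℕ.* r) ⟩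
    a ℕ.+ (1 ℕ.+ q ℕ.* r) ℕ.* d       ≡⟨ cong (λ z → a ℕ.+ z ℕ.* d) (repunit-eq K) ⟩
    a ℕ.+ p ℕ.^ K ℕ.* d               ∎
    where
    open ≡-Reasoning
    d = q ℕ.∸ a
    r = repunit K

  ≈-*N : ∀ K m n z → m ≡ n ℕ.+ p ℕ.^ K ℕ.* z → # m ≈[ K ] # n
  ≈-*N K m n z e = mk (Div-≡ (trans (solve 2 (λ a b → b := (a :+ b) :- a) refl (# n) (# (p ℕ.^ K ℕ.* z))) (cong (_- # n) (trans (sym (#-+ n (p ℕ.^ K ℕ.* z))) (cong # (sym e))))) (Div-N K z))

  U-n₀ : ∀ K a → U (n₀ (suc K) a) ≡ (q ℕ.∸ a) ℕ.* p ℕ.^ K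
  U-n₀ K a = trans (cong (λ z → U (suc z)) (NS.solve 3 (λ d p r → d NS.:* (NS.con 1 NS.:+ p NS.:* r) NS.:= d NS.:+ p NS.:* (d NS.:* r)) refl d p (repunit K)))
    (trans (U-eq (d ℕ.* repunit K) d (s≤s (ℕP.m∸n≤m q a))) (trans (NS.solve 3 (λ d q r → d NS.:+ q NS.:* (d NS.:* r) NS.:= d NS.:* (NS.con 1 NS.:+ q NS.:* r)) refl d q (repunit K)) (cong (d ℕ.*_) (repunit-eq K))))
    where d = q ℕ.∸ a

  n<p^n : ∀ n → n ℕ.< p ℕ.^ n
  n<p^n zero    = s≤s z≤n
  n<p^n (suc n) = ℕP.≤-trans (s≤s (n<p^n n)) (ℕP.≤-trans (ℕP.+-monoˡ-≤ (p ℕ.^ n) (ℕP.≤-trans (s≤s z≤n) (n<p^n n)))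
    (ℕP.≤-trans (ℕP.≤-reflexive (cong (p ℕ.^ n ℕ.+_) (sym (ℕP.+-identityʳ (p ℕ.^ n))))) (ℕP.*-monoˡ-≤ (p ℕ.^ n) {2} {p} (s≤s 0<q))))

  -- `gross-koblitz` gives the inverse of a product of units at an argument congruent to 1 -
  -- a/(p-1). The reflection formula carries it to a/(p-1) and into the numerator.
  gross-koblitz′ : ∀ E K a → a ℕ.< q → 2 ℕ.+ E ℕ.≤ suc K → ∀ M → E ℕ.* (p ℕ.* p) ℕ.≤ M → (1ℚ - P) * gauss a M ≈[ E ] Γₚ (n₀ (suc K) a)
  gross-koblitz′ E K a la hK M hM = ≈-trans step₁ (≈-trans (≈-*ʳ (Int-Πu j) step₂) (≈-reflexive (sym (cong (_* Πu j) sj))))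
    where
    open ≡-Reasoning
    N = p ℕ.^ suc K
    R′ = repunit (suc K)
    -- Then a + qk = N (a + q), so k is -a/q modulo N. The summand N makes k large enough for `hk`.
    k = a ℕ.* R′ ℕ.+ N
    j = n₀ (suc K) a
    n₁ = suc (a ℕ.+ p ℕ.* k)
    x = (1ℚ - P) * gauss a M
    Π′ = Πu (suc (a ℕ.* R′))
    s = (- 1ℚ) ^ a
    r = (- 1ℚ) ^ (a ℕ.* R′)
    ix : Int x
    ix = Int-* (Int-- Int-1 (Int-# p)) (gauss-Int a la M)
    E≤ : E ℕ.≤ suc K
    E≤ = ℕP.≤-trans (ℕP.m≤n+m E 2) hK
    N≡ : N ≡ 1 ℕ.+ q ℕ.* R′
    N≡ = sym (repunit-eq (suc K))
    n₁≡ : n₁ ≡ N ℕ.* (a ℕ.+ p) ℕ.+ suc (a ℕ.* R′)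
    n₁≡ = trans (NS.solve 4 (λ a q r n → NS.con 1 NS.:+ (a NS.:+ (NS.con 1 NS.:+ q) NS.:* (a NS.:* r NS.:+ n)) NS.:= ((NS.con 1 NS.:+ q NS.:* r) NS.:* a NS.:+ n NS.:* (NS.con 1 NS.:+ q)) NS.:+ (NS.con 1 NS.:+ a NS.:* r)) refl a q R′ N)
      (cong (ℕ._+ suc (a ℕ.* R′)) (trans (cong (λ z → z ℕ.* a ℕ.+ N ℕ.* p) (sym N≡)) (sym (ℕP.*-distribˡ-+ N a p))))
    j+ : j ℕ.+ a ℕ.* R′ ≡ N
    j+ = trans (cong suc (trans (sym (ℕP.*-distribʳ-+ R′ (q ℕ.∸ a) a)) (cong (ℕ._* R′) (ℕP.m∸n+n≡m (ℕP.<⇒≤ la))))) (sym N≡)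
    j≤ : j ℕ.≤ N
    j≤ = ℕP.≤-trans (ℕP.m≤m+n j (a ℕ.* R′)) (ℕP.≤-reflexive j+)
    N∸j : N ℕ.∸ j ≡ a ℕ.* R′
    N∸j = trans (cong (ℕ._∸ j) (sym j+)) (ℕP.m+n∸m≡n j (a ℕ.* R′))
    sN : (- 1ℚ) ^ N ≡ - 1ℚ
    sN = -1^N (suc K)
    sj : (- 1ℚ) ^ j ≡ - r
    sj = begin
      (- 1ℚ) ^ j                  ≡⟨ sym (*-identityʳ ((- 1ℚ) ^ j)) ⟩
      (- 1ℚ) ^ j * 1ℚ             ≡⟨ cong ((- 1ℚ) ^ j *_) (sym (-1^-sq (a ℕ.* R′))) ⟩
      (- 1ℚ) ^ j * (r * r)        ≡⟨ sym (*-assoc ((- 1ℚ) ^ j) r r) ⟩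
      (- 1ℚ) ^ j * r * r          ≡⟨ cong (_* r) (trans (sym (^-+ (- 1ℚ) j (a ℕ.* R′))) (trans (cong ((- 1ℚ) ^_) j+) sN)) ⟩
      - 1ℚ * r                    ≡⟨ solve 1 (λ r → con (- 1ℚ) :* r := :- r) refl r ⟩
      - r ∎
    sk : (- 1ℚ) ^ k ≡ - r
    sk = trans (^-+ (- 1ℚ) (a ℕ.* R′) N) (trans (cong (r *_) sN) (solve 1 (λ r → r :* con (- 1ℚ) := :- r) refl r))
    sn₁ : (- 1ℚ) ^ n₁ ≡ s * r
    sn₁ = trans (cong ((- 1ℚ) ^_) n₁≡) (trans (^-+ (- 1ℚ) (N ℕ.* (a ℕ.+ p)) (suc (a ℕ.* R′))) (trans (cong (_* (- 1ℚ * r)) (trans (^-* (- 1ℚ) N (a ℕ.+ p)) (trans (cong (_^ (a ℕ.+ p)) sN) (trans (^-+ (- 1ℚ) a p) (cong (s *_) -1^p)))))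
      (solve 2 (λ s r → s :* con (- 1ℚ) :* (con (- 1ℚ) :* r) := s :* r) refl s r)))
    sU : (- 1ℚ) ^ U j ≡ s
    sU = begin
      (- 1ℚ) ^ U j                             ≡⟨ cong ((- 1ℚ) ^_) (trans (U-n₀ K a) (ℕP.*-comm (q ℕ.∸ a) (p ℕ.^ K))) ⟩
      (- 1ℚ) ^ (p ℕ.^ K ℕ.* (q ℕ.∸ a))         ≡⟨ trans (^-* (- 1ℚ) (p ℕ.^ K) (q ℕ.∸ a)) (cong (_^ (q ℕ.∸ a)) (-1^N K)) ⟩
      (- 1ℚ) ^ (q ℕ.∸ a)                       ≡⟨ sym (*-identityʳ _) ⟩
      (- 1ℚ) ^ (q ℕ.∸ a) * 1ℚ                  ≡⟨ cong ((- 1ℚ) ^ (q ℕ.∸ a) *_) (sym (-1^-sq a)) ⟩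
      (- 1ℚ) ^ (q ℕ.∸ a) * (s * s)             ≡⟨ sym (*-assoc ((- 1ℚ) ^ (q ℕ.∸ a)) s s) ⟩
      (- 1ℚ) ^ (q ℕ.∸ a) * s * s               ≡⟨ cong (_* s) (trans (sym (^-+ (- 1ℚ) (q ℕ.∸ a) a)) (trans (cong ((- 1ℚ) ^_) (ℕP.m∸n+n≡m (ℕP.<⇒≤ la))) -1^q)) ⟩
      1ℚ * s                                   ≡⟨ *-identityˡ s ⟩
      s ∎
    refl′ : Πu j * Π′ * s ≈[ E ] - 1ℚ
    refl′ = ≈-weaken E≤ (≈-trans (≈-reflexive (cong₂ (λ u v → Πu j * Πu (suc u) * v) (sym N∸j) (sym sU))) (reflection K j j≤))
    Πn₁ : Πu n₁ ≈[ E ] - s * Π′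
    Πn₁ = ≈-trans (≈-reflexive (trans (Πu-Γₚ n₁) (cong (_* Γₚ n₁) sn₁))) (≈-trans (≈-*ˡ (Int-* (Int-±1^ a) (Int-±1^ (a ℕ.* R′)))
      (≈-trans (≈-reflexive (cong Γₚ n₁≡)) (≈-weaken E≤ (Γₚ-period K (suc (a ℕ.* R′)) (a ℕ.+ p)))))
      (≈-reflexive (trans (solve 3 (λ s r π → s :* r :* (con (- 1ℚ) :* r :* π) := (r :* r) :* ((:- s) :* π)) refl s r Π′) (trans (cong (_* (- s * Π′)) (-1^-sq (a ℕ.* R′))) (*-identityˡ (- s * Π′))))))
    k≡0 : Div (2 ℕ.+ E) (# (a ℕ.+ q ℕ.* k))
    k≡0 = Div-weaken hK (Div-≡ (cong # (trans (cong (ℕ._* (a ℕ.+ q)) N≡) (trans (NS.solve 3 (λ a q r → (NS.con 1 NS.:+ q NS.:* r) NS.:* (a NS.:+ q) NS.:= a NS.:+ q NS.:* (a NS.:* r NS.:+ (NS.con 1 NS.:+ q NS.:* r))) refl a q R′) (cong (λ z → a ℕ.+ q ℕ.* (a ℕ.* R′ ℕ.+ z)) (sym N≡))))) (Div-N (suc K) (a ℕ.+ q)))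
    hk : E ℕ.* (p ℕ.* p) ℕ.≤ k
    hk = begin′
      where
      begin′ : E ℕ.* (p ℕ.* p) ℕ.≤ k
      begin′ = ℕP.≤-trans (ℕP.*-monoˡ-≤ (p ℕ.* p) (ℕP.<⇒≤ (n<p^n E))) (ℕP.≤-trans (ℕP.≤-reflexive (trans (ℕP.*-comm (p ℕ.^ E) (p ℕ.* p)) (ℕP.*-assoc p p (p ℕ.^ E))))
        (ℕP.≤-trans (ℕP.^-monoʳ-≤ p hK) (ℕP.m≤n+m N (a ℕ.* R′))))
    step₂ : x * (- s * Π′) ≈[ E ] - r
    step₂ = ≈-trans (≈-*ˡ ix (≈-sym Πn₁)) (≈-trans (gross-koblitz E a la k k≡0 hk M hM) (≈-reflexive sk))
    step₁ : x ≈[ E ] x * (- s * Π′) * Πu j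
    step₁ = ≈-trans (≈-reflexive (solve 1 (λ x → x := x :* (:- con (- 1ℚ))) refl x)) (≈-trans (≈-*ˡ ix (≈-neg (≈-sym refl′)))
      (≈-reflexive (solve 4 (λ x a b s → x :* (:- (a :* b :* s)) := x :* ((:- s) :* b) :* a) refl x (Πu j) Π′ s)))

  ν-shift : ∀ K z n → ν (p ℕ.^ suc K ℕ.* z ℕ.+ n) ≡ ν n
  ν-shift K z n = go (p ∣? n)
    where
    d₀ : p ∣ p ℕ.^ suc K ℕ.* z
    d₀ = ∣-trans (m∣m*n (p ℕ.^ K)) (m∣m*n z)
    go : Dec (p ∣ n) → ν (p ℕ.^ suc K ℕ.* z ℕ.+ n) ≡ ν n
    go (yes d) = trans (ν-yes _ (∣m∣n⇒∣m+n d₀ d)) (sym (ν-yes n d))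
    go (no nd) = trans (ν-no _ (λ h → nd (∣m+n∣m⇒∣n h d₀))) (sym (ν-no n nd))

  U-p* : ∀ n → U (p ℕ.* n) ≡ q ℕ.* n
  U-p* n = trans (sym (trans (cong (U (p ℕ.* n) ℕ.+_) (ν-yes (p ℕ.* n) (m∣m*n n))) (ℕP.+-identityʳ (U (p ℕ.* n))))) (U-eq n 0 (s≤s z≤n))

  U-period : ∀ K z n → U (p ℕ.^ suc K ℕ.* z ℕ.+ n) ≡ q ℕ.* p ℕ.^ K ℕ.* z ℕ.+ U n
  U-period K z zero    = trans (cong U (trans (ℕP.+-identityʳ _) (ℕP.*-assoc p (p ℕ.^ K) z))) (trans (U-p* (p ℕ.^ K ℕ.* z)) (trans (sym (ℕP.*-assoc q (p ℕ.^ K) z)) (sym (ℕP.+-identityʳ (q ℕ.* p ℕ.^ K ℕ.* z)))))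
  U-period K z (suc n) = trans (cong U (ℕP.+-suc (p ℕ.^ suc K ℕ.* z) n)) (trans (cong₂ ℕ._+_ (U-period K z n) (ν-shift K z n)) (ℕP.+-assoc (q ℕ.* p ℕ.^ K ℕ.* z) (U n) (ν n)))

  module Multiplication (K m η c₁ : ℕ) (p∤m : ¬ (p ∣ m)) (mη : m ℕ.* η ≡ 1 ℕ.+ p ℕ.^ suc K ℕ.* c₁) where

    -- Since η represents 1/m, this is the product of Γ_p(w + h/m) over h < n.
    A : ℕ → ℕ → ℚ
    A n w = ∏ n (λ h → Γₚ (h ℕ.* η ℕ.+ w))

    Int-A : ∀ n w → Int (A n w)
    Int-A n w = Int-∏ n (λ h → Int-Γₚ (h ℕ.* η ℕ.+ w))

    scaled : ∀ h w → # m * # (h ℕ.* η ℕ.+ w) ≈[ suc K ] # (m ℕ.* w ℕ.+ h)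
    scaled h w = ≈-trans (≈-reflexive (sym (#-* m (h ℕ.* η ℕ.+ w)))) (≈-*N (suc K) _ _ (c₁ ℕ.* h)
      (trans (NS.solve 4 (λ m h e w → m NS.:* (h NS.:* e NS.:+ w) NS.:= m NS.:* w NS.:+ h NS.:* (m NS.:* e)) refl m h η w) (trans (cong (λ z → m ℕ.* w ℕ.+ h ℕ.* z) mη)
        (NS.solve 4 (λ x h n c → x NS.:+ h NS.:* (NS.con 1 NS.:+ n NS.:* c) NS.:= x NS.:+ h NS.:+ n NS.:* (c NS.:* h)) refl (m ℕ.* w) h (p ℕ.^ suc K) c₁))))

    inner : ∀ w n → A n (suc w) * # m ^ U (m ℕ.* w ℕ.+ n) * Γₚ (m ℕ.* w) ≈[ suc K ] A n w * # m ^ U (m ℕ.* w) * Γₚ (m ℕ.* w ℕ.+ n)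
    inner w zero    = ≈-reflexive (cong₂ (λ a b → 1ℚ * # m ^ U a * Γₚ b) (ℕP.+-identityʳ (m ℕ.* w)) (sym (ℕP.+-identityʳ (m ℕ.* w))))
    inner w (suc n) = ≈-trans (≈-reflexive e₁) (≈-trans (≈-* (inner w n) key (Int-* (Int-* (Int-A n w) (Int-^ (U (m ℕ.* w)) (Int-# m))) (Int-Γₚ (m ℕ.* w ℕ.+ n)))
        (Int-* (Int-Γₚ (n ℕ.* η ℕ.+ w)) (Int-neg (Int-* (Int-un (n ℕ.* η ℕ.+ w)) (Int-^ (ν (m ℕ.* w ℕ.+ n)) (Int-# m))))))
      (≈-reflexive e₂))
      where
      y = m ℕ.* w ℕ.+ n
      x = n ℕ.* η ℕ.+ w
      e₁ : A n (suc w) * Γₚ (n ℕ.* η ℕ.+ suc w) * # m ^ U (m ℕ.* w ℕ.+ suc n) * Γₚ (m ℕ.* w) ≡ A n (suc w) * # m ^ U y * Γₚ (m ℕ.* w) * (Γₚ x * (- (un x * # m ^ ν y)))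
      e₁ = trans (cong₂ (λ a b → A n (suc w) * a * b * Γₚ (m ℕ.* w)) (trans (cong Γₚ (ℕP.+-suc (n ℕ.* η) w)) (Γₚ-suc x)) (trans (cong (λ z → # m ^ U z) (ℕP.+-suc (m ℕ.* w) n)) (^-+ (# m) (U y) (ν y))))
        (solve 6 (λ a g u t v h → a :* (g :* (:- u)) :* (t :* v) :* h := a :* t :* h :* (g :* (:- (u :* v)))) refl (A n (suc w)) (Γₚ x) (un x) (# m ^ U y) (# m ^ ν y) (Γₚ (m ℕ.* w)))
      key : Γₚ x * (- (un x * # m ^ ν y)) ≈[ suc K ] Γₚ x * (- un y)
      key = ≈-*ˡ (Int-Γₚ x) (≈-neg (un-scale m x y p∤m (scaled n w)))
      e₂ : A n w * # m ^ U (m ℕ.* w) * Γₚ y * (Γₚ x * (- un y)) ≡ A n w * Γₚ x * # m ^ U (m ℕ.* w) * Γₚ (m ℕ.* w ℕ.+ suc n)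
      e₂ = sym (trans (cong (A n w * Γₚ x * # m ^ U (m ℕ.* w) *_) (trans (cong Γₚ (ℕP.+-suc (m ℕ.* w) n)) (Γₚ-suc y)))
        (solve 5 (λ a g t h u → a :* g :* t :* (h :* (:- u)) := a :* t :* h :* (g :* (:- u))) refl (A n w) (Γₚ x) (# m ^ U (m ℕ.* w)) (Γₚ y) (un y)))

    -- Raising w by one brings in the unit parts of w + h/m on the left and of mw + h on the right,
    -- for h < m; `un-scale` matches them at the cost of a power of m. As every p-adic integer is
    -- congruent to a natural number, induction on w takes the place of a continuity argument.
    multiplication : ∀ w → A m w * # m ^ U (m ℕ.* w) ≈[ suc K ] A m 0 * Γₚ (m ℕ.* w)
    multiplication zero    = ≈-reflexive (cong (λ z → A m 0 * z) (trans (cong (λ z → # m ^ U z) (ℕP.*-zeroʳ m)) (sym (cong Γₚ (ℕP.*-zeroʳ m)))))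
    multiplication (suc w) = ≈-cancelUnit (Unit-Γₚ (m ℕ.* w)) (≈-trans (≈-reflexive e₁) (≈-trans (inner w m) (≈-trans (≈-*ʳ (Int-Γₚ (m ℕ.* w ℕ.+ m)) (multiplication w)) (≈-reflexive e₂))))
      where
      ms : m ℕ.* suc w ≡ m ℕ.* w ℕ.+ m
      ms = trans (ℕP.*-suc m w) (ℕP.+-comm m (m ℕ.* w))
      e₁ : Γₚ (m ℕ.* w) * (A m (suc w) * # m ^ U (m ℕ.* suc w)) ≡ A m (suc w) * # m ^ U (m ℕ.* w ℕ.+ m) * Γₚ (m ℕ.* w)
      e₁ = trans (cong (λ z → Γₚ (m ℕ.* w) * (A m (suc w) * # m ^ U z)) ms) (*-comm (Γₚ (m ℕ.* w)) _)
      e₂ : A m 0 * Γₚ (m ℕ.* w) * Γₚ (m ℕ.* w ℕ.+ m) ≡ Γₚ (m ℕ.* w) * (A m 0 * Γₚ (m ℕ.* suc w))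
      e₂ = trans (solve 3 (λ a g h → a :* g :* h := g :* (a :* h)) refl (A m 0) (Γₚ (m ℕ.* w)) (Γₚ (m ℕ.* w ℕ.+ m))) (cong (λ z → Γₚ (m ℕ.* w) * (A m 0 * Γₚ z)) (sym ms))

    τm : ℚ
    τm = # m ^ (p ℕ.^ K)

    multiplication-n₀ : ∀ a → A m (n₀ (suc K) a ℕ.* η) * τm ^ (q ℕ.∸ a) ≈[ suc K ] A m 0 * Γₚ (n₀ (suc K) a)
    multiplication-n₀ a = ≈-trans (≈-*ˡ (Int-A m v) (≈-sym pow)) (≈-trans (multiplication v) (≈-*ˡ (Int-A m 0) (≈-trans (≈-reflexive (cong Γₚ mw)) (Γₚ-period K n (c₁ ℕ.* n)))))
      where
      n = n₀ (suc K) a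
      v = n ℕ.* η
      mw : m ℕ.* v ≡ p ℕ.^ suc K ℕ.* (c₁ ℕ.* n) ℕ.+ n
      mw = trans (NS.solve 3 (λ m n e → m NS.:* (n NS.:* e) NS.:= n NS.:* (m NS.:* e)) refl m n η) (trans (cong (n ℕ.*_) mη) (NS.solve 3 (λ n x c → n NS.:* (NS.con 1 NS.:+ x NS.:* c) NS.:= x NS.:* (c NS.:* n) NS.:+ n) refl n (p ℕ.^ suc K) c₁))
      -- Each full period contains q p^K units, and m^(q p^K) ≡ 1 by Euler. The (q - a) p^K units
      -- below n₀ give the power of ω(m).
      pow : # m ^ U (m ℕ.* v) ≈[ suc K ] τm ^ (q ℕ.∸ a)
      pow = ≈-trans (≈-reflexive (trans (cong (# m ^_) (trans (cong U mw) (trans (U-period K (c₁ ℕ.* n) n) (cong (q ℕ.* p ℕ.^ K ℕ.* (c₁ ℕ.* n) ℕ.+_) (trans (U-n₀ K a) (ℕP.*-comm (q ℕ.∸ a) (p ℕ.^ K)))))))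
          (trans (^-+ (# m) (q ℕ.* p ℕ.^ K ℕ.* (c₁ ℕ.* n)) (p ℕ.^ K ℕ.* (q ℕ.∸ a))) (cong₂ _*_ (^-* (# m) (q ℕ.* p ℕ.^ K) (c₁ ℕ.* n)) (^-* (# m) (p ℕ.^ K) (q ℕ.∸ a))))))
        (≈-trans (≈-*ʳ (Int-^ (q ℕ.∸ a) (Int-^ (p ℕ.^ K) (Int-# m))) (≈-trans (≈-^ (c₁ ℕ.* n) (Int-^ (q ℕ.* p ℕ.^ K) (Int-# m)) Int-1 (euler K m p∤m)) (≈-reflexive (1^ (c₁ ℕ.* n)))))
          (≈-reflexive (*-identityˡ (τm ^ (q ℕ.∸ a)))))

  inverse-mod : ∀ K m → ¬ (p ∣ m) → Σ ℕ λ η → Σ ℕ λ c₁ → m ℕ.* η ≡ 1 ℕ.+ p ℕ.^ suc K ℕ.* c₁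
  inverse-mod K zero    h = ⊥-elim (h (p ∣0))
  inverse-mod K (suc m) h = suc m ℕ.^ (e ℕ.∸ 1) , go (Div→∣ (suc K) (ℤ.+ (suc m ℕ.^ e ℕ.∸ 1)) dv)
    where
    e = q ℕ.* p ℕ.^ K
    e>0 : 0 ℕ.< e
    e>0 = ℕP.*-mono-< {0} {q} {0} 0<q (ℕP.≤-trans (s≤s z≤n) (n<p^n K))
    pos : 1 ℕ.≤ suc m ℕ.^ e
    pos = ℕP.m^n>0 (suc m) e
    dv : Div (suc K) (# (suc m ℕ.^ e ℕ.∸ 1))
    dv = Div-≡ (trans (cong (_- 1ℚ) (trans (sym (#-^ (suc m) e)) (trans (cong # (sym (ℕP.m∸n+n≡m pos))) (trans (#-+ (suc m ℕ.^ e ℕ.∸ 1) 1) (cong (# (suc m ℕ.^ e ℕ.∸ 1) +_) #1)))))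
      (solve 1 (λ x → (x :+ con 1ℚ) :- con 1ℚ := x) refl (# (suc m ℕ.^ e ℕ.∸ 1)))) (_≈[_]_.diff (euler K (suc m) h))
    go : p ℕ.^ suc K ∣ suc m ℕ.^ e ℕ.∸ 1 → Σ ℕ λ c₁ → suc m ℕ.* suc m ℕ.^ (e ℕ.∸ 1) ≡ 1 ℕ.+ p ℕ.^ suc K ℕ.* c₁
    go (divides z eq) = z , trans (cong (suc m ℕ.^_) (ℕP.m+[n∸m]≡n e>0)) (trans (sym (ℕP.m+[n∸m]≡n pos)) (cong (1 ℕ.+_) (trans eq (ℕP.*-comm z (p ℕ.^ suc K)))))

  -- Teichmüller representatives

  res : ℤ → ℕ
  res z = z %ℕ p

  res< : ∀ z → res z ℕ.< p
  res< z = n%ℕd<d z p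

  ι-res : ∀ z → ι z ≈[ 1 ] # (res z)
  ι-res z = mk (Div-≡ (sym (trans (cong (_- # (res z)) (trans (cong ι (a≡a%ℕn+[a/ℕn]*n z p)) (trans (ι-+ (ℤ.+ res z) ((z /ℕ p) ℤ.* (ℤ.+ p))) (cong (# (res z) +_) (ι-* (z /ℕ p) (ℤ.+ p))))))
    (solve 3 (λ r t p → (r :+ t :* p) :- r := p :* t) refl (# (res z)) (ι (z /ℕ p)) P))) (Div-*ʳ (∣→Div1 p ∣-refl) (Int-ι (z /ℕ p))))

  small-eq : ∀ x y → x ℕ.< p → y ℕ.< p → # x ≈[ 1 ] # y → x ≡ y
  small-eq x y lx ly h = [ (λ l → go x y lx ly h l) , (λ l → sym (go y x ly lx (≈-sym h) l)) ]′ (ℕP.≤-total x y)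
    where
    go : ∀ x y → x ℕ.< p → y ℕ.< p → # x ≈[ 1 ] # y → x ℕ.≤ y → x ≡ y
    go x y lx ly (mk h) l = fin (y ℕ.∸ x) refl (Div1→∣ (y ℕ.∸ x) (Div-≡ e (Div-neg h)))
      where
      e : - (# x - # y) ≡ # (y ℕ.∸ x)
      e = trans (cong (λ z → - (# x - z)) (trans (cong # (sym (ℕP.m+[n∸m]≡n l))) (#-+ x (y ℕ.∸ x)))) (solve 2 (λ a b → :- (a :- (a :+ b)) := b) refl (# x) (# (y ℕ.∸ x)))
      fin : ∀ d → d ≡ y ℕ.∸ x → p ∣ d → x ≡ y
      fin zero    ed _ = trans (sym (ℕP.+-identityʳ x)) (trans (cong (x ℕ.+_) ed) (ℕP.m+[n∸m]≡n l))
      fin (suc d) ed k = ⊥-elim (ℕP.<-irrefl refl (ℕP.≤-trans (s≤s (∣⇒≤ k)) (ℕP.≤-trans (s≤s (ℕP.≤-trans (ℕP.≤-reflexive ed) (ℕP.m∸n≤m y x))) ly)))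

  -- The two sides are the row sums and the column sums of the matrix with entry F y at the places
  -- (x, y) with π x = y and 0 elsewhere.
  ∑-perm : ∀ n (π σ : ℕ → ℕ) (F : ℕ → ℚ) → (∀ x → x ℕ.< n → π x ℕ.< n) → (∀ y → y ℕ.< n → σ y ℕ.< n) →
    (∀ x → x ℕ.< n → σ (π x) ≡ x) → (∀ y → y ℕ.< n → π (σ y) ≡ y) → ∑ n (F ∘ π) ≡ ∑ n F
  ∑-perm n π σ F π< σ< σπ πσ = trans (∑-cong n (λ x l → sym (row x l))) (trans (∑-swap n n (λ x y → eqv (π x) y * F y)) (∑-cong n (λ y l → col y l)))
    where
    eqv : ℕ → ℕ → ℚ
    eqv zero    zero    = 1ℚ
    eqv zero    (suc b) = 0ℚ
    eqv (suc a) zero    = 0ℚ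
    eqv (suc a) (suc b) = eqv a b
    eqv-refl : ∀ a → eqv a a ≡ 1ℚ
    eqv-refl zero    = refl
    eqv-refl (suc a) = eqv-refl a
    eqv-≢ : ∀ a b → a ≢ b → eqv a b ≡ 0ℚ
    eqv-≢ zero    zero    h = ⊥-elim (h refl)
    eqv-≢ zero    (suc b) h = refl
    eqv-≢ (suc a) zero    h = refl
    eqv-≢ (suc a) (suc b) h = eqv-≢ a b (h ∘ cong suc)
    row : ∀ x → x ℕ.< n → ∑ n (λ y → eqv (π x) y * F y) ≡ F (π x)
    row x l = trans (∑-single n (λ y → eqv (π x) y * F y) (π x) (π< x l) (λ y _ ne → trans (cong (_* F y) (eqv-≢ (π x) y (ne ∘ sym))) (*-zeroˡ (F y))))
      (trans (cong (_* F (π x)) (eqv-refl (π x))) (*-identityˡ (F (π x))))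
    col : ∀ y → y ℕ.< n → ∑ n (λ x → eqv (π x) y * F y) ≡ F y
    col y l = trans (∑-single n (λ x → eqv (π x) y * F y) (σ y) (σ< y l) (λ x lx ne → trans (cong (_* F y) (eqv-≢ (π x) y (λ e → ne (trans (sym (σπ x lx)) (cong σ e))))) (*-zeroˡ (F y))))
      (trans (cong (λ z → eqv z y * F y) (πσ y l)) (trans (cong (_* F y) (eqv-refl y)) (*-identityˡ (F y))))

  τ : ℕ → ℤ → ℚ
  τ L z = ι z ^ (p ℕ.^ L)

  Int-τ : ∀ L z → Int (τ L z)
  Int-τ L z = Int-^ (p ℕ.^ L) (Int-ι z)

  τ-cong : ∀ L z z′ → ι z ≈[ 1 ] ι z′ → τ L z ≈[ suc L ] τ L z′
  τ-cong L z z′ h = ≈-weaken (s≤s (ℕP.m≤m+n L 0)) (≈-lift^ L (Int-ι z) (Int-ι z′) h)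

  fermat-ι : ∀ z → ι z ^ p ≈[ 1 ] ι z
  fermat-ι z = ≈-trans (≈-^ p (Int-ι z) (Int-# (res z)) (ι-res z)) (≈-trans (fermat (res z)) (≈-sym (ι-res z)))

  τ≈1 : ∀ L z → τ L z ≈[ 1 ] ι z
  τ≈1 zero    z = ≈-reflexive (*-identityʳ (ι z))
  τ≈1 (suc L) z = ≈-trans (≈-reflexive (^-* (ι z) p (p ℕ.^ L))) (≈-trans (≈-^ (p ℕ.^ L) (Int-^ p (Int-ι z)) (Int-ι z) (fermat-ι z)) (τ≈1 L z))

  τ^p : ∀ L z → τ L z ^ p ≈[ suc L ] τ L z
  τ^p L z = ≈-≡ (trans (sym (^-* (ι z) p (p ℕ.^ L))) (trans (cong (ι z ^_) (ℕP.*-comm p (p ℕ.^ L))) (^-* (ι z) (p ℕ.^ L) p))) refl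
    (≈-weaken (s≤s (ℕP.m≤m+n L 0)) (≈-lift^ L (Int-^ p (Int-ι z)) (Int-ι z) (fermat-ι z)))

  τ-* : ∀ L y z → τ L (y ℤ.* z) ≡ τ L y * τ L z
  τ-* L y z = trans (cong (_^ (p ℕ.^ L)) (ι-* y z)) (*-^ (ι y) (ι z) (p ℕ.^ L))

  Unit-τ : ∀ L z → ¬ (p ∣ ℤ.∣ z ∣) → Unit (τ L z)
  Unit-τ L z h = Unit-^ (p ℕ.^ L) (Unit-ι z h)

  τ^q : ∀ L z → ¬ (p ∣ ℤ.∣ z ∣) → τ L z ^ q ≈[ suc L ] 1ℚ
  τ^q L z h = ≈-cancelUnit (Unit-τ L z h) (≈-trans (τ^p L z) (≈-reflexive (sym (*-identityʳ (τ L z)))))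

  p^≢0 : ∀ L → Σ ℕ λ m → p ℕ.^ L ≡ suc m
  p^≢0 L = p ℕ.^ L ℕ.∸ 1 , sym (ℕP.m+[n∸m]≡n {1} (ℕP.≤-trans (s≤s z≤n) (n<p^n L)))

  τ-0 : ∀ L → τ L (ℤ.+ 0) ≡ 0ℚ
  τ-0 L = trans (cong₂ _^_ #0 (proj₂ (p^≢0 L))) (0^ (proj₁ (p^≢0 L)))

  τ-step : ∀ L n z → τ (n ℕ.+ L) z ≈[ suc L ] τ L z
  τ-step L zero    z = ≈-refl
  τ-step L (suc n) z = ≈-trans (≈-reflexive (trans (cong (ι z ^_) (ℕP.*-comm p (p ℕ.^ (n ℕ.+ L)))) (^-* (ι z) (p ℕ.^ (n ℕ.+ L)) p))) (≈-trans (≈-weaken (s≤s (ℕP.m≤n+m L n)) (τ^p (n ℕ.+ L) z)) (τ-step L n z))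

  search : ∀ r n → (∀ i → i ℕ.< n → p ∣ suc i ℕ.^ r ℕ.∸ 1) ⊎ Σ ℕ λ i → i ℕ.< n × ¬ (p ∣ suc i ℕ.^ r ℕ.∸ 1)
  search r zero = inj₁ (λ i ())
  search r (suc n) = go (search r n) (p ∣? suc n ℕ.^ r ℕ.∸ 1)
    where
    go : ((∀ i → i ℕ.< n → p ∣ suc i ℕ.^ r ℕ.∸ 1) ⊎ Σ ℕ λ i → i ℕ.< n × ¬ (p ∣ suc i ℕ.^ r ℕ.∸ 1)) → Dec (p ∣ suc n ℕ.^ r ℕ.∸ 1) →
      (∀ i → i ℕ.< suc n → p ∣ suc i ℕ.^ r ℕ.∸ 1) ⊎ Σ ℕ λ i → i ℕ.< suc n × ¬ (p ∣ suc i ℕ.^ r ℕ.∸ 1)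
    go (inj₂ (i , l , h)) d = inj₂ (i , ℕP.m≤n⇒m≤1+n l , h)
    go (inj₁ h) (no nd) = inj₂ (n , ℕP.≤-refl , nd)
    go (inj₁ h) (yes d) = inj₁ (λ i l → [ (λ l′ → h i l′) , (λ e → subst (λ i → p ∣ suc i ℕ.^ r ℕ.∸ 1) (sym e) d) ]′ (ℕP.m≤n⇒m<n∨m≡n (ℕP.≤-pred l)))

  #^-1 : ∀ i r → # (suc i) ^ r - 1ℚ ≡ # (suc i ℕ.^ r ℕ.∸ 1)
  #^-1 i r = trans (cong (_- 1ℚ) (trans (sym (#-^ (suc i) r)) (trans (cong # (sym (ℕP.m∸n+n≡m (ℕP.m^n>0 (suc i) r)))) (trans (#-+ (suc i ℕ.^ r ℕ.∸ 1) 1) (cong (# (suc i ℕ.^ r ℕ.∸ 1) +_) #1)))))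
    (solve 1 (λ x → (x :+ con 1ℚ) :- con 1ℚ := x) refl (# (suc i ℕ.^ r ℕ.∸ 1)))

  ¬Div1-1 : ¬ Div 1 1ℚ
  ¬Div1-1 h = p∤1 (Div1→∣ 1 (Div-≡ (sym #1) h))

  Unit-fac : ∀ n → n ℕ.< p → Unit (fac n)
  Unit-fac zero    l       = Unit-1
  Unit-fac (suc n) (s≤s l) = Unit-* (Unit-# (suc n) (p∤<p n l)) (Unit-fac n (ℕP.m≤n⇒m≤1+n l))

  -- x^r - 1 of degree r < p - 1 cannot vanish modulo p at 1, …, r + 1, for its r-th difference is r!.
  nonroot : ∀ r → suc r ℕ.< q → Σ ℕ λ i → suc i ℕ.< p × ¬ (p ∣ suc i ℕ.^ suc r ℕ.∸ 1)
  nonroot r l = go (search (suc r) (suc (suc r)))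
    where
    go : ((∀ i → i ℕ.< suc (suc r) → p ∣ suc i ℕ.^ suc r ℕ.∸ 1) ⊎ Σ ℕ λ i → i ℕ.< suc (suc r) × ¬ (p ∣ suc i ℕ.^ suc r ℕ.∸ 1)) → Σ ℕ λ i → suc i ℕ.< p × ¬ (p ∣ suc i ℕ.^ suc r ℕ.∸ 1)
    go (inj₂ (i , li , h)) = i , s≤s (ℕP.≤-trans li l) , h
    go (inj₁ h) = ⊥-elim (¬Div1-1 (Div-cancelUnit (Unit-fac (suc r) (ℕP.m≤n⇒m≤1+n l)) (Div-≡ (sym (*-identityʳ (fac (suc r)))) d)))
      where
      d : Div 1 (fac (suc r))
      d = ≈0→Div (≈-trans (≈-reflexive (sym (Δ^-pow (suc r) 1))) (≈-trans (Δ^-≈ (suc r) 1 (λ i li → mk (Div-≡ (trans (sym (#^-1 i (suc r))) (cong (λ n → # n ^ suc r - 1ℚ) (ℕP.+-comm 1 i))) (∣→Div1 (suc i ℕ.^ suc r ℕ.∸ 1) (h i (s≤s li))))))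
        (≈-reflexive (Δ^-const r 1ℚ 1))))

  powerSum : ℕ → ℕ → ℚ
  powerSum L r = ∑ p (λ x → τ L (ℤ.+ x) ^ r)

  Int-powerSum : ∀ L r → Int (powerSum L r)
  Int-powerSum L r = Int-∑ p (λ x → Int-^ r (Int-τ L (ℤ.+ x)))

  -- For the g of `nonroot` the substitution x ↦ gx permutes the residues and multiplies the sum by
  -- ω(g)^(r+1), which differs from 1 by a unit.
  powerSum-zero : ∀ L r → suc r ℕ.< q → powerSum L (suc r) ≈[ suc L ] 0ℚ
  powerSum-zero L r l = go (nonroot r l)
    where
    F : ℕ → ℚ
    F x = τ L (ℤ.+ x) ^ suc r
    F-cong : ∀ x y → # x ≈[ 1 ] # y → F x ≈[ suc L ] F y
    F-cong x y h = ≈-^ (suc r) (Int-τ L (ℤ.+ x)) (Int-τ L (ℤ.+ y)) (τ-cong L (ℤ.+ x) (ℤ.+ y) h)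
    F-* : ∀ x y → F (x ℕ.* y) ≡ F x * F y
    F-* x y = trans (cong (_^ suc r) (trans (cong (τ L) (ℤP.pos-* x y)) (τ-* L (ℤ.+ x) (ℤ.+ y)))) (*-^ (τ L (ℤ.+ x)) (τ L (ℤ.+ y)) (suc r))
    go : (Σ ℕ λ i → suc i ℕ.< p × ¬ (p ∣ suc i ℕ.^ suc r ℕ.∸ 1)) → powerSum L (suc r) ≈[ suc L ] 0ℚ
    go (i , s≤s li , hi) = Div→≈0 (Div-cancelUnit u (Div-≡ (solve 2 (λ f s → f :* s :- s := (f :- con 1ℚ) :* s) refl (F g) Sm) (_≈[_]_.diff sum-eq)))
      where
      g = suc i
      Sm = powerSum L (suc r)
      p∤g : ¬ (p ∣ g)
      p∤g = p∤<p i li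
      inv : Σ ℕ λ η → Σ ℕ λ c₁ → g ℕ.* η ≡ 1 ℕ.+ p ℕ.^ 1 ℕ.* c₁
      inv = inverse-mod 0 g p∤g
      g′ = proj₁ inv
      π σ : ℕ → ℕ
      π x = res (ℤ.+ (g ℕ.* x))
      σ y = res (ℤ.+ (g′ ℕ.* y))
      gg′ : # (g ℕ.* g′) ≈[ 1 ] 1ℚ
      gg′ = ≈-trans (≈-*N 1 (g ℕ.* g′) 1 (proj₁ (proj₂ inv)) (proj₂ (proj₂ inv))) (≈-reflexive #1)
      back : ∀ a b x → # (a ℕ.* b) ≈[ 1 ] 1ℚ → # (res (ℤ.+ (a ℕ.* res (ℤ.+ (b ℕ.* x))))) ≈[ 1 ] # x
      back a b x h = ≈-trans (≈-sym (ι-res (ℤ.+ (a ℕ.* res (ℤ.+ (b ℕ.* x)))))) (≈-trans (≈-reflexive (#-* a (res (ℤ.+ (b ℕ.* x)))))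
        (≈-trans (≈-*ˡ (Int-# a) (≈-sym (ι-res (ℤ.+ (b ℕ.* x))))) (≈-trans (≈-reflexive (trans (cong (# a *_) (#-* b x)) (trans (sym (*-assoc (# a) (# b) (# x))) (cong (_* # x) (sym (#-* a b))))))
          (≈-trans (≈-*ʳ (Int-# x) h) (≈-reflexive (*-identityˡ (# x)))))))
      perm : ∑ p (F ∘ π) ≡ Sm
      perm = ∑-perm p π σ F (λ x _ → res< (ℤ.+ (g ℕ.* x))) (λ y _ → res< (ℤ.+ (g′ ℕ.* y)))
        (λ x lx → small-eq _ x (res< (ℤ.+ (g′ ℕ.* π x))) lx (back g′ g x (≈-trans (≈-reflexive (cong # (ℕP.*-comm g′ g))) gg′)))
        (λ y ly → small-eq _ y (res< (ℤ.+ (g ℕ.* σ y))) ly (back g g′ y gg′))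
      sum-eq : F g * Sm ≈[ suc L ] Sm
      sum-eq = ≈-trans (≈-reflexive (sym (∑-*ˡ p (F g) F))) (≈-trans (≈-∑ p (λ x _ → ≈-trans (≈-reflexive (sym (F-* g x))) (F-cong (g ℕ.* x) (π x) (ι-res (ℤ.+ (g ℕ.* x)))))) (≈-reflexive perm))
      z : ℕ
      z = (g ℕ.^ (p ℕ.^ L)) ℕ.^ suc r
      Fz : F g ≡ # z
      Fz = trans (cong (_^ suc r) (sym (#-^ g (p ℕ.^ L)))) (sym (#-^ (g ℕ.^ (p ℕ.^ L)) (suc r)))
      Fz-1 : ι ((ℤ.+ z) ℤ.- (ℤ.+ 1)) ≡ F g - 1ℚ
      Fz-1 = trans (ι-- (ℤ.+ z) (ℤ.+ 1)) (trans (cong (_- # 1) (sym Fz)) (cong (λ y → F g - y) #1))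
      u : Unit (F g - 1ℚ)
      u = subst Unit Fz-1 (Unit-ι ((ℤ.+ z) ℤ.- (ℤ.+ 1)) (λ d → hi (Div1→∣ (g ℕ.^ suc r ℕ.∸ 1) (Div-≡ (#^-1 i (suc r))
        (_≈[_]_.diff {y = 1ℚ} (≈-trans (≈-^ (suc r) (Int-# g) (Int-τ L (ℤ.+ g)) (≈-sym (τ≈1 L (ℤ.+ g)))) (mk (Div-≡ Fz-1
          (∣→Div-ι 1 ((ℤ.+ z) ℤ.- (ℤ.+ 1)) (subst (_∣ ℤ.∣ (ℤ.+ z) ℤ.- (ℤ.+ 1) ∣) (sym (ℕP.*-identityʳ p)) d))))))))))

  p∤suc : ∀ x → suc x ℕ.< p → ¬ (p ∣ suc x)
  p∤suc x (s≤s l) = p∤<p x l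

  powerSum-period : ∀ L r m → powerSum L (suc r ℕ.+ q ℕ.* m) ≈[ suc L ] powerSum L (suc r)
  powerSum-period L r m = ≈-∑ p t
    where
    t : ∀ x → x ℕ.< p → τ L (ℤ.+ x) ^ (suc r ℕ.+ q ℕ.* m) ≈[ suc L ] τ L (ℤ.+ x) ^ suc r
    t zero    l = ≈-reflexive (trans (cong (_^ (suc r ℕ.+ q ℕ.* m)) (τ-0 L)) (trans (0^ (r ℕ.+ q ℕ.* m)) (sym (trans (cong (_^ suc r) (τ-0 L)) (0^ r)))))
    t (suc x) l = ≈-trans (≈-reflexive (trans (^-+ (τ L (ℤ.+ suc x)) (suc r) (q ℕ.* m)) (cong (τ L (ℤ.+ suc x) ^ suc r *_) (^-* (τ L (ℤ.+ suc x)) q m))))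
      (≈-trans (≈-*ˡ (Int-^ (suc r) (Int-τ L (ℤ.+ suc x))) (≈-trans (≈-^ m (Int-^ q (Int-τ L (ℤ.+ suc x))) Int-1 (τ^q L (ℤ.+ suc x) (p∤suc x l))) (≈-reflexive (1^ m)))) (≈-reflexive (*-identityʳ (τ L (ℤ.+ suc x) ^ suc r))))

  powerSum-q : ∀ L m → powerSum L (q ℕ.* suc m) ≈[ suc L ] # q
  powerSum-q L m = ≈-trans (≈-∑ p t) (≈-reflexive (trans (+-identityˡ (∑ q (λ _ → 1ℚ))) (trans (∑-const q 1ℚ) (*-identityʳ (# q)))))
    where
    f : ℕ → ℚ
    f zero    = 0ℚ
    f (suc _) = 1ℚ
    q≡ : q ℕ.* suc m ≡ suc (q ℕ.* suc m ℕ.∸ 1)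
    q≡ = sym (ℕP.m+[n∸m]≡n {1} (ℕP.*-mono-< {0} {q} {0} 0<q (s≤s (z≤n {m}))))
    t : ∀ x → x ℕ.< p → τ L (ℤ.+ x) ^ (q ℕ.* suc m) ≈[ suc L ] f x
    t zero    l = ≈-reflexive (trans (cong₂ _^_ (τ-0 L) q≡) (0^ (q ℕ.* suc m ℕ.∸ 1)))
    t (suc x) l = ≈-trans (≈-reflexive (^-* (τ L (ℤ.+ suc x)) q (suc m))) (≈-trans (≈-^ (suc m) (Int-^ q (Int-τ L (ℤ.+ suc x))) Int-1 (τ^q L (ℤ.+ suc x) (p∤suc x l))) (≈-reflexive (1^ (suc m))))

  powerSum-eq : ∀ L r → 0 ℕ.< r → powerSum L r ≈[ suc L ] # q * δ₀ (r ℕD.% q)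
  powerSum-eq L r hr = go r hr (divMod-q r)
    where
    go : ∀ r → 0 ℕ.< r → Σ ℕ (λ a → Σ ℕ λ n → a ℕ.< q × r ≡ a ℕ.+ q ℕ.* n) → powerSum L r ≈[ suc L ] # q * δ₀ (r ℕD.% q)
    go _ hr (zero , zero , l , refl) = ⊥-elim (ℕP.<-irrefl (sym (ℕP.*-zeroʳ q)) hr)
    go _ hr (zero , suc m , l , refl) = ≈-trans (powerSum-q L m) (≈-reflexive (trans (sym (*-identityʳ (# q))) (cong (λ z → # q * δ₀ z) (sym (%q-eq 0 (suc m) l)))))
    go _ hr (suc a , m , l , refl) = ≈-trans (powerSum-period L a m) (≈-trans (powerSum-zero L a l) (≈-reflexive (trans (sym (*-zeroʳ (# q))) (cong (λ z → # q * δ₀ z) (sym (%q-eq (suc a) m l))))))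

  δ-χ : ∀ s a e₁ → a ℕ.< q → s ℕ.+ a ≡ q ℕ.* e₁ → ∀ n → δ₀ ((s ℕ.+ n) ℕD.% q) ≡ χ a n
  δ-χ s a e₁ la hs n = go n (divMod-q n)
    where
    go : ∀ n → Σ ℕ (λ r → Σ ℕ λ m → r ℕ.< q × n ≡ r ℕ.+ q ℕ.* m) → δ₀ ((s ℕ.+ n) ℕD.% q) ≡ χ a n
    go _ (r , m , l , refl) = [ eq , ne ]′ (dec (r ℕ.≟ a))
      where
      dec : Dec (r ≡ a) → (r ≡ a) ⊎ (r ≢ a)
      dec (yes e) = inj₁ e
      dec (no ne) = inj₂ ne
      eq : r ≡ a → δ₀ ((s ℕ.+ (r ℕ.+ q ℕ.* m)) ℕD.% q) ≡ χ a (r ℕ.+ q ℕ.* m)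
      eq refl = trans (cong δ₀ (trans (cong (ℕD._% q) (trans (sym (ℕP.+-assoc s r (q ℕ.* m))) (trans (cong (ℕ._+ q ℕ.* m) hs) (sym (ℕP.*-distribˡ-+ q e₁ m))))) (%q-eq 0 (e₁ ℕ.+ m) 0<q)))
        (sym (χ-yes r (r ℕ.+ q ℕ.* m) (%q-eq r m l)))
      ne : r ≢ a → δ₀ ((s ℕ.+ (r ℕ.+ q ℕ.* m)) ℕD.% q) ≡ χ a (r ℕ.+ q ℕ.* m)
      ne h = trans (g (divMod-q (s ℕ.+ (r ℕ.+ q ℕ.* m)))) (sym (χ-no a (r ℕ.+ q ℕ.* m) (λ e → h (trans (sym (%q-eq r m l)) e))))
        where
        g : Σ ℕ (λ u → Σ ℕ λ k → u ℕ.< q × s ℕ.+ (r ℕ.+ q ℕ.* m) ≡ u ℕ.+ q ℕ.* k) → δ₀ ((s ℕ.+ (r ℕ.+ q ℕ.* m)) ℕD.% q) ≡ 0ℚ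
        g (suc u , k , lu , eu) = cong δ₀ (trans (cong (ℕD._% q) eu) (%q-eq (suc u) k lu))
        g (zero  , k , lu , eu) = ⊥-elim (h (trans (sym (%q-eq r (m ℕ.+ e₁) l)) (trans (cong (ℕD._% q) eq′) (%q-eq a k la))))
          where
          eq′ : r ℕ.+ q ℕ.* (m ℕ.+ e₁) ≡ a ℕ.+ q ℕ.* k
          eq′ = begin
            r ℕ.+ q ℕ.* (m ℕ.+ e₁)               ≡⟨ cong (r ℕ.+_) (ℕP.*-distribˡ-+ q m e₁) ⟩
            r ℕ.+ (q ℕ.* m ℕ.+ q ℕ.* e₁)         ≡⟨ cong (λ z → r ℕ.+ (q ℕ.* m ℕ.+ z)) (sym hs) ⟩
            r ℕ.+ (q ℕ.* m ℕ.+ (s ℕ.+ a))        ≡⟨ NS.solve 4 (λ r x s a → r NS.:+ (x NS.:+ (s NS.:+ a)) NS.:= a NS.:+ (s NS.:+ (r NS.:+ x))) refl r (q ℕ.* m) s a ⟩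
            a ℕ.+ (s ℕ.+ (r ℕ.+ q ℕ.* m))        ≡⟨ cong (a ℕ.+_) eu ⟩
            a ℕ.+ q ℕ.* k                        ∎
            where open ≡-Reasoning

  -- Jacobi sums

  δ∣ : ℕ → ℚ
  δ∣ n = 1ℚ - # (ν n)

  q≡P-1 : # q ≡ - (1ℚ - P)
  q≡P-1 = trans (solve 1 (λ x → x := :- (con 1ℚ :- (con 1ℚ :+ x))) refl (# q)) (cong (λ z → - (1ℚ - z)) (sym (#-suc q)))

  Int-δ∣ : ∀ n → Int (δ∣ n)
  Int-δ∣ n = Int-- Int-1 (Int-# (ν n))

  gauss-0 : ∀ E M → E ℕ.* (p ℕ.* p) ℕ.≤ M → (1ℚ - P) * gauss 0 M ≈[ E ] 1ℚ
  gauss-0 E M hM = ≈-trans (gross-koblitz′ E (suc E) 0 0<q ℕP.≤-refl M hM) (≈-weaken (ℕP.m≤n+m E 2) (≈-trans (≈-reflexive (cong Γₚ (trans (repunit-eq (suc (suc E))) (sym (ℕP.+-identityʳ (p ℕ.^ suc (suc E))))))) (≈-trans (Γₚ-period1 (suc E) 0) (≈-reflexive refl))))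

  -- Averaged over the nontrivial additive characters, ζ^n is -1/(p-1) unless p divides n.
  trace-val : ∀ E M L → suc E ℕ.* (p ℕ.* p) ℕ.≤ M → E ℕ.≤ L → ∀ a b n → a ≈[ 1 ] # n → b ≈[ 1 ] # n → Div (suc (slope (M ℕ.* q) ℕ.+ E)) (a - b) → slope (M ℕ.* q) ℕ.+ E ℕ.≤ L →
    (1ℚ - P) * trace M (X a b) ≈[ E ] 1ℚ - P * δ∣ n
  trace-val E M L hM hL a b n ha hb hab hs = go (p ∣? n)
    where
    E≤M : E ℕ.* (p ℕ.* p) ℕ.≤ M
    E≤M = ℕP.≤-trans (ℕP.m≤n+m (E ℕ.* (p ℕ.* p)) (p ℕ.* p)) hM
    i1 : Int (1ℚ - P)
    i1 = Int-- Int-1 (Int-# p)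
    near : ∀ x t → Div 1 (x - t) → Σ ℚ λ α → Int α × x ≡ t + P * α
    near x t (div y iy e) = y , iy , trans (solve 2 (λ x t → x := t :+ (x :- t)) refl x t) (cong (t +_) (trans e (cong (_* y) (*-identityʳ P))))
    go : Dec (p ∣ n) → (1ℚ - P) * trace M (X a b) ≈[ E ] 1ℚ - P * δ∣ n
    go (yes d) = h (near a 0ℚ (_≈[_]_.diff (≈-trans ha (Div→≈0 (∣→Div1 n d))))) (near b 0ℚ (_≈[_]_.diff (≈-trans hb (Div→≈0 (∣→Div1 n d)))))
      where
      h : (Σ ℚ λ α → Int α × a ≡ 0ℚ + P * α) → (Σ ℚ λ β → Int β × b ≡ 0ℚ + P * β) → (1ℚ - P) * trace M (X a b) ≈[ E ] 1ℚ - P * δ∣ n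
      h (α , iα , ea) (β , iβ , eb) = ≈-trans (≈-*ˡ i1 (≈-trans (≈-reflexive (cong₂ (λ u v → trace M (X u v)) ea eb)) (≈-trans (trace-inv E M 0ℚ 0ℚ α β Lat-X00 iα iβ
          (Div-≡ (trans (cong₂ _-_ ea eb) (solve 2 (λ x y → (con 0ℚ :+ x) :- (con 0ℚ :+ y) := x :- y) refl (P * α) (P * β))) hab) hM)
          (≈-reflexive (trace-X00 M (ℕP.≤-trans (ℕP.≤-trans (s≤s z≤n) (ℕP.m≤m+n (p ℕ.* p) (E ℕ.* (p ℕ.* p)))) hM))))))
        (≈-reflexive (trans (solve 1 (λ P → (con 1ℚ :- P) :* con 1ℚ := con 1ℚ :- P :* (con 1ℚ :- con 0ℚ)) refl P) (cong (λ z → 1ℚ - P * (1ℚ - z)) (sym (trans (cong # (ν-yes n d)) #0)))))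
    go (no nd) = h (near a t (_≈[_]_.diff (≈-trans ha (≈-sym (τ≈1 L (ℤ.+ n)))))) (near b (t ^ p) (_≈[_]_.diff (≈-trans hb (≈-sym (≈-trans (≈-weaken (s≤s z≤n) (τ^p L (ℤ.+ n))) (τ≈1 L (ℤ.+ n)))))))
      where
      t = τ L (ℤ.+ n)
      h : (Σ ℚ λ α → Int α × a ≡ t + P * α) → (Σ ℚ λ β → Int β × b ≡ t ^ p + P * β) → (1ℚ - P) * trace M (X a b) ≈[ E ] 1ℚ - P * δ∣ n
      h (α , iα , ea) (β , iβ , eb) = ≈-trans (≈-*ˡ i1 (≈-trans (≈-reflexive (cong₂ (λ u v → trace M (X u v)) ea eb)) (≈-trans (trace-inv E M t (t ^ p) α β (Lat-τ t (Int-τ L (ℤ.+ n))) iα iβ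
          (Div-≡ (trans (cong₂ (λ u v → (u - v) + (t ^ p - t)) ea eb) (solve 4 (λ t s x y → ((t :+ x) :- (s :+ y)) :+ (s :- t) := x :- y) refl t (t ^ p) (P * α) (P * β)))
            (Div-+ hab (Div-weaken (s≤s hs) (_≈[_]_.diff (τ^p L (ℤ.+ n)))))) hM) (trace-τ E M t (Int-τ L (ℤ.+ n)) (≈-weaken (ℕP.m≤n⇒m≤1+n hL) (τ^q L (ℤ.+ n) nd))))))
        (≈-trans (gauss-0 E M E≤M) (≈-reflexive (trans (solve 1 (λ P → con 1ℚ := con 1ℚ :- P :* (con 1ℚ :- con 1ℚ)) refl P) (cong (λ z → 1ℚ - P * (1ℚ - z)) (sym (trans (cong # (ν-no n nd)) #1))))))

  DLat : ℕ → Seq → Set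
  DLat e f = ∀ n → Div e (P ^ slope n * f n)

  slope-+ : ∀ i j → slope i ℕ.+ slope j ℕ.≤ slope (i ℕ.+ j)
  slope-+ i j = ℕP.≤-trans (ℕP.≤-reflexive (NS.solve 4 (λ a b c d → (a NS.:+ b) NS.:+ (c NS.:+ d) NS.:= (a NS.:+ c) NS.:+ (b NS.:+ d)) refl (v/p i) (v/p (v/p i)) (v/p j) (v/p (v/p j))))
    (ℕP.+-mono-≤ (h i j) (ℕP.≤-trans (h (v/p i) (v/p j)) (v/p-mono (h i j))))
    where
    h : ∀ i j → v/p i ℕ.+ v/p j ℕ.≤ v/p (i ℕ.+ j)
    h i j = ℕP.≤-trans (ℕP.≤-reflexive (sym (ℕD.m*n/n≡m (v/p i ℕ.+ v/p j) p))) (v/p-mono (ℕP.≤-trans (ℕP.≤-reflexive (ℕP.*-distribʳ-+ p (v/p i) (v/p j))) (ℕP.+-mono-≤ (ℕD.m/n*n≤m i p) (ℕD.m/n*n≤m j p))))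

  DLat-⋆ : ∀ e e′ f g → DLat e f → DLat e′ g → DLat (e ℕ.+ e′) (f ⋆ g)
  DLat-⋆ e e′ f g hf hg n = Div-≡ (⋆-*ˡ (P ^ slope n) f g n) (Div-⋆ (e ℕ.+ e′) (λ i → P ^ slope n * f i) g n t)
    where
    t : ∀ i j → i ℕ.+ j ≡ n → Div (e ℕ.+ e′) (P ^ slope n * f i * g j)
    t i j refl = Div-≡ (trans (solve 5 (λ d a f b g → d :* (a :* f :* (b :* g)) := (a :* b :* d) :* f :* g) refl (P ^ d) (P ^ slope i) (f i) (P ^ slope j) (g j))
        (cong (λ z → z * f i * g j) (trans (cong (_* P ^ d) (sym (^-+ P (slope i) (slope j)))) (trans (sym (^-+ P (slope i ℕ.+ slope j) d)) (cong (P ^_) (ℕP.m+[n∸m]≡n (slope-+ i j)))))))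
      (Div-*ˡ (Int-^ d (Int-# p)) (Div-* (hf i) (hg j)))
      where d = slope (i ℕ.+ j) ℕ.∸ (slope i ℕ.+ slope j)

  DLat-c : DLat 0 c
  DLat-c n = Int→Div (Int-c n)

  DLat-*c : ∀ e (u : Seq) → (∀ n → Div e (u n)) → DLat e (λ n → u n * c n)
  DLat-*c e u hu n = Div-≡ (solve 3 (λ a u c → u :* (a :* c) := a :* (u :* c)) refl (P ^ slope n) (u n) (c n)) (Div-*ʳ (hu n) (Int-c n))

  module JacobiSum (L i : ℕ) (i>0 : 0 ℕ.< i) (i<q : i ℕ.< q) where

    t : ℕ → ℚ
    t x = τ L (ℤ.+ x)

    Jac : ℚ
    Jac = ∑ p (λ x → ∑ p (λ y → δ∣ (1 ℕ.+ x ℕ.+ y) * (t x ^ (i ℕ.+ i) * t y ^ i)))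

    f : ℕ → Seq
    f x = X (t x) (t x ^ p)

    -- The series `f x` summed over x against ω(x)^r. Orthogonality of characters leaves q times the
    -- part of `c` with n ≡ -r modulo p - 1.
    F : ℕ → Seq
    F r n = powerSum L (r ℕ.+ n) * c n

    F-∑ : ∀ r n → ∑ p (λ x → t x ^ r * f x n) ≡ F r n
    F-∑ r n = trans (∑-ext p (λ x → trans (cong (t x ^ r *_) (X-τ (t x) n)) (trans (sym (*-assoc (t x ^ r) (t x ^ n) (c n))) (cong (_* c n) (sym (^-+ (t x) r n)))))) (∑-*ʳ p (λ x → t x ^ (r ℕ.+ n)) (c n))

    lam-xy μ-xy : ℕ → ℕ → ℚ
    lam-xy x y = 1ℚ + (t x + t y)
    μ-xy x y = 1ℚ + (t x ^ p + t y ^ p)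

    X-xy : ∀ x y n → X (lam-xy x y) (μ-xy x y) n ≡ (c ⋆ (f x ⋆ f y)) n
    X-xy x y n = trans (X-⋆′ 1ℚ 1ℚ (t x + t y) (t x ^ p + t y ^ p) refl refl n) (⋆-ext {c} {c} (λ _ → refl) (λ m → X-⋆′ (t x) (t x ^ p) (t y) (t y ^ p) refl refl m) n)

    -- The sum of ω(x²y)^i ζ^(1+x+y) over x and y, the trace acting as the average over ζ ≠ 1.
    -- Summing over x and y under the trace gives three Gauss sums; taking the trace first gives the
    -- Jacobi sum. The constant 1 in the exponent is a third variable scaled away, and the trace
    -- recovers its character.
    S₁ : ℕ → ℚ
    S₁ M = ∑ p (λ x → ∑ p (λ y → t x ^ (i ℕ.+ i) * (t y ^ i * trace M (X (lam-xy x y) (μ-xy x y)))))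

    expand : ∀ n → (c ⋆ (F (i ℕ.+ i) ⋆ F i)) n ≡ ∑ p (λ x → ∑ p (λ y → t x ^ (i ℕ.+ i) * (t y ^ i * (c ⋆ (f x ⋆ f y)) n)))
    expand n = trans (⋆-ext {c} {c} (λ _ → refl) inner n) (trans (⋆-∑ʳ p c (λ x m → ∑ p (λ y → t x ^ (i ℕ.+ i) * (t y ^ i * (f x ⋆ f y) m))) n)
      (∑-ext p (λ x → trans (⋆-∑ʳ p c (λ y m → t x ^ (i ℕ.+ i) * (t y ^ i * (f x ⋆ f y) m)) n) (∑-ext p (λ y → trans (⋆-*ʳ (t x ^ (i ℕ.+ i)) c (λ m → t y ^ i * (f x ⋆ f y) m) n) (cong (t x ^ (i ℕ.+ i) *_) (⋆-*ʳ (t y ^ i) c (f x ⋆ f y) n)))))))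
      where
      inner : ∀ m → (F (i ℕ.+ i) ⋆ F i) m ≡ ∑ p (λ x → ∑ p (λ y → t x ^ (i ℕ.+ i) * (t y ^ i * (f x ⋆ f y) m)))
      inner m = trans (⋆-ext (λ n → sym (F-∑ (i ℕ.+ i) n)) (λ n → sym (F-∑ i n)) m) (trans (⋆-∑ˡ p (λ x n → t x ^ (i ℕ.+ i) * f x n) (λ n → ∑ p (λ y → t y ^ i * f y n)) m)
        (∑-ext p (λ x → trans (⋆-∑ʳ p (λ n → t x ^ (i ℕ.+ i) * f x n) (λ y n → t y ^ i * f y n) m) (∑-ext p (λ y → trans (⋆-*ˡ (t x ^ (i ℕ.+ i)) (f x) (λ n → t y ^ i * f y n) m) (cong (t x ^ (i ℕ.+ i) *_) (⋆-*ʳ (t y ^ i) (f x) (f y) m)))))))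

    S₁-trace : ∀ M → S₁ M ≡ trace M (c ⋆ (F (i ℕ.+ i) ⋆ F i))
    S₁-trace M = begin
      S₁ M
        ≡⟨ ∑-ext p (λ x → ∑-ext p (λ y → trans (cong (λ z → A x * (B y * z)) (trace-ext M (X-xy x y))) (trans (cong (A x *_) (sym (∑-*ˡ N (B y) (λ n → w n * h x y n)))) (sym (∑-*ˡ N (A x) (λ n → B y * (w n * h x y n))))))) ⟩
      ∑ p (λ x → ∑ p (λ y → ∑ N (λ n → A x * (B y * (w n * h x y n)))))
        ≡⟨ ∑-ext p (λ x → ∑-swap p N (λ y n → A x * (B y * (w n * h x y n)))) ⟩
      ∑ p (λ x → ∑ N (λ n → ∑ p (λ y → A x * (B y * (w n * h x y n)))))
        ≡⟨ ∑-swap p N (λ x n → ∑ p (λ y → A x * (B y * (w n * h x y n)))) ⟩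
      ∑ N (λ n → ∑ p (λ x → ∑ p (λ y → A x * (B y * (w n * h x y n)))))
        ≡⟨ ∑-ext N (λ n → trans (∑-ext p (λ x → trans (∑-ext p (λ y → solve 4 (λ a b w h → a :* (b :* (w :* h)) := w :* (a :* (b :* h))) refl (A x) (B y) (w n) (h x y n))) (∑-*ˡ p (w n) (λ y → A x * (B y * h x y n)))))
             (trans (∑-*ˡ p (w n) (λ x → ∑ p (λ y → A x * (B y * h x y n)))) (cong (w n *_) (sym (expand n))))) ⟩
      trace M (c ⋆ (F (i ℕ.+ i) ⋆ F i)) ∎
      where
      open ≡-Reasoning
      N = M ℕ.* q
      A B : ℕ → ℚ
      A x = t x ^ (i ℕ.+ i)
      B y = t y ^ i
      h : ℕ → ℕ → Seq
      h x y = c ⋆ (f x ⋆ f y)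

    F≈ : ∀ r a e₁ → 0 ℕ.< r → a ℕ.< q → r ℕ.+ a ≡ q ℕ.* e₁ → ∀ n → Div (suc L) (powerSum L (r ℕ.+ n) - # q * χ a n)
    F≈ r a e₁ hr la hs n = _≈[_]_.diff (≈-trans (powerSum-eq L (r ℕ.+ n) (ℕP.≤-trans hr (ℕP.m≤m+n r n))) (≈-reflexive (cong (# q *_) (δ-χ r a e₁ la hs n))))

    Int-χ : ∀ a n → Int (χ a n)
    Int-χ a n with n ℕD.% q ℕ.≟ a
    ... | yes _ = Int-1
    ... | no  _ = Int-0

    module _ (E a b c₀ e₁ e : ℕ) (la : a ℕ.< q) (lb : b ℕ.< q) (lc : c₀ ℕ.< q) (ib : i ℕ.+ b ≡ q) (ia : (i ℕ.+ i) ℕ.+ a ≡ q ℕ.* e₁) (abc : c₀ ℕ.+ (a ℕ.+ b) ≡ q ℕ.* e) where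

      -- The truncation; the 4 is the loss of the two Cauchy products in `trace-triple`.
      M : ℕ
      M = (4 ℕ.+ E) ℕ.* (p ℕ.* p)

      s : ℕ
      s = slope (M ℕ.* q)

      F′ : ℕ → Seq
      F′ a n = # q * (χ a n * c n)

      eF : ℕ → ℕ → Seq
      eF r a n = (powerSum L (r ℕ.+ n) - # q * χ a n) * c n

      F-split : ∀ r a n → F r n ≡ F′ a n + eF r a n
      F-split r a n = solve 4 (λ x q y c → x :* c := q :* (y :* c) :+ (x :- q :* y) :* c) refl (powerSum L (r ℕ.+ n)) (# q) (χ a n) (c n)

      err : Seq
      err = c ⋆ (λ m → (eF (i ℕ.+ i) a ⋆ F′ b) m + (F (i ℕ.+ i) ⋆ eF i b) m)

      split : ∀ n → (c ⋆ (F (i ℕ.+ i) ⋆ F i)) n ≡ # q * # q * (c ⋆ ((λ j → χ a j * c j) ⋆ (λ l → χ b l * c l))) n + err n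
      split n = trans (⋆-ext {c} {c} (λ _ → refl) inner n) (trans (⋆-+ʳ c (F′ a ⋆ F′ b) (λ m → (eF (i ℕ.+ i) a ⋆ F′ b) m + (F (i ℕ.+ i) ⋆ eF i b) m) n) (cong (_+ err n) main))
        where
        inner : ∀ m → (F (i ℕ.+ i) ⋆ F i) m ≡ (F′ a ⋆ F′ b) m + ((eF (i ℕ.+ i) a ⋆ F′ b) m + (F (i ℕ.+ i) ⋆ eF i b) m)
        inner m = trans (⋆-ext {F (i ℕ.+ i)} {F (i ℕ.+ i)} (λ _ → refl) (F-split i b) m) (trans (⋆-+ʳ (F (i ℕ.+ i)) (F′ b) (eF i b) m)
          (trans (cong (_+ (F (i ℕ.+ i) ⋆ eF i b) m) (trans (⋆-ext {g = F′ b} {g′ = F′ b} (F-split (i ℕ.+ i) a) (λ _ → refl) m) (⋆-+ˡ (F′ a) (eF (i ℕ.+ i) a) (F′ b) m)))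
            (+-assoc ((F′ a ⋆ F′ b) m) ((eF (i ℕ.+ i) a ⋆ F′ b) m) ((F (i ℕ.+ i) ⋆ eF i b) m))))
        Ga Gb : Seq
        Ga j = χ a j * c j
        Gb l = χ b l * c l
        main : (c ⋆ (F′ a ⋆ F′ b)) n ≡ # q * # q * (c ⋆ (Ga ⋆ Gb)) n
        main = trans (⋆-ext {c} {c} (λ _ → refl) (λ m → trans (⋆-*ˡ (# q) Ga (F′ b) m) (trans (cong (# q *_) (⋆-*ʳ (# q) Ga Gb m)) (sym (*-assoc (# q) (# q) ((Ga ⋆ Gb) m))))) n) (⋆-*ʳ (# q * # q) c (Ga ⋆ Gb) n)

      DLat-err : DLat (suc L) err
      DLat-err = DLat-⋆ 0 (suc L) c _ DLat-c (λ m → Div-≡ (sym (*-distribˡ-+ (P ^ slope m) ((eF (i ℕ.+ i) a ⋆ F′ b) m) ((F (i ℕ.+ i) ⋆ eF i b) m)))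
        (Div-+ (subst (λ e → Div e (P ^ slope m * (eF (i ℕ.+ i) a ⋆ F′ b) m)) (ℕP.+-identityʳ (suc L)) (DLat-⋆ (suc L) 0 (eF (i ℕ.+ i) a) (F′ b) hA hB′ m))
               (DLat-⋆ 0 (suc L) (F (i ℕ.+ i)) (eF i b) hF hB m)))
        where
        hA : DLat (suc L) (eF (i ℕ.+ i) a)
        hA = DLat-*c (suc L) (λ n → powerSum L ((i ℕ.+ i) ℕ.+ n) - # q * χ a n) (F≈ (i ℕ.+ i) a e₁ (ℕP.≤-trans i>0 (ℕP.m≤m+n i i)) la ia)
        hB : DLat (suc L) (eF i b)
        hB = DLat-*c (suc L) (λ n → powerSum L (i ℕ.+ n) - # q * χ b n) (F≈ i b 1 i>0 lb (trans ib (sym (ℕP.*-identityʳ q))))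
        hF : DLat 0 (F (i ℕ.+ i))
        hF = DLat-*c 0 (λ n → powerSum L ((i ℕ.+ i) ℕ.+ n)) (λ n → Int→Div (Int-powerSum L ((i ℕ.+ i) ℕ.+ n)))
        hB′ : DLat 0 (F′ b)
        hB′ n = Div-≡ (cong (P ^ slope n *_) (*-assoc (# q) (χ b n) (c n))) (DLat-*c 0 (λ n → # q * χ b n) (λ n → Int→Div (Int-* (Int-# q) (Int-χ b n))) n)

      module _ (hL : s ℕ.+ E ℕ.≤ L) where

        -- The power sums are known modulo p^(L+1), and p^s clears every denominator below the
        -- truncation. This is why the Teichmüller representatives are needed to the precision s +
        -- E.
        err≈0 : ∀ n → n ℕ.< M ℕ.* q → Div E (err n)
        err≈0 n l = Div-weaken (ℕP.m≤n+m E (suc (s ℕ.∸ slope n))) (Div-cancelP (slope n) (subst (λ z → Div z (P ^ slope n * err n)) refl (Div-weaken le (DLat-err n))))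
          where
          le : slope n ℕ.+ (suc (s ℕ.∸ slope n) ℕ.+ E) ℕ.≤ suc L
          le = ℕP.≤-trans (ℕP.≤-reflexive (trans (NS.solve 3 (λ a b e → a NS.:+ ((NS.con 1 NS.:+ b) NS.:+ e) NS.:= NS.con 1 NS.:+ ((a NS.:+ b) NS.:+ e)) refl (slope n) (s ℕ.∸ slope n) E) (cong (λ z → suc (z ℕ.+ E)) (ℕP.m+[n∸m]≡n (slope-mono (ℕP.<⇒≤ l)))))) (s≤s hL)

        S₁-gauss : S₁ M ≈[ E ] # q * # q * ((- P) ^ e * (gauss c₀ M * (gauss a M * gauss b M)))
        S₁-gauss = ≈-trans (≈-reflexive (S₁-trace M)) (≈-trans (≈-∑ (M ℕ.* q) (λ n l → ≈-trans (≈-reflexive (cong (w n *_) (split n)))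
            (≈-trans (≈-*ˡ (Int-w n) (≈-trans (≈-+ (≈-refl {x = # q * # q * g n}) (Div→≈0 (err≈0 n l))) (≈-reflexive (+-identityʳ (# q * # q * g n)))))
              (≈-reflexive (solve 3 (λ w q g → w :* (q :* g) := q :* (w :* g)) refl (w n) (# q * # q) (g n))))))
          (≈-trans (≈-reflexive (∑-*ˡ (M ℕ.* q) (# q * # q) (λ n → w n * g n))) (≈-*ˡ (Int-* (Int-# q) (Int-# q)) (trace-triple E M a b c₀ e la lb lc abc ℕP.≤-refl))))
          where
          g : Seq
          g = c ⋆ ((λ j → χ a j * c j) ⋆ (λ l → χ b l * c l))

        -- In the value 1 - pδ of the trace, the 1 contributes a product of two power sums, which
        -- vanishes because 0 < i < p - 1; the indicator δ restricts the rest to the line.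
        S₁-jacobi : (1ℚ - P) * S₁ M ≈[ E ] - (P * Jac)
        S₁-jacobi = ≈-trans (≈-reflexive e₀) (≈-trans (≈-∑ p (λ x _ → ≈-∑ p (λ y _ → ≈-*ˡ (Int-* (iA x) (iB y)) (val x y)))) (≈-trans (≈-reflexive e₂) (≈-trans (≈-+ PS0 ≈-refl) (≈-reflexive (+-identityˡ (- (P * Jac)))))))
          where
          A B : ℕ → ℚ
          A x = t x ^ (i ℕ.+ i)
          B y = t y ^ i
          iA : ∀ x → Int (A x)
          iA x = Int-^ (i ℕ.+ i) (Int-τ L (ℤ.+ x))
          iB : ∀ y → Int (B y)
          iB y = Int-^ i (Int-τ L (ℤ.+ y))
          T′ : ℕ → ℕ → ℚ
          T′ x y = trace M (X (lam-xy x y) (μ-xy x y))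
          hE : E ℕ.≤ L
          hE = ℕP.≤-trans (ℕP.m≤n+m E s) hL
          e₀ : (1ℚ - P) * S₁ M ≡ ∑ p (λ x → ∑ p (λ y → A x * B y * ((1ℚ - P) * T′ x y)))
          e₀ = trans (sym (∑-*ˡ p (1ℚ - P) (λ x → ∑ p (λ y → A x * (B y * T′ x y))))) (∑-ext p (λ x → trans (sym (∑-*ˡ p (1ℚ - P) (λ y → A x * (B y * T′ x y))))
            (∑-ext p (λ y → solve 4 (λ u a b t → u :* (a :* (b :* t)) := a :* b :* (u :* t)) refl (1ℚ - P) (A x) (B y) (T′ x y)))))
          xyn : ∀ x y → 1ℚ + (# x + # y) ≡ # (1 ℕ.+ x ℕ.+ y)
          xyn x y = sym (trans (#-+ (1 ℕ.+ x) y) (trans (cong (_+ # y) (#-suc x)) (+-assoc 1ℚ (# x) (# y))))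
          val : ∀ x y → (1ℚ - P) * T′ x y ≈[ E ] 1ℚ - P * δ∣ (1 ℕ.+ x ℕ.+ y)
          val x y = trace-val E M L (ℕP.*-monoˡ-≤ (p ℕ.* p) (s≤s (ℕP.m≤n+m E 3))) hE (lam-xy x y) (μ-xy x y) (1 ℕ.+ x ℕ.+ y)
            (≈-trans (≈-+ (≈-refl {x = 1ℚ}) (≈-+ (τ≈1 L (ℤ.+ x)) (τ≈1 L (ℤ.+ y)))) (≈-reflexive (xyn x y)))
            (≈-trans (≈-+ (≈-refl {x = 1ℚ}) (≈-+ (tp x) (tp y))) (≈-reflexive (xyn x y)))
            (Div-weaken (s≤s hL) (Div-≡ (solve 4 (λ a b c d → :- ((c :- a) :+ (d :- b)) := (con 1ℚ :+ (a :+ b)) :- (con 1ℚ :+ (c :+ d))) refl (t x) (t y) (t x ^ p) (t y ^ p))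
              (Div-neg (Div-+ (_≈[_]_.diff (τ^p L (ℤ.+ x))) (_≈[_]_.diff (τ^p L (ℤ.+ y))))))) hL
            where
            tp : ∀ x → t x ^ p ≈[ 1 ] # x
            tp x = ≈-trans (≈-weaken (s≤s z≤n) (τ^p L (ℤ.+ x))) (τ≈1 L (ℤ.+ x))
          e₂ : ∑ p (λ x → ∑ p (λ y → A x * B y * (1ℚ - P * δ∣ (1 ℕ.+ x ℕ.+ y)))) ≡ powerSum L (i ℕ.+ i) * powerSum L i + - (P * Jac)
          e₂ = trans (∑-ext p (λ x → trans (∑-ext p (λ y → solve 4 (λ a b P d → a :* b :* (con 1ℚ :- P :* d) := a :* b :- P :* (d :* (a :* b))) refl (A x) (B y) P (δ∣ (1 ℕ.+ x ℕ.+ y))))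
              (trans (∑-- p (λ y → A x * B y) (λ y → P * (δ∣ (1 ℕ.+ x ℕ.+ y) * (A x * B y)))) (cong (λ z → ∑ p (λ y → A x * B y) - z) (∑-*ˡ p P (λ y → δ∣ (1 ℕ.+ x ℕ.+ y) * (A x * B y)))))))
            (trans (∑-- p (λ x → ∑ p (λ y → A x * B y)) (λ x → P * ∑ p (λ y → δ∣ (1 ℕ.+ x ℕ.+ y) * (A x * B y)))) (cong₂ _-_ (sym (∑-* p p A B)) (∑-*ˡ p P (λ x → ∑ p (λ y → δ∣ (1 ℕ.+ x ℕ.+ y) * (A x * B y))))))
          PSi : powerSum L i ≈[ suc L ] 0ℚ
          PSi = subst (λ r → powerSum L r ≈[ suc L ] 0ℚ) i≡ (powerSum-zero L (i ℕ.∸ 1) (subst (ℕ._< q) (sym i≡) i<q))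
            where
            i≡ : suc (i ℕ.∸ 1) ≡ i
            i≡ = ℕP.m+[n∸m]≡n i>0
          PS0 : powerSum L (i ℕ.+ i) * powerSum L i ≈[ E ] 0ℚ
          PS0 = ≈-trans (≈-*ˡ (Int-powerSum L (i ℕ.+ i)) (≈-weaken (ℕP.m≤n⇒m≤1+n hE) PSi)) (≈-reflexive (*-zeroʳ (powerSum L (i ℕ.+ i))))

        -- Each of the three Gauss sums absorbs one factor 1 - p: two come from q² = (1 - p)², the
        -- third from the normalisation of the trace.
        jacobi-gauss : ∀ K → 2 ℕ.+ E ℕ.≤ suc K → - (P * Jac) ≈[ E ] (- P) ^ e * (Γₚ (n₀ (suc K) c₀) * (Γₚ (n₀ (suc K) a) * Γₚ (n₀ (suc K) b)))
        jacobi-gauss K hK = ≈-trans (≈-sym S₁-jacobi) (≈-trans (≈-*ˡ (Int-- Int-1 (Int-# p)) S₁-gauss) (≈-trans (≈-reflexive eq) (≈-*ˡ (Int-^ e (Int-neg (Int-# p)))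
          (≈-* (gk c₀ lc) (≈-* (gk a la) (gk b lb) (Int-Γₚ (n₀ (suc K) a)) (ig b lb)) (Int-Γₚ (n₀ (suc K) c₀)) (Int-* (ig a la) (ig b lb))))))
          where
          u : ℚ
          u = 1ℚ - P
          ig : ∀ a → a ℕ.< q → Int (u * gauss a M)
          ig a l = Int-* (Int-- Int-1 (Int-# p)) (gauss-Int a l M)
          gk : ∀ a → a ℕ.< q → u * gauss a M ≈[ E ] Γₚ (n₀ (suc K) a)
          gk a l = gross-koblitz′ E K a l hK M (ℕP.*-monoˡ-≤ (p ℕ.* p) (ℕP.m≤n+m E 4))
          eq : u * (# q * # q * ((- P) ^ e * (gauss c₀ M * (gauss a M * gauss b M)))) ≡ (- P) ^ e * (u * gauss c₀ M * (u * gauss a M * (u * gauss b M)))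
          eq = trans (cong (λ z → u * (z * z * ((- P) ^ e * (gauss c₀ M * (gauss a M * gauss b M))))) q≡P-1)
            (solve 5 (λ u x c a b → u :* ((:- u) :* (:- u) :* (x :* (c :* (a :* b)))) := x :* (u :* c :* (u :* a :* (u :* b)))) refl u ((- P) ^ e) (gauss c₀ M) (gauss a M) (gauss b M))

  -- Values of the gamma function at multiples of 1/6(p-1)

  p∤3 : ¬ (p ∣ 3)
  p∤3 = p∤<p 2 q>2

  p∤6q : ¬ (p ∣ 6 ℕ.* q)
  p∤6q = p∤* (p∤* p∤2 p∤3) (λ h → go q refl h)
    where
    go : ∀ m → m ≡ q → ¬ (p ∣ m)
    go zero    e h = ℕP.<-irrefl e 0<q
    go (suc r) e h = p∤<p r (subst (r ℕ.<_) e ℕP.≤-refl) h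

  -- For 0 < j < p-1: the representatives modulo 1 of 1/3 - j/q, 2/3 - j/q, 1/2 + j/q are r₁/6q, r₂/6q, r₄/6q,
  -- the floors being -m₁, -m₂, m₄; a and d represent 2j and -3j modulo q = p - 1.
  record Split (j : ℕ) : Set where
    field
      r₁ r₂ r₄ d a l l′ e m₁ m₂ m₄ : ℕ
      d<q : d ℕ.< q
      a<q : a ℕ.< q
      3j  : 3 ℕ.* j ℕ.+ d ≡ q ℕ.* l
      2j  : 2 ℕ.* j ≡ a ℕ.+ q ℕ.* l′
      abc : d ℕ.+ (a ℕ.+ j) ≡ q ℕ.* e
      r₁< : r₁ ℕ.< 6 ℕ.* q
      r₂< : r₂ ℕ.< 6 ℕ.* q
      r₄< : r₄ ℕ.< 6 ℕ.* q
      r₁≡ : r₁ ℕ.+ 6 ℕ.* j ≡ 2 ℕ.* q ℕ.+ 6 ℕ.* q ℕ.* m₁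
      r₂≡ : r₂ ℕ.+ 6 ℕ.* j ≡ 4 ℕ.* q ℕ.+ 6 ℕ.* q ℕ.* m₂
      r₄≡ : r₄ ℕ.+ 6 ℕ.* q ℕ.* m₄ ≡ 3 ℕ.* q ℕ.+ 6 ℕ.* j
      m₄≤ : m₄ ℕ.≤ 1 ℕ.+ m₂
      expo : (1 ℕ.+ m₁) ℕ.+ ((1 ℕ.+ m₂) ℕ.∸ m₄) ≡ suc e
      prod₃ : ∀ (g : ℕ → ℚ) → g r₁ * g r₂ * g (6 ℕ.* (q ℕ.∸ j)) ≡ g (2 ℕ.* d) * g (2 ℕ.* q ℕ.+ 2 ℕ.* d) * g (4 ℕ.* q ℕ.+ 2 ℕ.* d)
      prod₂ : ∀ (g : ℕ → ℚ) → g (6 ℕ.* j) * g r₄ ≡ g (3 ℕ.* a) * g (3 ℕ.* q ℕ.+ 3 ℕ.* a)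

  module Values (K : ℕ) where

    k : ℕ
    k = suc K

    μ : ℕ
    μ = proj₁ (inverse-mod K (6 ℕ.* q) p∤6q)

    μ-inv : # μ * # (6 ℕ.* q) ≈[ k ] 1ℚ
    μ-inv = ≈-trans (≈-reflexive (trans (*-comm (# μ) (# (6 ℕ.* q))) (sym (#-* (6 ℕ.* q) μ)))) (≈-trans (≈-*N k (6 ℕ.* q ℕ.* μ) 1 (proj₁ (proj₂ (inverse-mod K (6 ℕ.* q) p∤6q))) (proj₂ (proj₂ (inverse-mod K (6 ℕ.* q) p∤6q)))) (≈-reflexive #1))

    -- Γ_p (r / 6q)
    Γ̃ : ℕ → ℚ
    Γ̃ r = Γₚ (r ℕ.* μ)

    Γ̃-rep : ∀ n r → # n * # (6 ℕ.* q) ≈[ k ] # r → Γₚ n ≈[ k ] Γ̃ r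
    Γ̃-rep n r h = Γₚ-cong K n (r ℕ.* μ) (≈-cancelUnit (Unit-# (6 ℕ.* q) p∤6q) (≈-trans (≈-reflexive (*-comm (# (6 ℕ.* q)) (# n))) (≈-trans h (≈-sym (≈-trans
      (≈-reflexive (trans (cong (# (6 ℕ.* q) *_) (#-* r μ)) (solve 3 (λ a b c → a :* (b :* c) := b :* (c :* a)) refl (# (6 ℕ.* q)) (# r) (# μ)))) (≈-trans (≈-*ˡ (Int-# r) μ-inv) (≈-reflexive (*-identityʳ (# r)))))))))

    Int-Γ̃ : ∀ r → Int (Γ̃ r)
    Int-Γ̃ r = Int-Γₚ (r ℕ.* μ)

    Unit-Γ̃ : ∀ r → Unit (Γ̃ r)
    Unit-Γ̃ r = Unit-Γₚ (r ℕ.* μ)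

    n₀≈ : ∀ K′ a → k ℕ.≤ K′ → a ℕ.≤ q → # q * # (n₀ K′ a) ≈[ k ] # a
    n₀≈ K′ a hK la = ≈-weaken hK (≈-trans (≈-reflexive (sym (#-* q (n₀ K′ a)))) (≈-*N K′ (q ℕ.* n₀ K′ a) a (q ℕ.∸ a) (n₀-eq K′ a la)))

    Γ̃-n₀ : ∀ K′ a → k ℕ.≤ K′ → a ℕ.≤ q → Γₚ (n₀ K′ a) ≈[ k ] Γ̃ (6 ℕ.* a)
    Γ̃-n₀ K′ a hK la = Γ̃-rep (n₀ K′ a) (6 ℕ.* a) (≈-trans (≈-reflexive (trans (cong (# (n₀ K′ a) *_) (#-* 6 q)) (solve 3 (λ n s q → n :* (s :* q) := s :* (q :* n)) refl (# (n₀ K′ a)) (# 6) (# q))))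
      (≈-trans (≈-*ˡ (Int-# 6) (n₀≈ K′ a hK la)) (≈-reflexive (sym (#-* 6 a)))))

    module Multi (m u : ℕ) (p∤m : ¬ (p ∣ m)) (mu : m ℕ.* u ≡ 6) where

      im = inverse-mod K m p∤m
      η = proj₁ im
      open Multiplication K m η (proj₁ (proj₂ im)) p∤m (proj₂ (proj₂ im)) public

      η≈ : # m * # η ≈[ k ] 1ℚ
      η≈ = ≈-trans (≈-reflexive (sym (#-* m η))) (≈-trans (≈-*N k (m ℕ.* η) 1 (proj₁ (proj₂ im)) (proj₂ (proj₂ im))) (≈-reflexive #1))

      -- With m u = 6 the argument h/m + a/(mq) equals (uqh + ua)/6q.
      rep : ∀ h a → a ℕ.≤ q → Γₚ (h ℕ.* η ℕ.+ n₀ k a ℕ.* η) ≈[ k ] Γ̃ (u ℕ.* (q ℕ.* h) ℕ.+ u ℕ.* a)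
      rep h a la = Γ̃-rep (h ℕ.* η ℕ.+ n₀ k a ℕ.* η) (u ℕ.* (q ℕ.* h) ℕ.+ u ℕ.* a) (≈-trans (≈-reflexive e₁) (≈-trans (≈-*ˡ (Int-* (Int-# u) (Int-+ (Int-* (Int-# q) (Int-# h)) (Int-* (Int-# q) (Int-# (n₀ k a))))) η≈)
        (≈-trans (≈-reflexive (*-identityʳ _)) (≈-trans (≈-*ˡ (Int-# u) (≈-+ (≈-refl {x = # q * # h}) (n₀≈ k a ℕP.≤-refl la))) (≈-reflexive e₂)))))
        where
        e₁ : # (h ℕ.* η ℕ.+ n₀ k a ℕ.* η) * # (6 ℕ.* q) ≡ # u * (# q * # h + # q * # (n₀ k a)) * (# m * # η)
        e₁ = trans (cong₂ _*_ (trans (#-+ (h ℕ.* η) (n₀ k a ℕ.* η)) (cong₂ _+_ (#-* h η) (#-* (n₀ k a) η))) (trans (#-* 6 q) (cong (_* # q) (trans (cong # (sym mu)) (#-* m u)))))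
          (solve 6 (λ h e n m u q → (h :* e :+ n :* e) :* (m :* u :* q) := u :* (q :* h :+ q :* n) :* (m :* e)) refl (# h) (# η) (# (n₀ k a)) (# m) (# u) (# q))
        e₂ : # u * (# q * # h + # a) ≡ # (u ℕ.* (q ℕ.* h) ℕ.+ u ℕ.* a)
        e₂ = sym (trans (#-+ (u ℕ.* (q ℕ.* h)) (u ℕ.* a)) (trans (cong₂ _+_ (trans (#-* u (q ℕ.* h)) (cong (# u *_) (#-* q h))) (#-* u a)) (sym (*-distribˡ-+ (# u) (# q * # h) (# a)))))

      rep0 : ∀ h → Γₚ (h ℕ.* η ℕ.+ 0) ≈[ k ] Γ̃ (u ℕ.* (q ℕ.* h))
      rep0 h = Γ̃-rep (h ℕ.* η ℕ.+ 0) (u ℕ.* (q ℕ.* h)) (≈-trans (≈-reflexive e₁) (≈-trans (≈-*ˡ (Int-* (Int-# u) (Int-* (Int-# q) (Int-# h))) η≈) (≈-reflexive (trans (*-identityʳ (# u * (# q * # h))) (sym (trans (#-* u (q ℕ.* h)) (cong (# u *_) (#-* q h))))))))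
        where
        e₁ : # (h ℕ.* η ℕ.+ 0) * # (6 ℕ.* q) ≡ # u * (# q * # h) * (# m * # η)
        e₁ = trans (cong₂ _*_ (trans (cong # (ℕP.+-identityʳ (h ℕ.* η))) (#-* h η)) (trans (#-* 6 q) (cong (_* # q) (trans (cong # (sym mu)) (#-* m u)))))
          (solve 5 (λ h e m u q → (h :* e) :* (m :* u :* q) := u :* (q :* h) :* (m :* e)) refl (# h) (# η) (# m) (# u) (# q))

    τ₂ τ₃ : ℚ
    τ₂ = # 2 ^ (p ℕ.^ K)
    τ₃ = # 3 ^ (p ℕ.^ K)

    -- Multiplication formula for Γ_p(x) Γ_p(x + 1/3) Γ_p(x + 2/3) at x = a/3q, written in units of
    -- 1/6q.
    mult₃ : ∀ a → a ℕ.≤ q → Γ̃ (2 ℕ.* a) * Γ̃ (2 ℕ.* q ℕ.+ 2 ℕ.* a) * Γ̃ (4 ℕ.* q ℕ.+ 2 ℕ.* a) * τ₃ ^ (q ℕ.∸ a) ≈[ k ] Γ̃ (2 ℕ.* q) * Γ̃ (4 ℕ.* q) * Γ̃ (6 ℕ.* a)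
    mult₃ a la = ≈-trans (≈-*ʳ (Int-^ (q ℕ.∸ a) (Int-^ (p ℕ.^ K) (Int-# 3))) (≈-sym lhs)) (≈-trans (multiplication-n₀ a) (≈-* rhs (Γ̃-n₀ k a ℕP.≤-refl la) (Int-* (Int-Γ̃ (2 ℕ.* q)) (Int-Γ̃ (4 ℕ.* q))) (Int-Γₚ (n₀ k a))))
      where
      open Multi 3 2 p∤3 refl
      lhs : A 3 (n₀ k a ℕ.* η) ≈[ k ] Γ̃ (2 ℕ.* a) * Γ̃ (2 ℕ.* q ℕ.+ 2 ℕ.* a) * Γ̃ (4 ℕ.* q ℕ.+ 2 ℕ.* a)
      lhs = ≈-trans (≈-* (≈-* (≈-*ˡ Int-1 (rep 0 a la)) (rep 1 a la) (Int-* Int-1 (Int-Γ̃ (2 ℕ.* (q ℕ.* 0) ℕ.+ 2 ℕ.* a))) (Int-Γₚ (1 ℕ.* η ℕ.+ n₀ k a ℕ.* η))) (rep 2 a la) (Int-* (Int-* Int-1 (Int-Γ̃ (2 ℕ.* (q ℕ.* 0) ℕ.+ 2 ℕ.* a))) (Int-Γ̃ (2 ℕ.* (q ℕ.* 1) ℕ.+ 2 ℕ.* a))) (Int-Γₚ (2 ℕ.* η ℕ.+ n₀ k a ℕ.* η)))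
        (≈-reflexive (cong₂ _*_ (cong₂ _*_ (trans (*-identityˡ _) (cong (λ z → Γ̃ (2 ℕ.* z ℕ.+ 2 ℕ.* a)) (ℕP.*-zeroʳ q))) (cong (λ z → Γ̃ (2 ℕ.* z ℕ.+ 2 ℕ.* a)) (ℕP.*-identityʳ q)))
          (cong (λ z → Γ̃ (z ℕ.+ 2 ℕ.* a)) (NS.solve 1 (λ q → NS.con 2 NS.:* (q NS.:* NS.con 2) NS.:= NS.con 4 NS.:* q) refl q))))
      rhs : A 3 0 ≈[ k ] Γ̃ (2 ℕ.* q) * Γ̃ (4 ℕ.* q)
      rhs = ≈-trans (≈-* (≈-*ˡ Int-1 (rep0 1)) (rep0 2) (Int-* Int-1 (Int-Γ̃ (2 ℕ.* (q ℕ.* 1)))) (Int-Γₚ (2 ℕ.* η ℕ.+ 0)))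
        (≈-reflexive (cong₂ _*_ (trans (*-identityˡ _) (cong (λ z → Γ̃ (2 ℕ.* z)) (ℕP.*-identityʳ q))) (cong Γ̃ (NS.solve 1 (λ q → NS.con 2 NS.:* (q NS.:* NS.con 2) NS.:= NS.con 4 NS.:* q) refl q))))

    mult₂ : ∀ a → a ℕ.≤ q → Γ̃ (3 ℕ.* a) * Γ̃ (3 ℕ.* q ℕ.+ 3 ℕ.* a) * τ₂ ^ (q ℕ.∸ a) ≈[ k ] Γ̃ (3 ℕ.* q) * Γ̃ (6 ℕ.* a)
    mult₂ a la = ≈-trans (≈-*ʳ (Int-^ (q ℕ.∸ a) (Int-^ (p ℕ.^ K) (Int-# 2))) (≈-sym lhs)) (≈-trans (multiplication-n₀ a) (≈-* rhs (Γ̃-n₀ k a ℕP.≤-refl la) (Int-Γ̃ (3 ℕ.* q)) (Int-Γₚ (n₀ k a))))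
      where
      open Multi 2 3 p∤2 refl
      lhs : A 2 (n₀ k a ℕ.* η) ≈[ k ] Γ̃ (3 ℕ.* a) * Γ̃ (3 ℕ.* q ℕ.+ 3 ℕ.* a)
      lhs = ≈-trans (≈-* (≈-*ˡ Int-1 (rep 0 a la)) (rep 1 a la) (Int-* Int-1 (Int-Γ̃ (3 ℕ.* (q ℕ.* 0) ℕ.+ 3 ℕ.* a))) (Int-Γₚ (1 ℕ.* η ℕ.+ n₀ k a ℕ.* η)))
        (≈-reflexive (cong₂ _*_ (trans (*-identityˡ _) (cong (λ z → Γ̃ (3 ℕ.* z ℕ.+ 3 ℕ.* a)) (ℕP.*-zeroʳ q))) (cong (λ z → Γ̃ (3 ℕ.* z ℕ.+ 3 ℕ.* a)) (ℕP.*-identityʳ q))))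
      rhs : A 2 0 ≈[ k ] Γ̃ (3 ℕ.* q)
      rhs = ≈-trans (≈-*ˡ Int-1 (rep0 1)) (≈-reflexive (trans (*-identityˡ _) (cong (λ z → Γ̃ (3 ℕ.* z)) (ℕP.*-identityʳ q))))

    Γ̃-refl : ∀ j → j ℕ.≤ q → Γ̃ (6 ℕ.* j) * Γ̃ (6 ℕ.* (q ℕ.∸ j)) ≈[ k ] - ((- 1ℚ) ^ j)
    Γ̃-refl j lj = ≈-trans (≈-* (≈-sym (Γ̃-n₀ k j ℕP.≤-refl lj)) (≈-sym (Γ̃-n₀ k (q ℕ.∸ j) ℕP.≤-refl (ℕP.m∸n≤m q j))) (Int-Γₚ (n₀ k j)) (Int-Γ̃ (6 ℕ.* (q ℕ.∸ j))))
      (≈-trans (≈-reflexive e₁) (≈-trans (≈-*ʳ (Int-±1^ j) (reflection K x x≤)) (≈-reflexive (solve 1 (λ s → con (- 1ℚ) :* s := :- s) refl ((- 1ℚ) ^ j)))))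
      where
      open ≡-Reasoning
      N = p ℕ.^ k
      x = n₀ k j
      x+ : x ℕ.+ j ℕ.* repunit k ≡ N
      x+ = trans (cong suc (trans (sym (ℕP.*-distribʳ-+ (repunit k) (q ℕ.∸ j) j)) (cong (ℕ._* repunit k) (ℕP.m∸n+n≡m lj)))) (repunit-eq k)
      x≤ : x ℕ.≤ N
      x≤ = ℕP.≤-trans (ℕP.m≤m+n x (j ℕ.* repunit k)) (ℕP.≤-reflexive x+)
      y≡ : n₀ k (q ℕ.∸ j) ≡ suc (N ℕ.∸ x)
      y≡ = cong suc (trans (cong (ℕ._* repunit k) (ℕP.m∸[m∸n]≡n lj)) (sym (trans (cong (ℕ._∸ x) (sym x+)) (ℕP.m+n∸m≡n x (j ℕ.* repunit k)))))
      sgn : (- 1ℚ) ^ x * (- 1ℚ) ^ suc (N ℕ.∸ x) ≡ 1ℚ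
      sgn = begin
        (- 1ℚ) ^ x * (- 1ℚ * (- 1ℚ) ^ (N ℕ.∸ x))   ≡⟨ solve 2 (λ a b → a :* (con (- 1ℚ) :* b) := con (- 1ℚ) :* (a :* b)) refl ((- 1ℚ) ^ x) ((- 1ℚ) ^ (N ℕ.∸ x)) ⟩
        - 1ℚ * ((- 1ℚ) ^ x * (- 1ℚ) ^ (N ℕ.∸ x))   ≡⟨ cong (- 1ℚ *_) (trans (sym (^-+ (- 1ℚ) x (N ℕ.∸ x))) (trans (cong ((- 1ℚ) ^_) (ℕP.m+[n∸m]≡n x≤)) (-1^N k))) ⟩
        - 1ℚ * - 1ℚ                                ≡⟨ refl ⟩
        1ℚ                                         ∎
      sU : (- 1ℚ) ^ U x * (- 1ℚ) ^ j ≡ 1ℚ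
      sU = trans (cong (_* (- 1ℚ) ^ j) (trans (cong ((- 1ℚ) ^_) (trans (U-n₀ K j) (ℕP.*-comm (q ℕ.∸ j) (p ℕ.^ K)))) (trans (^-* (- 1ℚ) (p ℕ.^ K) (q ℕ.∸ j)) (cong (_^ (q ℕ.∸ j)) (-1^N K)))))
        (trans (sym (^-+ (- 1ℚ) (q ℕ.∸ j) j)) (trans (cong ((- 1ℚ) ^_) (ℕP.m∸n+n≡m lj)) -1^q))
      e₁ : Γₚ x * Γₚ (n₀ k (q ℕ.∸ j)) ≡ Πu x * Πu (suc (N ℕ.∸ x)) * (- 1ℚ) ^ U x * (- 1ℚ) ^ j
      e₁ = trans (cong (λ z → Γₚ x * Γₚ z) y≡) (trans (solve 4 (λ a b c d → a :* b :* (c :* d) := (a :* c) :* (b :* d)) refl ((- 1ℚ) ^ x) (Πu x) ((- 1ℚ) ^ suc (N ℕ.∸ x)) (Πu (suc (N ℕ.∸ x))))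
        (trans (cong₂ _*_ (trans sgn (sym sU)) refl) (solve 4 (λ u s a b → (u :* s) :* (a :* b) := a :* b :* u :* s) refl ((- 1ℚ) ^ U x) ((- 1ℚ) ^ j) (Πu x) (Πu (suc (N ℕ.∸ x))))))

    -- Γ_p(1/3) Γ_p(2/3) Γ_p(1/2), the common denominator of all summands of the first function; the
    -- lower parameter 0 gives Γ_p(0) = 1.
    C : ℚ
    C = Γ̃ (2 ℕ.* q) * Γ̃ (4 ℕ.* q) * Γ̃ (3 ℕ.* q)

    Unit-C : Unit C
    Unit-C = Unit-* (Unit-* (Unit-Γ̃ (2 ℕ.* q)) (Unit-Γ̃ (4 ℕ.* q))) (Unit-Γ̃ (3 ℕ.* q))

    τ₂^q : τ₂ ^ q ≈[ k ] 1ℚ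
    τ₂^q = τ^q K (ℤ.+ 2) p∤2

    τ₃^q : τ₃ ^ q ≈[ k ] 1ℚ
    τ₃^q = τ^q K (ℤ.+ 3) p∤3

    ^q* : ∀ {x} → Int x → x ^ q ≈[ k ] 1ℚ → ∀ l → x ^ (q ℕ.* l) ≈[ k ] 1ℚ
    ^q* {x} ix h l = ≈-trans (≈-reflexive (^-* x q l)) (≈-trans (≈-^ l (Int-^ q ix) Int-1 h) (≈-reflexive (1^ l)))

    module Value (j : ℕ) (j>0 : 0 ℕ.< j) (j<q : j ℕ.< q) (sp : Split j) (L : ℕ) where

      open Split sp

      i : ℕ
      i = q ℕ.∸ j

      i>0 : 0 ℕ.< i
      i>0 = ℕP.m<n⇒0<n∸m j<q

      i<q : i ℕ.< q
      i<q = ℕP.∸-monoʳ-< {q} {j} {0} j>0 (ℕP.<⇒≤ j<q)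

      i+j : i ℕ.+ j ≡ q
      i+j = ℕP.m∸n+n≡m (ℕP.<⇒≤ j<q)

      open JacobiSum L i i>0 i<q using (Jac; s; jacobi-gauss) public

      num : ℚ
      num = Γ̃ r₁ * Γ̃ r₂ * (Γ̃ (6 ℕ.* j) * Γ̃ r₄)

      Int-num : Int num
      Int-num = Int-* (Int-* (Int-Γ̃ r₁) (Int-Γ̃ r₂)) (Int-* (Int-Γ̃ (6 ℕ.* j)) (Int-Γ̃ r₄))

      ia : (i ℕ.+ i) ℕ.+ a ≡ q ℕ.* (2 ℕ.∸ l′)
      ia = go l′ 2j
        where
        ii : (i ℕ.+ i) ℕ.+ 2 ℕ.* j ≡ 2 ℕ.* q
        ii = trans (NS.solve 2 (λ i j → (i NS.:+ i) NS.:+ NS.con 2 NS.:* j NS.:= NS.con 2 NS.:* (i NS.:+ j)) refl i j) (cong (2 ℕ.*_) i+j)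
        go : ∀ l′ → 2 ℕ.* j ≡ a ℕ.+ q ℕ.* l′ → (i ℕ.+ i) ℕ.+ a ≡ q ℕ.* (2 ℕ.∸ l′)
        go zero    h = trans (cong ((i ℕ.+ i) ℕ.+_) (trans (sym (ℕP.+-identityʳ a)) (trans (cong (a ℕ.+_) (sym (ℕP.*-zeroʳ q))) (sym h)))) (trans ii (ℕP.*-comm 2 q))
        go (suc zero) h = ℕP.+-cancelʳ-≡ q _ _ (trans (ℕP.+-assoc (i ℕ.+ i) a q) (trans (cong ((i ℕ.+ i) ℕ.+_) (trans (cong (a ℕ.+_) (sym (ℕP.*-identityʳ q))) (sym h))) (trans ii (NS.solve 1 (λ q → NS.con 2 NS.:* q NS.:= q NS.:* NS.con 1 NS.:+ q) refl q))))
        go (suc (suc l)) h = ⊥-elim (ℕP.<-irrefl h (ℕP.≤-trans (ℕP.*-monoʳ-< 2 j<q) (ℕP.≤-trans (ℕP.≤-reflexive (ℕP.*-comm 2 q)) (ℕP.≤-trans (ℕP.*-monoʳ-≤ q (s≤s (s≤s (z≤n {l})))) (ℕP.m≤n+m (q ℕ.* suc (suc l)) a)))))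

      -- The values at r₁ and r₂ lack Γ_p(1 - j/q) to form the triple of `mult₃`. The reflection
      -- formula supplies it together with a second Γ_p(j/q). One Γ_p(j/q) completes r₄ to the pair
      -- of `mult₂`, the other is the last of the three Gross-Koblitz factors.
      gammas : - (num * ((- 1ℚ) ^ j * τ₃ ^ (3 ℕ.* j))) ≈[ k ] C * τ₂ ^ (2 ℕ.* j) * (Γ̃ (6 ℕ.* d) * (Γ̃ (6 ℕ.* a) * Γ̃ (6 ℕ.* j)))
      gammas = ≈-trans s₁ (≈-trans (≈-reflexive s₂) (≈-trans (≈-*ʳ (Int-* (Int-^ (2 ℕ.* j) iτ₂) (Int-Γ̃ (6 ℕ.* j))) (≈-* (mult₃ d (ℕP.<⇒≤ d<q)) (mult₂ a (ℕP.<⇒≤ a<q)) (Int-* (Int-* (Int-Γ̃ (2 ℕ.* q)) (Int-Γ̃ (4 ℕ.* q))) (Int-Γ̃ (6 ℕ.* d))) iM₂)) (≈-reflexive s₃)))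
        where
        iτ₂ : Int τ₂
        iτ₂ = Int-^ (p ℕ.^ K) (Int-# 2)
        iτ₃ : Int τ₃
        iτ₃ = Int-^ (p ℕ.^ K) (Int-# 3)
        G₆ = Γ̃ (6 ℕ.* j)
        G₆′ = Γ̃ (6 ℕ.* (q ℕ.∸ j))
        M₂ = Γ̃ (3 ℕ.* a) * Γ̃ (3 ℕ.* q ℕ.+ 3 ℕ.* a) * τ₂ ^ (q ℕ.∸ a)
        M₃ = Γ̃ (2 ℕ.* d) * Γ̃ (2 ℕ.* q ℕ.+ 2 ℕ.* d) * Γ̃ (4 ℕ.* q ℕ.+ 2 ℕ.* d) * τ₃ ^ (q ℕ.∸ d)
        iM₂ : Int M₂
        iM₂ = Int-* (Int-* (Int-Γ̃ (3 ℕ.* a)) (Int-Γ̃ (3 ℕ.* q ℕ.+ 3 ℕ.* a))) (Int-^ (q ℕ.∸ a) iτ₂)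
        t₃ : τ₃ ^ (3 ℕ.* j) ≈[ k ] τ₃ ^ (q ℕ.∸ d)
        t₃ = ≈-trans (≈-sym (≈-trans (≈-*ˡ (Int-^ (3 ℕ.* j) iτ₃) τ₃^q) (≈-reflexive (*-identityʳ (τ₃ ^ (3 ℕ.* j))))))
          (≈-trans (≈-reflexive (trans (sym (^-+ τ₃ (3 ℕ.* j) q)) (trans (cong (τ₃ ^_) e₃) (^-+ τ₃ (q ℕ.∸ d) (q ℕ.* l))))) (≈-trans (≈-*ˡ (Int-^ (q ℕ.∸ d) iτ₃) (^q* iτ₃ τ₃^q l)) (≈-reflexive (*-identityʳ (τ₃ ^ (q ℕ.∸ d))))))
          where
          e₃ : 3 ℕ.* j ℕ.+ q ≡ (q ℕ.∸ d) ℕ.+ q ℕ.* l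
          e₃ = trans (cong (3 ℕ.* j ℕ.+_) (sym (ℕP.m+[n∸m]≡n (ℕP.<⇒≤ d<q)))) (trans (NS.solve 3 (λ j d x → j NS.:+ (d NS.:+ x) NS.:= x NS.:+ (j NS.:+ d)) refl (3 ℕ.* j) d (q ℕ.∸ d)) (cong ((q ℕ.∸ d) ℕ.+_) 3j))
        t₂ : τ₂ ^ (q ℕ.∸ a) * τ₂ ^ (2 ℕ.* j) ≈[ k ] 1ℚ
        t₂ = ≈-trans (≈-reflexive (trans (sym (^-+ τ₂ (q ℕ.∸ a) (2 ℕ.* j))) (cong (τ₂ ^_) e₂))) (^q* iτ₂ τ₂^q (suc l′))
          where
          e₂ : (q ℕ.∸ a) ℕ.+ 2 ℕ.* j ≡ q ℕ.* suc l′
          e₂ = trans (cong ((q ℕ.∸ a) ℕ.+_) 2j) (trans (sym (ℕP.+-assoc (q ℕ.∸ a) a (q ℕ.* l′))) (trans (cong (ℕ._+ q ℕ.* l′) (ℕP.m∸n+n≡m (ℕP.<⇒≤ a<q))) (sym (ℕP.*-suc q l′))))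
        s₁ : - (num * ((- 1ℚ) ^ j * τ₃ ^ (3 ℕ.* j))) ≈[ k ] num * (G₆ * G₆′) * τ₃ ^ (q ℕ.∸ d) * (τ₂ ^ (q ℕ.∸ a) * τ₂ ^ (2 ℕ.* j))
        s₁ = ≈-trans (≈-reflexive (solve 3 (λ n s t → :- (n :* (s :* t)) := n :* (:- s) :* t :* con 1ℚ) refl num ((- 1ℚ) ^ j) (τ₃ ^ (3 ℕ.* j))))
          (≈-* (≈-* (≈-*ˡ Int-num (≈-sym (Γ̃-refl j (ℕP.<⇒≤ j<q)))) t₃ (Int-* Int-num (Int-* (Int-Γ̃ (6 ℕ.* j)) (Int-Γ̃ (6 ℕ.* (q ℕ.∸ j))))) (Int-^ (3 ℕ.* j) iτ₃)) (≈-sym t₂)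
            (Int-* (Int-* Int-num (Int-* (Int-Γ̃ (6 ℕ.* j)) (Int-Γ̃ (6 ℕ.* (q ℕ.∸ j))))) (Int-^ (q ℕ.∸ d) iτ₃)) Int-1)
        s₂ : num * (G₆ * G₆′) * τ₃ ^ (q ℕ.∸ d) * (τ₂ ^ (q ℕ.∸ a) * τ₂ ^ (2 ℕ.* j)) ≡ M₃ * M₂ * (τ₂ ^ (2 ℕ.* j) * G₆)
        s₂ = trans (solve 8 (λ a b c d e t x y → a :* b :* (c :* d) :* (c :* e) :* t :* (x :* y) := (a :* b :* e) :* t :* ((c :* d) :* x) :* (y :* c)) refl (Γ̃ r₁) (Γ̃ r₂) G₆ (Γ̃ r₄) G₆′ (τ₃ ^ (q ℕ.∸ d)) (τ₂ ^ (q ℕ.∸ a)) (τ₂ ^ (2 ℕ.* j)))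
          (cong₂ (λ u v → u * τ₃ ^ (q ℕ.∸ d) * (v * τ₂ ^ (q ℕ.∸ a)) * (τ₂ ^ (2 ℕ.* j) * G₆)) (prod₃ Γ̃) (prod₂ Γ̃))
        s₃ : Γ̃ (2 ℕ.* q) * Γ̃ (4 ℕ.* q) * Γ̃ (6 ℕ.* d) * (Γ̃ (3 ℕ.* q) * Γ̃ (6 ℕ.* a)) * (τ₂ ^ (2 ℕ.* j) * G₆) ≡ C * τ₂ ^ (2 ℕ.* j) * (Γ̃ (6 ℕ.* d) * (Γ̃ (6 ℕ.* a) * G₆))
        s₃ = solve 7 (λ a b c d e f g → a :* b :* c :* (d :* e) :* (f :* g) := a :* b :* d :* f :* (c :* (e :* g))) refl (Γ̃ (2 ℕ.* q)) (Γ̃ (4 ℕ.* q)) (Γ̃ (6 ℕ.* d)) (Γ̃ (3 ℕ.* q)) (Γ̃ (6 ℕ.* a)) (τ₂ ^ (2 ℕ.* j)) G₆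

      bound : ℕ
      bound = s k a j d (2 ℕ.∸ l′) e a<q j<q d<q i+j ia abc ℕ.+ k

      value : bound ℕ.≤ L → (- P) ^ suc e * num * ((- 1ℚ) ^ j * τ₃ ^ (3 ℕ.* j)) ≈[ k ] - (P * P * C * (τ₂ ^ (2 ℕ.* j) * Jac))
      value hL = ≈-trans (≈-reflexive e₁) (≈-trans (≈-*ˡ (Int-* (Int-# p) (Int-^ e (Int-neg (Int-# p)))) gammas) (≈-trans (≈-reflexive e₂)
        (≈-trans (≈-*ˡ iPC (≈-trans (≈-*ˡ (Int-^ e (Int-neg (Int-# p))) (≈-sym gg)) (≈-sym (jacobi-gauss k a j d (2 ℕ.∸ l′) e a<q j<q d<q i+j ia abc hL (suc k) ℕP.≤-refl)))) (≈-reflexive e₃))))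
        where
        iPC : Int (P * C * τ₂ ^ (2 ℕ.* j))
        iPC = Int-* (Int-* (Int-# p) (Unit.int-u Unit-C)) (Int-^ (2 ℕ.* j) (Int-^ (p ℕ.^ K) (Int-# 2)))
        σ = (- 1ℚ) ^ j * τ₃ ^ (3 ℕ.* j)
        ggg : ℚ
        ggg = Γ̃ (6 ℕ.* d) * (Γ̃ (6 ℕ.* a) * Γ̃ (6 ℕ.* j))
        hk : k ℕ.≤ suc (suc k)
        hk = ℕP.m≤n+m k 2
        gg : Γₚ (n₀ (suc (suc k)) d) * (Γₚ (n₀ (suc (suc k)) a) * Γₚ (n₀ (suc (suc k)) j)) ≈[ k ] ggg
        gg = ≈-* (Γ̃-n₀ (suc (suc k)) d hk (ℕP.<⇒≤ d<q)) (≈-* (Γ̃-n₀ (suc (suc k)) a hk (ℕP.<⇒≤ a<q)) (Γ̃-n₀ (suc (suc k)) j hk (ℕP.<⇒≤ j<q)) (Int-Γ̃ (6 ℕ.* a)) (Int-Γₚ (n₀ (suc (suc k)) j))) (Int-Γ̃ (6 ℕ.* d)) (Int-* (Int-Γₚ (n₀ (suc (suc k)) a)) (Int-Γₚ (n₀ (suc (suc k)) j)))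
        e₁ : (- P) ^ suc e * num * σ ≡ P * (- P) ^ e * (- (num * σ))
        e₁ = solve 4 (λ P x n s → (:- P) :* x :* n :* s := P :* x :* (:- (n :* s))) refl P ((- P) ^ e) num σ
        e₂ : P * (- P) ^ e * (C * τ₂ ^ (2 ℕ.* j) * ggg) ≡ P * C * τ₂ ^ (2 ℕ.* j) * ((- P) ^ e * ggg)
        e₂ = solve 5 (λ P x c t g → P :* x :* (c :* t :* g) := P :* c :* t :* (x :* g)) refl P ((- P) ^ e) C (τ₂ ^ (2 ℕ.* j)) ggg
        e₃ : P * C * τ₂ ^ (2 ℕ.* j) * (- (P * Jac)) ≡ - (P * P * C * (τ₂ ^ (2 ℕ.* j) * Jac))
        e₃ = solve 4 (λ P c t J → P :* c :* t :* (:- (P :* J)) := :- (P :* P :* c :* (t :* J))) refl P C (τ₂ ^ (2 ℕ.* j)) Jac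

  module RS = +-*-Solver

  -- j is located relative to q/3, 2q/3 and q/2. Of the six combinations four occur, since the
  -- lowest third lies in the lower half and the highest third in the upper half.
  split : ∀ j → 0 ℕ.< j → j ℕ.< q → Split j
  split j j>0 j<q = go (3 ℕ.* j ℕ.≤? q) (3 ℕ.* j ℕ.≤? 2 ℕ.* q) (2 ℕ.* j ℕ.<? q)
    where
    6q = 6 ℕ.* q
    <6q : ∀ c x → x ℕ.< q → c ℕ.≤ 4 → c ℕ.* q ℕ.+ 2 ℕ.* x ℕ.< 6q
    <6q c x l hc = ℕP.≤-trans (ℕP.+-mono-≤-< (ℕP.*-monoˡ-≤ q hc) (ℕP.*-monoʳ-< 2 l)) (ℕP.≤-reflexive (NS.solve 1 (λ q → NS.con 4 NS.:* q NS.:+ NS.con 2 NS.:* q NS.:= NS.con 6 NS.:* q) refl q))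
    <6q3 : ∀ x → x ℕ.< q → 3 ℕ.* q ℕ.+ 3 ℕ.* x ℕ.< 6q
    <6q3 x l = ℕP.≤-trans (ℕP.+-monoʳ-< (3 ℕ.* q) (ℕP.*-monoʳ-< 3 l)) (ℕP.≤-reflexive (NS.solve 1 (λ q → NS.con 3 NS.:* q NS.:+ NS.con 3 NS.:* q NS.:= NS.con 6 NS.:* q) refl q))
    <6q3′ : ∀ x → x ℕ.< q → 3 ℕ.* x ℕ.< 6q
    <6q3′ x l = ℕP.≤-trans (s≤s (ℕP.m≤n+m (3 ℕ.* x) (3 ℕ.* q))) (<6q3 x l)
    6i : 6 ℕ.* (q ℕ.∸ j) ℕ.+ 6 ℕ.* j ≡ 6q
    6i = trans (sym (ℕP.*-distribˡ-+ 6 (q ℕ.∸ j) j)) (cong (6 ℕ.*_) (ℕP.m∸n+n≡m (ℕP.<⇒≤ j<q)))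
    -- the two halves: 2j = a or 2j = q + a
    record Half (l′ m₄ r₄ a : ℕ) : Set where
      field
        a<q : a ℕ.< q
        2j  : 2 ℕ.* j ≡ a ℕ.+ q ℕ.* l′
        r₄< : r₄ ℕ.< 6 ℕ.* q
        r₄≡ : r₄ ℕ.+ 6 ℕ.* q ℕ.* m₄ ≡ 3 ℕ.* q ℕ.+ 6 ℕ.* j
        prod₂ : ∀ (g : ℕ → ℚ) → g (6 ℕ.* j) * g r₄ ≡ g (3 ℕ.* a) * g (3 ℕ.* q ℕ.+ 3 ℕ.* a)
    lo : 2 ℕ.* j ℕ.< q → Half 0 0 (3 ℕ.* q ℕ.+ 6 ℕ.* j) (2 ℕ.* j)
    lo h = record
      { a<q = h
      ; 2j = trans (sym (ℕP.+-identityʳ (2 ℕ.* j))) (cong (2 ℕ.* j ℕ.+_) (sym (ℕP.*-zeroʳ q)))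
      ; r₄< = subst (ℕ._< 6q) (cong (3 ℕ.* q ℕ.+_) (sym 6j)) (<6q3 (2 ℕ.* j) h)
      ; r₄≡ = trans (cong (3 ℕ.* q ℕ.+ 6 ℕ.* j ℕ.+_) (ℕP.*-zeroʳ 6q)) (ℕP.+-identityʳ (3 ℕ.* q ℕ.+ 6 ℕ.* j))
      ; prod₂ = λ g → cong₂ (λ x y → g x * g (3 ℕ.* q ℕ.+ y)) 6j 6j }
      where
      6j : 6 ℕ.* j ≡ 3 ℕ.* (2 ℕ.* j)
      6j = ℕP.*-assoc 3 2 j
    hi : ∀ a → q ℕ.+ a ≡ 2 ℕ.* j → Half 1 1 (3 ℕ.* a) a
    hi a h = record
      { a<q = a<
      ; 2j = trans (sym h) (trans (ℕP.+-comm q a) (cong (a ℕ.+_) (sym (ℕP.*-identityʳ q))))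
      ; r₄< = <6q3′ a a<
      ; r₄≡ = trans (NS.solve 2 (λ a q → NS.con 3 NS.:* a NS.:+ NS.con 6 NS.:* q NS.:* NS.con 1 NS.:= NS.con 3 NS.:* q NS.:+ NS.con 3 NS.:* (q NS.:+ a)) refl a q) (cong (3 ℕ.* q ℕ.+_) (sym 6j))
      ; prod₂ = λ g → trans (cong (λ x → g x * g (3 ℕ.* a)) (trans 6j (ℕP.*-distribˡ-+ 3 q a))) (*-comm (g (3 ℕ.* q ℕ.+ 3 ℕ.* a)) (g (3 ℕ.* a))) }
      where
      6j : 6 ℕ.* j ≡ 3 ℕ.* (q ℕ.+ a)
      6j = trans (ℕP.*-assoc 3 2 j) (cong (3 ℕ.*_) (sym h))
      a< : a ℕ.< q
      a< = ℕP.+-cancelˡ-< q a q (subst (ℕ._< q ℕ.+ q) (sym h) (ℕP.≤-trans (ℕP.*-monoʳ-< 2 j<q) (ℕP.≤-reflexive (NS.solve 1 (λ q → NS.con 2 NS.:* q NS.:= q NS.:+ q) refl q))))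
    -- the three thirds: l q = 3j + d with l = 1, 2, 3
    T₁ : ∀ d l′ m₄ r₄ a → Half l′ m₄ r₄ a → l′ ≡ 0 → m₄ ≡ 0 → 3 ℕ.* j ℕ.+ d ≡ q → Split j
    T₁ d l′ m₄ r₄ a H refl refl h = record
      { r₁ = 2 ℕ.* d ; r₂ = 2 ℕ.* q ℕ.+ 2 ℕ.* d ; r₄ = r₄ ; d = d ; a = a ; l = 1 ; l′ = 0 ; e = 1 ; m₁ = 0 ; m₂ = 0 ; m₄ = 0
      ; d<q = d< ; a<q = Half.a<q H ; 3j = trans h (sym (ℕP.*-identityʳ q)) ; 2j = Half.2j H
      ; abc = trans (cong (λ z → d ℕ.+ (z ℕ.+ j)) (trans (sym (trans (cong (a ℕ.+_) (ℕP.*-zeroʳ q)) (ℕP.+-identityʳ a))) (sym (Half.2j H)))) (trans (NS.solve 2 (λ d j → d NS.:+ (NS.con 2 NS.:* j NS.:+ j) NS.:= NS.con 3 NS.:* j NS.:+ d) refl d j) (trans h (sym (ℕP.*-identityʳ q))))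
      ; r₁< = <6q 0 d d< z≤n ; r₂< = <6q 2 d d< (s≤s (s≤s z≤n)) ; r₄< = Half.r₄< H
      ; r₁≡ = trans (NS.solve 2 (λ d j → NS.con 2 NS.:* d NS.:+ NS.con 6 NS.:* j NS.:= NS.con 2 NS.:* (NS.con 3 NS.:* j NS.:+ d)) refl d j) (trans (cong (2 ℕ.*_) h) (NS.solve 1 (λ q → NS.con 2 NS.:* q NS.:= NS.con 2 NS.:* q NS.:+ NS.con 6 NS.:* q NS.:* NS.con 0) refl q))
      ; r₂≡ = trans (NS.solve 3 (λ d j q → NS.con 2 NS.:* q NS.:+ NS.con 2 NS.:* d NS.:+ NS.con 6 NS.:* j NS.:= NS.con 2 NS.:* q NS.:+ NS.con 2 NS.:* (NS.con 3 NS.:* j NS.:+ d)) refl d j q) (trans (cong (λ z → 2 ℕ.* q ℕ.+ 2 ℕ.* z) h) (NS.solve 1 (λ q → NS.con 2 NS.:* q NS.:+ NS.con 2 NS.:* q NS.:= NS.con 4 NS.:* q NS.:+ NS.con 6 NS.:* q NS.:* NS.con 0) refl q))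
      ; r₄≡ = Half.r₄≡ H ; m₄≤ = z≤n ; expo = refl
      ; prod₃ = λ g → cong (λ z → g (2 ℕ.* d) * g (2 ℕ.* q ℕ.+ 2 ℕ.* d) * g z) i≡
      ; prod₂ = Half.prod₂ H }
      where
      d< : d ℕ.< q
      d< = ℕP.≤-trans (ℕP.+-monoˡ-≤ d (ℕP.≤-trans j>0 (ℕP.m≤m+n j _))) (ℕP.≤-reflexive h)
      i≡ : 6 ℕ.* (q ℕ.∸ j) ≡ 4 ℕ.* q ℕ.+ 2 ℕ.* d
      i≡ = ℕP.+-cancelʳ-≡ (6 ℕ.* j) _ _ (trans 6i (trans (NS.solve 1 (λ q → NS.con 6 NS.:* q NS.:= NS.con 4 NS.:* q NS.:+ NS.con 2 NS.:* q) refl q) (trans (cong (λ z → 4 ℕ.* q ℕ.+ 2 ℕ.* z) (sym h)) (NS.solve 3 (λ q d j → NS.con 4 NS.:* q NS.:+ NS.con 2 NS.:* (NS.con 3 NS.:* j NS.:+ d) NS.:= NS.con 4 NS.:* q NS.:+ NS.con 2 NS.:* d NS.:+ NS.con 6 NS.:* j) refl q d j))))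
    T₂ : ∀ d l′ m₄ r₄ a e → Half l′ m₄ r₄ a → m₄ ℕ.≤ 1 → (2 ℕ.+ (1 ℕ.∸ m₄) ≡ suc e) → e ℕ.+ l′ ≡ 2 → 3 ℕ.* j ℕ.+ d ≡ 2 ℕ.* q → d ℕ.< q → Split j
    T₂ d l′ m₄ r₄ a e H hm he hl h d< = record
      { r₁ = 4 ℕ.* q ℕ.+ 2 ℕ.* d ; r₂ = 2 ℕ.* d ; r₄ = r₄ ; d = d ; a = a ; l = 2 ; l′ = l′ ; e = e ; m₁ = 1 ; m₂ = 0 ; m₄ = m₄
      ; d<q = d< ; a<q = Half.a<q H ; 3j = trans h (ℕP.*-comm 2 q) ; 2j = Half.2j H
      ; abc = ℕP.+-cancelʳ-≡ (q ℕ.* l′) _ _ (trans (NS.solve 4 (λ d a j x → d NS.:+ (a NS.:+ j) NS.:+ x NS.:= d NS.:+ ((a NS.:+ x) NS.:+ j)) refl d a j (q ℕ.* l′)) (trans (cong (λ z → d ℕ.+ (z ℕ.+ j)) (sym (Half.2j H)))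
          (trans (NS.solve 2 (λ d j → d NS.:+ (NS.con 2 NS.:* j NS.:+ j) NS.:= NS.con 3 NS.:* j NS.:+ d) refl d j) (trans h (trans (ℕP.*-comm 2 q) (trans (cong (q ℕ.*_) (sym hl)) (ℕP.*-distribˡ-+ q e l′)))))))
      ; r₁< = <6q 4 d d< ℕP.≤-refl ; r₂< = <6q 0 d d< z≤n ; r₄< = Half.r₄< H
      ; r₁≡ = trans (NS.solve 3 (λ d j q → NS.con 4 NS.:* q NS.:+ NS.con 2 NS.:* d NS.:+ NS.con 6 NS.:* j NS.:= NS.con 4 NS.:* q NS.:+ NS.con 2 NS.:* (NS.con 3 NS.:* j NS.:+ d)) refl d j q) (trans (cong (λ z → 4 ℕ.* q ℕ.+ 2 ℕ.* z) h) (NS.solve 1 (λ q → NS.con 4 NS.:* q NS.:+ NS.con 2 NS.:* (NS.con 2 NS.:* q) NS.:= NS.con 2 NS.:* q NS.:+ NS.con 6 NS.:* q NS.:* NS.con 1) refl q))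
      ; r₂≡ = trans (NS.solve 2 (λ d j → NS.con 2 NS.:* d NS.:+ NS.con 6 NS.:* j NS.:= NS.con 2 NS.:* (NS.con 3 NS.:* j NS.:+ d)) refl d j) (trans (cong (2 ℕ.*_) h) (NS.solve 1 (λ q → NS.con 2 NS.:* (NS.con 2 NS.:* q) NS.:= NS.con 4 NS.:* q NS.:+ NS.con 6 NS.:* q NS.:* NS.con 0) refl q))
      ; r₄≡ = Half.r₄≡ H ; m₄≤ = hm ; expo = he
      ; prod₃ = λ g → trans (cong (λ z → g (4 ℕ.* q ℕ.+ 2 ℕ.* d) * g (2 ℕ.* d) * g z) i≡) (RS.solve 3 (λ a b c → a RS.:* b RS.:* c RS.:= b RS.:* c RS.:* a) refl (g (4 ℕ.* q ℕ.+ 2 ℕ.* d)) (g (2 ℕ.* d)) (g (2 ℕ.* q ℕ.+ 2 ℕ.* d)))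
      ; prod₂ = Half.prod₂ H }
      where
      i≡ : 6 ℕ.* (q ℕ.∸ j) ≡ 2 ℕ.* q ℕ.+ 2 ℕ.* d
      i≡ = ℕP.+-cancelʳ-≡ (6 ℕ.* j) _ _ (trans 6i (trans (NS.solve 1 (λ q → NS.con 6 NS.:* q NS.:= NS.con 2 NS.:* q NS.:+ NS.con 2 NS.:* (NS.con 2 NS.:* q)) refl q) (trans (cong (λ z → 2 ℕ.* q ℕ.+ 2 ℕ.* z) (sym h)) (NS.solve 3 (λ q d j → NS.con 2 NS.:* q NS.:+ NS.con 2 NS.:* (NS.con 3 NS.:* j NS.:+ d) NS.:= NS.con 2 NS.:* q NS.:+ NS.con 2 NS.:* d NS.:+ NS.con 6 NS.:* j) refl q d j))))
    T₃ : ∀ d l′ m₄ r₄ a → Half l′ m₄ r₄ a → l′ ≡ 1 → m₄ ≡ 1 → 3 ℕ.* j ℕ.+ d ≡ 3 ℕ.* q → d ℕ.< q → Split j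
    T₃ d l′ m₄ r₄ a H refl refl h d< = record
      { r₁ = 2 ℕ.* q ℕ.+ 2 ℕ.* d ; r₂ = 4 ℕ.* q ℕ.+ 2 ℕ.* d ; r₄ = r₄ ; d = d ; a = a ; l = 3 ; l′ = 1 ; e = 2 ; m₁ = 1 ; m₂ = 1 ; m₄ = 1
      ; d<q = d< ; a<q = Half.a<q H ; 3j = trans h (ℕP.*-comm 3 q) ; 2j = Half.2j H
      ; abc = ℕP.+-cancelʳ-≡ (q ℕ.* 1) _ _ (trans (NS.solve 4 (λ d a j x → d NS.:+ (a NS.:+ j) NS.:+ x NS.:= d NS.:+ ((a NS.:+ x) NS.:+ j)) refl d a j (q ℕ.* 1)) (trans (cong (λ z → d ℕ.+ (z ℕ.+ j)) (sym (Half.2j H)))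
          (trans (NS.solve 2 (λ d j → d NS.:+ (NS.con 2 NS.:* j NS.:+ j) NS.:= NS.con 3 NS.:* j NS.:+ d) refl d j) (trans h (NS.solve 1 (λ q → NS.con 3 NS.:* q NS.:= q NS.:* NS.con 2 NS.:+ q NS.:* NS.con 1) refl q)))))
      ; r₁< = <6q 2 d d< (s≤s (s≤s z≤n)) ; r₂< = <6q 4 d d< ℕP.≤-refl ; r₄< = Half.r₄< H
      ; r₁≡ = trans (NS.solve 3 (λ d j q → NS.con 2 NS.:* q NS.:+ NS.con 2 NS.:* d NS.:+ NS.con 6 NS.:* j NS.:= NS.con 2 NS.:* q NS.:+ NS.con 2 NS.:* (NS.con 3 NS.:* j NS.:+ d)) refl d j q) (trans (cong (λ z → 2 ℕ.* q ℕ.+ 2 ℕ.* z) h) (NS.solve 1 (λ q → NS.con 2 NS.:* q NS.:+ NS.con 2 NS.:* (NS.con 3 NS.:* q) NS.:= NS.con 2 NS.:* q NS.:+ NS.con 6 NS.:* q NS.:* NS.con 1) refl q))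
      ; r₂≡ = trans (NS.solve 3 (λ d j q → NS.con 4 NS.:* q NS.:+ NS.con 2 NS.:* d NS.:+ NS.con 6 NS.:* j NS.:= NS.con 4 NS.:* q NS.:+ NS.con 2 NS.:* (NS.con 3 NS.:* j NS.:+ d)) refl d j q) (trans (cong (λ z → 4 ℕ.* q ℕ.+ 2 ℕ.* z) h) (NS.solve 1 (λ q → NS.con 4 NS.:* q NS.:+ NS.con 2 NS.:* (NS.con 3 NS.:* q) NS.:= NS.con 4 NS.:* q NS.:+ NS.con 6 NS.:* q NS.:* NS.con 1) refl q))
      ; r₄≡ = Half.r₄≡ H ; m₄≤ = s≤s z≤n ; expo = refl
      ; prod₃ = λ g → trans (cong (λ z → g (2 ℕ.* q ℕ.+ 2 ℕ.* d) * g (4 ℕ.* q ℕ.+ 2 ℕ.* d) * g z) i≡) (RS.solve 3 (λ a b c → a RS.:* b RS.:* c RS.:= c RS.:* a RS.:* b) refl (g (2 ℕ.* q ℕ.+ 2 ℕ.* d)) (g (4 ℕ.* q ℕ.+ 2 ℕ.* d)) (g (2 ℕ.* d)))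
      ; prod₂ = Half.prod₂ H }
      where
      i≡ : 6 ℕ.* (q ℕ.∸ j) ≡ 2 ℕ.* d
      i≡ = ℕP.+-cancelʳ-≡ (6 ℕ.* j) _ _ (trans 6i (trans (NS.solve 1 (λ q → NS.con 6 NS.:* q NS.:= NS.con 2 NS.:* (NS.con 3 NS.:* q)) refl q) (trans (cong (2 ℕ.*_) (sym h)) (NS.solve 2 (λ d j → NS.con 2 NS.:* (NS.con 3 NS.:* j NS.:+ d) NS.:= NS.con 2 NS.:* d NS.:+ NS.con 6 NS.:* j) refl d j))))
    half : Dec (2 ℕ.* j ℕ.< q) → (Half 0 0 (3 ℕ.* q ℕ.+ 6 ℕ.* j) (2 ℕ.* j) × 2 ℕ.* j ℕ.< q) ⊎ Σ ℕ λ a → Half 1 1 (3 ℕ.* a) a × q ℕ.≤ 2 ℕ.* j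
    half (yes h) = inj₁ (lo h , h)
    half (no h)  = inj₂ (2 ℕ.* j ℕ.∸ q , hi (2 ℕ.* j ℕ.∸ q) (ℕP.m+[n∸m]≡n (ℕP.≮⇒≥ h)) , ℕP.≮⇒≥ h)
    jjj : 3 ℕ.* j ≡ 2 ℕ.* j ℕ.+ j
    jjj = NS.solve 1 (λ j → NS.con 3 NS.:* j NS.:= NS.con 2 NS.:* j NS.:+ j) refl j
    go : Dec (3 ℕ.* j ℕ.≤ q) → Dec (3 ℕ.* j ℕ.≤ 2 ℕ.* q) → Dec (2 ℕ.* j ℕ.< q) → Split j
    go (yes h₁) _ _ = T₁ (q ℕ.∸ 3 ℕ.* j) 0 0 _ _ (lo (ℕP.≤-trans (ℕP.≤-trans (ℕP.≤-reflexive (ℕP.+-comm 1 (2 ℕ.* j))) (ℕP.≤-trans (ℕP.+-monoʳ-≤ (2 ℕ.* j) j>0) (ℕP.≤-reflexive (sym jjj)))) h₁)) refl refl (ℕP.m+[n∸m]≡n h₁)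
    go (no ¬h₁) (yes h₂) d = [ (λ (H , _) → T₂ _ 0 0 _ _ 2 H z≤n refl refl (ℕP.m+[n∸m]≡n h₂) d<) , (λ (a , H , _) → T₂ _ 1 1 _ a 1 H ℕP.≤-refl refl refl (ℕP.m+[n∸m]≡n h₂) d<) ]′ (half d)
      where
      d< : 2 ℕ.* q ℕ.∸ 3 ℕ.* j ℕ.< q
      d< = ℕP.+-cancelʳ-< (3 ℕ.* j) _ q (subst (ℕ._< q ℕ.+ 3 ℕ.* j) (sym (ℕP.m∸n+n≡m h₂)) (ℕP.≤-trans (s≤s (ℕP.≤-reflexive (NS.solve 1 (λ q → NS.con 2 NS.:* q NS.:= q NS.:+ q) refl q))) (ℕP.+-monoʳ-< q (ℕP.≰⇒> ¬h₁))))
    go (no ¬h₁) (no ¬h₂) d = [ (λ (_ , h) → ⊥-elim (¬h₂ (ℕP.≤-trans (ℕP.≤-reflexive jjj) (ℕP.≤-trans (ℕP.+-mono-≤ (ℕP.<⇒≤ h) (ℕP.<⇒≤ j<q)) (ℕP.≤-reflexive (NS.solve 1 (λ q → q NS.:+ q NS.:= NS.con 2 NS.:* q) refl q)))))) ,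
        (λ (a , H , _) → T₃ _ 1 1 _ a H refl refl (ℕP.m+[n∸m]≡n le) d<) ]′ (half d)
      where
      le : 3 ℕ.* j ℕ.≤ 3 ℕ.* q
      le = ℕP.*-monoʳ-≤ 3 (ℕP.<⇒≤ j<q)
      d< : 3 ℕ.* q ℕ.∸ 3 ℕ.* j ℕ.< q
      d< = ℕP.+-cancelʳ-< (3 ℕ.* j) _ q (subst (ℕ._< q ℕ.+ 3 ℕ.* j) (sym (ℕP.m∸n+n≡m le)) (ℕP.≤-trans (s≤s (ℕP.≤-reflexive (NS.solve 1 (λ q → NS.con 3 NS.:* q NS.:= q NS.:+ NS.con 2 NS.:* q) refl q))) (ℕP.+-monoʳ-< q (ℕP.≰⇒> ¬h₂))))

  -- Counting points

  δ∣-yes : ∀ n → p ∣ n → δ∣ n ≡ 1ℚ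
  δ∣-yes n h = trans (cong (λ z → 1ℚ - z) (trans (cong # (ν-yes n h)) #0)) refl

  δ∣-no : ∀ n → ¬ (p ∣ n) → δ∣ n ≡ 0ℚ
  δ∣-no n h = trans (cong (λ z → 1ℚ - z) (trans (cong # (ν-no n h)) #1)) refl

  δ∣ℤ : ℤ → ℚ
  δ∣ℤ m = δ∣ ℤ.∣ m ∣

  ∣→1 : ∀ m → p ∣ ℤ.∣ m ∣ → Div 1 (ι m)
  ∣→1 m h = ∣→Div-ι 1 m (subst (_∣ ℤ.∣ m ∣) (sym (ℕP.*-identityʳ p)) h)

  1→∣ : ∀ m → Div 1 (ι m) → p ∣ ℤ.∣ m ∣
  1→∣ m h = subst (_∣ ℤ.∣ m ∣) (ℕP.*-identityʳ p) (Div→∣ 1 m h)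

  δ∣ℤ-cong : ∀ m m′ → (p ∣ ℤ.∣ m ∣ → p ∣ ℤ.∣ m′ ∣) → (p ∣ ℤ.∣ m′ ∣ → p ∣ ℤ.∣ m ∣) → δ∣ℤ m ≡ δ∣ℤ m′
  δ∣ℤ-cong m m′ f g = go (p ∣? ℤ.∣ m ∣)
    where
    go : Dec (p ∣ ℤ.∣ m ∣) → δ∣ℤ m ≡ δ∣ℤ m′
    go (yes h) = trans (δ∣-yes _ h) (sym (δ∣-yes _ (f h)))
    go (no h)  = trans (δ∣-no _ h) (sym (δ∣-no _ (λ z → h (g z))))

  δ∣ℤ-≈ : ∀ m m′ → ι m ≈[ 1 ] ι m′ → δ∣ℤ m ≡ δ∣ℤ m′
  δ∣ℤ-≈ m m′ h = δ∣ℤ-cong m m′ (λ d → 1→∣ m′ (≈0→Div (≈-trans (≈-sym h) (Div→≈0 (∣→1 m d))))) (λ d → 1→∣ m (≈0→Div (≈-trans h (Div→≈0 (∣→1 m′ d)))))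

  q′ : ℕ
  q′ = q ℕ.∸ 1

  qq : q ≡ suc q′
  qq = sym (ℕP.m+[n∸m]≡n 0<q)

  homSum : ℕ → ℚ → ℚ → ℚ
  homSum zero    u v = 1ℚ
  homSum (suc n) u v = u ^ suc n + v * homSum n u v

  homSum-diff : ∀ n u v → (u - v) * homSum n u v ≡ u ^ suc n - v ^ suc n
  homSum-diff zero    u v = solve 2 (λ u v → (u :- v) :* con 1ℚ := u :* con 1ℚ :- v :* con 1ℚ) refl u v
  homSum-diff (suc n) u v = trans (solve 4 (λ u v x h → (u :- v) :* (x :+ v :* h) := (u :- v) :* x :+ v :* ((u :- v) :* h)) refl u v (u ^ suc n) (homSum n u v))
    (trans (cong (λ z → (u - v) * u ^ suc n + v * z) (homSum-diff n u v)) (solve 4 (λ u v x y → (u :- v) :* x :+ v :* (x :- y) := u :* x :- v :* y) refl u v (u ^ suc n) (v ^ suc n)))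

  -- The orthogonality sum over the nontrivial characters only: the trivial one is excluded because
  -- the Jacobi sums are evaluated for 0 < j < p - 1.
  geomSum : ℚ → ℚ → ℚ
  geomSum u v = ∑ q′ (λ j → u ^ (q ℕ.∸ suc j) * v ^ suc j)

  geomSum-homSum : ∀ u v → geomSum u v ≡ u * homSum q′ u v - u ^ q
  geomSum-homSum u v = trans (∑-ext q′ (λ j → cong (λ z → u ^ (z ℕ.∸ suc j) * v ^ suc j) qq)) (trans (go q′) (cong (λ z → u * homSum q′ u v - u ^ z) (sym qq)))
    where
    go : ∀ n → ∑ n (λ j → u ^ (n ℕ.∸ j) * v ^ suc j) ≡ u * homSum n u v - u ^ suc n
    go zero    = solve 1 (λ u → con 0ℚ := u :* con 1ℚ :- u :* con 1ℚ) refl u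
    go (suc n) = trans (cong (u ^ suc n * v ^ 1 +_) (trans (∑-ext n (λ j → solve 3 (λ a v b → a :* (v :* b) := v :* (a :* b)) refl (u ^ (n ℕ.∸ j)) v (v ^ suc j))) (trans (∑-*ˡ n v (λ j → u ^ (n ℕ.∸ j) * v ^ suc j)) (cong (v *_) (go n)))))
      (solve 4 (λ u v x h → x :* (v :* con 1ℚ) :+ v :* (u :* h :- x) := u :* (x :+ v :* h) :- u :* x) refl u v (u ^ suc n) (homSum n u v))

  Int-homSum : ∀ n {u v} → Int u → Int v → Int (homSum n u v)
  Int-homSum zero    iu iv = Int-1
  Int-homSum (suc n) iu iv = Int-+ (Int-^ (suc n) iu) (Int-* iv (Int-homSum n iu iv))

  homSum-≈ : ∀ {e} n {u v} → Int u → Int v → u ≈[ e ] v → homSum n u v ≈[ e ] # (suc n) * v ^ n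
  homSum-≈ zero    iu iv h = ≈-reflexive (trans (sym (*-identityˡ 1ℚ)) (cong (_* 1ℚ) (sym #1)))
  homSum-≈ (suc n) {u} {v} iu iv h = ≈-trans (≈-+ (≈-^ (suc n) iu iv h) (≈-*ˡ iv (homSum-≈ n iu iv h))) (≈-reflexive (trans (solve 3 (λ v x m → v :* x :+ v :* (m :* x) := (con 1ℚ :+ m) :* (v :* x)) refl v (v ^ n) (# (suc n))) (cong (_* (v * v ^ n)) (sym (#-suc (suc n))))))

  -- u^q - v^q vanishes for units, so the complete sum vanishes unless u and v agree, where it
  -- consists of q equal terms. The second term on the right is the omitted summand u^q, which is 1
  -- or 0.
  geomSum-val : ∀ L U V → ¬ (p ∣ ℤ.∣ V ∣) → geomSum (τ L U) (τ L V) ≈[ suc L ] # q * δ∣ℤ (U ℤ.- V) - (1ℚ - δ∣ℤ U)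
  geomSum-val L U V hV = ≈-trans (≈-reflexive (geomSum-homSum u v)) (go (p ∣? ℤ.∣ U ∣) (p ∣? ℤ.∣ U ℤ.- V ∣))
    where
    u = τ L U
    v = τ L V
    iU = Int-τ L U
    iV = Int-τ L V
    Hh = homSum q′ u v
    iH : Int Hh
    iH = Int-homSum q′ iU iV
    rhs : ∀ {a b} → δ∣ℤ (U ℤ.- V) ≡ a → δ∣ℤ U ≡ b → # q * δ∣ℤ (U ℤ.- V) - (1ℚ - δ∣ℤ U) ≡ # q * a - (1ℚ - b)
    rhs e e′ = cong₂ (λ a b → # q * a - (1ℚ - b)) e e′
    U≈V : Div 1 (ι (U ℤ.- V)) → ι U ≈[ 1 ] ι V
    U≈V h = mk (Div-≡ (ι-- U V) h)
    go : Dec (p ∣ ℤ.∣ U ∣) → Dec (p ∣ ℤ.∣ U ℤ.- V ∣) → u * Hh - u ^ q ≈[ suc L ] # q * δ∣ℤ (U ℤ.- V) - (1ℚ - δ∣ℤ U)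
    go (yes dU) (yes dUV) = ⊥-elim (hV (1→∣ V (≈0→Div (≈-trans (≈-sym (U≈V (∣→1 (U ℤ.- V) dUV))) (Div→≈0 (∣→1 U dU))))))
    go (yes dU) (no nUV) = ≈-trans (≈-- (≈-*ʳ iH u0) (≈-trans (≈-^ q iU Int-0 u0) (≈-reflexive (trans (cong (0ℚ ^_) qq) (0^ q′)))))
      (≈-reflexive (trans (solve 2 (λ h q → con 0ℚ :* h :- con 0ℚ := q :* con 0ℚ :- (con 1ℚ :- con 1ℚ)) refl Hh (# q)) (sym (rhs (δ∣-no _ nUV) (δ∣-yes _ dU)))))
      where
      u0 : u ≈[ suc L ] 0ℚ
      u0 = ≈-trans (τ-cong L U (ℤ.+ 0) (≈-trans (Div→≈0 (∣→1 U dU)) (≈-reflexive (sym #0)))) (≈-reflexive (τ-0 L))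
    go (no nU) (yes dUV) = ≈-trans (≈-- (≈-* u≈v (homSum-≈ q′ iU iV u≈v) iV iH) (τ^q L U nU)) (≈-trans (≈-- (≈-trans (≈-reflexive e) (≈-*ˡ (Int-# q) (τ^q L V hV))) (≈-refl {x = 1ℚ}))
      (≈-reflexive (trans (solve 1 (λ q → q :* con 1ℚ :- con 1ℚ := q :* con 1ℚ :- (con 1ℚ :- con 0ℚ)) refl (# q)) (sym (rhs (δ∣-yes _ dUV) (δ∣-no _ nU))))))
      where
      u≈v : u ≈[ suc L ] v
      u≈v = τ-cong L U V (U≈V (∣→1 (U ℤ.- V) dUV))
      e : v * (# (suc q′) * v ^ q′) ≡ # q * v ^ q
      e = trans (solve 3 (λ v m x → v :* (m :* x) := m :* (v :* x)) refl v (# (suc q′)) (v ^ q′)) (cong (λ z → # z * v ^ z) (sym qq))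
    go (no nU) (no nUV) = ≈-trans (≈-- (≈-*ˡ iU H0) (τ^q L U nU)) (≈-reflexive (trans (solve 2 (λ u q → u :* con 0ℚ :- con 1ℚ := q :* con 0ℚ :- (con 1ℚ :- con 0ℚ)) refl u (# q)) (sym (rhs (δ∣-no _ nUV) (δ∣-no _ nU)))))
      where
      D′ : ℤ
      D′ = U ℤ.^ (p ℕ.^ L) ℤ.- V ℤ.^ (p ℕ.^ L)
      D≡ : ι D′ ≡ u - v
      D≡ = trans (ι-- (U ℤ.^ (p ℕ.^ L)) (V ℤ.^ (p ℕ.^ L))) (cong₂ _-_ (ι-^ U (p ℕ.^ L)) (ι-^ V (p ℕ.^ L)))
      unit-uv : Unit (u - v)
      unit-uv = subst Unit D≡ (Unit-ι D′ (λ d → nUV (1→∣ (U ℤ.- V) (Div-≡ (sym (ι-- U V)) (_≈[_]_.diff {y = ι V} (≈-trans (≈-sym (τ≈1 L U)) (≈-trans (mk (Div-≡ D≡ (∣→1 D′ d))) (τ≈1 L V))))))))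
      H0 : Hh ≈[ suc L ] 0ℚ
      H0 = ≈-cancelUnit unit-uv (≈-trans (≈-reflexive (trans (homSum-diff q′ u v) (cong (λ z → u ^ z - v ^ z) (sym qq)))) (≈-trans (≈-- (τ^q L U nU) (τ^q L V hV)) (≈-reflexive (sym (*-zeroʳ (u - v))))))

  jacobiSum : ℕ → ℕ → ℚ
  jacobiSum L i = ∑ p (λ x → ∑ p (λ y → δ∣ (1 ℕ.+ x ℕ.+ y) * (τ L (ℤ.+ x) ^ (i ℕ.+ i) * τ L (ℤ.+ y) ^ i)))

  yx : ℕ → ℕ
  yx x = res (ℤ.- (ℤ.+ suc x))

  W : ℕ → ℤ
  W x = ℤ.- (ℤ.+ (x ℕ.* x ℕ.* suc x))

  yx-div : ∀ x → p ∣ 1 ℕ.+ x ℕ.+ yx x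
  yx-div x = Div1→∣ _ (Div-≡ e (_≈[_]_.diff (≈-sym (ι-res (ℤ.- (ℤ.+ suc x))))))
    where
    e : # (yx x) - ι (ℤ.- (ℤ.+ suc x)) ≡ # (1 ℕ.+ x ℕ.+ yx x)
    e = trans (cong (λ z → # (yx x) - z) (ι-neg (ℤ.+ suc x))) (trans (solve 2 (λ a b → a :- (:- b) := b :+ a) refl (# (yx x)) (# (suc x))) (sym (#-+ (suc x) (yx x))))

  ∑-line : ∀ x (F : ℕ → ℚ) → ∑ p (λ y → δ∣ (1 ℕ.+ x ℕ.+ y) * F y) ≡ F (yx x)
  ∑-line x F = trans (∑-single p (λ y → δ∣ (1 ℕ.+ x ℕ.+ y) * F y) (yx x) (res< (ℤ.- (ℤ.+ suc x))) (λ y ly ne → trans (cong (_* F y) (δ∣-no (1 ℕ.+ x ℕ.+ y) (λ d → ne (uniq y ly d)))) (*-zeroˡ (F y))))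
    (trans (cong (_* F (yx x)) (δ∣-yes _ (yx-div x))) (*-identityˡ (F (yx x))))
    where
    uniq : ∀ y → y ℕ.< p → p ∣ 1 ℕ.+ x ℕ.+ y → y ≡ yx x
    uniq y ly d = small-eq y (yx x) ly (res< (ℤ.- (ℤ.+ suc x))) (mk (Div-≡ (trans (cong₂ _-_ (#-+ (suc x) y) (#-+ (suc x) (yx x))) (solve 3 (λ a b c → (a :+ b) :- (a :+ c) := b :- c) refl (# (suc x)) (# y) (# (yx x))))
      (Div-- (∣→Div1 _ d) (∣→Div1 _ (yx-div x)))))

  W≈ : ∀ x → # (x ℕ.* x ℕ.* yx x) ≈[ 1 ] ι (W x)
  W≈ x = ≈-trans (≈-reflexive (#-* (x ℕ.* x) (yx x))) (≈-trans (≈-*ˡ (Int-# (x ℕ.* x)) (≈-sym (ι-res (ℤ.- (ℤ.+ suc x)))))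
    (≈-reflexive (trans (cong (# (x ℕ.* x) *_) (ι-neg (ℤ.+ suc x))) (trans (solve 2 (λ a b → a :* (:- b) := :- (a :* b)) refl (# (x ℕ.* x)) (# (suc x))) (trans (cong -_ (sym (#-* (x ℕ.* x) (suc x)))) (sym (ι-neg (ℤ.+ (x ℕ.* x ℕ.* suc x)))))))))

  -- x²(1 + x) vanishes only at x = 0 and x = p - 1. The p - 2 other points account for the constant
  -- q - 1 in `∑-jacobiSum`.
  ∑-δ∣W : ∑ p (λ x → δ∣ℤ (W x)) ≡ 1ℚ + 1ℚ
  ∑-δ∣W = cong₂ _+_ (h 0 (p ∣0)) (trans (∑-single q (λ x → δ∣ℤ (W (suc x))) q′ (subst (q′ ℕ.<_) (sym qq) ℕP.≤-refl) z) (h (suc q′) (subst (λ n → p ∣ n ℕ.* n ℕ.* suc n) qq (n∣m*n (q ℕ.* q)))))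
    where
    abs : ∀ x → ℤ.∣ W x ∣ ≡ x ℕ.* x ℕ.* suc x
    abs x = ℤP.∣-i∣≡∣i∣ (ℤ.+ (x ℕ.* x ℕ.* suc x))
    h : ∀ x → p ∣ x ℕ.* x ℕ.* suc x → δ∣ℤ (W x) ≡ 1ℚ
    h x d = trans (cong δ∣ (abs x)) (δ∣-yes _ d)
    z : ∀ x → x ℕ.< q → x ≢ q′ → δ∣ℤ (W (suc x)) ≡ 0ℚ
    z x l ne = trans (cong δ∣ (abs (suc x))) (δ∣-no _ (p∤* (p∤* (p∤<p x l) (p∤<p x l)) (p∤<p (suc x) (ℕP.≤∧≢⇒< l (λ e → ne (ℕP.suc-injective (trans e qq)))))))

  ∑-jacobiSum : ∀ L V → ¬ (p ∣ ℤ.∣ V ∣) → ∑ q′ (λ j → jacobiSum L (q ℕ.∸ suc j) * τ L V ^ suc j) ≈[ suc L ] # q * ∑ p (λ x → δ∣ℤ (W x ℤ.- V)) - (# q - 1ℚ)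
  ∑-jacobiSum L V hV = ≈-trans (≈-reflexive e₁) (≈-trans (≈-∑ p (λ x _ → ≈-∑ p (λ y _ → ≈-*ˡ (Int-δ∣ (1 ℕ.+ x ℕ.+ y)) (geomSum-val L (m x y) V hV)))) (≈-reflexive e₂))
    where
    open ≡-Reasoning
    m : ℕ → ℕ → ℤ
    m x y = ℤ.+ (x ℕ.* x ℕ.* y)
    t : ℕ → ℚ
    t x = τ L (ℤ.+ x)
    v = τ L V
    τ-m : ∀ x y i → t x ^ (i ℕ.+ i) * t y ^ i ≡ τ L (m x y) ^ i
    τ-m x y i = trans (cong (_* t y ^ i) (trans (^-+ (t x) i i) (sym (*-^ (t x) (t x) i)))) (trans (sym (*-^ (t x * t x) (t y) i)) (cong (_^ i) (sym (trans (cong (τ L) (trans (ℤP.pos-* (x ℕ.* x) y) (cong (ℤ._* (ℤ.+ y)) (ℤP.pos-* x x)))) (trans (τ-* L ((ℤ.+ x) ℤ.* (ℤ.+ x)) (ℤ.+ y)) (cong (_* t y) (τ-* L (ℤ.+ x) (ℤ.+ x))))))))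
    e₁ : ∑ q′ (λ j → jacobiSum L (q ℕ.∸ suc j) * v ^ suc j) ≡ ∑ p (λ x → ∑ p (λ y → δ∣ (1 ℕ.+ x ℕ.+ y) * geomSum (τ L (m x y)) v))
    e₁ = begin
      ∑ q′ (λ j → jacobiSum L (q ℕ.∸ suc j) * v ^ suc j)
        ≡⟨ ∑-ext q′ (λ j → trans (sym (∑-*ʳ p (λ x → ∑ p (λ y → δ∣ (1 ℕ.+ x ℕ.+ y) * (t x ^ ((q ℕ.∸ suc j) ℕ.+ (q ℕ.∸ suc j)) * t y ^ (q ℕ.∸ suc j)))) (v ^ suc j)))
             (∑-ext p (λ x → trans (sym (∑-*ʳ p (λ y → δ∣ (1 ℕ.+ x ℕ.+ y) * (t x ^ ((q ℕ.∸ suc j) ℕ.+ (q ℕ.∸ suc j)) * t y ^ (q ℕ.∸ suc j))) (v ^ suc j)))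
               (∑-ext p (λ y → trans (cong (λ z → δ∣ (1 ℕ.+ x ℕ.+ y) * z * v ^ suc j) (τ-m x y (q ℕ.∸ suc j))) (*-assoc (δ∣ (1 ℕ.+ x ℕ.+ y)) (τ L (m x y) ^ (q ℕ.∸ suc j)) (v ^ suc j))))))) ⟩
      ∑ q′ (λ j → ∑ p (λ x → ∑ p (λ y → B x y j)))
        ≡⟨ ∑-swap q′ p (λ j x → ∑ p (λ y → B x y j)) ⟩
      ∑ p (λ x → ∑ q′ (λ j → ∑ p (λ y → B x y j)))
        ≡⟨ ∑-ext p (λ x → trans (∑-swap q′ p (λ j y → B x y j)) (∑-ext p (λ y → ∑-*ˡ q′ (δ∣ (1 ℕ.+ x ℕ.+ y)) (λ j → τ L (m x y) ^ (q ℕ.∸ suc j) * v ^ suc j)))) ⟩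
      ∑ p (λ x → ∑ p (λ y → δ∣ (1 ℕ.+ x ℕ.+ y) * geomSum (τ L (m x y)) v)) ∎
      where
      B : ℕ → ℕ → ℕ → ℚ
      B x y j = δ∣ (1 ℕ.+ x ℕ.+ y) * (τ L (m x y) ^ (q ℕ.∸ suc j) * v ^ suc j)
    Z : ℕ → ℚ
    Z x = δ∣ℤ (W x ℤ.- V)
    row : ∀ x → ∑ p (λ y → δ∣ (1 ℕ.+ x ℕ.+ y) * (# q * δ∣ℤ (m x y ℤ.- V) - (1ℚ - δ∣ℤ (m x y)))) ≡ # q * Z x - (1ℚ - δ∣ℤ (W x))
    row x = trans (∑-line x (λ y → # q * δ∣ℤ (m x y ℤ.- V) - (1ℚ - δ∣ℤ (m x y)))) (cong₂ (λ a b → # q * a - (1ℚ - b))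
      (δ∣ℤ-≈ (m x (yx x) ℤ.- V) (W x ℤ.- V) (≈-≡ (sym (ι-- (m x (yx x)) V)) (sym (ι-- (W x) V)) (≈-- (W≈ x) (≈-refl {x = ι V})))) (δ∣ℤ-≈ (m x (yx x)) (W x) (W≈ x)))
    e₂ : ∑ p (λ x → ∑ p (λ y → δ∣ (1 ℕ.+ x ℕ.+ y) * (# q * δ∣ℤ (m x y ℤ.- V) - (1ℚ - δ∣ℤ (m x y))))) ≡ # q * ∑ p Z - (# q - 1ℚ)
    e₂ = begin
      ∑ p (λ x → ∑ p (λ y → δ∣ (1 ℕ.+ x ℕ.+ y) * (# q * δ∣ℤ (m x y ℤ.- V) - (1ℚ - δ∣ℤ (m x y)))))  ≡⟨ ∑-ext p row ⟩
      ∑ p (λ x → # q * Z x - (1ℚ - δ∣ℤ (W x)))                          ≡⟨ ∑-- p (λ x → # q * Z x) (λ x → 1ℚ - δ∣ℤ (W x)) ⟩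
      ∑ p (λ x → # q * Z x) - ∑ p (λ x → 1ℚ - δ∣ℤ (W x))                ≡⟨ cong₂ _-_ (∑-*ˡ p (# q) Z) (trans (∑-- p (λ _ → 1ℚ) (λ x → δ∣ℤ (W x))) (cong₂ _-_ (trans (∑-const p 1ℚ) (*-identityʳ P)) ∑-δ∣W)) ⟩
      # q * ∑ p Z - (P - (1ℚ + 1ℚ))                                     ≡⟨ cong (λ z → # q * ∑ p Z - (z - (1ℚ + 1ℚ))) (#-suc q) ⟩
      # q * ∑ p Z - ((1ℚ + # q) - (1ℚ + 1ℚ))                            ≡⟨ cong (λ z → # q * ∑ p Z - z) (solve 1 (λ q → (con 1ℚ :+ q) :- (con 1ℚ :+ con 1ℚ) := q :- con 1ℚ) refl (# q)) ⟩
      # q * ∑ p Z - (# q - 1ℚ) ∎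

  module Sums (K : ℕ) where

    open Values K

    -- X j is the numerator of the j-th summand of ₂G₂, without the character.
    IsNumerator : (ℕ → ℚ) → Set
    IsNumerator X′ = (X′ 0 ≈[ k ] P * P * C) × (∀ j (j>0 : 0 ℕ.< j) (j<q : j ℕ.< q) → X′ j ≈[ k ] (- P) ^ suc (Split.e (split j j>0 j<q)) * Value.num j j>0 j<q (split j j>0 j<q) 0)

    module _ (X′ : ℕ → ℚ) (hX : IsNumerator X′) (iX : ∀ j → Int (X′ j)) (s V : ℤ) (v : ℚ) (iv : Int v) (hv : v * τ K s ≈[ k ] 1ℚ) (p∤V : ¬ (p ∣ ℤ.∣ V ∣))
             (hV : - (# 27 * ι s * ι V) ≈[ 1 ] # 4) where

      -- Equal to `bound` of `Value`: the precision of the Teichmüller representatives at which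
      -- Jacobi sums may be exchanged for gamma values modulo p^k.
      Lv : ℕ
      Lv = slope ((4 ℕ.+ k) ℕ.* (p ℕ.* p) ℕ.* q) ℕ.+ k

      V≈ : τ Lv V ≈[ k ] τ K V
      V≈ = subst (λ z → τ z V ≈[ k ] τ K V) (trans (ℕP.+-assoc (slope ((4 ℕ.+ k) ℕ.* (p ℕ.* p) ℕ.* q)) 1 K) refl) (τ-step K (slope ((4 ℕ.+ k) ℕ.* (p ℕ.* p) ℕ.* q) ℕ.+ 1) V)

      -- The Teichmüller lift of -27 s V ≡ 4. It combines ω̄(s)^j with the factors ω(3)^(3j),
      -- ω(2)^(2j) and (-1)^j of the multiplication and reflection formulas into the single
      -- character value ω(V)^j.
      chars : - (τ₃ ^ 3 * τ K s * τ K V) ≈[ k ] τ₂ ^ 2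
      chars = ≈-trans (≈-reflexive (sym e₁)) (≈-trans (τ-cong K (ℤ.- ((ℤ.+ 27) ℤ.* s ℤ.* V)) (ℤ.+ 4) (≈-trans (≈-reflexive (trans (ι-neg ((ℤ.+ 27) ℤ.* s ℤ.* V)) (cong -_ (trans (ι-* ((ℤ.+ 27) ℤ.* s) V) (cong (_* ι V) (ι-* (ℤ.+ 27) s)))))) hV)) (≈-reflexive e₂))
        where
        e₂ : τ K (ℤ.+ 4) ≡ τ₂ ^ 2
        e₂ = trans (τ-* K (ℤ.+ 2) (ℤ.+ 2)) (cong (τ₂ *_) (sym (*-identityʳ τ₂)))
        τ-neg : ∀ z → τ K (ℤ.- z) ≡ - τ K z
        τ-neg z = trans (cong (_^ (p ℕ.^ K)) (trans (ι-neg z) (solve 1 (λ x → :- x := con (- 1ℚ) :* x) refl (ι z)))) (trans (*-^ (- 1ℚ) (ι z) (p ℕ.^ K)) (trans (cong (_* τ K z) (-1^N K)) (solve 1 (λ x → con (- 1ℚ) :* x := :- x) refl (τ K z))))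
        e₁ : τ K (ℤ.- ((ℤ.+ 27) ℤ.* s ℤ.* V)) ≡ - (τ₃ ^ 3 * τ K s * τ K V)
        e₁ = trans (τ-neg ((ℤ.+ 27) ℤ.* s ℤ.* V)) (cong -_ (trans (τ-* K ((ℤ.+ 27) ℤ.* s) V) (cong (_* τ K V) (trans (τ-* K (ℤ.+ 27) s) (cong (_* τ K s) (trans (τ-* K (ℤ.+ 3) (ℤ.+ 9)) (cong (τ₃ *_) (trans (τ-* K (ℤ.+ 3) (ℤ.+ 3)) (cong (τ₃ *_) (sym (*-identityʳ τ₃)))))))))))

      iτ₃ : Int τ₃
      iτ₃ = Int-τ K (ℤ.+ 3)

      Unit-τ₂ : Unit τ₂
      Unit-τ₂ = Unit-τ K (ℤ.+ 2) p∤2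

      summand : ∀ j (j>0 : 0 ℕ.< j) (j<q : j ℕ.< q) → v ^ j * X′ j ≈[ k ] - (P * P * C * (jacobiSum Lv (q ℕ.∸ j) * τ Lv V ^ j))
      summand j j>0 j<q = ≈-cancelUnit (Unit-^ (2 ℕ.* j) Unit-τ₂) (≈-trans (≈-reflexive e₁) (≈-trans (≈-*ʳ (iX j) flip) (≈-trans (≈-*ˡ (Int-* (Int-* (Int-±1^ j) (Int-^ (3 ℕ.* j) iτ₃)) (Int-^ j (Int-τ K V))) (proj₂ hX j j>0 j<q))
          (≈-trans (≈-reflexive e₂) (≈-trans (≈-*ʳ (Int-^ j (Int-τ K V)) (Value.value j j>0 j<q (split j j>0 j<q) Lv ℕP.≤-refl)) (≈-trans (≈-*ˡ iPCJ (≈-sym (≈-^ j (Int-τ Lv V) (Int-τ K V) V≈))) (≈-reflexive e₃)))))))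
        where
        sp = split j j>0 j<q
        num = Value.num j j>0 j<q sp 0
        Q = (- P) ^ suc (Split.e sp)
        Jj = jacobiSum Lv (q ℕ.∸ j)
        iPCJ : Int (- (P * P * C * (τ₂ ^ (2 ℕ.* j) * Jj)))
        iPCJ = Int-neg (Int-* (Int-* (Int-* (Int-# p) (Int-# p)) (Unit.int-u Unit-C)) (Int-* (Int-^ (2 ℕ.* j) (Unit.int-u Unit-τ₂))
          (Int-∑ p (λ x → Int-∑ p (λ y → Int-* (Int-δ∣ (1 ℕ.+ x ℕ.+ y)) (Int-* (Int-^ ((q ℕ.∸ j) ℕ.+ (q ℕ.∸ j)) (Int-τ Lv (ℤ.+ x))) (Int-^ (q ℕ.∸ j) (Int-τ Lv (ℤ.+ y)))))))))
        e₁ : τ₂ ^ (2 ℕ.* j) * (v ^ j * X′ j) ≡ τ₂ ^ (2 ℕ.* j) * v ^ j * X′ j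
        e₁ = sym (*-assoc (τ₂ ^ (2 ℕ.* j)) (v ^ j) (X′ j))
        flip : τ₂ ^ (2 ℕ.* j) * v ^ j ≈[ k ] (- 1ℚ) ^ j * τ₃ ^ (3 ℕ.* j) * τ K V ^ j
        flip = ≈-trans (≈-reflexive (trans (cong (_* v ^ j) (^-* τ₂ 2 j)) (sym (*-^ (τ₂ ^ 2) v j)))) (≈-trans (≈-^ j (Int-* (Int-^ 2 (Unit.int-u Unit-τ₂)) iv) (Int-neg (Int-* (Int-^ 3 iτ₃) (Int-τ K V))) one)
          (≈-reflexive (trans (trans (cong (_^ j) (solve 2 (λ a b → :- (a :* b) := (con (- 1ℚ) :* a) :* b) refl (τ₃ ^ 3) (τ K V))) (*-^ (- 1ℚ * τ₃ ^ 3) (τ K V) j)) (cong (_* τ K V ^ j) (trans (*-^ (- 1ℚ) (τ₃ ^ 3) j) (cong ((- 1ℚ) ^ j *_) (sym (^-* τ₃ 3 j))))))))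
          where
          one : τ₂ ^ 2 * v ≈[ k ] - (τ₃ ^ 3 * τ K V)
          one = ≈-trans (≈-*ʳ iv (≈-sym chars)) (≈-trans (≈-reflexive (solve 4 (λ a s b v → :- (a :* s :* b) :* v := (:- (a :* b)) :* (v :* s)) refl (τ₃ ^ 3) (τ K s) (τ K V) v)) (≈-trans (≈-*ˡ (Int-neg (Int-* (Int-^ 3 iτ₃) (Int-τ K V))) hv) (≈-reflexive (*-identityʳ (- (τ₃ ^ 3 * τ K V))))))
        e₂ : (- 1ℚ) ^ j * τ₃ ^ (3 ℕ.* j) * τ K V ^ j * (Q * num) ≡ Q * num * ((- 1ℚ) ^ j * τ₃ ^ (3 ℕ.* j)) * τ K V ^ j
        e₂ = solve 5 (λ a b c q n → a :* b :* c :* (q :* n) := q :* n :* (a :* b) :* c) refl ((- 1ℚ) ^ j) (τ₃ ^ (3 ℕ.* j)) (τ K V ^ j) Q num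
        e₃ : - (P * P * C * (τ₂ ^ (2 ℕ.* j) * Jj)) * τ Lv V ^ j ≡ τ₂ ^ (2 ℕ.* j) * (- (P * P * C * (Jj * τ Lv V ^ j)))
        e₃ = solve 5 (λ P c t J v → (:- (P :* P :* c :* (t :* J))) :* v := t :* (:- (P :* P :* c :* (J :* v)))) refl P C (τ₂ ^ (2 ℕ.* j)) Jj (τ Lv V ^ j)

      Zc : ℚ
      Zc = ∑ p (λ x → δ∣ℤ (W x ℤ.- V))

      -- The summand j = 0 is p² C and has no Jacobi sum behind it. It cancels all but a multiple of
      -- q in the constant of `∑-jacobiSum`, so that q (Z - 1) remains, Z being the number of
      -- points.
      total : ∑ q (λ j → v ^ j * X′ j) ≈[ k ] - (# q * (P * P * C * (Zc - 1ℚ)))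
      total = ≈-trans (≈-reflexive (cong (λ n → ∑ n (λ j → v ^ j * X′ j)) qq)) (≈-trans (≈-+ (≈-trans (≈-reflexive (*-identityˡ (X′ 0))) (proj₁ hX)) (≈-trans (≈-∑ q′ (λ j l → summand (suc j) (s≤s z≤n) (lt j l))) (≈-trans (≈-reflexive e₁) (≈-neg (≈-*ˡ iPC (≈-weaken k≤ (∑-jacobiSum Lv V p∤V)))))))
          (≈-reflexive (solve 4 (λ a q z x → a :+ (:- (a :* (q :* z :- (q :- con 1ℚ)))) := :- (q :* (a :* (z :- con 1ℚ)))) refl (P * P * C) (# q) Zc (# q))))
        where
        iPC : Int (P * P * C)
        iPC = Int-* (Int-* (Int-# p) (Int-# p)) (Unit.int-u Unit-C)
        lt : ∀ j → j ℕ.< q′ → suc j ℕ.< q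
        lt j l = subst (suc j ℕ.<_) (sym qq) (s≤s l)
        k≤ : k ℕ.≤ suc Lv
        k≤ = ℕP.m≤n⇒m≤1+n (ℕP.m≤n+m k (slope ((4 ℕ.+ k) ℕ.* (p ℕ.* p) ℕ.* q)))
        e₁ : ∑ q′ (λ j → - (P * P * C * (jacobiSum Lv (q ℕ.∸ suc j) * τ Lv V ^ suc j))) ≡ - (P * P * C * ∑ q′ (λ j → jacobiSum Lv (q ℕ.∸ suc j) * τ Lv V ^ suc j))
        e₁ = trans (∑-ext q′ (λ j → solve 2 (λ a b → :- (a :* b) := (:- a) :* b) refl (P * P * C) (jacobiSum Lv (q ℕ.∸ suc j) * τ Lv V ^ suc j))) (trans (∑-*ˡ q′ (- (P * P * C)) (λ j → jacobiSum Lv (q ℕ.∸ suc j) * τ Lv V ^ suc j))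
          (solve 2 (λ a b → (:- a) :* b := :- (a :* b)) refl (P * P * C) (∑ q′ (λ j → jacobiSum Lv (q ℕ.∸ suc j) * τ Lv V ^ suc j))))

  -- Floors, residues and the factors of McCarthy’s function

  ι-sum : ∀ (f : ℕ → ℤ) n → ι (F.sumℤ (map f (upTo n))) ≡ ∑ n (λ i → ι (f i))
  ι-sum f n = go (λ i → i) n
    where
    go : ∀ (g : ℕ → ℕ) n → ι (F.sumℤ (map f (applyUpTo g n))) ≡ ∑ n (λ i → ι (f (g i)))
    go g zero    = #0
    go g (suc n) = trans (ι-+ (f (g 0)) (F.sumℤ (map f (applyUpTo (g ∘ suc) n)))) (cong (ι (f (g 0)) +_) (go (g ∘ suc) n))

  invZ-inv : ∀ k u → ¬ (p ∣ ℤ.∣ u ∣) → ι u * ι (F.invZ p k u) ≈[ suc k ] 1ℚ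
  invZ-inv k u hu = ≈-trans (≈-reflexive e) (τ^q k u hu)
    where
    pos : 1 ℕ.≤ p ℕ.^ k ℕ.* q
    pos = ℕP.*-mono-< {0} {p ℕ.^ k} {0} (ℕP.≤-trans (s≤s z≤n) (n<p^n k)) 0<q
    e : ι u * ι (F.invZ p k u) ≡ τ k u ^ q
    e = trans (cong (ι u *_) (ι-^ u (p ℕ.^ k ℕ.* q ℕ.∸ 1))) (trans (cong (ι u ^_) (ℕP.m+[n∸m]≡n pos)) (^-* (ι u) (p ℕ.^ k) q))

  Unit→∤ : ∀ z → Unit (ι z) → ¬ (p ∣ ℤ.∣ z ∣)
  Unit→∤ z u d = ¬Div1-1 (Div-cancelUnit u (Div-≡ (sym (*-identityʳ (ι z))) (∣→1 z d)))

  ι-gammaNat : ∀ n → ι (F.gammaNat p n) ≡ Γₚ n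
  ι-gammaNat n = trans (ι-* ((ℤ.- ℤ.1ℤ) ℤ.^ n) (F.prodUnits p n)) (cong₂ _*_ (trans (ι-^ (ℤ.- ℤ.1ℤ) n) (cong (_^ n) (trans (ι-neg ℤ.1ℤ) (cong -_ #1)))) (units n))
    where
    unitℤ : ℕ → ℤ
    unitℤ n = if n ℕ.≡ᵇ 0 then ℤ.1ℤ else (if F.divᵇ p n then ℤ.1ℤ else ℤ.+ n)
    one : ∀ n → ι (unitℤ n) ≡ un n
    one zero    = trans #1 (sym (un-yes 0 (p ∣0)))
    one (suc n) = go (p ∣? suc n)
      where
      nz : ∀ r → r ≢ 0 → (if r ℕ.≡ᵇ 0 then ℤ.1ℤ else ℤ.+ suc n) ≡ ℤ.+ suc n
      nz zero    h = ⊥-elim (h refl)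
      nz (suc r) h = refl
      go : Dec (p ∣ suc n) → ι (unitℤ (suc n)) ≡ un (suc n)
      go (yes d) = trans (cong (λ r → ι (if r ℕ.≡ᵇ 0 then ℤ.1ℤ else ℤ.+ suc n)) (n∣m⇒m%n≡0 (suc n) p d)) (trans #1 (sym (un-yes (suc n) d)))
      go (no nd) = trans (cong ι (nz (suc n ℕD.% p) (λ e → nd (m%n≡0⇒n∣m (suc n) p e)))) (sym (un-no (suc n) nd))
    units : ∀ n → ι (F.prodUnits p n) ≡ Πu n
    units zero    = #1
    units (suc n) = trans (ι-* (F.prodUnits p n) (unitℤ n)) (cong₂ _*_ (units n) (one n))

  modN≈ : ∀ k a → ι a ≈[ k ] # (F.modN a (p ℕ.^ k))
  modN≈ k a = go (p ℕ.^ k) refl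
    where
    go : ∀ n → n ≡ p ℕ.^ k → ι a ≈[ k ] # (F.modN a n)
    go zero    e = ⊥-elim (ℕP.<-irrefl e (ℕP.≤-trans (s≤s z≤n) (n<p^n k)))
    go (suc n) e = mk (Div-≡ (sym (trans (cong (_- # r) (trans (cong ι (a≡a%ℕn+[a/ℕn]*n a (suc n))) (trans (ι-+ (ℤ.+ r) ((a /ℕ suc n) ℤ.* (ℤ.+ suc n))) (cong (# r +_) (ι-* (a /ℕ suc n) (ℤ.+ suc n))))))
      (solve 3 (λ r t n → (r :+ t :* n) :- r := n :* t) refl (# r) (ι (a /ℕ suc n)) (# (suc n))))) (Div-*ʳ (∣→Div k (suc n) (subst (p ℕ.^ k ∣_) (sym e) ∣-refl)) (Int-ι (a /ℕ suc n))))
      where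
      r = a %ℕ suc n

  modN-0 : ∀ a → p ∣ ℤ.∣ a ∣ → F.modN a p ≡ 0
  modN-0 a d = small-eq (res a) 0 (res< a) (s≤s z≤n) (≈-trans (≈-sym (ι-res a)) (≈-trans (Div→≈0 (∣→1 a d)) (≈-reflexive (sym #0))))

  modN-≢0 : ∀ a → F.modN a p ≡ 0 → p ∣ ℤ.∣ a ∣
  modN-≢0 a e = 1→∣ a (≈0→Div (≈-trans (ι-res a) (≈-reflexive (trans (cong # e) #0))))

  floor-unique : ∀ N a b f g → a ℕ.< N → b ℕ.< N → (ℤ.+ a) ℤ.+ f ℤ.* (ℤ.+ N) ≡ (ℤ.+ b) ℤ.+ g ℤ.* (ℤ.+ N) → f ≡ g
  floor-unique N a b f g la lb h = sym (ℤP.i-j≡0⇒i≡j g f (ℤP.∣i∣≡0⇒i≡0 (zero-abs ℤ.∣ g ℤ.- f ∣ (ℕP.≤-trans (s≤s (ℕP.≤-reflexive (sym eq))) bound))))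
    where
    open ≡-Reasoning
    zero-abs : ∀ d → d ℕ.* N ℕ.< N → d ≡ 0
    zero-abs zero    l = refl
    zero-abs (suc d) l = ⊥-elim (ℕP.<-irrefl refl (ℕP.≤-trans (s≤s (ℕP.m≤m+n N (d ℕ.* N))) l))
    diff : a ℤ.⊖ b ≡ (g ℤ.- f) ℤ.* (ℤ.+ N)
    diff = ι-inj (begin
      ι (a ℤ.⊖ b)                                     ≡⟨ cong ι (sym (ℤP.m-n≡m⊖n a b)) ⟩
      ι ((ℤ.+ a) ℤ.- (ℤ.+ b))                         ≡⟨ ι-- (ℤ.+ a) (ℤ.+ b) ⟩
      # a - # b                                       ≡⟨ solve 3 (λ a b x → a :- b := (a :+ x) :- b :- x) refl (# a) (# b) (ι f * # N) ⟩
      (# a + ι f * # N) - # b - ι f * # N             ≡⟨ cong (λ z → z - # b - ι f * # N) (trans (sym (trans (ι-+ (ℤ.+ a) (f ℤ.* (ℤ.+ N))) (cong (# a +_) (ι-* f (ℤ.+ N))))) (trans (cong ι h) (trans (ι-+ (ℤ.+ b) (g ℤ.* (ℤ.+ N))) (cong (# b +_) (ι-* g (ℤ.+ N)))))) ⟩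
      (# b + ι g * # N) - # b - ι f * # N             ≡⟨ solve 4 (λ b g f n → (b :+ g :* n) :- b :- f :* n := (g :- f) :* n) refl (# b) (ι g) (ι f) (# N) ⟩
      (ι g - ι f) * # N                               ≡⟨ sym (trans (ι-* (g ℤ.- f) (ℤ.+ N)) (cong (_* # N) (ι-- g f))) ⟩
      ι ((g ℤ.- f) ℤ.* (ℤ.+ N))                       ∎)
    eq : ℤ.∣ a ℤ.⊖ b ∣ ≡ ℤ.∣ g ℤ.- f ∣ ℕ.* N
    eq = trans (cong ℤ.∣_∣ diff) (ℤP.abs-* (g ℤ.- f) (ℤ.+ N))
    bound : ℤ.∣ a ℤ.⊖ b ∣ ℕ.< N
    bound = ℕP.≤-trans (s≤s (ℤP.∣m⊝n∣≤m⊔n a b)) (ℕP.⊔-lub la lb)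

  floor-spec : ∀ x → Σ ℕ λ r → r ℕ.< ↧ₙ x × ι (↥ x) ≡ # r + ι (ℚ.floor x) * # (↧ₙ x)
  floor-spec x@(mkℚ n d _) = n ℤ.% (ℤ.+ suc d) , n%d<d n (ℤ.+ suc d) , trans (cong ι (a≡a%n+[a/n]*n n (ℤ.+ suc d))) (trans (ι-+ (ℤ.+ (n ℤ.% (ℤ.+ suc d))) ((n ℤ./ (ℤ.+ suc d)) ℤ.* (ℤ.+ suc d))) (cong (# (n ℤ.% (ℤ.+ suc d)) +_) (ι-* (n ℤ./ (ℤ.+ suc d)) (ℤ.+ suc d))))

  -- Floors and fractional parts are certified by a division with remainder after clearing a
  -- denominator N, whatever reduced form x has. Later N is 6q.
  floor-eq : ∀ N x r f → r ℕ.< N → x * # N ≡ # r + ι f * # N → ℚ.floor x ≡ f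
  floor-eq N x r f lr h = go (floor-spec x) (↥↧ x) (pos x)
    where
    pos : ∀ x → 0 ℕ.< ↧ₙ x
    pos (mkℚ _ _ _) = s≤s z≤n
    go : (Σ ℕ λ s → s ℕ.< ↧ₙ x × ι (↥ x) ≡ # s + ι (ℚ.floor x) * # (↧ₙ x)) → x * # (↧ₙ x) ≡ ι (↥ x) → 0 ℕ.< ↧ₙ x → ℚ.floor x ≡ f
    go (s , ls , e) xd 0<d = floor-unique (N ℕ.* ↧ₙ x) (s ℕ.* N) (r ℕ.* ↧ₙ x) (ℚ.floor x) f
      (subst (s ℕ.* N ℕ.<_) (ℕP.*-comm (↧ₙ x) N) (ℕP.*-monoˡ-< N {{>-nonZero (ℕP.≤-trans (s≤s z≤n) lr)}} ls)) (ℕP.*-monoˡ-< (↧ₙ x) {{>-nonZero 0<d}} lr) (ι-inj eq)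
      where
      open ≡-Reasoning
      δ = ↧ₙ x
      cast : ∀ a f → ι ((ℤ.+ a) ℤ.+ f ℤ.* (ℤ.+ (N ℕ.* δ))) ≡ # a + ι f * (# N * # δ)
      cast a f = trans (ι-+ (ℤ.+ a) (f ℤ.* (ℤ.+ (N ℕ.* δ)))) (cong (# a +_) (trans (ι-* f (ℤ.+ (N ℕ.* δ))) (cong (ι f *_) (#-* N δ))))
      eq : ι ((ℤ.+ (s ℕ.* N)) ℤ.+ ℚ.floor x ℤ.* (ℤ.+ (N ℕ.* δ))) ≡ ι ((ℤ.+ (r ℕ.* δ)) ℤ.+ f ℤ.* (ℤ.+ (N ℕ.* δ)))
      eq = begin
        ι ((ℤ.+ (s ℕ.* N)) ℤ.+ ℚ.floor x ℤ.* (ℤ.+ (N ℕ.* δ)))   ≡⟨ trans (cast (s ℕ.* N) (ℚ.floor x)) (cong (_+ ι (ℚ.floor x) * (# N * # δ)) (#-* s N)) ⟩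
        # s * # N + ι (ℚ.floor x) * (# N * # δ)                 ≡⟨ solve 4 (λ s n g d → s :* n :+ g :* (n :* d) := (s :+ g :* d) :* n) refl (# s) (# N) (ι (ℚ.floor x)) (# δ) ⟩
        (# s + ι (ℚ.floor x) * # δ) * # N                       ≡⟨ cong (_* # N) (trans (sym e) (sym xd)) ⟩
        x * # δ * # N                                           ≡⟨ solve 3 (λ x d n → x :* d :* n := x :* n :* d) refl x (# δ) (# N) ⟩
        x * # N * # δ                                           ≡⟨ cong (_* # δ) h ⟩
        (# r + ι f * # N) * # δ                                 ≡⟨ solve 4 (λ r f n d → (r :+ f :* n) :* d := r :* d :+ f :* (n :* d)) refl (# r) (ι f) (# N) (# δ) ⟩
        # r * # δ + ι f * (# N * # δ)                           ≡⟨ sym (trans (cast (r ℕ.* δ) f) (cong (_+ ι f * (# N * # δ)) (#-* r δ))) ⟩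
        ι ((ℤ.+ (r ℕ.* δ)) ℤ.+ f ℤ.* (ℤ.+ (N ℕ.* δ)))           ∎

  frac-eq : ∀ N x r f → r ℕ.< N → x * # N ≡ # r + ι f * # N → F.frac x * # N ≡ # r
  frac-eq N x r f lr h = trans (cong (λ z → (x - z) * # N) (trans (sym (ι-def (ℚ.floor x))) (cong ι (floor-eq N x r f lr h)))) (trans (solve 3 (λ x f n → (x :- f) :* n := x :* n :- f :* n) refl x (ι f) (# N))
    (trans (cong (_- ι f * # N) h) (solve 2 (λ a b → (a :+ b) :- b := a) refl (# r) (ι f * # N))))

  pTimes-eq : ∀ e n → e ℤ.+ ℤ.1ℤ ≡ ℤ.+ n → ι (F.pTimesNegPPow p e) ≡ - ((- P) ^ n)
  pTimes-eq e n h = trans (cong ι (go e n h)) (trans (ι-neg ((ℤ.- (ℤ.+ p)) ℤ.^ n)) (cong -_ (trans (ι-^ (ℤ.- (ℤ.+ p)) n) (cong (_^ n) (ι-neg (ℤ.+ p))))))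
    where
    go : ∀ e n → e ℤ.+ ℤ.1ℤ ≡ ℤ.+ n → F.pTimesNegPPow p e ≡ ℤ.- ((ℤ.- (ℤ.+ p)) ℤ.^ n)
    go e n h with e ℤ.+ ℤ.1ℤ | h
    ... | .(ℤ.+ n) | refl = refl

  divNat-* : ∀ z n → 0 ℕ.< n → F.divNat z n * # n ≡ ι z
  divNat-* z (suc n) l = /-* z n

  module Factors (K : ℕ) where

    open Values K public

    D₆ : ℕ
    D₆ = 6 ℕ.* q

    -- x · 6q is an integer and p ∤ 6q, so a factor p of the reduced denominator would also divide
    -- the numerator.
    den-∤ : ∀ x r → x * # D₆ ≡ # r → ¬ (p ∣ ↧ₙ x)
    den-∤ x@(mkℚ n d cop) r h pd = p∤1 (subst (p ∣_) (coprime⇒gcd≡1 {ℤ.∣ n ∣} {suc d} (Coprimality.recompute cop)) (gcd-greatest pn pd))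
      where
      e : ι (n ℤ.* (ℤ.+ D₆)) ≡ ι ((ℤ.+ r) ℤ.* (ℤ.+ suc d))
      e = trans (ι-* n (ℤ.+ D₆)) (trans (cong (_* # D₆) (sym (↥↧ x))) (trans (solve 3 (λ x d n → x :* d :* n := x :* n :* d) refl x (# (suc d)) (# D₆)) (trans (cong (_* # (suc d)) h) (sym (ι-* (ℤ.+ r) (ℤ.+ suc d))))))
      pn : p ∣ ℤ.∣ n ∣
      pn = [ (λ z → z) , (λ z → ⊥-elim (p∤6q z)) ]′ (euclidsLemma ℤ.∣ n ∣ D₆ pp (subst (p ∣_) (trans (sym (trans (cong ℤ.∣_∣ (ι-inj e)) (ℤP.abs-* (ℤ.+ r) (ℤ.+ suc d)))) (ℤP.abs-* n (ℤ.+ D₆))) (∣-trans pd (n∣m*n r))))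

    gammaP-eq : ∀ x r → x * # D₆ ≡ # r → ι (F.gammaP p k x) ≈[ k ] Γ̃ r
    gammaP-eq x r h = ≈-trans (≈-reflexive (ι-gammaNat (F.ratRep p k x))) (Γ̃-rep (F.ratRep p k x) r (≈-cancelUnit uδ (≈-trans (≈-*ˡ (Int-# δ) (≈-*ʳ (Int-# D₆) (≈-sym (modN≈ k ((↥ x) ℤ.* F.invZ p k (ℤ.+ δ)))))) (≈-trans (≈-reflexive e₁)
        (≈-trans (≈-*ˡ (Int-* (Int-ι (↥ x)) (Int-# D₆)) (≈-weaken (ℕP.n≤1+n k) (invZ-inv k (ℤ.+ δ) pδ))) (≈-reflexive e₂))))))
      where
      δ = ↧ₙ x
      pδ : ¬ (p ∣ δ)
      pδ = den-∤ x r h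
      uδ : Unit (# δ)
      uδ = Unit-# δ pδ
      I = ι (F.invZ p k (ℤ.+ δ))
      e₁ : # δ * (ι ((↥ x) ℤ.* F.invZ p k (ℤ.+ δ)) * # D₆) ≡ ι (↥ x) * # D₆ * (# δ * I)
      e₁ = trans (cong (λ z → # δ * (z * # D₆)) (ι-* (↥ x) (F.invZ p k (ℤ.+ δ)))) (solve 4 (λ d n i m → d :* (n :* i :* m) := n :* m :* (d :* i)) refl (# δ) (ι (↥ x)) I (# D₆))
      e₂ : ι (↥ x) * # D₆ * 1ℚ ≡ # δ * # r
      e₂ = trans (*-identityʳ (ι (↥ x) * # D₆)) (trans (cong (_* # D₆) (sym (↥↧ x))) (trans (solve 3 (λ x d n → x :* d :* n := d :* (x :* n)) refl x (# δ) (# D₆)) (cong (# δ *_) h)))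

    inv-gammaP : ∀ x r → x * # D₆ ≡ # r → ι (F.invZ p k (F.gammaP p k x)) * Γ̃ r ≈[ k ] 1ℚ
    inv-gammaP x r h = ≈-trans (≈-*ˡ (Int-ι (F.invZ p k (F.gammaP p k x))) (≈-sym (gammaP-eq x r h))) (≈-trans (≈-reflexive (*-comm (ι (F.invZ p k (F.gammaP p k x))) (ι (F.gammaP p k x))))
      (≈-weaken (ℕP.n≤1+n k) (invZ-inv k (F.gammaP p k x) (Unit→∤ (F.gammaP p k x) (subst Unit (sym (ι-gammaNat (F.ratRep p k x))) (Unit-Γₚ (F.ratRep p k x)))))))

    jq : ℕ → ℚ
    jq j = F.divNat (ℤ.+ j) q

    jq-eq : ∀ j → jq j * # D₆ ≡ # 6 * # j
    jq-eq j = trans (cong (jq j *_) (#-* 6 q)) (trans (solve 3 (λ x s q → x :* (s :* q) := s :* (x :* q)) refl (jq j) (# 6) (# q)) (cong (# 6 *_) (divNat-* (ℤ.+ j) q 0<q)))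

    -- The arguments are the certificates for the floors and the fractional parts, and n is the
    -- exponent of -p raised by the scaling with p. Multiplying by the values at ra and rb removes
    -- the inverse gamma values.
    factor-eq : ∀ j a b ra rb r r′ fa fb f₁ f₂ n → ra ℕ.< D₆ → rb ℕ.< D₆ → r ℕ.< D₆ → r′ ℕ.< D₆ →
      a * # D₆ ≡ # ra + ι fa * # D₆ → (- b) * # D₆ ≡ # rb + ι fb * # D₆ →
      # ra - # 6 * # j ≡ # r + ι f₁ * # D₆ → # rb + # 6 * # j ≡ # r′ + ι f₂ * # D₆ → - ι f₁ - ι f₂ + 1ℚ ≡ # n →
      ι (F.factor p k j a b) * (Γ̃ ra * Γ̃ rb) ≈[ k ] - ((- P) ^ n) * (Γ̃ r * Γ̃ r′)
    factor-eq j a b ra rb r r′ fa fb f₁ f₂ n lra lrb lr lr′ ha hb h₁ h₂ hn = ≈-trans (≈-reflexive e₁) (≈-trans (≈-* main (≈-* ia ib Int-1 (Int-* (Int-ι _) (Int-Γ̃ rb))) (Int-* (Int-neg (Int-^ n (Int-neg (Int-# p)))) (Int-* (Int-Γ̃ r) (Int-Γ̃ r′))) (Int-* (Int-* (Int-ι _) (Int-Γ̃ ra)) (Int-* (Int-ι _) (Int-Γ̃ rb)))) (≈-reflexive e₂))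
      where
      FA = F.frac a
      FB = F.frac (- b)
      hFA : FA * # D₆ ≡ # ra
      hFA = frac-eq D₆ a ra fa lra ha
      hFB : FB * # D₆ ≡ # rb
      hFB = frac-eq D₆ (- b) rb fb lrb hb
      sub : ∀ x z → x * # D₆ ≡ z → (x - jq j) * # D₆ ≡ z - # 6 * # j
      sub x z h = trans (solve 3 (λ x y d → (x :- y) :* d := x :* d :- y :* d) refl x (jq j) (# D₆)) (cong₂ _-_ h (jq-eq j))
      add : ∀ x z → x * # D₆ ≡ z → (x + jq j) * # D₆ ≡ z + # 6 * # j
      add x z h = trans (*-distribʳ-+ (# D₆) x (jq j)) (cong₂ _+_ h (jq-eq j))
      g₁ : F.frac (a - jq j) * # D₆ ≡ # r
      g₁ = frac-eq D₆ (a - jq j) r (f₁ ℤ.+ fa) lr (trans (sub a (# ra + ι fa * # D₆) ha) (trans (solve 4 (λ x f d y → (x :+ f :* d) :- y := (x :- y) :+ f :* d) refl (# ra) (ι fa) (# D₆) (# 6 * # j))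
        (trans (cong (_+ ι fa * # D₆) h₁) (trans (solve 4 (λ r f g d → (r :+ f :* d) :+ g :* d := r :+ (f :+ g) :* d) refl (# r) (ι f₁) (ι fa) (# D₆)) (cong (λ z → # r + z * # D₆) (sym (ι-+ f₁ fa)))))))
      g₂ : F.frac ((- b) + jq j) * # D₆ ≡ # r′
      g₂ = frac-eq D₆ ((- b) + jq j) r′ (f₂ ℤ.+ fb) lr′ (trans (add (- b) (# rb + ι fb * # D₆) hb) (trans (solve 4 (λ x f d y → (x :+ f :* d) :+ y := (x :+ y) :+ f :* d) refl (# rb) (ι fb) (# D₆) (# 6 * # j))
        (trans (cong (_+ ι fb * # D₆) h₂) (trans (solve 4 (λ r f g d → (r :+ f :* d) :+ g :* d := r :+ (f :+ g) :* d) refl (# r′) (ι f₂) (ι fb) (# D₆)) (cong (λ z → # r′ + z * # D₆) (sym (ι-+ f₂ fb)))))))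
      fl₁ : ℚ.floor (FA - jq j) ≡ f₁
      fl₁ = floor-eq D₆ (FA - jq j) r f₁ lr (trans (sub FA (# ra) hFA) h₁)
      fl₂ : ℚ.floor (FB + jq j) ≡ f₂
      fl₂ = floor-eq D₆ (FB + jq j) r′ f₂ lr′ (trans (add FB (# rb) hFB) h₂)
      e : ℤ
      e = (ℤ.- ℚ.floor (FA - jq j)) ℤ.- ℚ.floor (FB + jq j)
      e+1 : e ℤ.+ ℤ.1ℤ ≡ ℤ.+ n
      e+1 = ι-inj (trans (ι-+ e ℤ.1ℤ) (trans (cong₂ _+_ (trans (ι-- (ℤ.- ℚ.floor (FA - jq j)) (ℚ.floor (FB + jq j))) (cong₂ _-_ (trans (ι-neg (ℚ.floor (FA - jq j))) (cong (λ z → - ι z) fl₁)) (cong ι fl₂))) #1) hn))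
      p₁ = ι (F.pTimesNegPPow p e)
      γ₁ = ι (F.gammaP p k (F.frac (a - jq j)))
      γ₂ = ι (F.gammaP p k (F.frac ((- b) + jq j)))
      i₁ = ι (F.invZ p k (F.gammaP p k FA))
      i₂ = ι (F.invZ p k (F.gammaP p k FB))
      ia : i₁ * Γ̃ ra ≈[ k ] 1ℚ
      ia = inv-gammaP FA ra hFA
      ib : i₂ * Γ̃ rb ≈[ k ] 1ℚ
      ib = inv-gammaP FB rb hFB
      main : p₁ * (γ₁ * γ₂) ≈[ k ] - ((- P) ^ n) * (Γ̃ r * Γ̃ r′)
      main = ≈-trans (≈-reflexive (cong (_* (γ₁ * γ₂)) (pTimes-eq e n e+1))) (≈-*ˡ (Int-neg (Int-^ n (Int-neg (Int-# p)))) (≈-* (gammaP-eq (F.frac (a - jq j)) r g₁) (gammaP-eq (F.frac ((- b) + jq j)) r′ g₂) (Int-Γ̃ r) (Int-ι (F.gammaP p k (F.frac ((- b) + jq j))))))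
      e₁ : ι (F.factor p k j a b) * (Γ̃ ra * Γ̃ rb) ≡ p₁ * (γ₁ * γ₂) * (i₁ * Γ̃ ra * (i₂ * Γ̃ rb))
      e₁ = trans (cong (_* (Γ̃ ra * Γ̃ rb)) (trans (ι-* _ _) (cong (_* i₂) (trans (ι-* _ _) (cong (_* γ₂) (trans (ι-* _ _) (cong (_* i₁) (ι-* _ _))))))))
        (solve 7 (λ p a i b j x y → p :* a :* i :* b :* j :* (x :* y) := p :* (a :* b) :* (i :* x :* (j :* y))) refl p₁ γ₁ i₁ γ₂ i₂ (Γ̃ ra) (Γ̃ rb))
      e₂ : - ((- P) ^ n) * (Γ̃ r * Γ̃ r′) * (1ℚ * 1ℚ) ≡ - ((- P) ^ n) * (Γ̃ r * Γ̃ r′)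
      e₂ = trans (cong (- ((- P) ^ n) * (Γ̃ r * Γ̃ r′) *_) (*-identityˡ 1ℚ)) (*-identityʳ (- ((- P) ^ n) * (Γ̃ r * Γ̃ r′)))

  -- Quadratic residues and roots of the cubic

  h : ℕ
  h = proj₁ q-even

  hh : q ≡ h ℕ.+ h
  hh = proj₂ q-even

  0<h : 0 ℕ.< h
  0<h = go h hh
    where
    go : ∀ m → q ≡ m ℕ.+ m → 0 ℕ.< m
    go zero    e = ⊥-elim (ℕP.<-irrefl (sym e) 0<q)
    go (suc m) e = s≤s z≤n

  h<q : h ℕ.< q
  h<q = subst (h ℕ.<_) (sym hh) (ℕP.m<m+n h 0<h)

  ∣→≈ : ∀ a b → p ∣ ℤ.∣ a ℤ.- b ∣ → ι a ≈[ 1 ] ι b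
  ∣→≈ a b d = mk (Div-≡ (ι-- a b) (∣→1 (a ℤ.- b) d))

  ≈→∤ : ∀ {a b} → ι a ≈[ 1 ] ι b → ¬ (p ∣ ℤ.∣ b ∣) → ¬ (p ∣ ℤ.∣ a ∣)
  ≈→∤ {a} {b} e h d = h (1→∣ b (≈0→Div (≈-trans (≈-sym e) (Div→≈0 (∣→1 a d)))))

  euler-square : ∀ K a x → ¬ (p ∣ ℤ.∣ a ∣) → p ∣ ℤ.∣ (ℤ.+ x) ℤ.* (ℤ.+ x) ℤ.- a ∣ → τ K a ^ h ≈[ suc K ] 1ℚ
  euler-square K a x ha d = ≈-trans (≈-^ h (Int-τ K a) (Int-τ K x²) (τ-cong K a x² (≈-sym x²≈a))) (≈-trans (≈-reflexive e) (τ^q K (ℤ.+ x) p∤x))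
    where
    x² : ℤ
    x² = (ℤ.+ x) ℤ.* (ℤ.+ x)
    x²≈a : ι x² ≈[ 1 ] ι a
    x²≈a = ∣→≈ x² a d
    p∤x : ¬ (p ∣ x)
    p∤x z = ≈→∤ x²≈a ha (subst (p ∣_) (sym (ℤP.abs-* (ℤ.+ x) (ℤ.+ x))) (∣-trans z (n∣m*n x)))
    e : τ K x² ^ h ≡ τ K (ℤ.+ x) ^ q
    e = trans (cong (_^ h) (τ-* K (ℤ.+ x) (ℤ.+ x))) (trans (*-^ (τ K (ℤ.+ x)) (τ K (ℤ.+ x)) h) (trans (sym (^-+ (τ K (ℤ.+ x)) h h)) (cong (τ K (ℤ.+ x) ^_) (sym hh))))

  -- The sum over x and j of ω(x²)^(-j) ω(a)^j is evaluated in both orders.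
  euler-nonsquare : ∀ K a → ¬ (p ∣ ℤ.∣ a ∣) → (∀ x → x ℕ.< p → ¬ (p ∣ ℤ.∣ (ℤ.+ x) ℤ.* (ℤ.+ x) ℤ.- a ∣)) → τ K a ^ h ≈[ suc K ] - 1ℚ
  euler-nonsquare K a ha hn = ≈-cancelUnit Unit-q (≈-trans (≈-sym second) (≈-trans (≈-reflexive swap) (≈-trans first (≈-reflexive (solve 1 (λ x → :- x := x :* con (- 1ℚ)) refl (# q))))))
    where
    open ≡-Reasoning
    t : ℕ → ℚ
    t x = τ K (ℤ.+ x)
    v = τ K a
    x² : ℕ → ℤ
    x² x = (ℤ.+ x) ℤ.* (ℤ.+ x)
    first : ∑ p (λ x → geomSum (τ K (x² x)) v) ≈[ suc K ] - # q
    first = ≈-trans (≈-∑ p (λ x l → ≈-trans (geomSum-val K (x² x) a ha) (≈-reflexive (cong (λ z → # q * z - (1ℚ - δ∣ℤ (x² x))) (δ∣-no _ (hn x l)))))) (≈-reflexive (begin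
      ∑ p (λ x → # q * 0ℚ - (1ℚ - δ∣ℤ (x² x)))    ≡⟨ cong₂ _+_ (trans (cong (λ z → # q * 0ℚ - (1ℚ - z)) (δ∣-yes 0 (p ∣0))) (solve 1 (λ q → q :* con 0ℚ :- (con 1ℚ :- con 1ℚ) := con 0ℚ) refl (# q)))
                                                       (∑-cong q (λ x l → trans (cong (λ z → # q * 0ℚ - (1ℚ - z)) (δ∣-no _ (λ d → sq x l d))) (solve 1 (λ q → q :* con 0ℚ :- (con 1ℚ :- con 0ℚ) := :- con 1ℚ) refl (# q)))) ⟩
      0ℚ + ∑ q (λ _ → - 1ℚ)                       ≡⟨ trans (+-identityˡ (∑ q (λ _ → - 1ℚ))) (trans (∑-const q (- 1ℚ)) (solve 1 (λ x → x :* con (- 1ℚ) := :- x) refl (# q))) ⟩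
      - # q ∎))
      where
      sq : ∀ x → x ℕ.< q → ¬ (p ∣ ℤ.∣ x² (suc x) ∣)
      sq x l d = p∤* (p∤<p x l) (p∤<p x l) (subst (p ∣_) (ℤP.abs-* (ℤ.+ suc x) (ℤ.+ suc x)) d)
    ii : ℕ → ℕ
    ii j = (q ℕ.∸ suc j) ℕ.+ (q ℕ.∸ suc j)
    swap : ∑ q′ (λ j → powerSum K (ii j) * v ^ suc j) ≡ ∑ p (λ x → geomSum (τ K (x² x)) v)
    swap = trans (∑-ext q′ (λ j → trans (sym (∑-*ʳ p (λ x → t x ^ ii j) (v ^ suc j))) (∑-ext p (λ x → cong (_* v ^ suc j) (e x j))))) (∑-swap q′ p (λ j x → τ K (x² x) ^ (q ℕ.∸ suc j) * v ^ suc j))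
      where
      e : ∀ x j → t x ^ ii j ≡ τ K (x² x) ^ (q ℕ.∸ suc j)
      e x j = trans (^-+ (t x) (q ℕ.∸ suc j) (q ℕ.∸ suc j)) (trans (sym (*-^ (t x) (t x) (q ℕ.∸ suc j))) (cong (_^ (q ℕ.∸ suc j)) (sym (τ-* K (ℤ.+ x) (ℤ.+ x)))))
    j₀ : ℕ
    j₀ = h ℕ.∸ 1
    j₀≡ : suc j₀ ≡ h
    j₀≡ = ℕP.m+[n∸m]≡n 0<h
    qh : q ℕ.∸ h ≡ h
    qh = trans (cong (ℕ._∸ h) hh) (ℕP.m+n∸m≡n h h)
    pos : ∀ j → j ℕ.< q′ → 0 ℕ.< q ℕ.∸ suc j
    pos j l = ℕP.m<n⇒0<n∸m (subst (suc j ℕ.<_) (sym qq) (s≤s l))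
    -- 2(q - 1 - j) lies strictly between 0 and 2q, so it is divisible by q only if it equals q,
    -- that is for j + 1 = h: the quadratic character alone contributes.
    off : ∀ j → j ℕ.< q′ → j ≢ j₀ → δ₀ (ii j ℕD.% q) ≡ 0ℚ
    off j l ne = go (divMod-q (ii j))
      where
      i = q ℕ.∸ suc j
      i+ : i ℕ.+ suc j ≡ q
      i+ = ℕP.m∸n+n≡m (subst (suc j ℕ.≤_) (sym qq) (ℕP.m≤n⇒m≤1+n l))
      i<q : i ℕ.< q
      i<q = subst (i ℕ.<_) i+ (ℕP.m<m+n i (s≤s z≤n))
      go : Σ ℕ (λ u → Σ ℕ λ m → u ℕ.< q × ii j ≡ u ℕ.+ q ℕ.* m) → δ₀ (ii j ℕD.% q) ≡ 0ℚ
      go (suc u , m , lu , e) = cong δ₀ (trans (cong (ℕD._% q) e) (%q-eq (suc u) m lu))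
      go (zero , zero , lu , e) = ⊥-elim (ℕP.<-irrefl (sym (trans e (ℕP.*-zeroʳ q))) (ℕP.≤-trans (pos j l) (ℕP.m≤m+n i i)))
      go (zero , suc zero , lu , e) = ⊥-elim (ne (ℕP.suc-injective (trans (ℕP.+-cancelˡ-≡ i _ _ (trans i+ (trans hh (cong₂ ℕ._+_ (sym i≡h) refl)))) (sym j₀≡))))
        where
        i≡h : i ≡ h
        i≡h = ℕP.*-cancelˡ-≡ i h 2 (trans (cong (i ℕ.+_) (ℕP.+-identityʳ i)) (trans e (trans (ℕP.*-identityʳ q) (trans hh (cong (h ℕ.+_) (sym (ℕP.+-identityʳ h)))))))
      go (zero , suc (suc m) , lu , e) = ⊥-elim (ℕP.<-irrefl e (ℕP.≤-trans (ℕP.+-mono-< i<q i<q) (ℕP.≤-trans (ℕP.≤-reflexive (trans (cong (q ℕ.+_) (sym (ℕP.+-identityʳ q))) (ℕP.*-comm 2 q))) (ℕP.*-monoʳ-≤ q (s≤s (s≤s (z≤n {m})))))))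
    second : ∑ q′ (λ j → powerSum K (ii j) * v ^ suc j) ≈[ suc K ] # q * v ^ h
    second = ≈-trans (≈-∑ q′ (λ j l → ≈-*ʳ (Int-^ (suc j) (Int-τ K a)) (powerSum-eq K (ii j) (ℕP.≤-trans (pos j l) (ℕP.m≤m+n (q ℕ.∸ suc j) (q ℕ.∸ suc j)))))) (≈-reflexive
      (trans (∑-single q′ (λ j → # q * δ₀ (ii j ℕD.% q) * v ^ suc j) j₀ (subst (ℕ._≤ q′) (sym j₀≡) (ℕP.≤-pred (subst (h ℕ.<_) qq h<q)))
        (λ j l ne → trans (cong (λ z → # q * z * v ^ suc j) (off j l ne)) (solve 2 (λ a b → a :* con 0ℚ :* b := con 0ℚ) refl (# q) (v ^ suc j))))
        (cong₂ _*_ (trans (cong (λ z → # q * δ₀ z) (trans (cong (ℕD._% q) (trans (cong (λ z → (q ℕ.∸ z) ℕ.+ (q ℕ.∸ z)) j₀≡) (trans (cong₂ ℕ._+_ qh qh) (trans (sym hh) (sym (ℕP.*-identityʳ q)))))) (%q-eq 0 1 0<q))) (*-identityʳ (# q))) (cong (v ^_) j₀≡))))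

  any-true : ∀ (f : ℕ → Bool) (g : ℕ → ℕ) n → any f (applyUpTo g n) ≡ true → Σ ℕ λ i → i ℕ.< n × f (g i) ≡ true
  any-true f g (suc n) e with f (g 0) in eq
  ... | true  = 0 , s≤s z≤n , eq
  ... | false with any-true f (g ∘ suc) n e
  ...   | i , l , h = suc i , s≤s l , h

  any-false : ∀ (f : ℕ → Bool) (g : ℕ → ℕ) n → any f (applyUpTo g n) ≡ false → ∀ i → i ℕ.< n → f (g i) ≡ false
  any-false f g (suc n) e i l with f (g 0) in eq
  any-false f g (suc n) () i l | true
  any-false f g (suc n) e zero    l       | false = eq
  any-false f g (suc n) e (suc i) (s≤s l) | false = any-false f (g ∘ suc) n e i l

  ≡ᵇ0 : ∀ n → (n ℕ.≡ᵇ 0) ≡ true → n ≡ 0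
  ≡ᵇ0 zero e = refl

  ≢ᵇ0 : ∀ n → (n ℕ.≡ᵇ 0) ≡ false → n ≢ 0
  ≢ᵇ0 zero () refl

  qchar-eq : ∀ K a → ¬ (p ∣ ℤ.∣ a ∣) → ι (F.qchar p a) ≈[ suc K ] τ K a ^ h
  qchar-eq K a ha = go (F.modN a p) refl (any root (upTo p)) refl
    where
    x²-a : ℕ → ℤ
    x²-a x = (ℤ.+ x) ℤ.* (ℤ.+ x) ℤ.- a
    root : ℕ → Bool
    root x = F.modN (x²-a x) p ℕ.≡ᵇ 0
    go : ∀ m → F.modN a p ≡ m → ∀ b → any root (upTo p) ≡ b → ι (if m ℕ.≡ᵇ 0 then ℤ.0ℤ else (if b then ℤ.1ℤ else ℤ.- ℤ.1ℤ)) ≈[ suc K ] τ K a ^ h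
    go zero    e b     e′ = ⊥-elim (ha (modN-≢0 a e))
    go (suc m) e true  e′ = ≈-trans (≈-reflexive #1) (≈-sym (sq (any-true root (λ i → i) p e′)))
      where
      sq : (Σ ℕ λ i → i ℕ.< p × root i ≡ true) → τ K a ^ h ≈[ suc K ] 1ℚ
      sq (i , l , r) = euler-square K a i ha (modN-≢0 (x²-a i) (≡ᵇ0 (F.modN (x²-a i) p) r))
    go (suc m) e false e′ = ≈-trans (≈-reflexive (trans (ι-neg ℤ.1ℤ) (cong -_ #1))) (≈-sym (euler-nonsquare K a ha (λ x l d → ≢ᵇ0 (F.modN (x²-a x) p) (any-false root (λ i → i) p e′ x l) (modN-0 (x²-a x) d))))

  filter-count : ∀ (f : ℕ → Bool) (g : ℕ → ℕ) n → # (length (filterᵇ f (applyUpTo g n))) ≡ ∑ n (λ i → if f (g i) then 1ℚ else 0ℚ)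
  filter-count f g zero = #0
  filter-count f g (suc n) = go (f (g 0)) refl
    where
    IH = filter-count f (g ∘ suc) n
    go : ∀ b → f (g 0) ≡ b → # (length (filterᵇ f (applyUpTo g (suc n)))) ≡ (if f (g 0) then 1ℚ else 0ℚ) + ∑ n (λ i → if f (g (suc i)) then 1ℚ else 0ℚ)
    go true  e rewrite e = trans (#-suc (length (filterᵇ f (applyUpTo (g ∘ suc) n)))) (cong (1ℚ +_) IH)
    go false e rewrite e = trans IH (sym (+-identityˡ _))

  ind-δ∣ℤ : ∀ a → (if F.modN a p ℕ.≡ᵇ 0 then 1ℚ else 0ℚ) ≡ δ∣ℤ a
  ind-δ∣ℤ a = go (F.modN a p) refl
    where
    go : ∀ m → F.modN a p ≡ m → (if m ℕ.≡ᵇ 0 then 1ℚ else 0ℚ) ≡ δ∣ℤ a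
    go zero    e = sym (δ∣-yes _ (modN-≢0 a e))
    go (suc m) e = sym (δ∣-no _ (λ d → absurd (trans (sym e) (modN-0 a d))))
      where
      absurd : suc m ≡ 0 → ⊥
      absurd ()

  module Roots (s : ℤ) (p∤s : ¬ (p ∣ ℤ.∣ s ∣)) where

    s⁻¹ : ℤ
    s⁻¹ = F.invFp p s

    -- This is -4/(27 s) modulo p, inverses being (p-2)-th powers; the value to which x²y is
    -- prescribed.
    V : ℤ
    V = ℤ.- ((ℤ.+ 4) ℤ.* s⁻¹ ℤ.* (ℤ.+ 27) ℤ.^ q′)

    unit-pow : ∀ z → ¬ (p ∣ ℤ.∣ z ∣) → ι z * ι (z ℤ.^ q′) ≈[ 1 ] 1ℚ
    unit-pow z hz = ≈-trans (≈-reflexive (trans (cong (ι z *_) (ι-^ z q′)) (cong (ι z ^_) (sym qq)))) (≈-cancelUnit (Unit-ι z hz) (≈-trans (fermat-ι z) (≈-reflexive (sym (*-identityʳ (ι z))))))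

    p∤27 : ¬ (p ∣ 27)
    p∤27 = p∤* {3} {9} p∤3 (p∤* {3} {3} p∤3 p∤3)

    p∤pow : ∀ z → ¬ (p ∣ ℤ.∣ z ∣) → ¬ (p ∣ ℤ.∣ z ℤ.^ q′ ∣)
    p∤pow z hz = Unit→∤ (z ℤ.^ q′) (subst Unit (sym (ι-^ z q′)) (Unit-^ q′ (Unit-ι z hz)))

    V≡ : ι V ≡ - (# 4 * ι s⁻¹ * ι ((ℤ.+ 27) ℤ.^ q′))
    V≡ = trans (ι-neg ((ℤ.+ 4) ℤ.* s⁻¹ ℤ.* (ℤ.+ 27) ℤ.^ q′)) (cong -_ (trans (ι-* ((ℤ.+ 4) ℤ.* s⁻¹) ((ℤ.+ 27) ℤ.^ q′)) (cong (_* ι ((ℤ.+ 27) ℤ.^ q′)) (ι-* (ℤ.+ 4) s⁻¹))))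

    p∤V : ¬ (p ∣ ℤ.∣ V ∣)
    p∤V = Unit→∤ V (subst Unit (sym V≡) (Unit-neg (Unit-* (Unit-* (Unit-# 4 (p∤* {2} {2} p∤2 p∤2)) (Unit-ι s⁻¹ (p∤pow s p∤s))) (Unit-ι ((ℤ.+ 27) ℤ.^ q′) (p∤pow (ℤ.+ 27) p∤27)))))

    hV : - (# 27 * ι s * ι V) ≈[ 1 ] # 4
    hV = ≈-trans (≈-reflexive (trans (cong (λ z → - (# 27 * ι s * z)) V≡) (solve 5 (λ a b c d e → :- (a :* b :* (:- (c :* d :* e))) := c :* ((a :* e) :* (b :* d))) refl (# 27) (ι s) (# 4) (ι s⁻¹) (ι ((ℤ.+ 27) ℤ.^ q′)))))
      (≈-trans (≈-*ˡ (Int-# 4) (≈-trans (≈-* (unit-pow (ℤ.+ 27) p∤27) (unit-pow s p∤s) Int-1 (Int-* (Int-ι s) (Int-ι s⁻¹))) (≈-reflexive (*-identityˡ 1ℚ)))) (≈-reflexive (*-identityʳ (# 4))))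

    hV′ : # 27 * ι V ≈[ 1 ] - (# 4 * ι s⁻¹)
    hV′ = ≈-trans (≈-reflexive (trans (cong (# 27 *_) V≡) (solve 4 (λ a c d e → a :* (:- (c :* d :* e)) := (:- (c :* d)) :* (a :* e)) refl (# 27) (# 4) (ι s⁻¹) (ι ((ℤ.+ 27) ℤ.^ q′)))))
      (≈-trans (≈-*ˡ (Int-neg (Int-* (Int-# 4) (Int-ι s⁻¹))) (unit-pow (ℤ.+ 27) p∤27)) (≈-reflexive (*-identityʳ (- (# 4 * ι s⁻¹)))))

    π : ℕ → ℕ
    π x = res (ℤ.- (ℤ.+ x))

    π≈ : ∀ x → # (π x) ≈[ 1 ] - # x
    π≈ x = ≈-trans (≈-sym (ι-res (ℤ.- (ℤ.+ x)))) (≈-reflexive (ι-neg (ℤ.+ x)))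

    ππ : ∀ x → x ℕ.< p → π (π x) ≡ x
    ππ x l = small-eq (π (π x)) x (res< (ℤ.- (ℤ.+ π x))) l (≈-trans (π≈ (π x)) (≈-trans (≈-neg (π≈ x)) (≈-reflexive (solve 1 (λ x → :- (:- x) := x) refl (# x)))))

    cub : ℕ → ℤ
    cub y = F.cubic p s (ℤ.+ y)

    -- For y = -x the part 27y³ - 27y² becomes -27x²(1 + x), and 27 V ≡ -4/s. The roots of the cubic
    -- thus correspond to the points of the line with x²y ≡ V.
    cub-π : ∀ x → ι (cub (π x)) ≈[ 1 ] # 27 * ι (W x ℤ.- V)
    cub-π x = ≈-trans (≈-reflexive e₁) (≈-trans (≈-+ (≈-- (≈-*ˡ (Int-# 27) (≈-^ 3 (Int-# (π x)) (Int-neg (Int-# x)) (π≈ x))) (≈-*ˡ (Int-# 27) (≈-^ 2 (Int-# (π x)) (Int-neg (Int-# x)) (π≈ x))))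
        (≈-≡ (solve 1 (λ x → :- (:- x) := x) refl (# 4 * ι s⁻¹)) refl (≈-neg (≈-sym hV′)))) (≈-reflexive e₂))
      where
      e₁ : ι (cub (π x)) ≡ # 27 * # (π x) ^ 3 - # 27 * # (π x) ^ 2 + # 4 * ι s⁻¹
      e₁ = trans (ι-+ ((ℤ.+ 27) ℤ.* (ℤ.+ π x) ℤ.^ 3 ℤ.- (ℤ.+ 27) ℤ.* (ℤ.+ π x) ℤ.^ 2) ((ℤ.+ 4) ℤ.* s⁻¹)) (cong₂ _+_ (trans (ι-- ((ℤ.+ 27) ℤ.* (ℤ.+ π x) ℤ.^ 3) ((ℤ.+ 27) ℤ.* (ℤ.+ π x) ℤ.^ 2))
        (cong₂ _-_ (trans (ι-* (ℤ.+ 27) ((ℤ.+ π x) ℤ.^ 3)) (cong (# 27 *_) (ι-^ (ℤ.+ π x) 3))) (trans (ι-* (ℤ.+ 27) ((ℤ.+ π x) ℤ.^ 2)) (cong (# 27 *_) (ι-^ (ℤ.+ π x) 2))))) (ι-* (ℤ.+ 4) s⁻¹))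
      e₂ : # 27 * (- # x) ^ 3 - # 27 * (- # x) ^ 2 + - (# 27 * ι V) ≡ # 27 * ι (W x ℤ.- V)
      e₂ = trans (solve 3 (λ a x v → a :* ((:- x) :* ((:- x) :* ((:- x) :* con 1ℚ))) :- a :* ((:- x) :* ((:- x) :* con 1ℚ)) :+ (:- (a :* v)) := a :* ((:- (x :* x :* (con 1ℚ :+ x))) :- v)) refl (# 27) (# x) (ι V))
        (cong (# 27 *_) (sym (trans (ι-- (W x) V) (cong (_- ι V) (trans (ι-neg (ℤ.+ (x ℕ.* x ℕ.* suc x))) (cong -_ (trans (#-* (x ℕ.* x) (suc x)) (cong₂ _*_ (#-* x x) (#-suc x)))))))))

    δ∣ℤ-cub : ∀ x → δ∣ℤ (cub (π x)) ≡ δ∣ℤ (W x ℤ.- V)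
    δ∣ℤ-cub x = δ∣ℤ-cong (cub (π x)) (W x ℤ.- V) (λ d → 1→∣ (W x ℤ.- V) (Div-cancelUnit (Unit-# 27 p∤27) (≈0→Div (≈-trans (≈-sym (cub-π x)) (Div→≈0 (∣→1 (cub (π x)) d))))))
      (λ d → 1→∣ (cub (π x)) (≈0→Div (≈-trans (cub-π x) (Div→≈0 (Div-*ˡ (Int-# 27) (∣→1 (W x ℤ.- V) d))))))

    roots : ∑ p (λ x → δ∣ℤ (W x ℤ.- V)) ≡ # (F.numRoots p s)
    roots = trans (∑-ext p (λ x → sym (δ∣ℤ-cub x))) (trans (∑-perm p π π (λ y → δ∣ℤ (cub y)) (λ x _ → res< (ℤ.- (ℤ.+ x))) (λ x _ → res< (ℤ.- (ℤ.+ x))) ππ ππ)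
      (trans (∑-ext p (λ y → sym (ind-δ∣ℤ (cub y)))) (sym (filter-count (λ y → F.modN (cub y) p ℕ.≡ᵇ 0) (λ i → i) p))))

  -- The two hypergeometric functions

  -- The part of `Split` that concerns floors and remainders and makes sense for j = 0 as well.
  record Reg (j : ℕ) : Set where
    field
      r₁ r₂ r₄ m₁ m₂ m₄ : ℕ
      r₁< : r₁ ℕ.< 6 ℕ.* q
      r₂< : r₂ ℕ.< 6 ℕ.* q
      r₄< : r₄ ℕ.< 6 ℕ.* q
      r₁≡ : r₁ ℕ.+ 6 ℕ.* j ≡ 2 ℕ.* q ℕ.+ 6 ℕ.* q ℕ.* m₁
      r₂≡ : r₂ ℕ.+ 6 ℕ.* j ≡ 4 ℕ.* q ℕ.+ 6 ℕ.* q ℕ.* m₂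
      r₄≡ : r₄ ℕ.+ 6 ℕ.* q ℕ.* m₄ ≡ 3 ℕ.* q ℕ.+ 6 ℕ.* j
      m₄≤ : m₄ ℕ.≤ 1 ℕ.+ m₂
    expo : ℕ
    expo = (1 ℕ.+ m₁) ℕ.+ ((1 ℕ.+ m₂) ℕ.∸ m₄)

  6*< : ∀ {j} → j ℕ.< q → 6 ℕ.* j ℕ.< 6 ℕ.* q
  6*< l = ℕP.*-monoʳ-< 6 l

  c*q< : ∀ c → c ℕ.< 6 → c ℕ.* q ℕ.< 6 ℕ.* q
  c*q< c l = ℕP.*-monoˡ-< q l

  reg-split : ∀ {j} → Split j → Reg j
  reg-split sp = record { Split sp }

  reg-0 : Reg 0
  reg-0 = record
    { r₁ = 2 ℕ.* q ; r₂ = 4 ℕ.* q ; r₄ = 3 ℕ.* q ; m₁ = 0 ; m₂ = 0 ; m₄ = 0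
    ; r₁< = c*q< 2 (s≤s (s≤s (s≤s z≤n))) ; r₂< = c*q< 4 (s≤s (s≤s (s≤s (s≤s (s≤s z≤n))))) ; r₄< = c*q< 3 (s≤s (s≤s (s≤s (s≤s z≤n))))
    ; r₁≡ = cong (2 ℕ.* q ℕ.+_) (sym (ℕP.*-zeroʳ (6 ℕ.* q))) ; r₂≡ = cong (4 ℕ.* q ℕ.+_) (sym (ℕP.*-zeroʳ (6 ℕ.* q))) ; r₄≡ = cong (3 ℕ.* q ℕ.+_) (ℕP.*-zeroʳ (6 ℕ.* q))
    ; m₄≤ = z≤n }

  reg : ∀ j → j ℕ.< q → Reg j
  reg zero    l = reg-0
  reg (suc j) l = reg-split (split (suc j) (s≤s z≤n) l)

  N2 N3 N4 N5 N6 : ℚ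
  N2 = ℤ.+ 2 ℚ./ 1
  N3 = ℤ.+ 3 ℚ./ 1
  N4 = ℤ.+ 4 ℚ./ 1
  N5 = ℤ.+ 5 ℚ./ 1
  N6 = ℤ.+ 6 ℚ./ 1

  #c* : ∀ c x → # (c ℕ.* x) ≡ (ℤ.+ c ℚ./ 1) * # x
  #c* c x = trans (#-* c x) (cong (_* # x) (ι-def (ℤ.+ c)))

  -- Derives one linear equation from another by a ring identity that contains the difference of the
  -- two known sides.
  lin : ∀ {A B L R : ℚ} → A ≡ B → L ≡ R + (B - A) → L ≡ R
  lin {A} {R = R} refl e = trans e (trans (cong (R +_) (+-inverseʳ A)) (+-identityʳ R))

  module Terms (K : ℕ) where

    open Factors K public

    upper₁ upper₂ lower : Vec ℚ 2
    upper₁ = F.divNat (ℤ.+ 1) 3 ∷ᵛ F.divNat (ℤ.+ 2) 3 ∷ᵛ []ᵛ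
    upper₂ = F.divNat (ℤ.+ 1) 6 ∷ᵛ F.divNat (ℤ.+ 5) 6 ∷ᵛ []ᵛ
    lower  = 0ℚ ∷ᵛ F.divNat (ℤ.+ 1) 2 ∷ᵛ []ᵛ

    pf pf~ : ℕ → ℤ
    pf  j = F.prodFactors p k j upper₁ lower
    pf~ j = F.prodFactors p k j upper₂ lower

    frac-val : ∀ c m r → 0 ℕ.< m → c ℕ.* D₆ ≡ m ℕ.* r → F.divNat (ℤ.+ c) m * # D₆ ≡ # r
    frac-val c (suc m) r l h = #-cancel m (trans (solve 3 (λ m x d → m :* (x :* d) := x :* m :* d) refl (# (suc m)) (F.divNat (ℤ.+ c) (suc m)) (# D₆)) (trans (cong (_* # D₆) (divNat-* (ℤ.+ c) (suc m) (s≤s z≤n)))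
      (trans (sym (#-* c D₆)) (trans (cong # h) (#-* (suc m) r)))))

    upper : ∀ c m r → 0 ℕ.< m → c ℕ.* D₆ ≡ m ℕ.* r → F.divNat (ℤ.+ c) m * # D₆ ≡ # r + ι ℤ.0ℤ * # D₆
    upper c m r l h = trans (frac-val c m r l h) (trans (solve 2 (λ r d → r := r :+ con 0ℚ :* d) refl (# r) (# D₆)) (cong (λ z → # r + z * # D₆) (sym #0)))

    lower₀ : (- 0ℚ) * # D₆ ≡ # 0 + ι ℤ.0ℤ * # D₆
    lower₀ = trans (solve 1 (λ d → (:- con 0ℚ) :* d := con 0ℚ :+ con 0ℚ :* d) refl (# D₆)) (cong₂ (λ y z → y + z * # D₆) (sym #0) (sym #0))

    lower₁ : (- F.divNat (ℤ.+ 1) 2) * # D₆ ≡ # (3 ℕ.* q) + ι (ℤ.- ℤ.1ℤ) * # D₆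
    lower₁ = trans (solve 2 (λ x d → (:- x) :* d := :- (x :* d)) refl (F.divNat (ℤ.+ 1) 2) (# D₆)) (trans (cong -_ (frac-val 1 2 (3 ℕ.* q) (s≤s z≤n) (NS.solve 1 (λ q → NS.con 1 NS.:* (NS.con 6 NS.:* q) NS.:= NS.con 2 NS.:* (NS.con 3 NS.:* q)) refl q)))
      (trans (trans (cong -_ (#c* 3 q)) (trans (solve 1 (λ q → :- (con N3 :* q) := con N3 :* q :+ (:- con 1ℚ) :* (con N6 :* q)) refl (# q)) (cong₂ (λ y z → y + (- 1ℚ) * z) (sym (#c* 3 q)) (sym (#c* 6 q)))))
        (cong (λ z → # (3 ℕ.* q) + z * # D₆) (sym (trans (ι-neg ℤ.1ℤ) (cong -_ #1))))))

    0<D₆ : 0 ℕ.< D₆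
    0<D₆ = ℕP.*-mono-< {0} {6} {0} (s≤s z≤n) 0<q

    two : ∀ f g n₁ n₂ d₁ d₂ x y → Int d₁ → Int d₂ → Int x → Int y → ι f * d₁ ≈[ k ] - ((- P) ^ n₁) * x → ι g * d₂ ≈[ k ] - ((- P) ^ n₂) * y →
      ι (f ℤ.* (g ℤ.* ℤ.1ℤ)) * (d₁ * d₂) ≈[ k ] (- P) ^ (n₁ ℕ.+ n₂) * (x * y)
    two f g n₁ n₂ d₁ d₂ x y id₁ id₂ ix iy h₁ h₂ = ≈-trans (≈-reflexive e₁) (≈-trans (≈-* h₁ h₂ (Int-* (Int-neg (Int-^ n₁ (Int-neg (Int-# p)))) ix) (Int-* (Int-ι g) id₂)) (≈-reflexive e₂))
      where
      e₁ : ι (f ℤ.* (g ℤ.* ℤ.1ℤ)) * (d₁ * d₂) ≡ ι f * d₁ * (ι g * d₂)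
      e₁ = trans (cong (_* (d₁ * d₂)) (trans (ι-* f (g ℤ.* ℤ.1ℤ)) (cong (ι f *_) (cong ι (ℤP.*-identityʳ g))))) (solve 4 (λ f g a b → f :* g :* (a :* b) := f :* a :* (g :* b)) refl (ι f) (ι g) d₁ d₂)
      e₂ : - ((- P) ^ n₁) * x * (- ((- P) ^ n₂) * y) ≡ (- P) ^ (n₁ ℕ.+ n₂) * (x * y)
      e₂ = trans (solve 4 (λ a x b y → (:- a) :* x :* ((:- b) :* y) := a :* b :* (x :* y)) refl ((- P) ^ n₁) x ((- P) ^ n₂) y) (cong (_* (x * y)) (sym (^-+ (- P) n₁ n₂)))

    module _ {j : ℕ} (R : Reg j) where

      open Reg R

      Xr : ℚ
      Xr = (- P) ^ expo * (Γ̃ r₁ * Γ̃ r₂ * (Γ̃ (6 ℕ.* j) * Γ̃ r₄))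

      r₁-eq : # r₁ + N6 * # j ≡ N2 * # q + N6 * # q * # m₁
      r₁-eq = trans (cong (# r₁ +_) (sym (#c* 6 j))) (trans (sym (#-+ r₁ (6 ℕ.* j))) (trans (cong # r₁≡) (trans (#-+ (2 ℕ.* q) (6 ℕ.* q ℕ.* m₁)) (cong₂ _+_ (#c* 2 q) (trans (#-* (6 ℕ.* q) m₁) (cong (_* # m₁) (#c* 6 q)))))))

      r₂-eq : # r₂ + N6 * # j ≡ N4 * # q + N6 * # q * # m₂
      r₂-eq = trans (cong (# r₂ +_) (sym (#c* 6 j))) (trans (sym (#-+ r₂ (6 ℕ.* j))) (trans (cong # r₂≡) (trans (#-+ (4 ℕ.* q) (6 ℕ.* q ℕ.* m₂)) (cong₂ _+_ (#c* 4 q) (trans (#-* (6 ℕ.* q) m₂) (cong (_* # m₂) (#c* 6 q)))))))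

      r₄-eq : # r₄ + N6 * # q * # m₄ ≡ N3 * # q + N6 * # j
      r₄-eq = trans (cong (# r₄ +_) (sym (trans (#-* (6 ℕ.* q) m₄) (cong (_* # m₄) (#c* 6 q))))) (trans (sym (#-+ r₄ (6 ℕ.* q ℕ.* m₄))) (trans (cong # r₄≡) (trans (#-+ (3 ℕ.* q) (6 ℕ.* j)) (cong₂ _+_ (#c* 3 q) (#c* 6 j)))))

      m₂₄ : # ((1 ℕ.+ m₂) ℕ.∸ m₄) ≡ 1ℚ + # m₂ - # m₄
      m₂₄ = lin (sym (trans (sym (#-+ ((1 ℕ.+ m₂) ℕ.∸ m₄) m₄)) (trans (cong # (ℕP.m∸n+n≡m m₄≤)) (#-suc m₂))))
        (solve 3 (λ x m n → x := (con 1ℚ :+ m :- n) :+ ((x :+ n) :- (con 1ℚ :+ m))) refl (# ((1 ℕ.+ m₂) ℕ.∸ m₄)) (# m₂) (# m₄))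

    s6 : # 6 ≡ N6
    s6 = ι-def (ℤ.+ 6)

    hsub : ∀ {ra Q f Ff} r j → # ra ≡ Q → ι f ≡ Ff → Q - N6 * # j ≡ # r + Ff * (N6 * # q) → # ra - # 6 * # j ≡ # r + ι f * # D₆
    hsub r j e₁ e₂ h = trans (cong₂ (λ a b → a - b * # j) e₁ s6) (trans h (cong₂ (λ a b → # r + a * b) (sym e₂) (sym (#c* 6 q))))

    hadd : ∀ {rb Q f Ff} r j → # rb ≡ Q → ι f ≡ Ff → Q + N6 * # j ≡ # r + Ff * (N6 * # q) → # rb + # 6 * # j ≡ # r + ι f * # D₆
    hadd r j e₁ e₂ h = trans (cong₂ (λ a b → a + b * # j) e₁ s6) (trans h (cong₂ (λ a b → # r + a * b) (sym e₂) (sym (#c* 6 q))))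

    same6 : ∀ j → 0ℚ + N6 * # j ≡ # (6 ℕ.* j) + 0ℚ * (N6 * # q)
    same6 j = trans (solve 2 (λ j q → con 0ℚ :+ con N6 :* j := con N6 :* j :+ con 0ℚ :* (con N6 :* q)) refl (# j) (# q)) (cong (λ z → z + 0ℚ * (N6 * # q)) (sym (#c* 6 j)))

    -- the congruences of Reg, rewritten as the divisions with remainder that factor-eq asks for
    A₁ : ∀ (r J Q m : ℚ) → r + N6 * J ≡ N2 * Q + N6 * Q * m → N2 * Q - N6 * J ≡ r + (- m) * (N6 * Q)
    A₁ r J Q m h = lin h (solve 4 (λ r J Q m → con N2 :* Q :- con N6 :* J := (r :+ (:- m) :* (con N6 :* Q)) :+ ((con N2 :* Q :+ con N6 :* Q :* m) :- (r :+ con N6 :* J))) refl r J Q m)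

    A₂ : ∀ (r J Q m : ℚ) → r + N6 * J ≡ N4 * Q + N6 * Q * m → N4 * Q - N6 * J ≡ r + (- m) * (N6 * Q)
    A₂ r J Q m h = lin h (solve 4 (λ r J Q m → con N4 :* Q :- con N6 :* J := (r :+ (:- m) :* (con N6 :* Q)) :+ ((con N4 :* Q :+ con N6 :* Q :* m) :- (r :+ con N6 :* J))) refl r J Q m)

    A₄ : ∀ (r J Q m : ℚ) → r + N6 * Q * m ≡ N3 * Q + N6 * J → N3 * Q + N6 * J ≡ r + m * (N6 * Q)
    A₄ r J Q m h = trans (sym h) (solve 3 (λ r Q m → r :+ con N6 :* Q :* m := r :+ m :* (con N6 :* Q)) refl r Q m)

    B₁ : ∀ (r J J′ H Q m : ℚ) → Q ≡ H + H → J′ ≡ J + H → r + N6 * J′ ≡ N4 * Q + N6 * Q * m → Q - N6 * J ≡ r + (- m) * (N6 * Q)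
    B₁ r J _ H _ m refl refl h = lin h (solve 4 (λ r J H m → (H :+ H) :- con N6 :* J := (r :+ (:- m) :* (con N6 :* (H :+ H))) :+ ((con N4 :* (H :+ H) :+ con N6 :* (H :+ H) :* m) :- (r :+ con N6 :* (J :+ H)))) refl r J H m)

    B₂ : ∀ (r J J′ H Q m : ℚ) → Q ≡ H + H → J′ ≡ J + H → r + N6 * Q * m ≡ N3 * Q + N6 * J′ → 0ℚ + N6 * J ≡ r + (m - 1ℚ) * (N6 * Q)
    B₂ r J _ H _ m refl refl h = lin h (solve 4 (λ r J H m → con 0ℚ :+ con N6 :* J := (r :+ (m :- con 1ℚ) :* (con N6 :* (H :+ H))) :+ ((con N3 :* (H :+ H) :+ con N6 :* (J :+ H)) :- (r :+ con N6 :* (H :+ H) :* m))) refl r J H m)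

    B₃ : ∀ (r J J′ H Q m : ℚ) → Q ≡ H + H → J′ ≡ J + H → r + N6 * J′ ≡ N2 * Q + N6 * Q * m → N5 * Q - N6 * J ≡ r + (1ℚ - m) * (N6 * Q)
    B₃ r J _ H _ m refl refl h = lin h (solve 4 (λ r J H m → con N5 :* (H :+ H) :- con N6 :* J := (r :+ (con 1ℚ :- m) :* (con N6 :* (H :+ H))) :+ ((con N2 :* (H :+ H) :+ con N6 :* (H :+ H) :* m) :- (r :+ con N6 :* (J :+ H)))) refl r J H m)

    B₄ : ∀ (J J′ H Q : ℚ) → Q ≡ H + H → J′ ≡ J + H → N3 * Q + N6 * J ≡ N6 * J′ + 0ℚ * (N6 * Q)
    B₄ J _ H _ refl refl = solve 2 (λ J H → con N3 :* (H :+ H) :+ con N6 :* J := con N6 :* (J :+ H) :+ con 0ℚ :* (con N6 :* (H :+ H))) refl J H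

    C₁ : ∀ (r J J′ H Q m : ℚ) → Q ≡ H + H → J ≡ H + J′ → r + N6 * J′ ≡ N4 * Q + N6 * Q * m → Q - N6 * J ≡ r + (- (1ℚ + m)) * (N6 * Q)
    C₁ r _ J H _ m refl refl h = lin h (solve 4 (λ r J H m → (H :+ H) :- con N6 :* (H :+ J) := (r :+ (:- (con 1ℚ :+ m)) :* (con N6 :* (H :+ H))) :+ ((con N4 :* (H :+ H) :+ con N6 :* (H :+ H) :* m) :- (r :+ con N6 :* J))) refl r J H m)

    C₂ : ∀ (r J J′ H Q m : ℚ) → Q ≡ H + H → J ≡ H + J′ → r + N6 * Q * m ≡ N3 * Q + N6 * J′ → 0ℚ + N6 * J ≡ r + m * (N6 * Q)
    C₂ r _ J H _ m refl refl h = lin h (solve 4 (λ r J H m → con 0ℚ :+ con N6 :* (H :+ J) := (r :+ m :* (con N6 :* (H :+ H))) :+ ((con N3 :* (H :+ H) :+ con N6 :* J) :- (r :+ con N6 :* (H :+ H) :* m))) refl r J H m)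

    C₃ : ∀ (r J J′ H Q m : ℚ) → Q ≡ H + H → J ≡ H + J′ → r + N6 * J′ ≡ N2 * Q + N6 * Q * m → N5 * Q - N6 * J ≡ r + (- m) * (N6 * Q)
    C₃ r _ J H _ m refl refl h = lin h (solve 4 (λ r J H m → con N5 :* (H :+ H) :- con N6 :* (H :+ J) := (r :+ (:- m) :* (con N6 :* (H :+ H))) :+ ((con N2 :* (H :+ H) :+ con N6 :* (H :+ H) :* m) :- (r :+ con N6 :* J))) refl r J H m)

    C₄ : ∀ (J J′ H Q : ℚ) → Q ≡ H + H → J ≡ H + J′ → N3 * Q + N6 * J ≡ N6 * J′ + 1ℚ * (N6 * Q)
    C₄ _ J H _ refl refl = solve 2 (λ J H → con N3 :* (H :+ H) :+ con N6 :* (H :+ J) := con N6 :* J :+ con 1ℚ :* (con N6 :* (H :+ H))) refl J H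

    Q≡ : # q ≡ # h + # h
    Q≡ = trans (cong # hh) (#-+ h h)

    iΓΓ : ∀ a b → Int (Γ̃ a * Γ̃ b)
    iΓΓ a b = Int-* (Int-Γ̃ a) (Int-Γ̃ b)

    ι-m : ∀ m → ι (ℤ.- (ℤ.+ m)) ≡ - # m
    ι-m m = ι-neg (ℤ.+ m)

    v₁₃ = upper 1 3 (2 ℕ.* q) (s≤s z≤n) (NS.solve 1 (λ q → NS.con 1 NS.:* (NS.con 6 NS.:* q) NS.:= NS.con 3 NS.:* (NS.con 2 NS.:* q)) refl q)
    v₂₃ = upper 2 3 (4 ℕ.* q) (s≤s z≤n) (NS.solve 1 (λ q → NS.con 2 NS.:* (NS.con 6 NS.:* q) NS.:= NS.con 3 NS.:* (NS.con 4 NS.:* q)) refl q)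
    v₁₆ = upper 1 6 q (s≤s z≤n) (NS.solve 1 (λ q → NS.con 1 NS.:* (NS.con 6 NS.:* q) NS.:= NS.con 6 NS.:* q) refl q)
    v₅₆ = upper 5 6 (5 ℕ.* q) (s≤s z≤n) (NS.solve 1 (λ q → NS.con 5 NS.:* (NS.con 6 NS.:* q) NS.:= NS.con 6 NS.:* (NS.con 5 NS.:* q)) refl q)

    q<6q : q ℕ.< D₆
    q<6q = subst (ℕ._< D₆) (ℕP.*-identityˡ q) (c*q< 1 (s≤s (s≤s z≤n)))

    <2 : 2 ℕ.* q ℕ.< D₆
    <2 = c*q< 2 (s≤s (s≤s (s≤s z≤n)))
    <3 : 3 ℕ.* q ℕ.< D₆
    <3 = c*q< 3 (s≤s (s≤s (s≤s (s≤s z≤n))))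
    <4 : 4 ℕ.* q ℕ.< D₆
    <4 = c*q< 4 (s≤s (s≤s (s≤s (s≤s (s≤s z≤n)))))
    <5 : 5 ℕ.* q ℕ.< D₆
    <5 = c*q< 5 (s≤s (s≤s (s≤s (s≤s (s≤s (s≤s z≤n))))))

    -- The scaling of each factor by p raises its exponent by one, to 1 + m₁ and 1 + m₂ - m₄; the
    -- two signs that come with the scaling cancel.
    G-term : ∀ {j} → j ℕ.< q → (R : Reg j) → ι (pf j) * C ≈[ k ] Xr R
    G-term {j} l R = ≈-≡ e₁ e₂ (two _ _ (1 ℕ.+ m₁) ((1 ℕ.+ m₂) ℕ.∸ m₄) (Γ̃ (2 ℕ.* q) * Γ̃ 0) (Γ̃ (4 ℕ.* q) * Γ̃ (3 ℕ.* q)) (Γ̃ r₁ * Γ̃ (6 ℕ.* j)) (Γ̃ r₂ * Γ̃ r₄) (iΓΓ (2 ℕ.* q) 0) (iΓΓ (4 ℕ.* q) (3 ℕ.* q)) (iΓΓ r₁ (6 ℕ.* j)) (iΓΓ r₂ r₄)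
      (factor-eq j (F.divNat (ℤ.+ 1) 3) 0ℚ (2 ℕ.* q) 0 r₁ (6 ℕ.* j) ℤ.0ℤ ℤ.0ℤ (ℤ.- (ℤ.+ m₁)) ℤ.0ℤ (1 ℕ.+ m₁) <2 0<D₆ r₁< (6*< l) v₁₃ lower₀
        (hsub r₁ j (#c* 2 q) (ι-m m₁) (A₁ (# r₁) (# j) (# q) (# m₁) (r₁-eq R))) (hadd (6 ℕ.* j) j #0 #0 (same6 j)) (trans (cong₂ (λ x y → - x - y + 1ℚ) (ι-m m₁) #0) (trans (solve 1 (λ m → :- (:- m) :- con 0ℚ :+ con 1ℚ := con 1ℚ :+ m) refl (# m₁)) (sym (#-suc m₁)))))
      (factor-eq j (F.divNat (ℤ.+ 2) 3) (F.divNat (ℤ.+ 1) 2) (4 ℕ.* q) (3 ℕ.* q) r₂ r₄ ℤ.0ℤ (ℤ.- ℤ.1ℤ) (ℤ.- (ℤ.+ m₂)) (ℤ.+ m₄) ((1 ℕ.+ m₂) ℕ.∸ m₄) <4 <3 r₂< r₄< v₂₃ lower₁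
        (hsub r₂ j (#c* 4 q) (ι-m m₂) (A₂ (# r₂) (# j) (# q) (# m₂) (r₂-eq R))) (hadd r₄ j (#c* 3 q) refl (A₄ (# r₄) (# j) (# q) (# m₄) (r₄-eq R))) (trans (cong (λ x → - x - # m₄ + 1ℚ) (ι-m m₂)) (trans (solve 2 (λ m n → :- (:- m) :- n :+ con 1ℚ := con 1ℚ :+ m :- n) refl (# m₂) (# m₄)) (sym (m₂₄ R))))))
      where
      open Reg R
      e₁ : ι (pf j) * (Γ̃ (2 ℕ.* q) * Γ̃ 0 * (Γ̃ (4 ℕ.* q) * Γ̃ (3 ℕ.* q))) ≡ ι (pf j) * C
      e₁ = cong (ι (pf j) *_) (solve 3 (λ a b c → a :* con 1ℚ :* (b :* c) := a :* b :* c) refl (Γ̃ (2 ℕ.* q)) (Γ̃ (4 ℕ.* q)) (Γ̃ (3 ℕ.* q)))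
      e₂ : (- P) ^ ((1 ℕ.+ m₁) ℕ.+ ((1 ℕ.+ m₂) ℕ.∸ m₄)) * (Γ̃ r₁ * Γ̃ (6 ℕ.* j) * (Γ̃ r₂ * Γ̃ r₄)) ≡ Xr R
      e₂ = cong ((- P) ^ expo *_) (solve 4 (λ a b c d → a :* b :* (c :* d) := a :* c :* (b :* d)) refl (Γ̃ r₁) (Γ̃ (6 ℕ.* j)) (Γ̃ r₂) (Γ̃ r₄))

    C~ : ℚ
    C~ = Γ̃ q * Γ̃ 0 * (Γ̃ (5 ℕ.* q) * Γ̃ (3 ℕ.* q))

    -- The j-th summand of the second function is the summand of index i = j ± (p-1)/2 of the first.
    module _ {i : ℕ} (li : i ℕ.< q) (R : Reg i) where

      open Reg R

      n₁~ : ℕ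
      n₁~ = 1 ℕ.+ ((1 ℕ.+ m₂) ℕ.∸ m₄)

      #n₁~ : # n₁~ ≡ 1ℚ + (1ℚ + # m₂ - # m₄)
      #n₁~ = trans (#-suc ((1 ℕ.+ m₂) ℕ.∸ m₄)) (cong (1ℚ +_) (m₂₄ R))

      shape : (- P) ^ (n₁~ ℕ.+ m₁) * (Γ̃ r₂ * Γ̃ r₄ * (Γ̃ r₁ * Γ̃ (6 ℕ.* i))) ≡ Xr R
      shape = cong₂ (λ n z → (- P) ^ n * z) (NS.solve 2 (λ a b → (NS.con 1 NS.:+ a) NS.:+ b NS.:= (NS.con 1 NS.:+ b) NS.:+ a) refl ((1 ℕ.+ m₂) ℕ.∸ m₄) m₁)
        (solve 4 (λ a b c d → a :* b :* (c :* d) := c :* a :* (d :* b)) refl (Γ̃ r₂) (Γ̃ r₄) (Γ̃ r₁) (Γ̃ (6 ℕ.* i)))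

      -- With i/q = j/q + 1/2 modulo 1, the arguments at the parameters 1/6, 0, 5/6, 1/2 become
      -- those of the first function at 2/3, 1/2, 1/3, 0. The pairs are formed differently, so the
      -- total power of p is regrouped as `n₁~` + m₁.
      G~-term : ∀ j (f₁ f₂ g₁ g₂ : ℤ) →
        (# q - N6 * # j ≡ # r₂ + ι f₁ * (N6 * # q)) → (0ℚ + N6 * # j ≡ # r₄ + ι f₂ * (N6 * # q)) → (- ι f₁ - ι f₂ + 1ℚ ≡ 1ℚ + (1ℚ + # m₂ - # m₄)) →
        (N5 * # q - N6 * # j ≡ # r₁ + ι g₁ * (N6 * # q)) → (N3 * # q + N6 * # j ≡ N6 * # i + ι g₂ * (N6 * # q)) → (- ι g₁ - ι g₂ + 1ℚ ≡ # m₁) →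
        ι (pf~ j) * C~ ≈[ k ] Xr R
      G~-term j f₁ f₂ g₁ g₂ h₁ h₂ h₃ h₄ h₅ h₆ = ≈-≡ refl shape (two _ _ n₁~ m₁ (Γ̃ q * Γ̃ 0) (Γ̃ (5 ℕ.* q) * Γ̃ (3 ℕ.* q)) (Γ̃ r₂ * Γ̃ r₄) (Γ̃ r₁ * Γ̃ (6 ℕ.* i)) (iΓΓ q 0) (iΓΓ (5 ℕ.* q) (3 ℕ.* q)) (iΓΓ r₂ r₄) (iΓΓ r₁ (6 ℕ.* i))
        (factor-eq j (F.divNat (ℤ.+ 1) 6) 0ℚ q 0 r₂ r₄ ℤ.0ℤ ℤ.0ℤ f₁ f₂ n₁~ q<6q 0<D₆ r₂< r₄< v₁₆ lower₀ (hsub r₂ j refl refl h₁) (hadd r₄ j #0 refl h₂) (trans h₃ (sym #n₁~)))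
        (factor-eq j (F.divNat (ℤ.+ 5) 6) (F.divNat (ℤ.+ 1) 2) (5 ℕ.* q) (3 ℕ.* q) r₁ (6 ℕ.* i) ℤ.0ℤ (ℤ.- ℤ.1ℤ) g₁ g₂ m₁ <5 <3 r₁< (6*< li) v₅₆ lower₁ (hsub r₁ j (#c* 5 q) refl h₄)
          (hadd (6 ℕ.* i) j (#c* 3 q) refl (trans h₅ (cong (_+ ι g₂ * (N6 * # q)) (sym (#c* 6 i))))) h₆))

    G~-lo : ∀ {j} (l : j ℕ.+ h ℕ.< q) (R : Reg (j ℕ.+ h)) → ι (pf~ j) * C~ ≈[ k ] Xr R
    G~-lo {j} l R = G~-term l R j (ℤ.- (ℤ.+ m₂)) ((ℤ.+ m₄) ℤ.- ℤ.1ℤ) (ℤ.1ℤ ℤ.- (ℤ.+ m₁)) ℤ.0ℤ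
      (trans (B₁ (# r₂) (# j) (# (j ℕ.+ h)) (# h) (# q) (# m₂) Q≡ J≡ (r₂-eq R)) (cong (λ z → # r₂ + z * (N6 * # q)) (sym (ι-m m₂))))
      (trans (B₂ (# r₄) (# j) (# (j ℕ.+ h)) (# h) (# q) (# m₄) Q≡ J≡ (r₄-eq R)) (cong (λ z → # r₄ + z * (N6 * # q)) (sym i₂)))
      (trans (cong₂ (λ x y → - x - y + 1ℚ) (ι-m m₂) i₂) (solve 2 (λ m n → :- (:- m) :- (n :- con 1ℚ) :+ con 1ℚ := con 1ℚ :+ (con 1ℚ :+ m :- n)) refl (# m₂) (# m₄)))
      (trans (B₃ (# r₁) (# j) (# (j ℕ.+ h)) (# h) (# q) (# m₁) Q≡ J≡ (r₁-eq R)) (cong (λ z → # r₁ + z * (N6 * # q)) (sym i₁)))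
      (trans (B₄ (# j) (# (j ℕ.+ h)) (# h) (# q) Q≡ J≡) (cong (λ z → N6 * # (j ℕ.+ h) + z * (N6 * # q)) (sym #0)))
      (trans (cong₂ (λ x y → - x - y + 1ℚ) i₁ #0) (solve 1 (λ m → :- (con 1ℚ :- m) :- con 0ℚ :+ con 1ℚ := m) refl (# m₁)))
      where
      open Reg R
      J≡ : # (j ℕ.+ h) ≡ # j + # h
      J≡ = #-+ j h
      i₂ : ι ((ℤ.+ m₄) ℤ.- ℤ.1ℤ) ≡ # m₄ - 1ℚ
      i₂ = trans (ι-- (ℤ.+ m₄) ℤ.1ℤ) (cong (λ z → # m₄ - z) #1)
      i₁ : ι (ℤ.1ℤ ℤ.- (ℤ.+ m₁)) ≡ 1ℚ - # m₁
      i₁ = trans (ι-- ℤ.1ℤ (ℤ.+ m₁)) (cong (_- # m₁) #1)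

    G~-hi : ∀ {i} (l : i ℕ.< q) (R : Reg i) → ι (pf~ (h ℕ.+ i)) * C~ ≈[ k ] Xr R
    G~-hi {i} l R = G~-term l R (h ℕ.+ i) (ℤ.- (ℤ.+ suc m₂)) (ℤ.+ m₄) (ℤ.- (ℤ.+ m₁)) ℤ.1ℤ
      (trans (C₁ (# r₂) (# (h ℕ.+ i)) (# i) (# h) (# q) (# m₂) Q≡ J≡ (r₂-eq R)) (cong (λ z → # r₂ + z * (N6 * # q)) (sym i₁)))
      (C₂ (# r₄) (# (h ℕ.+ i)) (# i) (# h) (# q) (# m₄) Q≡ J≡ (r₄-eq R))
      (trans (cong (λ x → - x - # m₄ + 1ℚ) i₁) (solve 2 (λ m n → :- (:- (con 1ℚ :+ m)) :- n :+ con 1ℚ := con 1ℚ :+ (con 1ℚ :+ m :- n)) refl (# m₂) (# m₄)))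
      (trans (C₃ (# r₁) (# (h ℕ.+ i)) (# i) (# h) (# q) (# m₁) Q≡ J≡ (r₁-eq R)) (cong (λ z → # r₁ + z * (N6 * # q)) (sym (ι-m m₁))))
      (trans (C₄ (# (h ℕ.+ i)) (# i) (# h) (# q) Q≡ J≡) (cong (λ z → N6 * # i + z * (N6 * # q)) (sym #1)))
      (trans (cong₂ (λ x y → - x - y + 1ℚ) (ι-m m₁) #1) (solve 1 (λ m → :- (:- m) :- con 1ℚ :+ con 1ℚ := m) refl (# m₁)))
      where
      open Reg R
      J≡ : # (h ℕ.+ i) ≡ # h + # i
      J≡ = #-+ h i
      i₁ : ι (ℤ.- (ℤ.+ suc m₂)) ≡ - (1ℚ + # m₂)
      i₁ = trans (ι-m (suc m₂)) (cong -_ (#-suc m₂))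

  module Assembly (K : ℕ) where

    open Terms K
    open Sums K

    X₁ X₂ : ℕ → ℚ
    X₁ j = ι (pf j) * C
    X₂ j = ι (pf~ j) * C~

    numerators : IsNumerator X₁
    numerators = ≈-trans (G-term 0<q reg-0) (≈-reflexive (solve 4 (λ P a b c → (:- P) :* ((:- P) :* con 1ℚ) :* (a :* b :* (con 1ℚ :* c)) := P :* P :* (a :* b :* c)) refl P (Γ̃ (2 ℕ.* q)) (Γ̃ (4 ℕ.* q)) (Γ̃ (3 ℕ.* q)))) ,
      λ j j>0 j<q → ≈-trans (G-term j<q (reg-split (split j j>0 j<q))) (≈-reflexive (cong (λ n → (- P) ^ n * Value.num j j>0 j<q (split j j>0 j<q) 0) (Split.expo (split j j>0 j<q))))

    Int-X₁ : ∀ j → Int (X₁ j)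
    Int-X₁ j = Int-* (Int-ι (pf j)) (Unit.int-u Unit-C)

    X₂-lo : ∀ j → j ℕ.< h → X₂ j ≈[ k ] X₁ (h ℕ.+ j)
    X₂-lo j l = subst (λ i → X₂ j ≈[ k ] X₁ i) (ℕP.+-comm j h) (≈-trans (G~-lo l′ Rj) (≈-sym (G-term l′ Rj)))
      where
      l′ : j ℕ.+ h ℕ.< q
      l′ = subst (j ℕ.+ h ℕ.<_) (sym hh) (ℕP.+-monoˡ-< h l)
      Rj : Reg (j ℕ.+ h)
      Rj = reg (j ℕ.+ h) l′

    X₂-hi : ∀ i → i ℕ.< h → X₂ (h ℕ.+ i) ≈[ k ] X₁ i
    X₂-hi i l = ≈-trans (G~-hi l′ (reg i l′)) (≈-sym (G-term l′ (reg i l′)))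
      where
      l′ : i ℕ.< q
      l′ = ℕP.<-trans l h<q

    I : ℚ
    I = ι (F.invZ p k (ℤ.+ q))

    I-inv : I * # q ≈[ k ] 1ℚ
    I-inv = ≈-trans (≈-reflexive (*-comm I (# q))) (≈-weaken (ℕP.n≤1+n k) (invZ-inv k (ℤ.+ q) (Unit→∤ (ℤ.+ q) Unit-q)))

    -- The multiplication formula by 3 at a = (p-1)/2 relates Γ_p(1/6) Γ_p(1/2) Γ_p(5/6) to Γ_p(1/3)
    -- Γ_p(2/3) Γ_p(1/2). Its factor ω(3)^((p-1)/2) is the origin of the 3 in φ(3s).
    C≈C~ : C ≈[ k ] C~ * τ₃ ^ h
    C≈C~ = ≈-sym (≈-trans (≈-reflexive e₁) (≈-trans (mult₃ h (ℕP.<⇒≤ h<q)) (≈-reflexive (cong (λ z → Γ̃ (2 ℕ.* q) * Γ̃ (4 ℕ.* q) * Γ̃ z) 6h))))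
      where
      2h : 2 ℕ.* h ≡ q
      2h = trans (cong (h ℕ.+_) (ℕP.+-identityʳ h)) (sym hh)
      6h : 6 ℕ.* h ≡ 3 ℕ.* q
      6h = trans (ℕP.*-assoc 3 2 h) (cong (3 ℕ.*_) 2h)
      qh : q ℕ.∸ h ≡ h
      qh = trans (cong (ℕ._∸ h) hh) (ℕP.m+n∸m≡n h h)
      e₁ : C~ * τ₃ ^ h ≡ Γ̃ (2 ℕ.* h) * Γ̃ (2 ℕ.* q ℕ.+ 2 ℕ.* h) * Γ̃ (4 ℕ.* q ℕ.+ 2 ℕ.* h) * τ₃ ^ (q ℕ.∸ h)
      e₁ = trans (solve 4 (λ a b c t → a :* con 1ℚ :* (b :* c) :* t := a :* c :* b :* t) refl (Γ̃ q) (Γ̃ (5 ℕ.* q)) (Γ̃ (3 ℕ.* q)) (τ₃ ^ h))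
        (cong₂ _*_ (cong₂ _*_ (cong₂ (λ a b → Γ̃ a * Γ̃ b) (sym 2h) (trans (NS.solve 1 (λ q → NS.con 3 NS.:* q NS.:= NS.con 2 NS.:* q NS.:+ q) refl q) (cong (2 ℕ.* q ℕ.+_) (sym 2h))))
          (cong Γ̃ (trans (NS.solve 1 (λ q → NS.con 5 NS.:* q NS.:= NS.con 4 NS.:* q NS.:+ q) refl q) (cong (4 ℕ.* q ℕ.+_) (sym 2h))))) (cong (τ₃ ^_) (sym qh)))

    module _ (s : ℤ) (p∤s : ¬ (p ∣ ℤ.∣ s ∣)) where

      open Roots s p∤s

      v : ℚ
      v = ι (F.invZ p k (F.teich p k s))

      Int-v : Int v
      Int-v = Int-ι (F.invZ p k (F.teich p k s))

      v-inv : v * τ K s ≈[ k ] 1ℚ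
      v-inv = ≈-trans (≈-*ˡ Int-v (≈-sym (τ-step K 1 s))) (≈-trans (≈-reflexive (trans (*-comm v (τ k s)) (cong (_* v) (sym (ι-^ s (p ℕ.^ k)))))) (≈-weaken (ℕP.n≤1+n k) (invZ-inv k (F.teich p k s) (Unit→∤ (F.teich p k s) (subst Unit (sym (ι-^ s (p ℕ.^ k))) (Unit-τ k s p∤s))))))

      scaled-eq : ∀ (as bs : Vec ℚ 2) Cd → ι (F.scaledG 2 as bs p k s) * Cd ≡ - (I * ∑ q (λ j → v ^ j * (ι (F.prodFactors p k j as bs) * Cd)))
      scaled-eq as bs Cd = begin
        ι (F.scaledG 2 as bs p k s) * Cd                 ≡⟨ cong (_* Cd) (trans (ι-neg (F.invZ p k (ℤ.+ q) ℤ.* Sm)) (cong -_ (trans (ι-* (F.invZ p k (ℤ.+ q)) Sm) (cong (I *_) (ι-sum term′ q))))) ⟩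
        - (I * ∑ q (λ j → ι (term′ j))) * Cd             ≡⟨ solve 3 (λ i s c → (:- (i :* s)) :* c := :- (i :* (s :* c))) refl I (∑ q (λ j → ι (term′ j))) Cd ⟩
        - (I * (∑ q (λ j → ι (term′ j)) * Cd))           ≡⟨ cong (λ z → - (I * z)) (trans (sym (∑-*ʳ q (λ j → ι (term′ j)) Cd)) (∑-ext q (λ j → trans (cong (_* Cd) (t≡ j)) (*-assoc (v ^ j) (ι (F.prodFactors p k j as bs)) Cd)))) ⟩
        - (I * ∑ q (λ j → v ^ j * (ι (F.prodFactors p k j as bs) * Cd))) ∎
        where
        open ≡-Reasoning
        term′ : ℕ → ℤ
        term′ j = ((ℤ.- ℤ.1ℤ) ℤ.^ (j ℕ.* 2)) ℤ.* F.teichBarPow p k s j ℤ.* F.prodFactors p k j as bs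
        Sm : ℤ
        Sm = F.sumℤ (map term′ (upTo q))
        sgn : ∀ j → ι ((ℤ.- ℤ.1ℤ) ℤ.^ (j ℕ.* 2)) ≡ 1ℚ
        sgn j = trans (ι-^ (ℤ.- ℤ.1ℤ) (j ℕ.* 2)) (trans (cong₂ _^_ (trans (ι-neg ℤ.1ℤ) (cong -_ #1)) (trans (ℕP.*-comm j 2) (cong (j ℕ.+_) (ℕP.+-identityʳ j)))) (-1^even j))
        t≡ : ∀ j → ι (term′ j) ≡ v ^ j * ι (F.prodFactors p k j as bs)
        t≡ j = trans (ι-* (((ℤ.- ℤ.1ℤ) ℤ.^ (j ℕ.* 2)) ℤ.* F.teichBarPow p k s j) (F.prodFactors p k j as bs)) (cong (_* ι (F.prodFactors p k j as bs))
          (trans (ι-* ((ℤ.- ℤ.1ℤ) ℤ.^ (j ℕ.* 2)) (F.teichBarPow p k s j)) (trans (cong₂ _*_ (sgn j) (ι-^ (F.invZ p k (F.teich p k s)) j)) (*-identityˡ (v ^ j)))))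

      r : ℚ
      r = # (F.numRoots p s)

      A₀ : ℚ
      A₀ = ∑ q (λ j → v ^ j * X₁ j)

      A-val : A₀ ≈[ k ] - (# q * (P * P * C * (r - 1ℚ)))
      A-val = ≈-trans (total X₁ numerators Int-X₁ s V v Int-v v-inv p∤V hV) (≈-reflexive (cong (λ z → - (# q * (P * P * C * (z - 1ℚ)))) roots))

      Int-r-1 : Int (r - 1ℚ)
      Int-r-1 = Int-- (Int-# (F.numRoots p s)) Int-1

      Int-I : Int I
      Int-I = Int-ι (F.invZ p k (ℤ.+ q))

      IA : - (I * A₀) ≈[ k ] P * P * C * (r - 1ℚ)
      IA = ≈-trans (≈-neg (≈-*ˡ Int-I A-val)) (≈-trans (≈-reflexive (solve 3 (λ i q y → :- (i :* (:- (q :* y))) := (i :* q) :* y) refl I (# q) (P * P * C * (r - 1ℚ))))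
        (≈-trans (≈-*ʳ (Int-* (Int-* (Int-* (Int-# p) (Int-# p)) (Unit.int-u Unit-C)) Int-r-1) I-inv) (≈-reflexive (*-identityˡ (P * P * C * (r - 1ℚ))))))

      G-value : ι (F.scaled2G2 p k s) ≈[ k ] P * P * (r - 1ℚ)
      G-value = ≈-cancelUnit Unit-C (≈-trans (≈-reflexive (*-comm C (ι (F.scaled2G2 p k s)))) (≈-trans (≈-reflexive (scaled-eq upper₁ lower C)) (≈-trans IA (≈-reflexive (solve 3 (λ P c x → P :* P :* c :* x := c :* (P :* P :* x)) refl P C (r - 1ℚ))))))

      v-2h : v ^ h * v ^ h ≈[ k ] 1ℚ
      v-2h = ≈-trans (≈-reflexive (trans (sym (^-+ v h h)) (cong (v ^_) (sym hh)))) (≈-trans (≈-sym (≈-trans (≈-*ˡ (Int-^ q Int-v) (τ^q K s p∤s)) (≈-reflexive (*-identityʳ (v ^ q)))))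
        (≈-trans (≈-reflexive (sym (*-^ v (τ K s) q))) (≈-trans (≈-^ q (Int-* Int-v (Int-τ K s)) Int-1 v-inv) (≈-reflexive (1^ q)))))

      -- The shift of the index by h exchanges the two halves of the range. Since v^(2h) ≡ 1, both
      -- exchanges multiply the character value by the same sign v^h.
      A~-val : ∑ q (λ j → v ^ j * X₂ j) ≈[ k ] v ^ h * A₀
      A~-val = ≈-trans (≈-reflexive (trans (cong (λ n → ∑ n (λ j → v ^ j * X₂ j)) hh) (∑-split h h (λ j → v ^ j * X₂ j))))
        (≈-trans (≈-+ (≈-∑ h lo) (≈-∑ h hi)) (≈-reflexive (trans (cong₂ _+_ (∑-*ˡ h (v ^ h) (λ j → v ^ (h ℕ.+ j) * X₁ (h ℕ.+ j))) (∑-*ˡ h (v ^ h) (λ j → v ^ j * X₁ j)))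
          (trans (solve 3 (λ v a b → v :* a :+ v :* b := v :* (b :+ a)) refl (v ^ h) (∑ h (λ j → v ^ (h ℕ.+ j) * X₁ (h ℕ.+ j))) (∑ h (λ j → v ^ j * X₁ j)))
            (cong (v ^ h *_) (sym (trans (cong (λ n → ∑ n (λ j → v ^ j * X₁ j)) hh) (∑-split h h (λ j → v ^ j * X₁ j)))))))))
        where
        lo : ∀ j → j ℕ.< h → v ^ j * X₂ j ≈[ k ] v ^ h * (v ^ (h ℕ.+ j) * X₁ (h ℕ.+ j))
        lo j l = ≈-trans (≈-*ˡ (Int-^ j Int-v) (X₂-lo j l)) (≈-trans (≈-*ʳ (Int-X₁ (h ℕ.+ j)) (≈-sym (≈-trans (≈-*ʳ (Int-^ j Int-v) v-2h) (≈-reflexive (*-identityˡ (v ^ j))))))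
          (≈-reflexive (trans (solve 3 (λ a b x → a :* a :* b :* x := a :* ((a :* b) :* x)) refl (v ^ h) (v ^ j) (X₁ (h ℕ.+ j))) (cong (λ z → v ^ h * (z * X₁ (h ℕ.+ j))) (sym (^-+ v h j))))))
        hi : ∀ j → j ℕ.< h → v ^ (h ℕ.+ j) * X₂ (h ℕ.+ j) ≈[ k ] v ^ h * (v ^ j * X₁ j)
        hi j l = ≈-trans (≈-*ˡ (Int-^ (h ℕ.+ j) Int-v) (X₂-hi j l)) (≈-reflexive (trans (cong (_* X₁ j) (^-+ v h j)) (*-assoc (v ^ h) (v ^ j) (X₁ j))))

      φ : ℚ
      φ = ι (F.qchar p ((ℤ.+ 3) ℤ.* s))

      Int-φ : Int φ
      Int-φ = Int-ι (F.qchar p ((ℤ.+ 3) ℤ.* s))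

      -- v^h is the inverse of the sign ω(s)^h and hence equal to it, so the product is Euler's
      -- criterion for 3s.
      φ-val : v ^ h * τ₃ ^ h ≈[ k ] φ
      φ-val = ≈-trans (≈-*ʳ (Int-^ h (Int-τ K (ℤ.+ 3))) vh) (≈-trans (≈-reflexive (trans (*-comm (τ K s ^ h) (τ₃ ^ h)) (trans (sym (*-^ τ₃ (τ K s) h)) (cong (_^ h) (sym (τ-* K (ℤ.+ 3) s))))))
        (≈-sym (qchar-eq K ((ℤ.+ 3) ℤ.* s) (subst (λ n → ¬ (p ∣ n)) (sym (ℤP.abs-* (ℤ.+ 3) s)) (p∤* p∤3 p∤s)))))
        where
        vh : v ^ h ≈[ k ] τ K s ^ h
        vh = ≈-trans (≈-sym (≈-trans (≈-*ˡ (Int-^ h Int-v) (τ^q K s p∤s)) (≈-reflexive (*-identityʳ (v ^ h))))) (≈-trans (≈-reflexive (trans (cong (v ^ h *_) (trans (cong (τ K s ^_) hh) (^-+ (τ K s) h h)))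
          (trans (sym (*-assoc (v ^ h) (τ K s ^ h) (τ K s ^ h))) (cong (_* τ K s ^ h) (sym (*-^ v (τ K s) h)))))) (≈-trans (≈-*ʳ (Int-^ h (Int-τ K s)) (≈-trans (≈-^ h (Int-* Int-v (Int-τ K s)) Int-1 v-inv) (≈-reflexive (1^ h)))) (≈-reflexive (*-identityˡ (τ K s ^ h)))))

      Unit-C~ : Unit C~
      Unit-C~ = Unit-* (Unit-* (Unit-Γ̃ q) (Unit-Γ̃ 0)) (Unit-* (Unit-Γ̃ (5 ℕ.* q)) (Unit-Γ̃ (3 ℕ.* q)))

      G~-value : ι (F.scaled2G2t p k s) ≈[ k ] φ * (P * P * (r - 1ℚ))
      G~-value = ≈-cancelUnit Unit-C~ (≈-trans (≈-reflexive (*-comm C~ (ι (F.scaled2G2t p k s)))) (≈-trans (≈-reflexive (scaled-eq upper₂ lower C~)) (≈-trans (≈-neg (≈-*ˡ Int-I A~-val))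
        (≈-trans (≈-reflexive (solve 3 (λ i v a → :- (i :* (v :* a)) := v :* (:- (i :* a))) refl I (v ^ h) A₀)) (≈-trans (≈-*ˡ (Int-^ h Int-v) IA)
        (≈-trans (≈-reflexive (solve 4 (λ v P c x → v :* (P :* P :* c :* x) := (v :* (P :* P :* x)) :* c) refl (v ^ h) P C (r - 1ℚ)))
        (≈-trans (≈-*ˡ (Int-* (Int-^ h Int-v) iY) C≈C~) (≈-trans (≈-reflexive (solve 4 (λ v y c t → v :* y :* (c :* t) := c :* (v :* t :* y)) refl (v ^ h) (P * P * (r - 1ℚ)) C~ (τ₃ ^ h)))
          (≈-*ˡ (Unit.int-u Unit-C~) (≈-*ʳ iY φ-val))))))))))
        where
        iY : Int (P * P * (r - 1ℚ))
        iY = Int-* (Int-* (Int-# p) (Int-# p)) Int-r-1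

    identity : ∀ t s → ¬ (p ∣ ℤ.∣ t ∣) → ¬ (p ∣ ℤ.∣ s ∣) → p ℕ.^ k ∣ ℤ.∣ F.scaled2G2 p k t ℤ.- (F.scaled2G2 p k s ℤ.+ F.scaled2G2t p k s
        ℤ.+ (ℤ.+ p) ℤ.^ 2 ℤ.* ((ℤ.+ F.numRoots p t ℤ.- ℤ.+ F.numRoots p s) ℤ.+ (ℤ.1ℤ ℤ.- ℤ.+ F.numRoots p s) ℤ.* F.qchar p ((ℤ.+ 3) ℤ.* s))) ∣
    identity t s ht hs = Div→∣ k (F.scaled2G2 p k t ℤ.- (F.scaled2G2 p k s ℤ.+ F.scaled2G2t p k s ℤ.+ rest)) (≈0→Div (≈-trans (≈-reflexive e₁) (≈-trans (≈-- (G-value t ht) (≈-+ (≈-+ (G-value s hs) (G~-value s hs)) (≈-refl {x = P ^ 2 * ((r₁ - r₂) + (1ℚ - r₂) * f)}))) (≈-reflexive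
        (solve 4 (λ P x y f → P :* P :* (x :- con 1ℚ) :- (P :* P :* (y :- con 1ℚ) :+ f :* (P :* P :* (y :- con 1ℚ)) :+ P :* (P :* con 1ℚ) :* ((x :- y) :+ (con 1ℚ :- y) :* f)) := con 0ℚ) refl P r₁ r₂ f)))))
      where
      r₁ = r t ht
      r₂ = r s hs
      f = φ s hs
      N₁ = ℤ.+ F.numRoots p t
      N₂ = ℤ.+ F.numRoots p s
      Q = F.qchar p ((ℤ.+ 3) ℤ.* s)
      rest : ℤ
      rest = (ℤ.+ p) ℤ.^ 2 ℤ.* ((N₁ ℤ.- N₂) ℤ.+ (ℤ.1ℤ ℤ.- N₂) ℤ.* Q)
      e₁ : ι (F.scaled2G2 p k t ℤ.- (F.scaled2G2 p k s ℤ.+ F.scaled2G2t p k s ℤ.+ rest)) ≡ ι (F.scaled2G2 p k t) - (ι (F.scaled2G2 p k s) + ι (F.scaled2G2t p k s) + P ^ 2 * ((r₁ - r₂) + (1ℚ - r₂) * f))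
      e₁ = trans (ι-- (F.scaled2G2 p k t) (F.scaled2G2 p k s ℤ.+ F.scaled2G2t p k s ℤ.+ rest)) (cong (λ z → ι (F.scaled2G2 p k t) - z) (trans (ι-+ (F.scaled2G2 p k s ℤ.+ F.scaled2G2t p k s) rest)
        (cong₂ _+_ (ι-+ (F.scaled2G2 p k s) (F.scaled2G2t p k s)) (trans (ι-* ((ℤ.+ p) ℤ.^ 2) ((N₁ ℤ.- N₂) ℤ.+ (ℤ.1ℤ ℤ.- N₂) ℤ.* Q)) (cong₂ _*_ (ι-^ (ℤ.+ p) 2)
          (trans (ι-+ (N₁ ℤ.- N₂) ((ℤ.1ℤ ℤ.- N₂) ℤ.* Q)) (cong₂ _+_ (ι-- N₁ N₂) (trans (ι-* (ℤ.1ℤ ℤ.- N₂) Q) (cong (_* f) (trans (ι-- ℤ.1ℤ N₂) (cong (_- r₂) #1)))))))))))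

open import Defs
open import Data.Nat using (ℕ; _<_)
open import Data.Nat.Primality using (Prime)
open import Data.Integer using (ℤ; +_; _+_; _-_; _*_; _^_; 1ℤ)
open import Data.Integer.Divisibility using (_∣_)
open import Relation.Binary.PropositionalEquality using (_≡_; _≢_; refl)
open import Data.Nat using (zero; suc; z≤n; s≤s; s≤s⁻¹)
open import Data.Nat.Properties using (<-irrefl; ≤-trans; n≤1+n)
import Data.Nat.Divisibility as ℕ
open import Data.Empty using (⊥-elim)
open import Relation.Nullary using (¬_)

<⇒∤ : ∀ {p n} → 0 < n → n < p → ¬ (p ℕ.∣ n)
<⇒∤ {n = suc n} _ n<p p∣n = <-irrefl refl (≤-trans n<p (ℕ.∣⇒≤ p∣n))

∤1- : ∀ {p} t → 0 < t → t < p → t ≢ 1 → ¬ (p ℕ.∣ Data.Integer.∣ 1ℤ - + t ∣)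
∤1- (suc zero)    _ _   t≢1 = ⊥-elim (t≢1 refl)
∤1- (suc (suc t)) _ t<p _   = <⇒∤ (s≤s z≤n) (≤-trans (n≤1+n _) t<p)

theorem1p8 : (p : ℕ) → Prime p → 3 < p →
    (t : ℕ) → 0 < t → t < p → t ≢ 1 →
    (r₁ r₂ : ℕ) → r₁ ≡ numRoots p (+ t) → r₂ ≡ numRoots p (1ℤ - + t) →
    (k : ℕ) →
    + (p Data.Nat.^ k) ∣
    (scaled2G2 p k (+ t)
    - (scaled2G2 p k (1ℤ - + t) + scaled2G2t p k (1ℤ - + t)
    + (+ p) ^ 2 * ((+ r₁ - + r₂) + (1ℤ - + r₂) * qchar p (+ 3 * (1ℤ - + t)))))
theorem1p8 zero    _  ()  _ _ _ _ _ _ _ _ _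
theorem1p8 (suc q) pp 3<p t 0<t t<p t≢1 r₁ r₂ refl refl zero    = ℕ.1∣ _
theorem1p8 (suc q) pp 3<p t 0<t t<p t≢1 r₁ r₂ refl refl (suc K) =
  Proof.Assembly.identity q pp (s≤s⁻¹ 3<p) K (+ t) (1ℤ - + t) (<⇒∤ 0<t t<p) (∤1- t 0<t t<p t≢1)
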